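{- We have $$\prod_{p\equiv1 \bmod 8}\Bigl(1-\frac4p\Bigr)\Bigl(\frac{p+1}{p-1}\Bigr)^2=\begin{aligned}[t]0.&95694\,53478\,51601\,18343\,69670\,57273\,89182\,87531\,74977\,29139\\&14789\,05432\,60424\,60170\,16444\,88885\,94814\,40512\,03907\,95084\cdots\end{aligned}$$ and thus Shanks' constant satisfies $$I=\frac{\pi^2}{16\log(1+\sqrt2)}\prod_{p\equiv1 \bmod 8}\Bigl(1-\frac4p\Bigr)\Bigl(\frac{p+1}{p-1}\Bigr)^2=\begin{aligned}[t]0.&66974\,09699\,37071\,22053\,89224\,31571\,76440\,66883\,70157\,43648\\&24185\,73298\,52284\,52467\,99956\,45714\,72731\,50621\,02143\,59373\cdots\end{aligned}$$ The products are over the primes $p$ congruent to $1$ modulo $8$.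
   Context: $\log$ is the natural logarithm. Writing $x=0.d_1d_2\ldots d_{100}\cdots$ means that the displayed digits are the first 100 decimals of $x$, i.e. $0.d_1\ldots d_{100}\le x< 0.d_1\ldots d_{100}+10^{ -100}$. -}

module Defs where

open import Data.Integer as ℤ using (+_; -1ℤ)
open import Data.List using (List; filter; foldr; map; upTo)
open import Data.Nat as ℕ using (ℕ; zero; suc; 2+; _!)
open import Data.Nat.Properties
  using (m≤m⊔n; m≤n⊔m; m⊔n≤o⇒m≤o; m⊔n≤o⇒n≤o; m^n≢0; _!≢0)
  renaming (_≟_ to _≟ℕ_; ≤-refl to ≤ℕ-refl; ≤-trans to ≤ℕ-trans)
open import Data.Nat.DivMod using (_%_)
open import Data.Nat.Primality using (Prime; prime?)
open import Data.Product using (∃-syntax; _×_; _,_)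
open import Data.Rational as ℚ using (ℚ; 0ℚ; 1ℚ; ½; _/_)
import Data.Rational.Properties as ℚₚ
open import Data.Rational.Solver using (module +-*-Solver)
open import Data.Sum using (inj₁; inj₂)
open import Relation.Binary.PropositionalEquality
open import Relation.Nullary using (yes; no; contradiction)
open import Relation.Nullary.Decidable using (_×-dec_)
open import Relation.Unary using (Decidable)

module _ where
  open import Data.Rational
  open ℚₚ.≤-Reasoning
  open +-*-Solver

  ∣p-q∣≡∣q-p∣ : ∀ p q → ∣ p - q ∣ ≡ ∣ q - p ∣
  ∣p-q∣≡∣q-p∣ p q = trans (sym (ℚₚ.∣-p∣≡∣p∣ (p - q)))
    (cong ∣_∣ (solve 2 (λ p q → :- (p :- q) := q :- p) refl p q))

  ∣p∣≤∣p-q∣+∣q∣ : ∀ p q → ∣ p ∣ ≤ ∣ p - q ∣ + ∣ q ∣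
  ∣p∣≤∣p-q∣+∣q∣ p q = begin
    ∣ p ∣               ≡⟨ cong ∣_∣ (solve 2 (λ p q → p := p :- q :+ q) refl p q) ⟩
    ∣ p - q + q ∣       ≤⟨ ℚₚ.∣p+q∣≤∣p∣+∣q∣ (p - q) q ⟩
    ∣ p - q ∣ + ∣ q ∣   ∎

  p≤r+q⇒p-q≤r : ∀ p q r → p ≤ r + q → p - q ≤ r
  p≤r+q⇒p-q≤r p q r h = begin
    p - q       ≤⟨ ℚₚ.+-monoˡ-≤ (- q) h ⟩
    r + q - q   ≡⟨ solve 2 (λ r q → r :+ q :- q := r) refl r q ⟩
    r           ∎

  ∣∣p∣-∣q∣∣≤∣p-q∣ : ∀ p q → ∣ ∣ p ∣ - ∣ q ∣ ∣ ≤ ∣ p - q ∣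
  ∣∣p∣-∣q∣∣≤∣p-q∣ p q with ℚₚ.∣p∣≡p∨∣p∣≡-p (∣ p ∣ - ∣ q ∣)
  ... | inj₁ eq = begin
    ∣ ∣ p ∣ - ∣ q ∣ ∣   ≡⟨ eq ⟩
    ∣ p ∣ - ∣ q ∣       ≤⟨ p≤r+q⇒p-q≤r (∣ p ∣) (∣ q ∣) _ (∣p∣≤∣p-q∣+∣q∣ p q) ⟩
    ∣ p - q ∣           ∎
  ... | inj₂ eq = begin
    ∣ ∣ p ∣ - ∣ q ∣ ∣   ≡⟨ eq ⟩
    - (∣ p ∣ - ∣ q ∣)   ≡⟨ solve 2 (λ p q → :- (p :- q) := q :- p) refl (∣ p ∣) (∣ q ∣) ⟩
    ∣ q ∣ - ∣ p ∣       ≤⟨ p≤r+q⇒p-q≤r (∣ q ∣) (∣ p ∣) _ (∣p∣≤∣p-q∣+∣q∣ q p) ⟩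
    ∣ q - p ∣           ≡⟨ ∣p-q∣≡∣q-p∣ q p ⟩
    ∣ p - q ∣           ∎

  *-mono-<-pos : ∀ {p q} → 0ℚ < p → 0ℚ < q → 0ℚ < p * q
  *-mono-<-pos {p} {q} 0<p 0<q =
    let instance _ = positive 0<p ; _ = positive 0<q
    in ℚₚ.positive⁻¹ (p * q) {{ℚₚ.pos*pos⇒pos p q}}

  *-mono-≤-abs : ∀ p q {r s} → ∣ p ∣ ≤ r → 0ℚ ≤ s → ∣ q ∣ ≤ s → ∣ p * q ∣ ≤ r * s
  *-mono-≤-abs p q {r} {s} p≤r 0≤s q≤s =
    let instance _ = nonNegative 0≤s ; _ = ℚₚ.∣-∣-nonNeg p
    in begin
    ∣ p * q ∣       ≡⟨ ℚₚ.∣p*q∣≡∣p∣*∣q∣ p q ⟩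
    ∣ p ∣ * ∣ q ∣   ≤⟨ ℚₚ.*-monoˡ-≤-nonNeg ∣ p ∣ q≤s ⟩
    ∣ p ∣ * s       ≤⟨ ℚₚ.*-monoʳ-≤-nonNeg s p≤r ⟩
    r * s           ∎

  quotient : ∀ {ε b} → 0ℚ < ε → 0ℚ < b → ∃[ δ ] 0ℚ < δ × δ * b ≡ ε
  quotient {ε} {b} 0<ε 0<b =
    let instance
          b⁺ = positive 0<b
          b≢0 = ℚₚ.pos⇒nonZero b
    in ε * 1/ b
     , *-mono-<-pos 0<ε (ℚₚ.positive⁻¹ (1/ b) {{ℚₚ.1/pos⇒pos b}})
     , trans (ℚₚ.*-assoc ε (1/ b) b)
         (trans (cong (ε *_) (ℚₚ.*-inverseˡ b)) (ℚₚ.*-identityʳ ε))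

  half-pos : ∀ {ε} → 0ℚ < ε → 0ℚ < ε * ½
  half-pos 0<ε = *-mono-<-pos 0<ε (ℚₚ.positive⁻¹ ½)

  half+half : ∀ ε → ε * ½ + ε * ½ ≡ ε
  half+half ε = trans (sym (ℚₚ.*-distribˡ-+ ε ½ ½)) (ℚₚ.*-identityʳ ε)

  1/₀_ : ℚ → ℚ
  1/₀ q with q ℚₚ.≟ 0ℚ
  ... | yes _   = 0ℚ
  ... | no q≢0 = (1/ q) {{≢-nonZero q≢0}}

  p*1/₀p : ∀ p → p ≢ 0ℚ → p * 1/₀ p ≡ 1ℚ
  p*1/₀p p p≢0 with p ℚₚ.≟ 0ℚ
  ... | yes p≡0 = contradiction p≡0 p≢0
  ... | no  p≢0′ = ℚₚ.*-inverseʳ p {{≢-nonZero p≢0′}}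

  ≤∣p∣⇒p≢0 : ∀ {c p} → 0ℚ < c → c ≤ ∣ p ∣ → p ≢ 0ℚ
  ≤∣p∣⇒p≢0 0<c c≤0 refl = ℚₚ.<-irrefl refl (ℚₚ.<-≤-trans 0<c c≤0)

  1/₀-lipschitz : ∀ {c} a b → 0ℚ < c → c ≤ ∣ a ∣ → c ≤ ∣ b ∣ →
                  ∣ 1/₀ a - 1/₀ b ∣ * (c * c) ≤ ∣ a - b ∣
  1/₀-lipschitz {c} a b 0<c c≤a c≤b =
    let instance
          _ = nonNegative (ℚₚ.<⇒≤ 0<c)
          _ = ℚₚ.∣-∣-nonNeg a
          _ = ℚₚ.∣-∣-nonNeg (1/₀ a - 1/₀ b)
    in begin
    ∣ 1/₀ a - 1/₀ b ∣ * (c * c)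
      ≤⟨ ℚₚ.*-monoˡ-≤-nonNeg ∣ 1/₀ a - 1/₀ b ∣ (ℚₚ.≤-trans
           (ℚₚ.*-monoʳ-≤-nonNeg c c≤a) (ℚₚ.*-monoˡ-≤-nonNeg ∣ a ∣ c≤b)) ⟩
    ∣ 1/₀ a - 1/₀ b ∣ * (∣ a ∣ * ∣ b ∣)
      ≡⟨ cong (∣ 1/₀ a - 1/₀ b ∣ *_) (ℚₚ.∣p*q∣≡∣p∣*∣q∣ a b) ⟨
    ∣ 1/₀ a - 1/₀ b ∣ * ∣ a * b ∣
      ≡⟨ ℚₚ.∣p*q∣≡∣p∣*∣q∣ (1/₀ a - 1/₀ b) (a * b) ⟨
    ∣ (1/₀ a - 1/₀ b) * (a * b) ∣
      ≡⟨ cong ∣_∣ (solve 4 (λ a b i j → (i :- j) :* (a :* b)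
                                      := a :* i :* b :- b :* j :* a)
                           refl a b (1/₀ a) (1/₀ b)) ⟩
    ∣ a * 1/₀ a * b - b * 1/₀ b * a ∣
      ≡⟨ cong₂ (λ u v → ∣ u * b - v * a ∣)
           (p*1/₀p a (≤∣p∣⇒p≢0 0<c c≤a)) (p*1/₀p b (≤∣p∣⇒p≢0 0<c c≤b)) ⟩
    ∣ 1ℚ * b - 1ℚ * a ∣
      ≡⟨ cong₂ (λ u v → ∣ u - v ∣) (ℚₚ.*-identityˡ b) (ℚₚ.*-identityˡ a) ⟩
    ∣ b - a ∣
      ≡⟨ ∣p-q∣≡∣q-p∣ b a ⟩
    ∣ a - b ∣ ∎

IsCauchy : (ℕ → ℚ) → Set
IsCauchy x = ∀ {ε} → 0ℚ ℚ.< ε →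
  ∃[ N ] ∀ m n → N ℕ.≤ m → N ℕ.≤ n → ℚ.∣ x m ℚ.- x n ∣ ℚ.< ε

-- The modulus of convergence is data in the witness of IsCauchy; equality of
-- reals is _≃_, not _≡_.
record ℝ : Set where
  constructor mkℝ
  field
    seq    : ℕ → ℚ
    cauchy : IsCauchy seq
open ℝ public

module _ where
  open import Data.Rational
  open ℚₚ.≤-Reasoning
  open +-*-Solver

  const-cauchy : ∀ q → IsCauchy (λ _ → q)
  const-cauchy q {ε} 0<ε = 0 , λ _ _ _ _ →
    subst (λ r → ∣ r ∣ < ε) (sym (ℚₚ.+-inverseʳ q)) 0<ε

  +-cauchy : ∀ {x y} → IsCauchy x → IsCauchy y → IsCauchy (λ n → x n + y n)
  +-cauchy {x} {y} cx cy {ε} 0<ε =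
    let M , hx = cx (half-pos 0<ε)
        N , hy = cy (half-pos 0<ε)
    in M ℕ.⊔ N , λ m n ≤m ≤n → begin-strict
      ∣ x m + y m - (x n + y n) ∣
        ≡⟨ cong ∣_∣ (solve 4 (λ a b c d → a :+ b :- (c :+ d) := a :- c :+ (b :- d))
                             refl (x m) (y m) (x n) (y n)) ⟩
      ∣ x m - x n + (y m - y n) ∣
        ≤⟨ ℚₚ.∣p+q∣≤∣p∣+∣q∣ (x m - x n) (y m - y n) ⟩
      ∣ x m - x n ∣ + ∣ y m - y n ∣
        <⟨ ℚₚ.+-mono-< (hx m n (m⊔n≤o⇒m≤o M N ≤m) (m⊔n≤o⇒m≤o M N ≤n))
                       (hy m n (m⊔n≤o⇒n≤o M N ≤m) (m⊔n≤o⇒n≤o M N ≤n)) ⟩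
      ε * ½ + ε * ½
        ≡⟨ half+half ε ⟩
      ε ∎

  neg-cauchy : ∀ {x} → IsCauchy x → IsCauchy (λ n → - x n)
  neg-cauchy {x} cx {ε} 0<ε =
    let N , hx = cx 0<ε
    in N , λ m n ≤m ≤n → subst (_< ε)
      (trans (∣p-q∣≡∣q-p∣ (x m) (x n))
        (cong ∣_∣ (solve 2 (λ a b → b :- a := :- a :- :- b) refl (x m) (x n))))
      (hx m n ≤m ≤n)

  abs-cauchy : ∀ {x} → IsCauchy x → IsCauchy (λ n → ∣ x n ∣)
  abs-cauchy {x} cx 0<ε =
    let N , hx = cx 0<ε
    in N , λ m n ≤m ≤n →
      ℚₚ.≤-<-trans (∣∣p∣-∣q∣∣≤∣p-q∣ (x m) (x n)) (hx m n ≤m ≤n)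

  eventually-bounded : ∀ {x} → IsCauchy x →
    ∃[ B ] 0ℚ < B × ∃[ N ] ∀ n → N ℕ.≤ n → ∣ x n ∣ ≤ B
  eventually-bounded {x} cx =
    let N , hx = cx (ℚₚ.positive⁻¹ 1ℚ)
    in 1ℚ + ∣ x N ∣
     , ℚₚ.+-mono-<-≤ (ℚₚ.positive⁻¹ 1ℚ) (ℚₚ.0≤∣p∣ (x N))
     , N , λ n N≤n → ℚₚ.≤-trans (∣p∣≤∣p-q∣+∣q∣ (x n) (x N))
         (ℚₚ.+-monoˡ-≤ ∣ x N ∣ (ℚₚ.<⇒≤ (hx n N N≤n ≤ℕ-refl)))

  *-cauchy : ∀ {x y} → IsCauchy x → IsCauchy y → IsCauchy (λ n → x n * y n)
  *-cauchy {x} {y} cx cy {ε} 0<ε =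
    let A , 0<A , K , bx = eventually-bounded cx
        B , 0<B , L , by = eventually-bounded cy
        δ , 0<δ , δ*[A+B]≡ε = quotient 0<ε (ℚₚ.+-mono-< 0<A 0<B)
        M , hx = cx 0<δ
        N , hy = cy 0<δ
        0≤δ = ℚₚ.<⇒≤ 0<δ
        instance _ = positive 0<A
        R = (K ℕ.⊔ L) ℕ.⊔ (M ℕ.⊔ N)
        KL≤R = m≤m⊔n (K ℕ.⊔ L) (M ℕ.⊔ N)
        MN≤R = m≤n⊔m (K ℕ.⊔ L) (M ℕ.⊔ N)
        K≤R = ≤ℕ-trans (m≤m⊔n K L) KL≤R
        L≤R = ≤ℕ-trans (m≤n⊔m K L) KL≤R
        M≤R = ≤ℕ-trans (m≤m⊔n M N) MN≤R
        N≤R = ≤ℕ-trans (m≤n⊔m M N) MN≤R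
    in R , λ m n ≤m ≤n → begin-strict
      ∣ x m * y m - x n * y n ∣
        ≡⟨ cong ∣_∣ (solve 4 (λ a b c d → a :* b :- c :* d
                                        := a :* (b :- d) :+ (a :- c) :* d)
                             refl (x m) (y m) (x n) (y n)) ⟩
      ∣ x m * (y m - y n) + (x m - x n) * y n ∣
        ≤⟨ ℚₚ.∣p+q∣≤∣p∣+∣q∣ (x m * (y m - y n)) ((x m - x n) * y n) ⟩
      ∣ x m * (y m - y n) ∣ + ∣ (x m - x n) * y n ∣
        ≤⟨ ℚₚ.+-mono-≤
             (*-mono-≤-abs (x m) (y m - y n) (bx m (≤ℕ-trans K≤R ≤m))
                (ℚₚ.0≤∣p∣ (y m - y n)) ℚₚ.≤-refl)
             (*-mono-≤-abs (x m - x n) (y n)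
                (ℚₚ.<⇒≤ (hx m n (≤ℕ-trans M≤R ≤m) (≤ℕ-trans M≤R ≤n)))
                (ℚₚ.<⇒≤ 0<B) (by n (≤ℕ-trans L≤R ≤n))) ⟩
      A * ∣ y m - y n ∣ + δ * B
        <⟨ ℚₚ.+-monoˡ-< (δ * B) (ℚₚ.*-monoʳ-<-pos A
             (hy m n (≤ℕ-trans N≤R ≤m) (≤ℕ-trans N≤R ≤n))) ⟩
      A * δ + δ * B
        ≡⟨ solve 3 (λ A B δ → A :* δ :+ δ :* B := δ :* (A :+ B)) refl A B δ ⟩
      δ * (A + B)
        ≡⟨ δ*[A+B]≡ε ⟩
      ε ∎

  1/₀-cauchy : ∀ {x c N} → IsCauchy x → 0ℚ < c → (∀ n → N ℕ.≤ n → c ≤ ∣ x n ∣) →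
               IsCauchy (λ n → 1/₀ x n)
  1/₀-cauchy {x} {c} {N} cx 0<c hc {ε} 0<ε =
    let 0<cc = *-mono-<-pos 0<c 0<c
        M , hx = cx (*-mono-<-pos 0<ε 0<cc)
        instance
          cc⁺ = positive 0<cc
          cc≥0 = ℚₚ.pos⇒nonNeg (c * c)
    in M ℕ.⊔ N , λ m n ≤m ≤n → ℚₚ.*-cancelʳ-<-nonNeg (c * c) (ℚₚ.≤-<-trans
         (1/₀-lipschitz (x m) (x n) 0<c
           (hc m (m⊔n≤o⇒n≤o M N ≤m)) (hc n (m⊔n≤o⇒n≤o M N ≤n)))
         (hx m n (m⊔n≤o⇒m≤o M N ≤m) (m⊔n≤o⇒m≤o M N ≤n)))

infix  4 _<_ _≤_ _≃_
infixl 6 _+_ _-_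
infixl 7 _*_ _÷_[_]
infix  8 -_
infixr 9 _^_

fromℚ : ℚ → ℝ
fromℚ q = mkℝ (λ _ → q) (const-cauchy q)

fromℕ : ℕ → ℝ
fromℕ n = fromℚ (+ n / 1)

0ℝ 1ℝ : ℝ
0ℝ = fromℚ 0ℚ
1ℝ = fromℚ 1ℚ

_+_ : ℝ → ℝ → ℝ
mkℝ x cx + mkℝ y cy = mkℝ (λ n → x n ℚ.+ y n) (+-cauchy {x} {y} cx cy)

-_ : ℝ → ℝ
- mkℝ x cx = mkℝ (λ n → ℚ.- x n) (neg-cauchy {x} cx)

_-_ : ℝ → ℝ → ℝ
x - y = x + (- y)

_*_ : ℝ → ℝ → ℝ
mkℝ x cx * mkℝ y cy = mkℝ (λ n → x n ℚ.* y n) (*-cauchy {x} {y} cx cy)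

_^_ : ℝ → ℕ → ℝ
x ^ zero  = 1ℝ
x ^ suc n = x * x ^ n

∣_∣ : ℝ → ℝ
∣ mkℝ x cx ∣ = mkℝ (λ n → ℚ.∣ x n ∣) (abs-cauchy {x} cx)

_<_ : ℝ → ℝ → Set
x < y = ∃[ ε ] 0ℚ ℚ.< ε × ∃[ N ] ∀ n → N ℕ.≤ n → seq x n ℚ.+ ε ℚ.≤ seq y n

_≤_ : ℝ → ℝ → Set
x ≤ y = ∀ {ε} → 0ℚ ℚ.< ε → ∃[ N ] ∀ n → N ℕ.≤ n → seq x n ℚ.≤ seq y n ℚ.+ ε

_≃_ : ℝ → ℝ → Set
x ≃ y = x ≤ y × y ≤ x

-- Division takes evidence that the divisor is apart from 0; finitely many
-- terms of its sequence may still vanish, and 1/₀_ sends those to 0.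
_÷_[_] : (x y : ℝ) → 0ℝ < ∣ y ∣ → ℝ
x ÷ mkℝ y cy [ c , 0<c , N , 0+c≤∣y∣ ] = x * mkℝ (λ n → 1/₀ y n)
  (1/₀-cauchy {N = N} cy 0<c λ n N≤n →
    subst (ℚ._≤ ℚ.∣ y n ∣) (ℚₚ.+-identityˡ c) (0+c≤∣y∣ n N≤n))

Tendsto : (ℕ → ℝ) → ℝ → Set
Tendsto u l = ∀ {ε} → 0ℚ ℚ.< ε → ∃[ N ] ∀ n → N ℕ.≤ n → ∣ u n - l ∣ < fromℚ ε

partialSum : (ℕ → ℝ) → ℕ → ℝ
partialSum a zero    = 0ℝ
partialSum a (suc n) = partialSum a n + a n

HasSum : (ℕ → ℝ) → ℝ → Set
HasSum a s = Tendsto (partialSum a) s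

-- Convergence to a limit is a relation, so exp, cos, log and √ are
-- given by their graphs.  IsExp x y means eˣ = y.
IsExp : ℝ → ℝ → Set
IsExp x y = HasSum (λ k → fromℚ ((+ 1 / (k !)) {{k !≢0}}) * x ^ k) y

-- cos x = y
IsCos : ℝ → ℝ → Set
IsCos x y = HasSum
  (λ k → fromℚ ((-1ℤ ℤ.^ k / ((2 ℕ.* k) !)) {{(2 ℕ.* k) !≢0}}) * x ^ (2 ℕ.* k)) y

-- log x = y, the natural logarithm as the inverse of exp
IsLog : ℝ → ℝ → Set
IsLog x y = IsExp y x

-- √x = y
IsSqrt : ℝ → ℝ → Set
IsSqrt x y = 0ℝ ≤ y × y * y ≃ x

-- π/2 is the first positive zero of cos: cos is positive on [0 , π/2).
IsPi : ℝ → Set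
IsPi π = 0ℝ < π
       × IsCos (π * fromℚ ½) 0ℝ
       × (∀ {x y} → 0ℝ ≤ x → x < π * fromℚ ½ → IsCos x y → 0ℝ < y)

-- (1 - 4/p) ((p+1)/(p-1))² at a prime p, written with p = 2 + m so that no divisor is 0;
-- the values at 0 and 1 are never used.
eulerFactor : ℕ → ℚ
eulerFactor (2+ m) = (1ℚ ℚ.- + 4 / p) ℚ.* (r ℚ.* r)
  where
  p = 2+ m
  r = + suc p / suc m
eulerFactor _ = 1ℚ

Prime≡1[8] : ℕ → Set
Prime≡1[8] p = Prime p × p % 8 ≡ 1

prime≡1[8]? : Decidable Prime≡1[8]
prime≡1[8]? p = prime? p ×-dec (p % 8 ≟ℕ 1)

primes≡1[8]< : ℕ → List ℕ
primes≡1[8]< n = filter prime≡1[8]? (upTo n)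

partialProduct : ℕ → ℚ
partialProduct n = foldr ℚ._*_ 1ℚ (map eulerFactor (primes≡1[8]< n))

-- The partial products run over all p < n, so this is convergence of the
-- product with the primes taken in increasing order.
IsEulerProduct : ℝ → Set
IsEulerProduct P = Tendsto (λ n → fromℚ (partialProduct n)) P

-- x = 0.d₁d₂…dₖ⋯ (truncated, not rounded), where d is the natural number
-- whose decimal digits are d₁d₂…dₖ.
HasDecimals : (k : ℕ) → ℝ → ℕ → Set
HasDecimals k x d =
  fromℚ (+ d / 10 ℕ.^ k) ≤ x × x < fromℚ (+ d / 10 ℕ.^ k ℚ.+ + 1 / 10 ℕ.^ k)
  where instance _ = m^n≢0 10 k

{-# OPTIONS --safe #-}
-- With x = 1/p, the factor at p ≡ 1 modulo 8 is (1 - 4x)(1 + x)²/(1 - x)², which agrees to high order with a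
-- product of powers (1 - xˢ)^(b s), 2 ≤ s ≤ 60.  Weighting the four characters modulo 8 suitably, the product of
-- all L(s, χ)^(-weight) has these local factors at p ≡ 1 modulo 8, while at the other odd primes its factors
-- cancel to the same order.  The primes below 256 are split off exactly, which leaves a relative error below
-- 10⁻¹⁰⁵.  Euler's sieve identifies the products over primes with character sums, whose tails are expanded in
-- inverse factorial series, where the sum over n telescopes; the rest is fixed-point interval arithmetic.
--
-- π/2 is located by the sign of cos at two rational points and log (1 + √2) by comparing exp with 1 + √2, so
-- that the second expansion reduces to an inequality between integers.

module Submission where

open import Data.Empty using (⊥; ⊥-elim)
import Data.Integer.Properties as ℤₚ
open import Data.List using (List; []; _∷_; _++_; map; filter; foldr; upTo)
open import Data.List.Properties as Listₚ using (map-∘)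
open import Data.Maybe using (Maybe; just; nothing)
open import Data.Nat as ℕ using (ℕ; zero; suc; _∸_; _!)
import Data.Nat.DivMod as ℕᵈ
open import Data.Nat.Primality
import Data.Nat.Properties as ℕₚ
open import Data.Product using (∃-syntax; _×_; _,_; proj₁; proj₂)
import Data.Rational as ℚ
import Data.Rational.Properties as ℚₚ
open import Data.Rational.Solver using (module +-*-Solver)
open import Data.Sum using (_⊎_; inj₁; inj₂; [_,_]′)
open import Data.Unit using (⊤; tt)
open import Function using (_∘_; mk⇔)
open import Relation.Binary.PropositionalEquality
open import Relation.Nullary using (¬_; Dec; yes; no; does; contradiction)
import Defs as Real
open ℚₚ using (≤-refl; ≤-trans; ≤-reflexive; ≤-antisym; ≤-total; <-irrefl; <-≤-trans; ≤-<-trans; <⇒≤; +-mono-≤;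
  +-mono-<-≤; +-mono-≤-<; +-monoˡ-≤; +-monoʳ-≤; +-monoʳ-<; neg-antimono-≤; *-identityˡ; *-identityʳ; *-zeroˡ;
  *-zeroʳ; *-comm; *-assoc; *-distribˡ-+; *-distribʳ-+; +-identityˡ; +-identityʳ; +-inverseʳ; +-comm;
  +-assoc; positive⁻¹; nonNegative⁻¹; ∣p*q∣≡∣p∣*∣q∣; ∣-p∣≡∣p∣; 0≤p⇒∣p∣≡p; 0≤∣p∣; ∣p+q∣≤∣p∣+∣q∣;
  toℚᵘ-injective; toℚᵘ-fromℚᵘ)
open +-*-Solver using (solve; _:=_; _:+_; _:*_; _:-_; :-_; con)

-- The exponents `b s` come from the cyclotomic identity: 1 - 4x is the product of the (1 - xˢ)^(m
-- s), where m s counts the aperiodic necklaces of length s over 4 letters. The factor (1 + x)²/(1 -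
-- x)² = (1 - x²)²/(1 - x)⁴ cancels the exponent 4 at s = 1 and adds 2 at s = 2, so no L(1, χ)
-- occurs and all series converge absolutely. The exponents grow like 4ˢ/s; cutting off after s = 60
-- leaves an error of order (4/p)⁶¹, which is tiny only once the small primes are split off. No
-- L-value is formed as a real number. The sieve compares a finite product over primes with a finite
-- character sum whose length may be exponential in that of the product; this length is only
-- quantified over, since the tail enclosures do not depend on it. One evaluation therefore encloses
-- all late partial products at once. Comparison of Cauchy reals is undecidable, so π/2 and the
-- logarithm are bounded by refuting that they stay on the wrong side of a rational point; a single
-- late term of the sequence then settles the other side at the cost of a few units in the last
-- place.

-- Rational arithmetic: embeddings, reciprocals, powers, finite sums and products.

module Rationals where
  open import Data.Integer as ℤ using (ℤ; +_; -[1+_])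
  open ℚ
  import Data.Rational.Unnormalised as ℚᵘ
  import Data.Rational.Unnormalised.Properties as ℚᵘₚ

  infixr 8 _^_
  _^_ : ℚ → ℕ → ℚ
  p ^ zero  = 1ℚ
  p ^ suc n = p * p ^ n

  ^-homo-* : ∀ p m n → p ^ (m ℕ.+ n) ≡ p ^ m * p ^ n
  ^-homo-* p zero    n = sym (*-identityˡ (p ^ n))
  ^-homo-* p (suc m) n = trans (cong (p *_) (^-homo-* p m n)) (sym (*-assoc p (p ^ m) (p ^ n)))

  ^-distrib-* : ∀ p q n → (p * q) ^ n ≡ p ^ n * q ^ n
  ^-distrib-* p q zero    = refl
  ^-distrib-* p q (suc n) = trans (cong (p * q *_) (^-distrib-* p q n))
    (solve 4 (λ a b c d → a :* b :* (c :* d) := a :* c :* (b :* d)) refl p q (p ^ n) (q ^ n))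

  opaque
    -- Opaque because unfolding `z / 1` at numerals of hundreds of digits would start gcd
    -- computations.
    ιℤ : ℤ → ℚ
    ιℤ z = z / 1

    ιℤ-/1 : ∀ z → ιℤ z ≡ z / 1
    ιℤ-/1 z = refl

  ι : ℕ → ℚ
  ι n = ιℤ (+ n)

  opaque
    unfolding ιℤ

    private
      toℚᵘ-ιℤ : ∀ z → toℚᵘ (ιℤ z) ℚᵘ.≃ ℚᵘ.mkℚᵘ z 0
      toℚᵘ-ιℤ z = toℚᵘ-fromℚᵘ (ℚᵘ.mkℚᵘ z 0)

    ι0 : ι 0 ≡ 0ℚ
    ι0 = refl

    ι1 : ι 1 ≡ 1ℚ
    ι1 = refl

    ιℤ-+ : ∀ a b → ιℤ (a ℤ.+ b) ≡ ιℤ a + ιℤ b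
    ιℤ-+ a b = toℚᵘ-injective (begin
      toℚᵘ (ιℤ (a ℤ.+ b))                 ≈⟨ toℚᵘ-ιℤ (a ℤ.+ b) ⟩
      ℚᵘ.mkℚᵘ (a ℤ.+ b) 0                 ≈⟨ ℚᵘ.*≡* (cong (ℤ._* + 1) (cong₂ ℤ._+_ (sym (ℤₚ.*-identityʳ a)) (sym (ℤₚ.*-identityʳ b)))) ⟩
      ℚᵘ.mkℚᵘ a 0 ℚᵘ.+ ℚᵘ.mkℚᵘ b 0        ≈⟨ ℚᵘₚ.+-cong (toℚᵘ-ιℤ a) (toℚᵘ-ιℤ b) ⟨
      toℚᵘ (ιℤ a) ℚᵘ.+ toℚᵘ (ιℤ b)        ≈⟨ ℚₚ.toℚᵘ-homo-+ (ιℤ a) (ιℤ b) ⟨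
      toℚᵘ (ιℤ a + ιℤ b)                  ∎)
      where open ℚᵘₚ.≃-Reasoning

    ιℤ-* : ∀ a b → ιℤ (a ℤ.* b) ≡ ιℤ a * ιℤ b
    ιℤ-* a b = toℚᵘ-injective (begin
      toℚᵘ (ιℤ (a ℤ.* b))                 ≈⟨ toℚᵘ-ιℤ (a ℤ.* b) ⟩
      ℚᵘ.mkℚᵘ a 0 ℚᵘ.* ℚᵘ.mkℚᵘ b 0        ≈⟨ ℚᵘₚ.*-cong (toℚᵘ-ιℤ a) (toℚᵘ-ιℤ b) ⟨
      toℚᵘ (ιℤ a) ℚᵘ.* toℚᵘ (ιℤ b)        ≈⟨ ℚₚ.toℚᵘ-homo-* (ιℤ a) (ιℤ b) ⟨
      toℚᵘ (ιℤ a * ιℤ b)                  ∎)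
      where open ℚᵘₚ.≃-Reasoning

    ιℤ-mono-≤ : ∀ {a b} → a ℤ.≤ b → ιℤ a ≤ ιℤ b
    ιℤ-mono-≤ {a} {b} a≤b = ℚₚ.toℚᵘ-cancel-≤ (begin
      toℚᵘ (ιℤ a)      ≃⟨ toℚᵘ-ιℤ a ⟩
      ℚᵘ.mkℚᵘ a 0      ≤⟨ ℚᵘ.*≤* (subst₂ ℤ._≤_ (sym (ℤₚ.*-identityʳ a)) (sym (ℤₚ.*-identityʳ b)) a≤b) ⟩
      ℚᵘ.mkℚᵘ b 0      ≃⟨ toℚᵘ-ιℤ b ⟨
      toℚᵘ (ιℤ b)      ∎)
      where open ℚᵘₚ.≤-Reasoning

  ι-mono-≤ : ∀ {m n} → m ℕ.≤ n → ι m ≤ ι n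
  ι-mono-≤ = ιℤ-mono-≤ ∘ ℤ.+≤+

  ι-+ : ∀ m n → ι (m ℕ.+ n) ≡ ι m + ι n
  ι-+ m n = ιℤ-+ (+ m) (+ n)

  ι-* : ∀ m n → ι (m ℕ.* n) ≡ ι m * ι n
  ι-* m n = trans (cong ιℤ (ℤₚ.pos-* m n)) (ιℤ-* (+ m) (+ n))

  ι2 : ι 2 ≡ 1ℚ + 1ℚ
  ι2 = ιℤ-/1 (+ 2)

  ι-suc : ∀ n → ι (suc n) ≡ 1ℚ + ι n
  ι-suc n = trans (ι-+ 1 n) (cong (_+ ι n) ι1)

  ι-^ : ∀ m n → ι (m ℕ.^ n) ≡ ι m ^ n
  ι-^ m zero    = ι1
  ι-^ m (suc n) = trans (ι-* m (m ℕ.^ n)) (cong (ι m *_) (ι-^ m n))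

  0≤ι : ∀ n → 0ℚ ≤ ι n
  0≤ι n = subst (_≤ ι n) ι0 (ι-mono-≤ ℕ.z≤n)

  0≤1 : 0ℚ ≤ 1ℚ
  0≤1 = nonNegative⁻¹ 1ℚ

  1≤ι : ∀ n .{{_ : ℕ.NonZero n}} → 1ℚ ≤ ι n
  1≤ι (suc n) = subst (_≤ ι (suc n)) ι1 (ι-mono-≤ (ℕ.s≤s ℕ.z≤n))

  0<ι : ∀ n .{{_ : ℕ.NonZero n}} → 0ℚ < ι n
  0<ι n = <-≤-trans (positive⁻¹ 1ℚ) (1≤ι n)

  opaque
    unfolding ιℤ

    -- junk value: recip 0 = 0, which keeps recip completely multiplicative
    recip : ℕ → ℚ
    recip zero      = 0ℚ
    recip n@(suc _) = + 1 / n

    recip0 : recip 0 ≡ 0ℚ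
    recip0 = refl

    recip1 : recip 1 ≡ 1ℚ
    recip1 = refl

    z/n : ∀ z n .{{_ : ℕ.NonZero n}} → z / n ≡ ιℤ z * recip n
    z/n z (suc n) = toℚᵘ-injective (begin
      toℚᵘ (z / suc n)                       ≈⟨ toℚᵘ-fromℚᵘ (ℚᵘ.mkℚᵘ z n) ⟩
      ℚᵘ.mkℚᵘ z n                            ≈⟨ ℚᵘ.*≡* (cong₂ ℤ._*_ (ℤₚ.*-identityʳ z) (sym (cong +_ (ℕₚ.+-identityʳ (suc n))))) ⟨
      ℚᵘ.mkℚᵘ z 0 ℚᵘ.* ℚᵘ.mkℚᵘ (+ 1) n       ≈⟨ ℚᵘₚ.*-cong (toℚᵘ-ιℤ z) (toℚᵘ-fromℚᵘ (ℚᵘ.mkℚᵘ (+ 1) n)) ⟨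
      toℚᵘ (ιℤ z) ℚᵘ.* toℚᵘ (recip (suc n))  ≈⟨ ℚₚ.toℚᵘ-homo-* (ιℤ z) (recip (suc n)) ⟨
      toℚᵘ (ιℤ z * recip (suc n))            ∎)
      where open ℚᵘₚ.≃-Reasoning

    ι*recip : ∀ n .{{_ : ℕ.NonZero n}} → ι n * recip n ≡ 1ℚ
    ι*recip (suc n) = trans (sym (z/n (+ suc n) (suc n))) (toℚᵘ-injective
      (ℚᵘₚ.≃-trans (toℚᵘ-fromℚᵘ (ℚᵘ.mkℚᵘ (+ suc n) n)) (ℚᵘ.*≡* (ℤₚ.*-comm (+ suc n) (+ 1)))))

    0≤recip : ∀ n → 0ℚ ≤ recip n
    0≤recip zero    = ≤-refl
    0≤recip (suc n) = nonNegative⁻¹ (+ 1 / suc n) {{ℚₚ.normalize-nonNeg 1 (suc n)}}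

  recip*ι : ∀ n .{{_ : ℕ.NonZero n}} → recip n * ι n ≡ 1ℚ
  recip*ι n = trans (*-comm (recip n) (ι n)) (ι*recip n)

  n≤2^n : ∀ n → n ℕ.≤ 2 ℕ.^ n
  n≤2^n zero    = ℕ.z≤n
  n≤2^n (suc n) = ℕₚ.≤-trans (ℕ.s≤s (n≤2^n n)) (ℕₚ.≤-trans (ℕₚ.+-monoˡ-≤ (2 ℕ.^ n) (ℕ.>-nonZero⁻¹ (2 ℕ.^ n) {{ℕₚ.m^n≢0 2 n}}))
    (ℕₚ.+-monoʳ-≤ (2 ℕ.^ n) (ℕₚ.m≤m+n (2 ℕ.^ n) 0)))

  *-nonNeg : ∀ {p q} → 0ℚ ≤ p → 0ℚ ≤ q → 0ℚ ≤ p * q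
  *-nonNeg {p} {q} 0≤p 0≤q = nonNegative⁻¹ (p * q)
    {{ℚₚ.nonNeg*nonNeg⇒nonNeg p {{nonNegative 0≤p}} q {{nonNegative 0≤q}}}}

  +-nonNeg : ∀ {p q} → 0ℚ ≤ p → 0ℚ ≤ q → 0ℚ ≤ p + q
  +-nonNeg = +-mono-≤

  *-pos : ∀ {p q} → 0ℚ < p → 0ℚ < q → 0ℚ < p * q
  *-pos {p} {q} 0<p 0<q = positive⁻¹ (p * q) {{ℚₚ.pos*pos⇒pos p {{positive 0<p}} q {{positive 0<q}}}}

  p≤q⇒0≤q-p : ∀ {p q} → p ≤ q → 0ℚ ≤ q - p
  p≤q⇒0≤q-p {p} {q} h = subst (_≤ q - p) (+-inverseʳ p) (+-monoˡ-≤ (- p) h)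

  -- Reduces an inequality to the nonnegativity of the difference, which a ring
  -- identity then expresses through known nonnegative quantities.
  ≤-diff : ∀ {p q r} → 0ℚ ≤ r → p + r ≡ q → p ≤ q
  ≤-diff {p} {r = r} 0≤r refl = subst (_≤ p + r) (+-identityʳ p) (+-monoʳ-≤ p 0≤r)

  <-diff : ∀ {p q r} → 0ℚ < r → p + r ≡ q → p < q
  <-diff {p} {r = r} 0<r refl = subst (_< p + r) (+-identityʳ p) (+-monoʳ-< p 0<r)

  *-monoˡ : ∀ {p q} r → 0ℚ ≤ r → p ≤ q → r * p ≤ r * q
  *-monoˡ r 0≤r = ℚₚ.*-monoˡ-≤-nonNeg r {{nonNegative 0≤r}}

  *-monoʳ : ∀ {p q} r → 0ℚ ≤ r → p ≤ q → p * r ≤ q * r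
  *-monoʳ r 0≤r = ℚₚ.*-monoʳ-≤-nonNeg r {{nonNegative 0≤r}}

  *-mono : ∀ {p q r s} → 0ℚ ≤ p → 0ℚ ≤ r → p ≤ q → r ≤ s → p * r ≤ q * s
  *-mono {p} {q} {r} {s} 0≤p 0≤r p≤q r≤s =
    ≤-trans (*-monoˡ p 0≤p r≤s) (*-monoʳ s (≤-trans 0≤r r≤s) p≤q)

  *-cancelʳ : ∀ {p q} r → 0ℚ < r → p * r ≤ q * r → p ≤ q
  *-cancelʳ r 0<r = ℚₚ.*-cancelʳ-≤-pos r {{positive 0<r}}

  *-cancelʳ-< : ∀ {p q} r → 0ℚ < r → p * r < q * r → p < q
  *-cancelʳ-< r 0<r = ℚₚ.*-cancelʳ-<-nonNeg r {{ℚₚ.pos⇒nonNeg r {{positive 0<r}}}}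

  *-cancelʳ-≡ : ∀ {p q} r → 0ℚ < r → p * r ≡ q * r → p ≡ q
  *-cancelʳ-≡ r 0<r eq = ≤-antisym
    (*-cancelʳ r 0<r (≤-reflexive eq)) (*-cancelʳ r 0<r (≤-reflexive (sym eq)))

  ^-nonNeg : ∀ {p} n → 0ℚ ≤ p → 0ℚ ≤ p ^ n
  ^-nonNeg zero    0≤p = 0≤1
  ^-nonNeg (suc n) 0≤p = *-nonNeg 0≤p (^-nonNeg n 0≤p)

  ^-mono-≤ : ∀ {p q} n → 0ℚ ≤ p → p ≤ q → p ^ n ≤ q ^ n
  ^-mono-≤ zero    0≤p p≤q = ≤-refl
  ^-mono-≤ (suc n) 0≤p p≤q = *-mono 0≤p (^-nonNeg n 0≤p) p≤q (^-mono-≤ n 0≤p p≤q)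

  1^n≡1 : ∀ n → 1ℚ ^ n ≡ 1ℚ
  1^n≡1 zero    = refl
  1^n≡1 (suc n) = trans (*-identityˡ (1ℚ ^ n)) (1^n≡1 n)

  ^-≤1 : ∀ {p} n → 0ℚ ≤ p → p ≤ 1ℚ → p ^ n ≤ 1ℚ
  ^-≤1 {p} n 0≤p p≤1 = subst (p ^ n ≤_) (1^n≡1 n) (^-mono-≤ n 0≤p p≤1)

  1≤^ : ∀ {p} n → 1ℚ ≤ p → 1ℚ ≤ p ^ n
  1≤^ {p} n 1≤p = subst (_≤ p ^ n) (1^n≡1 n) (^-mono-≤ n 0≤1 1≤p)

  recip-* : ∀ m n → recip (m ℕ.* n) ≡ recip m * recip n
  recip-* zero n = trans recip0 (sym (trans (cong (_* recip n) recip0) (*-zeroˡ (recip n))))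
  recip-* m@(suc _) zero = trans (trans (cong recip (ℕₚ.*-zeroʳ m)) recip0)
    (sym (trans (cong (recip m *_) recip0) (*-zeroʳ (recip m))))
  recip-* m@(suc _) n@(suc _) = *-cancelʳ-≡ (ι (m ℕ.* n)) (0<ι (m ℕ.* n)) (begin
    recip (m ℕ.* n) * ι (m ℕ.* n)           ≡⟨ recip*ι (m ℕ.* n) ⟩
    1ℚ * 1ℚ                                 ≡⟨ cong₂ _*_ (recip*ι m) (recip*ι n) ⟨
    recip m * ι m * (recip n * ι n)         ≡⟨ solve 4 (λ a b c d → a :* b :* (c :* d) := a :* c :* (b :* d)) refl (recip m) (ι m) (recip n) (ι n) ⟩
    recip m * recip n * (ι m * ι n)         ≡⟨ cong (recip m * recip n *_) (ι-* m n) ⟨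
    recip m * recip n * ι (m ℕ.* n)         ∎)
    where open ≡-Reasoning

  recip-^ : ∀ m n → recip (m ℕ.^ n) ≡ recip m ^ n
  recip-^ m zero    = recip1
  recip-^ m (suc n) = trans (recip-* m (m ℕ.^ n)) (cong (recip m *_) (recip-^ m n))

  recip-antimono : ∀ {m n} .{{_ : ℕ.NonZero m}} → m ℕ.≤ n → recip n ≤ recip m
  recip-antimono {m} {zero} m≤n = subst (_≤ recip m) (sym recip0) (0≤recip m)
  recip-antimono {m} {n@(suc _)} m≤n = *-cancelʳ (ι n) (0<ι n) (begin
    recip n * ι n           ≡⟨ recip*ι n ⟩
    1ℚ                      ≡⟨ recip*ι m ⟨
    recip m * ι m           ≤⟨ *-monoˡ (recip m) (0≤recip m) (ι-mono-≤ m≤n) ⟩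
    recip m * ι n           ∎)
    where open ℚₚ.≤-Reasoning

  recip≤1 : ∀ n → recip n ≤ 1ℚ
  recip≤1 zero    = subst (_≤ 1ℚ) (sym recip0) 0≤1
  recip≤1 (suc n) = subst (recip (suc n) ≤_) recip1 (recip-antimono {1} (ℕ.s≤s ℕ.z≤n))

  0<recip : ∀ n .{{_ : ℕ.NonZero n}} → 0ℚ < recip n
  0<recip n = *-cancelʳ-< (ι n) (0<ι n)
    (subst₂ _<_ (sym (*-zeroˡ (ι n))) (sym (recip*ι n)) (positive⁻¹ 1ℚ))

  ∣∣≤⇒≤ : ∀ {p q} → ∣ p ∣ ≤ q → p ≤ q
  ∣∣≤⇒≤ {p} h with ≤-total 0ℚ p
  ... | inj₁ 0≤p = subst (_≤ _) (0≤p⇒∣p∣≡p 0≤p) h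
  ... | inj₂ p≤0 = ≤-trans p≤0 (≤-trans (0≤∣p∣ p) h)

  ∣∣≤⇒-≤ : ∀ {p q} → ∣ p ∣ ≤ q → - q ≤ p
  ∣∣≤⇒-≤ {p} {q} h = subst (- q ≤_) (solve 1 (λ p → :- :- p := p) refl p)
    (neg-antimono-≤ (∣∣≤⇒≤ (subst (_≤ q) (sym (∣-p∣≡∣p∣ p)) h)))

  ∣*∣≤ : ∀ {p q r s} → ∣ p ∣ ≤ r → ∣ q ∣ ≤ s → ∣ p * q ∣ ≤ r * s
  ∣*∣≤ {p} {q} h k = subst (_≤ _) (sym (∣p*q∣≡∣p∣*∣q∣ p q))
    (*-mono (0≤∣p∣ p) (0≤∣p∣ q) h k)

  ∣+∣≤ : ∀ {p q r s} → ∣ p ∣ ≤ r → ∣ q ∣ ≤ s → ∣ p + q ∣ ≤ r + s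
  ∣+∣≤ {p} {q} h k = ≤-trans (∣p+q∣≤∣p∣+∣q∣ p q) (+-mono-≤ h k)

  ∣-∣≤ : ∀ {p q r s} → ∣ p ∣ ≤ r → ∣ q ∣ ≤ s → ∣ p - q ∣ ≤ r + s
  ∣-∣≤ {p} {q} {s = s} h k = ∣+∣≤ {p} h (subst (_≤ s) (sym (∣-p∣≡∣p∣ q)) k)

  0≤⇒∣∣≤ : ∀ {p q} → 0ℚ ≤ p → p ≤ q → ∣ p ∣ ≤ q
  0≤⇒∣∣≤ 0≤p = subst (_≤ _) (sym (0≤p⇒∣p∣≡p 0≤p))

  Σ : (ℕ → ℚ) → ℕ → ℚ
  Σ f zero    = 0ℚ
  Σ f (suc n) = Σ f n + f n

  Π : (ℕ → ℚ) → ℕ → ℚ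
  Π f zero    = 1ℚ
  Π f (suc n) = Π f n * f n

  Σ-cong : ∀ {f g} n → (∀ i → f i ≡ g i) → Σ f n ≡ Σ g n
  Σ-cong zero    h = refl
  Σ-cong (suc n) h = cong₂ _+_ (Σ-cong n h) (h n)

  Σ-+ : ∀ f g n → Σ (λ i → f i + g i) n ≡ Σ f n + Σ g n
  Σ-+ f g zero    = refl
  Σ-+ f g (suc n) = trans (cong (_+ (f n + g n)) (Σ-+ f g n))
    (solve 4 (λ a b c d → a :+ b :+ (c :+ d) := a :+ c :+ (b :+ d)) refl (Σ f n) (Σ g n) (f n) (g n))

  Σ-*ˡ : ∀ c f n → Σ (λ i → c * f i) n ≡ c * Σ f n
  Σ-*ˡ c f zero    = sym (*-zeroʳ c)
  Σ-*ˡ c f (suc n) = trans (cong (_+ c * f n) (Σ-*ˡ c f n)) (sym (*-distribˡ-+ c (Σ f n) (f n)))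

  Σ-split : ∀ f m n → Σ f (m ℕ.+ n) ≡ Σ f m + Σ (λ i → f (m ℕ.+ i)) n
  Σ-split f m zero    = trans (cong (Σ f) (ℕₚ.+-identityʳ m)) (sym (+-identityʳ (Σ f m)))
  Σ-split f m (suc n) = trans (cong (Σ f) (ℕₚ.+-suc m n))
    (trans (cong (_+ f (m ℕ.+ n)) (Σ-split f m n)) (+-assoc (Σ f m) _ _))

  Σ-mono : ∀ {f g} n → (∀ i → f i ≤ g i) → Σ f n ≤ Σ g n
  Σ-mono zero    h = ≤-refl
  Σ-mono (suc n) h = +-mono-≤ (Σ-mono n h) (h n)

  Σ-nonNeg : ∀ {f} n → (∀ i → 0ℚ ≤ f i) → 0ℚ ≤ Σ f n
  Σ-nonNeg zero    h = ≤-refl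
  Σ-nonNeg (suc n) h = +-nonNeg (Σ-nonNeg n h) (h n)

  ∣Σ∣≤ : ∀ {f g} n → (∀ i → ∣ f i ∣ ≤ g i) → ∣ Σ f n ∣ ≤ Σ g n
  ∣Σ∣≤ zero    h = ≤-refl
  ∣Σ∣≤ {f} (suc n) h = ∣+∣≤ {Σ f n} (∣Σ∣≤ n h) (h n)

  Π-split : ∀ f m n → Π f (m ℕ.+ n) ≡ Π f m * Π (λ i → f (m ℕ.+ i)) n
  Π-split f m zero    = trans (cong (Π f) (ℕₚ.+-identityʳ m)) (sym (*-identityʳ (Π f m)))
  Π-split f m (suc n) = trans (cong (Π f) (ℕₚ.+-suc m n))
    (trans (cong (_* f (m ℕ.+ n)) (Π-split f m n)) (*-assoc (Π f m) _ _))

  Π-cong : ∀ {f g} n → (∀ i → f i ≡ g i) → Π f n ≡ Π g n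
  Π-cong zero    h = refl
  Π-cong (suc n) h = cong₂ _*_ (Π-cong n h) (h n)

  Π-* : ∀ f g n → Π (λ i → f i * g i) n ≡ Π f n * Π g n
  Π-* f g zero    = refl
  Π-* f g (suc n) = trans (cong (_* (f n * g n)) (Π-* f g n))
    (solve 4 (λ a b c d → a :* b :* (c :* d) := a :* c :* (b :* d)) refl (Π f n) (Π g n) (f n) (g n))

  Π-^ : ∀ f e n → Π (λ i → f i ^ e) n ≡ Π f n ^ e
  Π-^ f e zero    = sym (1^n≡1 e)
  Π-^ f e (suc n) = trans (cong (_* f n ^ e) (Π-^ f e n)) (sym (^-distrib-* (Π f n) (f n) e))

  Π-1 : ∀ n → Π (λ _ → 1ℚ) n ≡ 1ℚ
  Π-1 zero    = refl
  Π-1 (suc n) = trans (cong (_* 1ℚ) (Π-1 n)) (*-identityʳ 1ℚ)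

  Π-nonNeg : ∀ {f} n → (∀ i → 0ℚ ≤ f i) → 0ℚ ≤ Π f n
  Π-nonNeg zero    h = 0≤1
  Π-nonNeg (suc n) h = *-nonNeg (Π-nonNeg n h) (h n)

-- Fixed-point interval arithmetic with natural numbers as ends.

module Intervals where
  open ℚ
  open Rationals

  record Interval : Set where
    constructor _‥_
    field lo hi : ℕ
  open Interval public

  infixl 7 _div_
  -- Total, so that computed enclosures carry no evidence about divisors; such evidence is asked for
  -- only by the soundness lemmas.
  _div_ : ℕ → ℕ → ℕ
  a div zero      = 0
  a div d@(suc _) = a ℕ./ d

  floor≤ : ∀ a d .{{_ : ℕ.NonZero d}} → ι (a div d) ≤ ι a * recip d
  floor≤ a d@(suc _) = begin
    ι (a div d)                      ≡⟨ *-identityʳ (ι (a div d)) ⟨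
    ι (a div d) * 1ℚ                 ≡⟨ cong (ι (a div d) *_) (ι*recip d) ⟨
    ι (a div d) * (ι d * recip d)    ≡⟨ *-assoc (ι (a div d)) (ι d) (recip d) ⟨
    ι (a div d) * ι d * recip d      ≡⟨ cong (_* recip d) (ι-* (a div d) d) ⟨
    ι (a div d ℕ.* d) * recip d      ≤⟨ *-monoʳ (recip d) (0≤recip d) (ι-mono-≤ (ℕᵈ.m/n*n≤m a d)) ⟩
    ι a * recip d                    ∎
    where open ℚₚ.≤-Reasoning

  -- One more than the floor stands in for the ceiling; it overshoots when `d` divides `a`, which
  -- merely widens the enclosure.
  ≤ceil : ∀ a d .{{_ : ℕ.NonZero d}} → ι a * recip d ≤ ι (suc (a div d))
  ≤ceil a d@(suc _) = begin
    ι a * recip d                          ≤⟨ *-monoʳ (recip d) (0≤recip d) (ι-mono-≤ m≤[1+m/n]*n) ⟩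
    ι (suc (a div d) ℕ.* d) * recip d      ≡⟨ cong (_* recip d) (ι-* (suc (a div d)) d) ⟩
    ι (suc (a div d)) * ι d * recip d      ≡⟨ *-assoc (ι (suc (a div d))) (ι d) (recip d) ⟩
    ι (suc (a div d)) * (ι d * recip d)    ≡⟨ cong (ι (suc (a div d)) *_) (ι*recip d) ⟩
    ι (suc (a div d)) * 1ℚ                 ≡⟨ *-identityʳ (ι (suc (a div d))) ⟩
    ι (suc (a div d))                      ∎
    where
    open ℚₚ.≤-Reasoning
    m≤[1+m/n]*n : a ℕ.≤ suc (a div d) ℕ.* d
    m≤[1+m/n]*n = subst (ℕ._≤ d ℕ.+ a div d ℕ.* d) (sym (ℕᵈ.m≡m%n+[m/n]*n a d))
      (ℕₚ.+-monoˡ-≤ (a div d ℕ.* d) (ℕₚ.<⇒≤ (ℕᵈ.m%n<n a d)))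

  ι-∸ : ∀ a b {q} → 0ℚ ≤ q → ι a - ι b ≤ q → ι (a ∸ b) ≤ q
  ι-∸ zero    b       0≤q h = subst (_≤ _) (sym (trans (cong ι (ℕₚ.0∸n≡0 b)) ι0)) 0≤q
  ι-∸ (suc a) zero    0≤q h = subst (_≤ _) (trans (cong (λ z → ι (suc a) - z) ι0) (+-identityʳ (ι (suc a)))) h
  ι-∸ (suc a) (suc b) 0≤q h = ι-∸ a b 0≤q (subst (_≤ _)
    (trans (cong₂ _-_ (ι-suc a) (ι-suc b)) (solve 2 (λ a b → con 1ℚ :+ a :- (con 1ℚ :+ b) := a :- b) refl (ι a) (ι b))) h)

  infixl 6 _+ᴵ_
  _+ᴵ_ : Interval → Interval → Interval
  (a ‥ b) +ᴵ (c ‥ d) = (a ℕ.+ c) ‥ (b ℕ.+ d)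

  scale : ℕ → ℕ → Interval → Interval
  scale n d (a ‥ b) = (a ℕ.* n div d) ‥ suc (b ℕ.* n div d)

  ^-half : ∀ q n → q ^ (n ℕ.% 2) * (q * q) ^ (n ℕ./ 2) ≡ q ^ n
  ^-half q n = begin
    q ^ (n ℕ.% 2) * (q * q) ^ (n ℕ./ 2)              ≡⟨ cong (q ^ (n ℕ.% 2) *_) (trans (^-distrib-* q q (n ℕ./ 2)) (sym (^-homo-* q (n ℕ./ 2) (n ℕ./ 2)))) ⟩
    q ^ (n ℕ.% 2) * q ^ (n ℕ./ 2 ℕ.+ n ℕ./ 2)        ≡⟨ ^-homo-* q (n ℕ.% 2) (n ℕ./ 2 ℕ.+ n ℕ./ 2) ⟨
    q ^ (n ℕ.% 2 ℕ.+ (n ℕ./ 2 ℕ.+ n ℕ./ 2))          ≡⟨ cong (λ e → q ^ (n ℕ.% 2 ℕ.+ e)) (trans (cong (n ℕ./ 2 ℕ.+_) (sym (ℕₚ.+-identityʳ (n ℕ./ 2)))) (ℕₚ.*-comm 2 (n ℕ./ 2))) ⟩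
    q ^ (n ℕ.% 2 ℕ.+ n ℕ./ 2 ℕ.* 2)                  ≡⟨ cong (q ^_) (ℕᵈ.m≡m%n+[m/n]*n n 2) ⟨
    q ^ n                                            ∎
    where open ≡-Reasoning

  -- Fixed-point interval arithmetic: a ‥ b stands for [a/D, b/D].
  module FixedPoint (D : ℕ) .{{D≢0 : ℕ.NonZero D}} where

    0<D : 0ℚ < ι D
    0<D = 0<ι D

    infix 4 _∈_
    record _∈_ (q : ℚ) (I : Interval) : Set where
      constructor _,_
      field
        lower : ι (lo I) ≤ q * ι D
        upper : q * ι D ≤ ι (hi I)

    -- The ends are natural numbers, so membership carries the sign; this is what makes it sound to
    -- multiply end by end.
    ∈⇒0≤ : ∀ {q} I → q ∈ I → 0ℚ ≤ q
    ∈⇒0≤ {q} (a ‥ b) (l , _) = *-cancelʳ (ι D) 0<D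
      (subst (_≤ q * ι D) (sym (*-zeroˡ (ι D))) (≤-trans (0≤ι a) l))

    one : Interval
    one = D ‥ D

    ∈-one : 1ℚ ∈ one
    ∈-one = ≤-reflexive (sym (*-identityˡ (ι D))) , ≤-reflexive (*-identityˡ (ι D))

    ∈-+ : ∀ {q r} I J → q ∈ I → r ∈ J → q + r ∈ I +ᴵ J
    ∈-+ {q} {r} (a ‥ b) (c ‥ d) (l , h) (l′ , h′) =
      subst₂ _≤_ (sym (ι-+ a c)) (sym (*-distribʳ-+ (ι D) q r)) (+-mono-≤ l l′) ,
      subst₂ _≤_ (sym (*-distribʳ-+ (ι D) q r)) (sym (ι-+ b d)) (+-mono-≤ h h′)

    scale-≤ : ∀ {q} a n d .{{_ : ℕ.NonZero d}} → ι a ≤ q * ι D → ι (a ℕ.* n div d) ≤ q * (ι n * recip d) * ι D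
    scale-≤ {q} a n d l = begin
      ι (a ℕ.* n div d)                ≤⟨ floor≤ (a ℕ.* n) d ⟩
      ι (a ℕ.* n) * recip d            ≡⟨ cong (_* recip d) (ι-* a n) ⟩
      ι a * ι n * recip d              ≤⟨ *-monoʳ (recip d) (0≤recip d) (*-monoʳ (ι n) (0≤ι n) l) ⟩
      q * ι D * ι n * recip d          ≡⟨ solve 4 (λ q D n d → q :* D :* n :* d := q :* (n :* d) :* D) refl q (ι D) (ι n) (recip d) ⟩
      q * (ι n * recip d) * ι D        ∎
      where open ℚₚ.≤-Reasoning

    ≤-scale : ∀ {q} b n d .{{_ : ℕ.NonZero d}} → q * ι D ≤ ι b → q * (ι n * recip d) * ι D ≤ ι (suc (b ℕ.* n div d))
    ≤-scale {q} b n d h = begin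
      q * (ι n * recip d) * ι D        ≡⟨ solve 4 (λ q D n d → q :* D :* n :* d := q :* (n :* d) :* D) refl q (ι D) (ι n) (recip d) ⟨
      q * ι D * ι n * recip d          ≤⟨ *-monoʳ (recip d) (0≤recip d) (*-monoʳ (ι n) (0≤ι n) h) ⟩
      ι b * ι n * recip d              ≡⟨ cong (_* recip d) (ι-* b n) ⟨
      ι (b ℕ.* n) * recip d            ≤⟨ ≤ceil (b ℕ.* n) d ⟩
      ι (suc (b ℕ.* n div d))          ∎
      where open ℚₚ.≤-Reasoning

    ∈-scale : ∀ {q} I n d .{{_ : ℕ.NonZero d}} → q ∈ I → q * (ι n * recip d) ∈ scale n d I
    ∈-scale {q} (a ‥ b) n d (l , h) = scale-≤ {q} a n d l , ≤-scale {q} b n d h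

    infixl 7 _*ᴵ_
    _*ᴵ_ : Interval → Interval → Interval
    (a ‥ b) *ᴵ (c ‥ d) = (a ℕ.* c div D) ‥ suc (b ℕ.* d div D)

    private
      qDrD : ∀ q r → q * ι D * (r * ι D) * recip D ≡ q * r * ι D
      qDrD q r = trans (solve 4 (λ q D r d → q :* D :* (r :* D) :* d := q :* r :* D :* (D :* d)) refl q (ι D) r (recip D))
        (trans (cong (q * r * ι D *_) (ι*recip D)) (*-identityʳ (q * r * ι D)))

    ∈-* : ∀ {q r} I J → q ∈ I → r ∈ J → q * r ∈ I *ᴵ J
    ∈-* {q} {r} I@(a ‥ b) J@(c ‥ d) q∈I@(l , h) r∈J@(l′ , h′) = (begin
      ι (a ℕ.* c div D)                ≤⟨ floor≤ (a ℕ.* c) D ⟩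
      ι (a ℕ.* c) * recip D            ≡⟨ cong (_* recip D) (ι-* a c) ⟩
      ι a * ι c * recip D              ≤⟨ *-monoʳ (recip D) (0≤recip D) (*-mono (0≤ι a) (0≤ι c) l l′) ⟩
      q * ι D * (r * ι D) * recip D    ≡⟨ qDrD q r ⟩
      q * r * ι D                      ∎) , (begin
      q * r * ι D                      ≡⟨ qDrD q r ⟨
      q * ι D * (r * ι D) * recip D    ≤⟨ *-monoʳ (recip D) (0≤recip D) (*-mono (*-nonNeg {q} (∈⇒0≤ I q∈I) (0≤ι D)) (*-nonNeg {r} (∈⇒0≤ J r∈J) (0≤ι D)) h h′) ⟩
      ι b * ι d * recip D              ≡⟨ cong (_* recip D) (ι-* b d) ⟨
      ι (b ℕ.* d) * recip D            ≤⟨ ≤ceil (b ℕ.* d) D ⟩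
      ι (suc (b ℕ.* d div D))          ∎)
      where open ℚₚ.≤-Reasoning

    pow : Interval → ℕ → Interval
    pow I zero    = one
    pow I (suc n) = I *ᴵ pow I n

    ∈-pow : ∀ {q} I n → q ∈ I → q ^ n ∈ pow I n
    ∈-pow I zero    q∈I = ∈-one
    ∈-pow I (suc n) q∈I = ∈-* I (pow I n) q∈I (∈-pow I n q∈I)

    -- Square-and-multiply; f bounds the number of binary digits of the exponent.
    fastPow : ℕ → Interval → ℕ → Interval
    fastPow zero    I n = pow I n
    fastPow (suc f) I zero = one
    fastPow (suc f) I n@(suc _) with n ℕ.% 2
    ... | zero  = fastPow f (I *ᴵ I) (n ℕ./ 2)
    ... | suc _ = I *ᴵ fastPow f (I *ᴵ I) (n ℕ./ 2)

    ∈-fastPow : ∀ {q} f I n → q ∈ I → q ^ n ∈ fastPow f I n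
    ∈-fastPow zero    I n          q∈I = ∈-pow I n q∈I
    ∈-fastPow (suc f) I zero       q∈I = ∈-one
    ∈-fastPow {q} (suc f) I n@(suc _) q∈I
      with n ℕ.% 2 | ^-half q n | ℕᵈ.m%n<n n 2
    ... | zero  | eq | _ = subst (_∈ _) (trans (sym (*-identityˡ _)) eq)
          (∈-fastPow f (I *ᴵ I) (n ℕ./ 2) (∈-* I I q∈I q∈I))
    ... | suc zero | eq | _ = subst (_∈ _) (trans (cong (_* (q * q) ^ (n ℕ./ 2)) (sym (*-identityʳ q))) eq)
          (∈-* I (fastPow f (I *ᴵ I) (n ℕ./ 2)) q∈I (∈-fastPow f (I *ᴵ I) (n ℕ./ 2) (∈-* I I q∈I q∈I)))
    ... | suc (suc _) | _ | ℕ.s≤s (ℕ.s≤s ())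

    ∈-subst : ∀ {q r I} → q ≡ r → q ∈ I → r ∈ I
    ∈-subst refl h = h

    -- Differences of enclosed numbers need not be known to be nonnegative,
    -- so their truncated lower end is informative only when it is not 0.
    infix 4 _∈±_
    record _∈±_ (q : ℚ) (I : Interval) : Set where
      constructor _,_
      field
        lower : lo I ≢ 0 → ι (lo I) ≤ q * ι D
        upper : q * ι D ≤ ι (hi I)

    infixl 6 _-ᴵ_
    _-ᴵ_ : Interval → Interval → Interval
    (a ‥ b) -ᴵ (c ‥ d) = (a ∸ d) ‥ (b ∸ c)

    ∈±-scale : ∀ {q} I n d .{{_ : ℕ.NonZero d}} → q ∈± I → q * (ι n * recip d) ∈± scale n d I
    -- A zero lower end stays zero under scaling, so the claim about the lower end is vacuous.
    ∈±-scale {q} (zero ‥ b) n d (l , h) = (λ a≢0 → contradiction (0div d) a≢0) , ≤-scale {q} b n d h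
      where
      0div : ∀ d → 0 div d ≡ 0
      0div zero    = refl
      0div (suc d) = ℕᵈ.0/n≡0 (suc d)
    ∈±-scale {q} (a@(suc _) ‥ b) n d (l , h) = (λ _ → scale-≤ {q} a n d (l λ ())) , ≤-scale {q} b n d h

    ∈-‑ : ∀ {q r} I J → q ∈ I → r ∈ J → q - r ∈± I -ᴵ J
    ∈-‑ {q} {r} (a ‥ b) (c ‥ d) (l , h) (l′ , h′) = lower , upper
      where
      open ℚₚ.≤-Reasoning
      [q-r]D : (q - r) * ι D ≡ q * ι D - r * ι D
      [q-r]D = solve 3 (λ q r D → (q :- r) :* D := q :* D :- r :* D) refl q r (ι D)
      ι-∸′ : ∀ m n → n ℕ.≤ m → ι (m ∸ n) ≡ ι m - ι n
      ι-∸′ m n n≤m = trans (solve 2 (λ x y → x := x :+ y :- y) refl (ι (m ∸ n)) (ι n))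
        (cong (_- ι n) (trans (sym (ι-+ (m ∸ n) n)) (cong ι (ℕₚ.m∸n+n≡m n≤m))))
      lower : a ∸ d ≢ 0 → ι (a ∸ d) ≤ (q - r) * ι D
      lower a∸d≢0 = begin
        ι (a ∸ d)              ≡⟨ ι-∸′ a d (ℕₚ.<⇒≤ (ℕₚ.m∸n≢0⇒n<m a∸d≢0)) ⟩
        ι a - ι d              ≤⟨ +-mono-≤ l (neg-antimono-≤ h′) ⟩
        q * ι D - r * ι D      ≡⟨ [q-r]D ⟨
        (q - r) * ι D          ∎
      upper : (q - r) * ι D ≤ ι (b ∸ c)
      upper = begin
        (q - r) * ι D          ≡⟨ [q-r]D ⟩
        q * ι D - r * ι D      ≤⟨ +-mono-≤ h (neg-antimono-≤ l′) ⟩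
        ι b - ι c              ≤⟨ ≤-∸ b c ⟩
        ι (b ∸ c)              ∎
        where
        ≤-∸ : ∀ b c → ι b - ι c ≤ ι (b ∸ c)
        ≤-∸ b       zero    = ≤-reflexive (trans (cong (λ z → ι b - z) ι0) (+-identityʳ (ι b)))
        ≤-∸ zero    (suc c) = ≤-diff (0≤ι (suc c)) (solve 2 (λ x y → x :- y :+ y := x) refl (ι 0) (ι (suc c)))
        ≤-∸ (suc b) (suc c) = ≤-trans (≤-reflexive (trans (cong₂ _-_ (ι-suc b) (ι-suc c))
          (solve 2 (λ a b → con 1ℚ :+ a :- (con 1ℚ :+ b) := a :- b) refl (ι b) (ι c)))) (≤-∸ b c)

    -- In units of 1/D the reciprocal of [a/D, b/D] is [D²/b, D²/a]. A lower end 0 says nothing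
    -- about a difference, hence `nothing`.
    inv : Interval → Maybe Interval
    inv (a@(suc _) ‥ b@(suc _)) = just ((D ℕ.* D div b ∸ 1) ‥ suc (suc (D ℕ.* D div a)))
    inv _ = nothing

    -- Two units in the last place absorb an error of D⁻² in the relation q * r ≈ 1.
    ∈-inv : ∀ {q r I J} → 0ℚ ≤ q → ∣ q * r - 1ℚ ∣ * (ι D * ι D) ≤ 1ℚ → r ∈± I → inv I ≡ just J → q ∈ J
    ∈-inv {q} {r} {I = a@(suc _) ‥ b@(suc _)} 0≤q near (l , h) refl = lower , upper
      where
      open ℚₚ.≤-Reasoning
      DD = ι D * ι D
      0≤DD : 0ℚ ≤ DD
      0≤DD = *-nonNeg (0≤ι D) (0≤ι D)
      near⁺ : (q * r - 1ℚ) * DD ≤ 1ℚ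
      near⁺ = ≤-trans (*-monoʳ DD 0≤DD (∣∣≤⇒≤ {q * r - 1ℚ} ≤-refl)) near
      near⁻ : - 1ℚ ≤ (q * r - 1ℚ) * DD
      near⁻ = ≤-trans (neg-antimono-≤ near) (subst (_≤ (q * r - 1ℚ) * DD)
        (sym (ℚₚ.neg-distribˡ-* ∣ q * r - 1ℚ ∣ DD)) (*-monoʳ DD 0≤DD (∣∣≤⇒-≤ {q * r - 1ℚ} ≤-refl)))
      qDb : DD - 1ℚ ≤ q * ι D * ι b
      qDb = begin
        DD - 1ℚ                        ≤⟨ +-monoʳ-≤ DD near⁻ ⟩
        DD + (q * r - 1ℚ) * DD         ≡⟨ solve 3 (λ q r D → D :* D :+ (q :* r :- con 1ℚ) :* (D :* D) := q :* D :* (r :* D)) refl q r (ι D) ⟩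
        q * ι D * (r * ι D)            ≤⟨ *-monoˡ (q * ι D) (*-nonNeg 0≤q (0≤ι D)) h ⟩
        q * ι D * ι b                  ∎
      qDa : q * ι D * ι a ≤ DD + 1ℚ
      qDa = begin
        q * ι D * ι a                  ≤⟨ *-monoˡ (q * ι D) (*-nonNeg 0≤q (0≤ι D)) (l λ ()) ⟩
        q * ι D * (r * ι D)            ≡⟨ solve 3 (λ q r D → D :* D :+ (q :* r :- con 1ℚ) :* (D :* D) := q :* D :* (r :* D)) refl q r (ι D) ⟨
        DD + (q * r - 1ℚ) * DD         ≤⟨ +-monoʳ-≤ DD near⁺ ⟩
        DD + 1ℚ                        ∎
      lower : ι (D ℕ.* D div b ∸ 1) ≤ q * ι D
      lower = ι-∸ (D ℕ.* D div b) 1 (*-nonNeg 0≤q (0≤ι D)) (begin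
        ι (D ℕ.* D div b) - ι 1        ≤⟨ +-mono-≤ (floor≤ (D ℕ.* D) b) (neg-antimono-≤ (subst (recip b ≤_) (sym ι1) (recip≤1 b))) ⟩
        ι (D ℕ.* D) * recip b - recip b ≡⟨ cong (λ z → z * recip b - recip b) (ι-* D D) ⟩
        DD * recip b - recip b         ≡⟨ solve 2 (λ x y → x :* y :- y := (x :- con 1ℚ) :* y) refl DD (recip b) ⟩
        (DD - 1ℚ) * recip b            ≤⟨ *-monoʳ (recip b) (0≤recip b) qDb ⟩
        q * ι D * ι b * recip b        ≡⟨ trans (*-assoc (q * ι D) (ι b) (recip b)) (trans (cong (q * ι D *_) (ι*recip b)) (*-identityʳ (q * ι D))) ⟩
        q * ι D                        ∎)
      upper : q * ι D ≤ ι (suc (suc (D ℕ.* D div a)))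
      upper = begin
        q * ι D                        ≡⟨ trans (*-assoc (q * ι D) (ι a) (recip a)) (trans (cong (q * ι D *_) (ι*recip a)) (*-identityʳ (q * ι D))) ⟨
        q * ι D * ι a * recip a        ≤⟨ *-monoʳ (recip a) (0≤recip a) qDa ⟩
        (DD + 1ℚ) * recip a            ≡⟨ solve 2 (λ x y → (x :+ con 1ℚ) :* y := y :+ x :* y) refl DD (recip a) ⟩
        recip a + DD * recip a         ≤⟨ +-mono-≤ (recip≤1 a) (subst (λ z → z * recip a ≤ ι (suc (D ℕ.* D div a))) (ι-* D D) (≤ceil (D ℕ.* D) a)) ⟩
        1ℚ + ι (suc (D ℕ.* D div a))   ≡⟨ ι-suc (suc (D ℕ.* D div a)) ⟨
        ι (suc (suc (D ℕ.* D div a)))  ∎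

-- Tails of sums of 1/xˢ over a residue class modulo 8, by inverse factorial series.

module FactorialSeriesTails where
  open ℚ
  open Rationals
  open Intervals

  -- The i-th natural number congruent to 1 + y modulo 8 (for y < 8).
  pt : ℕ → ℕ → ℕ
  pt y i = suc (y ℕ.+ 8 ℕ.* i)

  -- With x = pt y i, the factorial-series terms
  --   Φ s j i = 8ʲ j! / (xˢ (x+8)(x+16)⋯(x+8j))
  -- satisfy Φ (s+1) j = Φ s (j+1) / (8(j+1)) + Φ (s+1) (j+1), and Φ 1 (j+1) telescopes.
  module FactorialSeries (y : ℕ) where

    c : ℕ → ℕ → ℚ
    c zero    i = 1ℚ
    c (suc j) i = c j i * (ι (8 ℕ.* suc j) * recip (pt y (i ℕ.+ suc j)))

    Φ : ℕ → ℕ → ℕ → ℚ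
    Φ s j i = recip (pt y i) ^ s * c j i

    pt-+ : ∀ i j → ι (pt y (i ℕ.+ j)) ≡ ι (pt y i) + ι (8 ℕ.* j)
    pt-+ i j = trans (cong ι (solve′ i j)) (ι-+ (pt y i) (8 ℕ.* j))
      where
      solve′ : ∀ i j → pt y (i ℕ.+ j) ≡ pt y i ℕ.+ 8 ℕ.* j
      solve′ i j = cong suc (trans (cong (y ℕ.+_) (ℕₚ.*-distribˡ-+ 8 i j)) (sym (ℕₚ.+-assoc y (8 ℕ.* i) (8 ℕ.* j))))

    -- With r = 1/x, m = 8(j+1) and R = 1/(x + m), the relation (x + m) R = 1 = x r gives r = R + m
    -- r R; multiply by rˢ `c j i`.
    Φ-rec : ∀ s j i → Φ (suc s) j i ≡ Φ s (suc j) i * (ι 1 * recip (8 ℕ.* suc j)) + Φ (suc s) (suc j) i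
    Φ-rec s j i = sym (begin
      r ^ s * (c j i * (m * R)) * (ι 1 * μ) + r * r ^ s * (c j i * (m * R))
        ≡⟨ cong (λ z → r ^ s * (c j i * (m * R)) * (z * μ) + r * r ^ s * (c j i * (m * R))) ι1 ⟩
      r ^ s * (c j i * (m * R)) * (1ℚ * μ) + r * r ^ s * (c j i * (m * R))
        ≡⟨ solve 6 (λ rs c m R μ r → rs :* (c :* (m :* R)) :* (con 1ℚ :* μ) :+ r :* rs :* (c :* (m :* R))
                                  := rs :* c :* R :* (m :* μ :+ m :* r)) refl (r ^ s) (c j i) m R μ r ⟩
      r ^ s * c j i * R * (m * μ + m * r)
        ≡⟨ cong (λ z → r ^ s * c j i * R * (z + m * r)) (trans (ι*recip (8 ℕ.* suc j)) (sym (ι*recip (pt y i)))) ⟩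
      r ^ s * c j i * R * (ι (pt y i) * r + m * r)
        ≡⟨ solve 6 (λ rs c m R p r → rs :* c :* R :* (p :* r :+ m :* r)
                                  := r :* rs :* c :* ((p :+ m) :* R)) refl (r ^ s) (c j i) m R (ι (pt y i)) r ⟩
      r * r ^ s * c j i * ((ι (pt y i) + m) * R)
        ≡⟨ cong (λ z → r * r ^ s * c j i * (z * R)) (pt-+ i (suc j)) ⟨
      r * r ^ s * c j i * (ι (pt y (i ℕ.+ suc j)) * R)
        ≡⟨ cong (r * r ^ s * c j i *_) (ι*recip (pt y (i ℕ.+ suc j))) ⟩
      r * r ^ s * c j i * 1ℚ
        ≡⟨ *-identityʳ (r * r ^ s * c j i) ⟩
      r * r ^ s * c j i ∎)
      where
      open ≡-Reasoning
      r = recip (pt y i)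
      R = recip (pt y (i ℕ.+ suc j))
      m = ι (8 ℕ.* suc j)
      μ = recip (8 ℕ.* suc j)

    -- Moving from x to x + 8 turns the denominator of `Φ 1 j` into (x+8)(x+16)⋯(x+8(j+1)), which is
    -- that of `c (suc j) i`.
    c-suc : ∀ j i → Φ 1 j (suc i) * ι (8 ℕ.* suc j) ≡ c (suc j) i
    c-suc zero i = trans (solve 2 (λ r m → r :* con 1ℚ :* con 1ℚ :* m := con 1ℚ :* (m :* r)) refl (recip (pt y (suc i))) (ι 8))
      (cong (λ z → 1ℚ * (ι 8 * recip (pt y z))) (trans (cong suc (sym (ℕₚ.+-identityʳ i))) (sym (ℕₚ.+-suc i 0))))
    c-suc (suc j) i = begin
      r * 1ℚ * (c j (suc i) * (m * R)) * m′        ≡⟨ solve 5 (λ r c m R m′ → r :* con 1ℚ :* (c :* (m :* R)) :* m′ := r :* con 1ℚ :* c :* m :* (m′ :* R)) refl r (c j (suc i)) m R m′ ⟩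
      r * 1ℚ * c j (suc i) * m * (m′ * R)          ≡⟨ cong (_* (m′ * R)) (c-suc j i) ⟩
      c (suc j) i * (m′ * R)                       ≡⟨ cong (λ z → c (suc j) i * (m′ * recip (pt y z))) (sym (ℕₚ.+-suc i (suc j))) ⟩
      c (suc j) i * (m′ * recip (pt y (i ℕ.+ suc (suc j)))) ∎
      where
      open ≡-Reasoning
      r = recip (pt y (suc i))
      R = recip (pt y (suc i ℕ.+ suc j))
      m = ι (8 ℕ.* suc j)
      m′ = ι (8 ℕ.* suc (suc j))

    Φ-telescope : ∀ j i → Φ 1 j i ≡ Φ 1 j (suc i) + Φ 1 (suc j) i
    Φ-telescope j i = trans (Φ-rec 0 j i) (cong (_+ Φ 1 (suc j) i) (begin
      1ℚ * c (suc j) i * (ι 1 * μ)                 ≡⟨ cong₂ (λ z w → 1ℚ * z * (w * μ)) (sym (c-suc j i)) ι1 ⟩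
      1ℚ * (Φ 1 j (suc i) * m) * (1ℚ * μ)          ≡⟨ solve 3 (λ x m μ → con 1ℚ :* (x :* m) :* (con 1ℚ :* μ) := x :* (m :* μ)) refl (Φ 1 j (suc i)) m μ ⟩
      Φ 1 j (suc i) * (m * μ)                      ≡⟨ cong (Φ 1 j (suc i) *_) (ι*recip (8 ℕ.* suc j)) ⟩
      Φ 1 j (suc i) * 1ℚ                           ≡⟨ *-identityʳ (Φ 1 j (suc i)) ⟩
      Φ 1 j (suc i)                                ∎))
      where
      open ≡-Reasoning
      m = ι (8 ℕ.* suc j)
      μ = recip (8 ℕ.* suc j)

    0≤c : ∀ j i → 0ℚ ≤ c j i
    0≤c zero    i = 0≤1
    0≤c (suc j) i = *-nonNeg (0≤c j i) (*-nonNeg (0≤ι (8 ℕ.* suc j)) (0≤recip (pt y (i ℕ.+ suc j))))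

    c≤1 : ∀ j i → c j i ≤ 1ℚ
    c≤1 zero    i = ≤-refl
    c≤1 (suc j) i = *-mono {s = 1ℚ} (0≤c j i) (*-nonNeg (0≤ι (8 ℕ.* suc j)) (0≤recip p)) (c≤1 j i) (begin
      ι (8 ℕ.* suc j) * recip p     ≤⟨ *-monoʳ (recip p) (0≤recip p) (ι-mono-≤ 8j≤p) ⟩
      ι p * recip p                 ≡⟨ ι*recip p ⟩
      1ℚ                            ∎)
      where
      open ℚₚ.≤-Reasoning
      p = pt y (i ℕ.+ suc j)
      8j≤p : 8 ℕ.* suc j ℕ.≤ p
      8j≤p = ℕₚ.≤-trans (ℕₚ.*-monoʳ-≤ 8 (ℕₚ.m≤n+m (suc j) i))
        (ℕₚ.≤-trans (ℕₚ.m≤n+m (8 ℕ.* (i ℕ.+ suc j)) y) (ℕₚ.n≤1+n _))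

    0≤Φ : ∀ s j i → 0ℚ ≤ Φ s j i
    0≤Φ s j i = *-nonNeg (^-nonNeg s (0≤recip (pt y i))) (0≤c j i)

    Φ1≤recip : ∀ j i → Φ 1 j i ≤ recip (pt y i)
    Φ1≤recip j i = begin
      recip (pt y i) * 1ℚ * c j i     ≤⟨ *-monoˡ (recip (pt y i) * 1ℚ) (*-nonNeg (0≤recip (pt y i)) 0≤1) (c≤1 j i) ⟩
      recip (pt y i) * 1ℚ * 1ℚ        ≡⟨ solve 1 (λ x → x :* con 1ℚ :* con 1ℚ := x) refl (recip (pt y i)) ⟩
      recip (pt y i)                  ∎
      where open ℚₚ.≤-Reasoning

    module _ (k₀ k : ℕ) where

      -- `T s 0` is the tail that is wanted. The rows keep only the entries with j ≥ 1, which avoids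
      -- the harmonic sum `T 1 0`, unbounded in `k`.
      T : ℕ → ℕ → ℚ
      T s j = Σ (λ i → Φ s j (k₀ ℕ.+ i)) k

      T-rec : ∀ s j → T (suc s) j ≡ T s (suc j) * (ι 1 * recip (8 ℕ.* suc j)) + T (suc s) (suc j)
      T-rec s j = begin
        T (suc s) j
          ≡⟨ Σ-cong k (λ i → trans (Φ-rec s j (k₀ ℕ.+ i)) (cong (_+ Φ (suc s) (suc j) (k₀ ℕ.+ i)) (*-comm (Φ s (suc j) (k₀ ℕ.+ i)) w))) ⟩
        Σ (λ i → w * Φ s (suc j) (k₀ ℕ.+ i) + Φ (suc s) (suc j) (k₀ ℕ.+ i)) k
          ≡⟨ Σ-+ (λ i → w * Φ s (suc j) (k₀ ℕ.+ i)) (λ i → Φ (suc s) (suc j) (k₀ ℕ.+ i)) k ⟩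
        Σ (λ i → w * Φ s (suc j) (k₀ ℕ.+ i)) k + T (suc s) (suc j)
          ≡⟨ cong (_+ T (suc s) (suc j)) (trans (Σ-*ˡ w (λ i → Φ s (suc j) (k₀ ℕ.+ i)) k) (*-comm w (T s (suc j)))) ⟩
        T s (suc j) * w + T (suc s) (suc j) ∎
        where
        open ≡-Reasoning
        w = ι 1 * recip (8 ℕ.* suc j)

      0≤T : ∀ s j → 0ℚ ≤ T s j
      0≤T s j = Σ-nonNeg k (λ i → 0≤Φ s j (k₀ ℕ.+ i))

      -- Closes the recursion at the end of a row, where the next entry is unknown: an additional
      -- factor 1/x is at most 1/`pt y k₀` on the whole range.
      T-suc-≤ : ∀ s j → T (suc s) j ≤ T s j * (ι 1 * recip (pt y k₀))
      T-suc-≤ s j = begin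
        T (suc s) j                                 ≤⟨ Σ-mono k (λ i → bound i) ⟩
        Σ (λ i → w * Φ s j (k₀ ℕ.+ i)) k            ≡⟨ Σ-*ˡ w (λ i → Φ s j (k₀ ℕ.+ i)) k ⟩
        w * T s j                                   ≡⟨ *-comm w (T s j) ⟩
        T s j * w                                   ∎
        where
        open ℚₚ.≤-Reasoning
        w = ι 1 * recip (pt y k₀)
        bound : ∀ i → Φ (suc s) j (k₀ ℕ.+ i) ≤ w * Φ s j (k₀ ℕ.+ i)
        bound i = begin
          r * r ^ s * c j (k₀ ℕ.+ i)                    ≡⟨ *-assoc r (r ^ s) (c j (k₀ ℕ.+ i)) ⟩
          r * Φ s j (k₀ ℕ.+ i)                          ≤⟨ *-monoʳ (Φ s j (k₀ ℕ.+ i)) (0≤Φ s j (k₀ ℕ.+ i)) (recip-antimono (ℕ.s≤s (ℕₚ.+-monoʳ-≤ y (ℕₚ.*-monoʳ-≤ 8 (ℕₚ.m≤m+n k₀ i))))) ⟩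
          recip (pt y k₀) * Φ s j (k₀ ℕ.+ i)            ≡⟨ cong (_* Φ s j (k₀ ℕ.+ i)) (sym (trans (cong (_* recip (pt y k₀)) ι1) (*-identityˡ (recip (pt y k₀))))) ⟩
          w * Φ s j (k₀ ℕ.+ i)                          ∎
          where r = recip (pt y (k₀ ℕ.+ i))

      T1 : ∀ j → T 1 (suc j) ≡ Φ 1 j k₀ - Φ 1 j (k₀ ℕ.+ k)
      T1 j = go k
        where
        go : ∀ k → Σ (λ i → Φ 1 (suc j) (k₀ ℕ.+ i)) k ≡ Φ 1 j k₀ - Φ 1 j (k₀ ℕ.+ k)
        go zero = sym (trans (cong (λ z → Φ 1 j k₀ - Φ 1 j z) (ℕₚ.+-identityʳ k₀)) (+-inverseʳ (Φ 1 j k₀)))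
        go (suc k) = begin
          Σ (λ i → Φ 1 (suc j) (k₀ ℕ.+ i)) k + Φ 1 (suc j) (k₀ ℕ.+ k)
            ≡⟨ cong (_+ Φ 1 (suc j) (k₀ ℕ.+ k)) (go k) ⟩
          Φ 1 j k₀ - Φ 1 j (k₀ ℕ.+ k) + Φ 1 (suc j) (k₀ ℕ.+ k)
            ≡⟨ cong (λ z → Φ 1 j k₀ - z + Φ 1 (suc j) (k₀ ℕ.+ k)) (Φ-telescope j (k₀ ℕ.+ k)) ⟩
          Φ 1 j k₀ - (Φ 1 j (suc (k₀ ℕ.+ k)) + Φ 1 (suc j) (k₀ ℕ.+ k)) + Φ 1 (suc j) (k₀ ℕ.+ k)
            ≡⟨ solve 3 (λ a b c → a :- (b :+ c) :+ c := a :- b) refl (Φ 1 j k₀) (Φ 1 j (suc (k₀ ℕ.+ k))) (Φ 1 (suc j) (k₀ ℕ.+ k)) ⟩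
          Φ 1 j k₀ - Φ 1 j (suc (k₀ ℕ.+ k))
            ≡⟨ cong (λ z → Φ 1 j k₀ - Φ 1 j z) (sym (ℕₚ.+-suc k₀ k)) ⟩
          Φ 1 j k₀ - Φ 1 j (k₀ ℕ.+ suc k) ∎
          where open ≡-Reasoning

  -- Enclosures of T s 1, T s 2, …, as a nonempty list.
  Row : Set
  Row = Interval × List Interval

  -- Turns the entries T s (j+1), T s (j+2), ... into T (s+1) j together with the row T (s+1) (j+1),
  -- .... The recursion `T-rec` runs backwards from the far end, where the last new entry is
  -- enclosed crudely between 0 and 1/x times the old one.
  step : ℕ → ℕ → Interval → List Interval → Interval × Row
  step x j I []       = scale 1 (8 ℕ.* suc j) I +ᴵ Z , Z , []
    where
    Z : Interval
    Z = 0 ‥ suc (hi I ℕ.* 1 div x)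
  step x j I (J ∷ Js) with step x (suc j) J Js
  ... | h , h′ , t = scale 1 (8 ℕ.* suc j) I +ᴵ h , h , h′ ∷ t

  nonempty : Row → List Interval
  nonempty (I , Is) = I ∷ Is

  firstRow : ℕ → ℕ → ℕ → Interval → ℕ → Row
  firstRow y k₀ j I zero    = (lo I ∸ 1) ‥ hi I , []
  firstRow y k₀ j I (suc n) = (lo I ∸ 1) ‥ hi I ,
    nonempty (firstRow y k₀ (suc j) (scale (8 ℕ.* suc j) (pt y (k₀ ℕ.+ suc j)) I) n)

  module TailEnclosure (D : ℕ) .{{D≢0 : ℕ.NonZero D}} (y k₀ k : ℕ) (D≤k : D ℕ.≤ k) where
    open FixedPoint D
    open FactorialSeries y

    Encloses : (ℕ → ℚ) → ℕ → List Interval → Set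
    Encloses t j []       = ⊤
    Encloses t j (I ∷ Is) = t j ∈ I × Encloses t (suc j) Is

    step-sound : ∀ s j I Is → T k₀ k s (suc j) ∈ I → Encloses (T k₀ k s) (suc (suc j)) Is →
                 let h , J , Js = step (pt y k₀) j I Is in
                 T k₀ k (suc s) j ∈ h × T k₀ k (suc s) (suc j) ∈ J × Encloses (T k₀ k (suc s)) (suc (suc j)) Js
    step-sound s j I [] t∈I _ =
      ∈-subst (sym (T-rec k₀ k s j)) (∈-+ (scale 1 (8 ℕ.* suc j) I) Z (∈-scale I 1 (8 ℕ.* suc j) t∈I) z) , z , tt
      where
      Z : Interval
      Z = 0 ‥ suc (hi I ℕ.* 1 div pt y k₀)
      z : T k₀ k (suc s) (suc j) ∈ Z
      z = subst (_≤ T k₀ k (suc s) (suc j) * ι D) (sym ι0) (*-nonNeg (0≤T k₀ k (suc s) (suc j)) (0≤ι D)) ,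
          ≤-trans (*-monoʳ (ι D) (0≤ι D) (T-suc-≤ k₀ k s (suc j))) (_∈_.upper (∈-scale I 1 (pt y k₀) t∈I))
    step-sound s j I (J ∷ Js) t∈I (t∈J , t∈Js) with step (pt y k₀) (suc j) J Js | step-sound s (suc j) J Js t∈J t∈Js
    ... | h , h′ , t | t∈h , t∈h′ , t∈t =
      ∈-subst (sym (T-rec k₀ k s j)) (∈-+ (scale 1 (8 ℕ.* suc j) I) h (∈-scale I 1 (8 ℕ.* suc j) t∈I) t∈h) , t∈h , t∈h′ , t∈t

    -- The far end of the telescoping sum is at most 1/D, since its argument exceeds k ≥ D. One unit
    -- off the lower end covers it, which makes the enclosure independent of `k`.
    first-sound : ∀ j I → Φ 1 j k₀ ∈ I → T k₀ k 1 (suc j) ∈ ((lo I ∸ 1) ‥ hi I)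
    first-sound j I (l , h) = lower , ≤-trans (*-monoʳ (ι D) (0≤ι D) T≤Φ) h
      where
      open ℚₚ.≤-Reasoning
      φ = Φ 1 j k₀
      ψ = Φ 1 j (k₀ ℕ.+ k)
      T≤Φ : T k₀ k 1 (suc j) ≤ φ
      T≤Φ = ≤-diff (0≤Φ 1 j (k₀ ℕ.+ k)) (trans (cong (_+ ψ) (T1 k₀ k j)) (solve 2 (λ a b → a :- b :+ b := a) refl φ ψ))
      D≤pt : D ℕ.≤ pt y (k₀ ℕ.+ k)
      D≤pt = ℕₚ.≤-trans D≤k (ℕₚ.≤-trans (ℕₚ.m≤n+m k k₀) (ℕₚ.≤-trans (ℕₚ.m≤m+n (k₀ ℕ.+ k) _)
        (ℕₚ.≤-trans (ℕₚ.m≤n+m (8 ℕ.* (k₀ ℕ.+ k)) y) (ℕₚ.n≤1+n _))))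
      ψD≤1 : ψ * ι D ≤ 1ℚ
      ψD≤1 = begin
        ψ * ι D                          ≤⟨ *-monoʳ (ι D) (0≤ι D) (≤-trans (Φ1≤recip j (k₀ ℕ.+ k)) (recip-antimono D≤pt)) ⟩
        recip D * ι D                    ≡⟨ recip*ι D ⟩
        1ℚ                               ∎
      lower : ι (lo I ∸ 1) ≤ T k₀ k 1 (suc j) * ι D
      lower = ι-∸ (lo I) 1 (*-nonNeg (0≤T k₀ k 1 (suc j)) (0≤ι D)) (begin
        ι (lo I) - ι 1                   ≡⟨ cong (λ z → ι (lo I) - z) ι1 ⟩
        ι (lo I) - 1ℚ                    ≤⟨ +-mono-≤ l (neg-antimono-≤ ψD≤1) ⟩
        φ * ι D - ψ * ι D                ≡⟨ solve 3 (λ a b d → a :* d :- b :* d := (a :- b) :* d) refl φ ψ (ι D) ⟩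
        (φ - ψ) * ι D                    ≡⟨ cong (_* ι D) (T1 k₀ k j) ⟨
        T k₀ k 1 (suc j) * ι D           ∎)

    firstRow-sound : ∀ j I n → Φ 1 j k₀ ∈ I →
                     Encloses (T k₀ k 1) (suc j) (nonempty (firstRow y k₀ j I n))
    firstRow-sound j I zero    φ∈I = first-sound j I φ∈I , tt
    firstRow-sound j I (suc n) φ∈I = first-sound j I φ∈I ,
      firstRow-sound (suc j) (scale m p I) n (∈-subst (*-assoc (recip (pt y k₀) * 1ℚ) (c j k₀) (ι m * recip p)) (∈-scale I m p φ∈I))
      where
      m = 8 ℕ.* suc j
      p = pt y (k₀ ℕ.+ suc j)

    base-sound : Φ 1 0 k₀ ∈ scale 1 (pt y k₀) one
    base-sound = ∈-subst (trans (cong (λ z → 1ℚ * (z * recip (pt y k₀))) ι1)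
        (solve 1 (λ r → con 1ℚ :* (con 1ℚ :* r) := r :* con 1ℚ :* con 1ℚ) refl (recip (pt y k₀))))
      (∈-scale one 1 (pt y k₀) ∈-one)

-- Euler's sieve for completely multiplicative sequences bounded by 1/m².

module Sieves where
  open import Data.Bool using (Bool; true; false; _∧_; not)
  import Data.Bool.Properties as Boolₚ
  open import Data.List.Relation.Unary.All using ([]; _∷_)
  open import Data.Nat.ListAction using (product)
  open import Data.Nat.Divisibility
  open import Data.Nat.Primality.Factorisation using (factorise)
  open ℚ
  open import Relation.Nullary.Decidable using (dec-true; dec-false; does-⇔; toSum)
  open Rationals

  primeDivisor : ∀ n → 2 ℕ.≤ n → ∃[ p ] Prime p × p ∣ n
  primeDivisor n 2≤n with factorise n {{ℕ.>-nonZero (ℕₚ.<⇒≤ 2≤n)}}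
  ... | record { factors = [] ; isFactorisation = n≡1 } = contradiction n≡1 (ℕₚ.>⇒≢ 2≤n)
  ... | record { factors = p ∷ ps ; isFactorisation = eq ; factorsPrime = prime-p ∷ _ } =
    p , prime-p , divides (product ps) (trans eq (ℕₚ.*-comm p (product ps)))

  𝟙 : Bool → ℚ
  𝟙 true  = 1ℚ
  𝟙 false = 0ℚ

  sifted : ℕ → ℕ → Bool
  sifted zero    m = true
  sifted (suc n) m = sifted n m ∧ not (does (prime? n) ∧ does (n ∣? m))

  sifted-∤ : ∀ n {m p} → sifted n m ≡ true → p ℕ.< n → Prime p → ¬ p ∣ m
  sifted-∤ (suc n) {m} {p} h p<1+n prime-p p∣m with sifted n m in eq | ℕₚ.m<1+n⇒m<n∨m≡n p<1+n
  ... | false | _         = contradiction h λ ()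
  ... | true  | inj₁ p<n  = sifted-∤ n eq p<n prime-p p∣m
  ... | true  | inj₂ refl = contradiction (trans (sym h) (cong not
    (cong₂ _∧_ (dec-true (prime? n) prime-p) (dec-true (n ∣? m) p∣m)))) λ ()

  sifted-1 : ∀ n → sifted n 1 ≡ true
  sifted-1 zero    = refl
  sifted-1 (suc n) = cong₂ _∧_ (sifted-1 n) (lemma (prime? n))
    where
    lemma : (p? : Dec (Prime n)) → not (does p? ∧ does (n ∣? 1)) ≡ true
    lemma (no _)  = refl
    lemma (yes p) = cong not (dec-false (n ∣? 1) λ n∣1 → ¬prime[1] (subst Prime (∣1⇒≡1 n∣1) p))

  sifted-< : ∀ n m → 2 ℕ.≤ m → m ℕ.< n → sifted n m ≡ false
  sifted-< n m 2≤m m<n with sifted n m in eq | primeDivisor m 2≤m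
  ... | false | _ = refl
  ... | true  | p , prime-p , p∣m = contradiction p∣m (sifted-∤ n eq
    (ℕₚ.≤-<-trans (∣⇒≤ {{ℕ.>-nonZero (ℕₚ.<⇒≤ 2≤m)}} p∣m) m<n) prime-p)

  -- By Euclid's lemma a prime below `n` that divides p m divides m, for it cannot be p itself.
  sifted-* : ∀ n {p} m → Prime p → n ℕ.≤ p → sifted n (p ℕ.* m) ≡ sifted n m
  sifted-* zero    m prime-p n≤p = refl
  sifted-* (suc n) {p} m prime-p n<p =
    cong₂ (λ x y → x ∧ not y) (sifted-* n m prime-p (ℕₚ.<⇒≤ n<p)) (lemma (prime? n))
    where
    lemma : (n? : Dec (Prime n)) → does n? ∧ does (n ∣? p ℕ.* m) ≡ does n? ∧ does (n ∣? m)
    lemma (no _)        = refl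
    lemma (yes prime-n) = does-⇔ (mk⇔ to (λ n∣m → ∣-trans n∣m (n∣m*n p))) (n ∣? p ℕ.* m) (n ∣? m)
      where
      to : n ∣ p ℕ.* m → n ∣ m
      to n∣pm with euclidsLemma p m prime-n n∣pm
      ... | inj₂ n∣m = n∣m
      ... | inj₁ n∣p with prime⇒irreducible prime-p n∣p
      ...   | inj₁ refl = contradiction prime-n ¬prime[1]
      ...   | inj₂ refl = contradiction n<p (ℕₚ.<-irrefl refl)

  onlyIf : ∀ {ℓ} {A : Set ℓ} → Dec A → ℚ → ℚ
  onlyIf (yes _) x = x
  onlyIf (no _)  x = 1ℚ

  Σ-cong-< : ∀ {f g} n → (∀ i → i ℕ.< n → f i ≡ g i) → Σ f n ≡ Σ g n
  Σ-cong-< zero    h = refl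
  Σ-cong-< (suc n) h = cong₂ _+_ (Σ-cong-< n (λ i i<n → h i (ℕₚ.m<n⇒m<1+n i<n))) (h n ℕₚ.≤-refl)

  Σ-0 : ∀ n → Σ (λ _ → 0ℚ) n ≡ 0ℚ
  Σ-0 zero    = refl
  Σ-0 (suc n) = trans (cong (_+ 0ℚ) (Σ-0 n)) (+-identityʳ 0ℚ)

  Σ-head : ∀ f n → Σ f (suc n) ≡ f 0 + Σ (f ∘ suc) n
  Σ-head f n = trans (Σ-split f 1 n) (cong (_+ Σ (f ∘ suc) n) (+-identityˡ (f 0)))

  -- Induction over blocks of p consecutive indices; only the first index of each block is a
  -- multiple of p.
  Σ-multiples : ∀ p .{{_ : ℕ.NonZero p}} (g : ℕ → ℚ) M → Σ (λ m → 𝟙 (does (p ∣? m)) * g m) (p ℕ.* M) ≡ Σ (λ i → g (p ℕ.* i)) M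
  Σ-multiples p g zero = cong (Σ (λ m → 𝟙 (does (p ∣? m)) * g m)) (ℕₚ.*-zeroʳ p)
  Σ-multiples p@(suc p-1) g (suc M) = begin
    Σ h (p ℕ.* suc M)                       ≡⟨ cong (Σ h) (trans (ℕₚ.*-suc p M) (ℕₚ.+-comm p (p ℕ.* M))) ⟩
    Σ h (p ℕ.* M ℕ.+ p)                     ≡⟨ Σ-split h (p ℕ.* M) p ⟩
    Σ h (p ℕ.* M) + Σ block p               ≡⟨ cong₂ _+_ (Σ-multiples p g M) (Σ-head block p-1) ⟩
    Σ (λ i → g (p ℕ.* i)) M + (block 0 + Σ (block ∘ suc) p-1)
      ≡⟨ cong₂ (λ x y → Σ (λ i → g (p ℕ.* i)) M + (x + y)) block0 (trans (Σ-cong-< p-1 block≡0) (Σ-0 p-1)) ⟩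
    Σ (λ i → g (p ℕ.* i)) M + (g (p ℕ.* M) + 0ℚ)
      ≡⟨ cong (Σ (λ i → g (p ℕ.* i)) M +_) (+-identityʳ (g (p ℕ.* M))) ⟩
    Σ (λ i → g (p ℕ.* i)) M + g (p ℕ.* M)   ∎
    where
    open ≡-Reasoning
    h block : ℕ → ℚ
    h m = 𝟙 (does (p ∣? m)) * g m
    block i = h (p ℕ.* M ℕ.+ i)
    block0 : block 0 ≡ g (p ℕ.* M)
    block0 = trans (cong h (ℕₚ.+-identityʳ (p ℕ.* M)))
      (trans (cong (λ b → 𝟙 b * g (p ℕ.* M)) (dec-true (p ∣? p ℕ.* M) (m∣m*n M))) (*-identityˡ (g (p ℕ.* M))))
    block≡0 : ∀ i → i ℕ.< p-1 → block (suc i) ≡ 0ℚ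
    block≡0 i i<p-1 = trans (cong (λ b → 𝟙 b * g (p ℕ.* M ℕ.+ suc i)) (dec-false (p ∣? p ℕ.* M ℕ.+ suc i)
      (λ d → >⇒∤ (ℕ.s≤s i<p-1) (∣m+n∣m⇒∣n d (m∣m*n M))))) (*-zeroˡ (g (p ℕ.* M ℕ.+ suc i)))

  -- 1/(n+1)² ≤ 1/(n(n+1)) = 1/n - 1/(n+1).
  recip²≤ : ∀ n .{{_ : ℕ.NonZero n}} → recip (suc n) ^ 2 ≤ recip n - recip (suc n)
  recip²≤ n = begin
    r * (r * 1ℚ)             ≤⟨ *-monoˡ r (0≤recip (suc n)) (*-monoʳ 1ℚ 0≤1 (recip-antimono (ℕₚ.n≤1+n n))) ⟩
    r * (R * 1ℚ)             ≡⟨ cong (λ z → r * (R * z)) (sym (trans (cong (_- ι n) (ι-suc n)) (solve 1 (λ x → con 1ℚ :+ x :- x := con 1ℚ) refl (ι n)))) ⟩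
    r * (R * (ι (suc n) - ι n))              ≡⟨ solve 4 (λ r R a b → r :* (R :* (a :- b)) := R :* (a :* r) :- r :* (b :* R)) refl r R (ι (suc n)) (ι n) ⟩
    R * (ι (suc n) * r) - r * (ι n * R)      ≡⟨ cong₂ (λ x y → R * x - r * y) (ι*recip (suc n)) (ι*recip n) ⟩
    R * 1ℚ - r * 1ℚ          ≡⟨ cong₂ _-_ (*-identityʳ R) (*-identityʳ r) ⟩
    R - r                    ∎
    where
    open ℚₚ.≤-Reasoning
    r = recip (suc n)
    R = recip n

  Σ-recip²≤ : ∀ n .{{_ : ℕ.NonZero n}} k → Σ (λ i → recip (suc n ℕ.+ i) ^ 2) k ≤ recip n - recip (n ℕ.+ k)
  Σ-recip²≤ n zero = ≤-reflexive (sym (trans (cong (λ z → recip n - recip z) (ℕₚ.+-identityʳ n)) (+-inverseʳ (recip n))))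
  Σ-recip²≤ n@(suc _) (suc k) = begin
    Σ (λ i → recip (suc n ℕ.+ i) ^ 2) k + recip (suc n ℕ.+ k) ^ 2
      ≤⟨ +-mono-≤ (Σ-recip²≤ n k) (recip²≤ (n ℕ.+ k)) ⟩
    recip n - recip (n ℕ.+ k) + (recip (n ℕ.+ k) - recip (suc n ℕ.+ k))
      ≡⟨ solve 3 (λ a b c → a :- b :+ (b :- c) := a :- c) refl (recip n) (recip (n ℕ.+ k)) (recip (suc n ℕ.+ k)) ⟩
    recip n - recip (suc n ℕ.+ k)
      ≡⟨ cong (λ z → recip n - recip z) (ℕₚ.+-suc n k) ⟨
    recip n - recip (n ℕ.+ suc k) ∎
    where open ℚₚ.≤-Reasoning

  Σ-recip²≤recip : ∀ n .{{_ : ℕ.NonZero n}} k → Σ (λ i → recip (suc n ℕ.+ i) ^ 2) k ≤ recip n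
  Σ-recip²≤recip n k = ≤-trans (Σ-recip²≤ n k)
    (≤-diff (0≤recip (n ℕ.+ k)) (solve 2 (λ a b → a :- b :+ b := a) refl (recip n) (recip (n ℕ.+ k))))

  module EulerSieve
    (a : ℕ → ℚ) (a-0 : a 0 ≡ 0ℚ) (a-1 : a 1 ≡ 1ℚ) (a-* : ∀ m n → a (m ℕ.* n) ≡ a m * a n)
    (a-≤ : ∀ m → ∣ a m ∣ ≤ recip m ^ 2) where

    siftedSum : ℕ → ℕ → ℚ
    siftedSum n M = Σ (λ m → 𝟙 (sifted n m) * a m) M

    factor : ℕ → ℚ
    factor n = onlyIf (prime? n) (1ℚ - a n)

    factor-prime : ∀ {n} → Prime n → factor n ≡ 1ℚ - a n
    factor-prime {n} prime-n with prime? n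
    ... | yes _       = refl
    ... | no ¬prime-n = contradiction prime-n ¬prime-n

    factor-composite : ∀ {n} → ¬ Prime n → factor n ≡ 1ℚ
    factor-composite {n} ¬prime-n with prime? n
    ... | yes prime-n = contradiction prime-n ¬prime-n
    ... | no _        = refl

    private
      ∣𝟙*a∣≤ : ∀ b m → ∣ 𝟙 b * a m ∣ ≤ recip m ^ 2
      ∣𝟙*a∣≤ true  m = subst (λ z → ∣ z ∣ ≤ recip m ^ 2) (sym (*-identityˡ (a m))) (a-≤ m)
      ∣𝟙*a∣≤ false m = subst (λ z → ∣ z ∣ ≤ recip m ^ 2) (sym (*-zeroˡ (a m))) (^-nonNeg 2 (0≤recip m))

    tail : ∀ n M .{{_ : ℕ.NonZero M}} M′ → suc M ℕ.≤ M′ →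
           ∣ siftedSum n M′ - siftedSum n (suc M) ∣ ≤ recip M
    tail n M M′ M<M′ with ℕₚ.m≤n⇒∃[o]m+o≡n M<M′
    ... | k , refl = subst (λ z → ∣ z ∣ ≤ recip M) (begin
        rest                                         ≡⟨ solve 2 (λ x y → y := x :+ y :- x) refl (siftedSum n (suc M)) rest ⟩
        siftedSum n (suc M) + rest - siftedSum n (suc M) ≡⟨ cong (_- siftedSum n (suc M)) (Σ-split (λ m → 𝟙 (sifted n m) * a m) (suc M) k) ⟨
        siftedSum n (suc M ℕ.+ k) - siftedSum n (suc M) ∎)
      (≤-trans (∣Σ∣≤ k (λ i → ∣𝟙*a∣≤ (sifted n (suc M ℕ.+ i)) (suc M ℕ.+ i))) (Σ-recip²≤recip M k))
      where
      open ≡-Reasoning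
      rest = Σ (λ i → 𝟙 (sifted n (suc M ℕ.+ i)) * a (suc M ℕ.+ i)) k

    -- The identity is exact because the multiples of p below p M are the p i with i < M;
    -- multiplicativity extracts `a p`, and by `sifted-*` the factor p does not affect sifting by
    -- smaller primes.
    siftedSum-prime : ∀ p M → Prime p → siftedSum p (p ℕ.* M) ≡ siftedSum (suc p) (p ℕ.* M) + a p * siftedSum p M
    siftedSum-prime p M prime-p = begin
      siftedSum p (p ℕ.* M)
        ≡⟨ Σ-cong (p ℕ.* M) separate ⟩
      Σ (λ m → 𝟙 (sifted (suc p) m) * a m + 𝟙 (does (p ∣? m)) * (𝟙 (sifted p m) * a m)) (p ℕ.* M)
        ≡⟨ Σ-+ (λ m → 𝟙 (sifted (suc p) m) * a m) (λ m → 𝟙 (does (p ∣? m)) * (𝟙 (sifted p m) * a m)) (p ℕ.* M) ⟩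
      siftedSum (suc p) (p ℕ.* M) + Σ (λ m → 𝟙 (does (p ∣? m)) * (𝟙 (sifted p m) * a m)) (p ℕ.* M)
        ≡⟨ cong (siftedSum (suc p) (p ℕ.* M) +_) (Σ-multiples p {{prime⇒nonZero prime-p}} (λ m → 𝟙 (sifted p m) * a m) M) ⟩
      siftedSum (suc p) (p ℕ.* M) + Σ (λ i → 𝟙 (sifted p (p ℕ.* i)) * a (p ℕ.* i)) M
        ≡⟨ cong (siftedSum (suc p) (p ℕ.* M) +_) (trans (Σ-cong M pull) (Σ-*ˡ (a p) (λ i → 𝟙 (sifted p i) * a i) M)) ⟩
      siftedSum (suc p) (p ℕ.* M) + a p * siftedSum p M ∎
      where
      open ≡-Reasoning
      split : ∀ b d x → 𝟙 b * x ≡ 𝟙 (b ∧ not (true ∧ d)) * x + 𝟙 d * (𝟙 b * x)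
      split false false = solve 1 (λ x → con 0ℚ :* x := con 0ℚ :* x :+ con 0ℚ :* (con 0ℚ :* x)) refl
      split false true  = solve 1 (λ x → con 0ℚ :* x := con 0ℚ :* x :+ con 1ℚ :* (con 0ℚ :* x)) refl
      split true  false = solve 1 (λ x → con 1ℚ :* x := con 1ℚ :* x :+ con 0ℚ :* (con 1ℚ :* x)) refl
      split true  true  = solve 1 (λ x → con 1ℚ :* x := con 0ℚ :* x :+ con 1ℚ :* (con 1ℚ :* x)) refl
      separate : ∀ m → 𝟙 (sifted p m) * a m ≡ 𝟙 (sifted (suc p) m) * a m + 𝟙 (does (p ∣? m)) * (𝟙 (sifted p m) * a m)
      separate m = trans (split (sifted p m) (does (p ∣? m)) (a m))
        (cong (λ b → 𝟙 (sifted p m ∧ not (b ∧ does (p ∣? m))) * a m + 𝟙 (does (p ∣? m)) * (𝟙 (sifted p m) * a m))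
          (sym (dec-true (prime? p) prime-p)))
      pull : ∀ i → 𝟙 (sifted p (p ℕ.* i)) * a (p ℕ.* i) ≡ a p * (𝟙 (sifted p i) * a i)
      pull i = trans (cong₂ (λ b x → 𝟙 b * x) (sifted-* p i prime-p ℕₚ.≤-refl) (a-* p i))
        (solve 3 (λ b p i → b :* (p :* i) := p :* (b :* i)) refl (𝟙 (sifted p i)) (a p) (a i))

    siftedSum-composite : ∀ n M → ¬ Prime n → siftedSum (suc n) M ≡ siftedSum n M
    siftedSum-composite n M ¬prime-n = Σ-cong M λ m → cong (λ b → 𝟙 b * a m)
      (trans (cong (λ b → sifted n m ∧ not (b ∧ does (n ∣? m))) (dec-false (prime? n) ¬prime-n)) (Boolₚ.∧-identityʳ (sifted n m)))

    ∣1-a∣≤2 : ∀ m → ∣ 1ℚ - a m ∣ ≤ ι 2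
    ∣1-a∣≤2 m = subst (∣ 1ℚ - a m ∣ ≤_) (sym ι2)
      (∣-∣≤ {1ℚ} {a m} (≤-refl {1ℚ}) (≤-trans (a-≤ m) (^-≤1 2 (0≤recip m) (recip≤1 m))))

    -- A sieve step turns an error e into at most 2 e + 2/M. With 2/M added on the left, the bound
    -- simply doubles, and the induction closes.
    Near : ℕ → ℕ → Set
    Near n M = ∣ Π factor n * siftedSum 0 (suc M) - siftedSum n (suc M) ∣ + ι 2 * recip M ≤ ι 2 ^ suc n * recip M

    sieve-composite : ∀ n M .{{_ : ℕ.NonZero M}} → Near n M → ¬ Prime n → Near (suc n) M
    sieve-composite n M near ¬prime-n = begin
      ∣ Π factor n * factor n * siftedSum 0 (suc M) - siftedSum (suc n) (suc M) ∣ + ι 2 * recip M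
        ≡⟨ cong₂ (λ x y → ∣ x * siftedSum 0 (suc M) - y ∣ + ι 2 * recip M)
             (trans (cong (Π factor n *_) (factor-composite ¬prime-n)) (*-identityʳ (Π factor n))) (siftedSum-composite n (suc M) ¬prime-n) ⟩
      ∣ Π factor n * siftedSum 0 (suc M) - siftedSum n (suc M) ∣ + ι 2 * recip M   ≤⟨ near ⟩
      ι 2 ^ suc n * recip M         ≡⟨ *-identityˡ (ι 2 ^ suc n * recip M) ⟨
      1ℚ * (ι 2 ^ suc n * recip M)  ≤⟨ *-monoʳ (ι 2 ^ suc n * recip M) (*-nonNeg (^-nonNeg (suc n) (0≤ι 2)) (0≤recip M)) (1≤ι 2) ⟩
      ι 2 * (ι 2 ^ suc n * recip M) ≡⟨ *-assoc (ι 2) (ι 2 ^ suc n) (recip M) ⟨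
      ι 2 ^ suc (suc n) * recip M   ∎
      where open ℚₚ.≤-Reasoning
    sieve-prime : ∀ n M .{{_ : ℕ.NonZero M}} → Near n M → Prime n → Near (suc n) M
    sieve-prime p M near prime-p = begin
      ∣ E * factor p * S₀ - S⁺ ∣ + ι 2 * t
        ≡⟨ cong (λ z → ∣ E * z * S₀ - S⁺ ∣ + ι 2 * t) (factor-prime prime-p) ⟩
      ∣ E * (1ℚ - a p) * S₀ - S⁺ ∣ + ι 2 * t
        ≡⟨ cong (λ z → ∣ z ∣ + ι 2 * t) (solve 5 (λ E a S₀ S⁺ S → E :* (con 1ℚ :- a) :* S₀ :- S⁺ := (con 1ℚ :- a) :* (E :* S₀ :- S) :+ (S :- a :* S :- S⁺)) refl E (a p) S₀ S⁺ S) ⟩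
      ∣ (1ℚ - a p) * (E * S₀ - S) + (S - a p * S - S⁺) ∣ + ι 2 * t
        ≤⟨ +-monoˡ-≤ (ι 2 * t) (∣+∣≤ {(1ℚ - a p) * (E * S₀ - S)} (∣*∣≤ {1ℚ - a p} (∣1-a∣≤2 p) ≤-refl) local) ⟩
      ι 2 * ∣ E * S₀ - S ∣ + ι 2 * t + ι 2 * t
        ≡⟨ cong (λ z → ι 2 * ∣ E * S₀ - S ∣ + z * t + z * t) ι2 ⟩
      ι 2 * ∣ E * S₀ - S ∣ + (1ℚ + 1ℚ) * t + (1ℚ + 1ℚ) * t
        ≡⟨ solve 3 (λ w e t → w :* e :+ (con 1ℚ :+ con 1ℚ) :* t :+ (con 1ℚ :+ con 1ℚ) :* t := w :* e :+ (con 1ℚ :+ con 1ℚ) :* ((con 1ℚ :+ con 1ℚ) :* t)) refl (ι 2) ∣ E * S₀ - S ∣ t ⟩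
      ι 2 * ∣ E * S₀ - S ∣ + (1ℚ + 1ℚ) * ((1ℚ + 1ℚ) * t)
        ≡⟨ cong (λ z → ι 2 * ∣ E * S₀ - S ∣ + z * (z * t)) ι2 ⟨
      ι 2 * ∣ E * S₀ - S ∣ + ι 2 * (ι 2 * t)
        ≡⟨ *-distribˡ-+ (ι 2) ∣ E * S₀ - S ∣ (ι 2 * t) ⟨
      ι 2 * (∣ E * S₀ - S ∣ + ι 2 * t)
        ≤⟨ *-monoˡ (ι 2) (0≤ι 2) near ⟩
      ι 2 * (ι 2 ^ suc p * t)
        ≡⟨ *-assoc (ι 2) (ι 2 ^ suc p) t ⟨
      ι 2 ^ suc (suc p) * t ∎
      where
      open ℚₚ.≤-Reasoning
      t = recip M
      E = Π factor p
      S₀ = siftedSum 0 (suc M)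
      S = siftedSum p (suc M)
      S⁺ = siftedSum (suc p) (suc M)
      M<pM : suc M ℕ.≤ p ℕ.* suc M
      M<pM = ℕₚ.m≤n*m (suc M) p {{prime⇒nonZero prime-p}}
      SpM = siftedSum p (p ℕ.* suc M)
      S⁺pM = siftedSum (suc p) (p ℕ.* suc M)
      -- both sums are compared with their values at p (M + 1), where the sieve step is exact
      local : ∣ S - a p * S - S⁺ ∣ ≤ ι 2 * t
      local = begin
        ∣ S - a p * S - S⁺ ∣
          ≡⟨ cong ∣_∣ (solve 4 (λ S aS S⁺ x → S :- aS :- S⁺ := (x :- S⁺) :- (x :+ aS :- S)) refl S (a p * S) S⁺ S⁺pM) ⟩
        ∣ (S⁺pM - S⁺) - (S⁺pM + a p * S - S) ∣
          ≡⟨ cong (λ z → ∣ (S⁺pM - S⁺) - (z - S) ∣) (siftedSum-prime p (suc M) prime-p) ⟨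
        ∣ (S⁺pM - S⁺) - (SpM - S) ∣
          ≤⟨ ∣-∣≤ {S⁺pM - S⁺} {SpM - S} (tail (suc p) M (p ℕ.* suc M) M<pM) (tail p M (p ℕ.* suc M) M<pM) ⟩
        t + t
          ≡⟨ solve 1 (λ t → t :+ t := (con 1ℚ :+ con 1ℚ) :* t) refl t ⟩
        (1ℚ + 1ℚ) * t
          ≡⟨ cong (_* t) ι2 ⟨
        ι 2 * t ∎

    sieve : ∀ n M .{{_ : ℕ.NonZero M}} → Near n M
    sieve zero M = ≤-reflexive (trans
      (cong (λ z → ∣ z ∣ + ι 2 * recip M) (solve 1 (λ x → con 1ℚ :* x :- x := con 0ℚ) refl (siftedSum 0 (suc M))))
      (solve 2 (λ t r → con 0ℚ :+ t :* r := t :* con 1ℚ :* r) refl (ι 2) (recip M)))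
    sieve (suc n) M = [ sieve-prime n M (sieve n M) , sieve-composite n M (sieve n M) ]′ (toSum (prime? n))

    -- Every m with 2 ≤ m < n + 2 is sifted out by one of its prime divisors, and the index 0
    -- contributes `a 0`, which is 0; only m = 1 remains.
    siftedSum-initial : ∀ n → siftedSum (suc (suc n)) (suc (suc n)) ≡ 1ℚ
    siftedSum-initial n = trans (Σ-split (λ m → 𝟙 (sifted (suc (suc n)) m) * a m) 2 n) (begin
      0ℚ + 𝟙 (sifted N 0) * a 0 + 𝟙 (sifted N 1) * a 1 + Σ (λ i → 𝟙 (sifted N (2 ℕ.+ i)) * a (2 ℕ.+ i)) n
        ≡⟨ cong₂ _+_ (cong₂ (λ x y → 0ℚ + 𝟙 (sifted N 0) * x + y) a-0 (cong₂ (λ b x → 𝟙 b * x) (sifted-1 N) a-1))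
           (trans (Σ-cong-< n (λ i i<n → trans (cong (λ b → 𝟙 b * a (2 ℕ.+ i)) (sifted-< N (2 ℕ.+ i) (ℕ.s≤s (ℕ.s≤s ℕ.z≤n)) (ℕ.s≤s (ℕ.s≤s i<n)))) (*-zeroˡ (a (2 ℕ.+ i))))) (Σ-0 n)) ⟩
      0ℚ + 𝟙 (sifted N 0) * 0ℚ + 1ℚ * 1ℚ + 0ℚ
        ≡⟨ solve 1 (λ x → con 0ℚ :+ x :* con 0ℚ :+ con 1ℚ :* con 1ℚ :+ con 0ℚ := con 1ℚ) refl (𝟙 (sifted N 0)) ⟩
      1ℚ ∎)
      where
      open ≡-Reasoning
      N = suc (suc n)

    -- 1/N bounds the sifted numbers beyond N, and the other term is the error of the sieve. Its
    -- exponential factor is harmless because M can be chosen after N.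
    euler : ∀ N .{{_ : ℕ.NonZero N}} M → N ℕ.≤ M →
            ∣ Π factor (suc N) * Σ a (suc M) - 1ℚ ∣ ≤ recip N + ι 2 ^ suc (suc N) * recip M
    euler N@(suc N-1) M@(suc _) N≤M = begin
      ∣ E * Σ a (suc M) - 1ℚ ∣
        ≡⟨ cong₂ (λ x y → ∣ E * x - y ∣) (Σ-cong (suc M) (λ m → sym (*-identityˡ (a m)))) (sym (siftedSum-initial N-1)) ⟩
      ∣ E * S₀ - S₁ ∣
        ≡⟨ cong ∣_∣ (solve 3 (λ x S y → x :- y := (S :- y) :+ (x :- S)) refl (E * S₀) S S₁) ⟩
      ∣ (S - S₁) + (E * S₀ - S) ∣
        ≤⟨ ∣+∣≤ {S - S₁} (tail (suc N) N (suc M) (ℕ.s≤s N≤M)) (≤-trans (≤-diff (*-nonNeg (0≤ι 2) (0≤recip M)) refl) (sieve (suc N) M)) ⟩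
      recip N + ι 2 ^ suc (suc N) * recip M ∎
      where
      open ℚₚ.≤-Reasoning
      E = Π factor (suc N)
      S₀ = siftedSum 0 (suc M)
      S = siftedSum (suc N) (suc M)
      S₁ = siftedSum (suc N) (suc N)

-- The four Dirichlet characters modulo 8 and weighted products over them.

module Characters where
  open import Data.Fin using (Fin; toℕ; fromℕ<)
  open import Data.Fin.Properties using (all?; toℕ-fromℕ<)
  open ℚ
  open import Relation.Nullary.Decidable using (toWitness)
  open Rationals
  open Intervals
  open FactorialSeriesTails
  open Sieves

  -- Character values as data: multiplicativity can be decided by evaluation, and a case distinction
  -- selects the factor to apply.
  data Sign : Set where
    ⊕ ⊖ ⊙ : Sign

  ⟦_⟧ : Sign → ℚ
  ⟦ ⊕ ⟧ = 1ℚ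
  ⟦ ⊖ ⟧ = - 1ℚ
  ⟦ ⊙ ⟧ = 0ℚ

  infixl 7 _⊗_
  _⊗_ : Sign → Sign → Sign
  ⊕ ⊗ s = s
  ⊖ ⊗ ⊕ = ⊖
  ⊖ ⊗ ⊖ = ⊕
  ⊖ ⊗ ⊙ = ⊙
  ⊙ ⊗ _ = ⊙

  ⟦⟧-⊗ : ∀ s t → ⟦ s ⊗ t ⟧ ≡ ⟦ s ⟧ * ⟦ t ⟧
  ⟦⟧-⊗ ⊕ t = sym (*-identityˡ ⟦ t ⟧)
  ⟦⟧-⊗ ⊖ ⊕ = refl
  ⟦⟧-⊗ ⊖ ⊖ = refl
  ⟦⟧-⊗ ⊖ ⊙ = refl
  ⟦⟧-⊗ ⊙ t = sym (*-zeroˡ ⟦ t ⟧)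

  ∣⟦⟧∣≤1 : ∀ s → ∣ ⟦ s ⟧ ∣ ≤ 1ℚ
  ∣⟦⟧∣≤1 ⊕ = ≤-refl
  ∣⟦⟧∣≤1 ⊖ = ≤-refl
  ∣⟦⟧∣≤1 ⊙ = 0≤1

  infix 4 _≟ˢ_
  _≟ˢ_ : (s t : Sign) → Dec (s ≡ t)
  ⊕ ≟ˢ ⊕ = yes refl
  ⊕ ≟ˢ ⊖ = no λ ()
  ⊕ ≟ˢ ⊙ = no λ ()
  ⊖ ≟ˢ ⊕ = no λ ()
  ⊖ ≟ˢ ⊖ = yes refl
  ⊖ ≟ˢ ⊙ = no λ ()
  ⊙ ≟ˢ ⊕ = no λ ()
  ⊙ ≟ˢ ⊖ = no λ ()
  ⊙ ≟ˢ ⊙ = yes refl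

  data Char : Set where
    χ₀ χ₁ χ₂ χ₃ : Char

  -- `χ₁`, `χ₂` and `χ₃` are the Kronecker symbols of discriminant -4, -8 and 8.
  sgn : Char → ℕ → Sign
  sgn χ₀ 1 = ⊕
  sgn χ₀ 3 = ⊕
  sgn χ₀ 5 = ⊕
  sgn χ₀ 7 = ⊕
  sgn χ₁ 1 = ⊕
  sgn χ₁ 3 = ⊖
  sgn χ₁ 5 = ⊕
  sgn χ₁ 7 = ⊖
  sgn χ₂ 1 = ⊕
  sgn χ₂ 3 = ⊕
  sgn χ₂ 5 = ⊖
  sgn χ₂ 7 = ⊖
  sgn χ₃ 1 = ⊕
  sgn χ₃ 3 = ⊖
  sgn χ₃ 5 = ⊖
  sgn χ₃ 7 = ⊕
  sgn _  _ = ⊙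

  χ : Char → ℕ → ℚ
  χ i m = ⟦ sgn i (m ℕ.% 8) ⟧

  private
    -- Decided on all 64 pairs of residues.
    sgn-* : ∀ i (r t : Fin 8) → sgn i (toℕ r ℕ.* toℕ t ℕ.% 8) ≡ sgn i (toℕ r) ⊗ sgn i (toℕ t)
    sgn-* χ₀ = toWitness {a? = all? λ r → all? λ t → sgn χ₀ (toℕ r ℕ.* toℕ t ℕ.% 8) ≟ˢ sgn χ₀ (toℕ r) ⊗ sgn χ₀ (toℕ t)} tt
    sgn-* χ₁ = toWitness {a? = all? λ r → all? λ t → sgn χ₁ (toℕ r ℕ.* toℕ t ℕ.% 8) ≟ˢ sgn χ₁ (toℕ r) ⊗ sgn χ₁ (toℕ t)} tt
    sgn-* χ₂ = toWitness {a? = all? λ r → all? λ t → sgn χ₂ (toℕ r ℕ.* toℕ t ℕ.% 8) ≟ˢ sgn χ₂ (toℕ r) ⊗ sgn χ₂ (toℕ t)} tt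
    sgn-* χ₃ = toWitness {a? = all? λ r → all? λ t → sgn χ₃ (toℕ r ℕ.* toℕ t ℕ.% 8) ≟ˢ sgn χ₃ (toℕ r) ⊗ sgn χ₃ (toℕ t)} tt

  χ-* : ∀ i m n → χ i (m ℕ.* n) ≡ χ i m * χ i n
  χ-* i m n = trans (cong ⟦_⟧ (begin
    sgn i (m ℕ.* n ℕ.% 8)                        ≡⟨ cong (sgn i) (ℕᵈ.%-distribˡ-* m n 8) ⟩
    sgn i ((m ℕ.% 8) ℕ.* (n ℕ.% 8) ℕ.% 8)        ≡⟨ cong₂ (λ u v → sgn i (u ℕ.* v ℕ.% 8)) (toℕ-fromℕ< (ℕᵈ.m%n<n m 8)) (toℕ-fromℕ< (ℕᵈ.m%n<n n 8)) ⟨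
    sgn i (toℕ r ℕ.* toℕ t ℕ.% 8)                ≡⟨ sgn-* i r t ⟩
    sgn i (toℕ r) ⊗ sgn i (toℕ t)                ≡⟨ cong₂ (λ u v → sgn i u ⊗ sgn i v) (toℕ-fromℕ< (ℕᵈ.m%n<n m 8)) (toℕ-fromℕ< (ℕᵈ.m%n<n n 8)) ⟩
    sgn i (m ℕ.% 8) ⊗ sgn i (n ℕ.% 8)            ∎)) (⟦⟧-⊗ (sgn i (m ℕ.% 8)) (sgn i (n ℕ.% 8)))
    where
    open ≡-Reasoning
    r = fromℕ< (ℕᵈ.m%n<n m 8)
    t = fromℕ< (ℕᵈ.m%n<n n 8)

  term : Char → ℕ → ℕ → ℚ
  term i s m = χ i m * recip m ^ s

  term-0 : ∀ i s → term i s 0 ≡ 0ℚ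
  term-0 χ₀ s = *-zeroˡ (recip 0 ^ s)
  term-0 χ₁ s = *-zeroˡ (recip 0 ^ s)
  term-0 χ₂ s = *-zeroˡ (recip 0 ^ s)
  term-0 χ₃ s = *-zeroˡ (recip 0 ^ s)

  χ-1 : ∀ i → χ i 1 ≡ 1ℚ
  χ-1 χ₀ = refl
  χ-1 χ₁ = refl
  χ-1 χ₂ = refl
  χ-1 χ₃ = refl

  term-1 : ∀ i s → term i s 1 ≡ 1ℚ
  term-1 i s = trans (cong₂ _*_ (χ-1 i) (trans (cong (_^ s) recip1) (1^n≡1 s))) (*-identityˡ 1ℚ)

  term-* : ∀ i s m n → term i s (m ℕ.* n) ≡ term i s m * term i s n
  term-* i s m n = trans (cong₂ _*_ (χ-* i m n) (trans (cong (_^ s) (recip-* m n)) (^-distrib-* (recip m) (recip n) s)))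
    (solve 4 (λ a b c d → a :* b :* (c :* d) := a :* c :* (b :* d)) refl (χ i m) (χ i n) (recip m ^ s) (recip n ^ s))

  term-≤ : ∀ i s m → ∣ term i (2 ℕ.+ s) m ∣ ≤ recip m ^ 2
  term-≤ i s m = begin
    ∣ χ i m * recip m ^ (2 ℕ.+ s) ∣     ≤⟨ ∣*∣≤ {χ i m} (∣⟦⟧∣≤1 (sgn i (m ℕ.% 8))) (≤-reflexive (0≤p⇒∣p∣≡p (^-nonNeg (2 ℕ.+ s) (0≤recip m)))) ⟩
    1ℚ * recip m ^ (2 ℕ.+ s)            ≡⟨ trans (*-identityˡ (recip m ^ (2 ℕ.+ s))) (^-homo-* (recip m) 2 s) ⟩
    recip m ^ 2 * recip m ^ s           ≤⟨ *-monoˡ (recip m ^ 2) (^-nonNeg 2 (0≤recip m)) (^-≤1 s (0≤recip m) (recip≤1 m)) ⟩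
    recip m ^ 2 * 1ℚ                    ≡⟨ *-identityʳ (recip m ^ 2) ⟩
    recip m ^ 2                         ∎
    where open ℚₚ.≤-Reasoning

  module L (i : Char) (s : ℕ) =
    EulerSieve (term i (2 ℕ.+ s)) (term-0 i (2 ℕ.+ s)) (term-1 i (2 ℕ.+ s)) (term-* i (2 ℕ.+ s)) (term-≤ i s)

  -- 8⁻ˢ times a partial sum of the Hurwitz zeta value ζ(s, (1+y)/8).
  Z : ℕ → ℕ → ℕ → ℚ
  Z s y K = Σ (λ k → recip (pt y k) ^ s) K

  -- Subtracting `0ℚ` gives the case `χ₀` the shape of a difference too, so that all four are
  -- enclosed through `_-ᴵ_`.
  combination : Char → ℚ → ℚ → ℚ → ℚ → ℚ
  combination χ₀ a b c d = (a + b + c + d) - 0ℚ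
  combination χ₁ a b c d = (a + c) - (b + d)
  combination χ₂ a b c d = (a + b) - (c + d)
  combination χ₃ a b c d = (a + d) - (b + c)

  Σ-term : ∀ i s K → Σ (term i s) (8 ℕ.* K) ≡ combination i (Z s 0 K) (Z s 2 K) (Z s 4 K) (Z s 6 K)
  Σ-term i s zero = sym (combination-0 i)
    where
    combination-0 : ∀ i → combination i 0ℚ 0ℚ 0ℚ 0ℚ ≡ 0ℚ
    combination-0 χ₀ = refl
    combination-0 χ₁ = refl
    combination-0 χ₂ = refl
    combination-0 χ₃ = refl
  Σ-term i s (suc K) = begin
    Σ (term i s) (8 ℕ.* suc K)
      ≡⟨ cong (Σ (term i s)) (trans (ℕₚ.*-suc 8 K) (ℕₚ.+-comm 8 (8 ℕ.* K))) ⟩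
    Σ (term i s) (8 ℕ.* K ℕ.+ 8)
      ≡⟨ Σ-split (term i s) (8 ℕ.* K) 8 ⟩
    Σ (term i s) (8 ℕ.* K) + Σ (λ r → term i s (8 ℕ.* K ℕ.+ r)) 8
      ≡⟨ cong₂ _+_ (Σ-term i s K) (Σ-cong-< 8 periodic) ⟩
    combination i (Z s 0 K) (Z s 2 K) (Z s 4 K) (Z s 6 K) + Σ (λ r → ⟦ sgn i r ⟧ * x r) 8
      ≡⟨ block i (Z s 0 K) (Z s 2 K) (Z s 4 K) (Z s 6 K) (x 0) (x 1) (x 2) (x 3) (x 4) (x 5) (x 6) (x 7) ⟩
    combination i (Z s 0 K + x 1) (Z s 2 K + x 3) (Z s 4 K + x 5) (Z s 6 K + x 7)
      ≡⟨ cong₂ (λ u v → combination i (Z s 0 K + u) (Z s 2 K + x 3) (Z s 4 K + v) (Z s 6 K + x 7)) (point 0) (point 4) ⟩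
    combination i (Z s 0 (suc K)) (Z s 2 K + x 3) (Z s 4 (suc K)) (Z s 6 K + x 7)
      ≡⟨ cong₂ (λ u v → combination i (Z s 0 (suc K)) (Z s 2 K + u) (Z s 4 (suc K)) (Z s 6 K + v)) (point 2) (point 6) ⟩
    combination i (Z s 0 (suc K)) (Z s 2 (suc K)) (Z s 4 (suc K)) (Z s 6 (suc K)) ∎
    where
    open ≡-Reasoning
    x : ℕ → ℚ
    x r = recip (8 ℕ.* K ℕ.+ r) ^ s
    point : ∀ y → x (suc y) ≡ recip (pt y K) ^ s
    point y = cong (λ m → recip m ^ s) (trans (ℕₚ.+-suc (8 ℕ.* K) y) (cong suc (ℕₚ.+-comm (8 ℕ.* K) y)))
    periodic : ∀ r → r ℕ.< 8 → term i s (8 ℕ.* K ℕ.+ r) ≡ ⟦ sgn i r ⟧ * x r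
    periodic r r<8 = cong (λ t → ⟦ sgn i t ⟧ * x r) (begin
      (8 ℕ.* K ℕ.+ r) ℕ.% 8     ≡⟨ cong (ℕ._% 8) (trans (ℕₚ.+-comm (8 ℕ.* K) r) (cong (r ℕ.+_) (ℕₚ.*-comm 8 K))) ⟩
      (r ℕ.+ K ℕ.* 8) ℕ.% 8     ≡⟨ ℕᵈ.[m+kn]%n≡m%n r K 8 ⟩
      r ℕ.% 8                   ≡⟨ ℕᵈ.m<n⇒m%n≡m r<8 ⟩
      r                         ∎)
    blockSum : Char → (x₀ x₁ x₂ x₃ x₄ x₅ x₆ x₇ : ℚ) → ℚ
    blockSum i x₀ x₁ x₂ x₃ x₄ x₅ x₆ x₇ = 0ℚ + ⟦ sgn i 0 ⟧ * x₀ + ⟦ sgn i 1 ⟧ * x₁ + ⟦ sgn i 2 ⟧ * x₂ + ⟦ sgn i 3 ⟧ * x₃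
      + ⟦ sgn i 4 ⟧ * x₄ + ⟦ sgn i 5 ⟧ * x₅ + ⟦ sgn i 6 ⟧ * x₆ + ⟦ sgn i 7 ⟧ * x₇
    -- Removing the even residues beforehand leaves the solver an identity in 8 variables.
    drop : ∀ {x₀ x₁ x₂ x₃ x₄ x₅ x₆ x₇ : ℚ} (e₁ e₃ e₅ e₇ : ℚ) →
      0ℚ + 0ℚ * x₀ + e₁ * x₁ + 0ℚ * x₂ + e₃ * x₃ + 0ℚ * x₄ + e₅ * x₅ + 0ℚ * x₆ + e₇ * x₇ ≡ e₁ * x₁ + e₃ * x₃ + e₅ * x₅ + e₇ * x₇
    drop {x₀} {x₁} {x₂} {x₃} {x₄} {x₅} {x₆} {x₇} e₁ e₃ e₅ e₇
      rewrite *-zeroˡ x₀ | *-zeroˡ x₂ | *-zeroˡ x₄ | *-zeroˡ x₆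
            | +-identityˡ 0ℚ | +-identityˡ (e₁ * x₁) | +-identityʳ (e₁ * x₁)
            | +-identityʳ (e₁ * x₁ + e₃ * x₃) | +-identityʳ (e₁ * x₁ + e₃ * x₃ + e₅ * x₅) = refl
    block : ∀ i a b c d (x₀ x₁ x₂ x₃ x₄ x₅ x₆ x₇ : ℚ) →
            combination i a b c d + blockSum i x₀ x₁ x₂ x₃ x₄ x₅ x₆ x₇ ≡ combination i (a + x₁) (b + x₃) (c + x₅) (d + x₇)
    block χ₀ a b c d x₀ x₁ x₂ x₃ x₄ x₅ x₆ x₇ = trans (cong (combination χ₀ a b c d +_) (drop {x₀} {x₁} {x₂} {x₃} {x₄} {x₅} {x₆} {x₇} 1ℚ 1ℚ 1ℚ 1ℚ))
      (solve 8 (λ a b c d x₁ x₃ x₅ x₇ → ((a :+ b :+ c :+ d) :- con 0ℚ) :+ (con 1ℚ :* x₁ :+ con 1ℚ :* x₃ :+ con 1ℚ :* x₅ :+ con 1ℚ :* x₇)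
        := (a :+ x₁ :+ (b :+ x₃) :+ (c :+ x₅) :+ (d :+ x₇)) :- con 0ℚ) refl a b c d x₁ x₃ x₅ x₇)
    block χ₁ a b c d x₀ x₁ x₂ x₃ x₄ x₅ x₆ x₇ = trans (cong (combination χ₁ a b c d +_) (drop {x₀} {x₁} {x₂} {x₃} {x₄} {x₅} {x₆} {x₇} 1ℚ (- 1ℚ) 1ℚ (- 1ℚ)))
      (solve 8 (λ a b c d x₁ x₃ x₅ x₇ → ((a :+ c) :- (b :+ d)) :+ (con 1ℚ :* x₁ :+ con (- 1ℚ) :* x₃ :+ con 1ℚ :* x₅ :+ con (- 1ℚ) :* x₇)
        := (a :+ x₁ :+ (c :+ x₅)) :- (b :+ x₃ :+ (d :+ x₇))) refl a b c d x₁ x₃ x₅ x₇)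
    block χ₂ a b c d x₀ x₁ x₂ x₃ x₄ x₅ x₆ x₇ = trans (cong (combination χ₂ a b c d +_) (drop {x₀} {x₁} {x₂} {x₃} {x₄} {x₅} {x₆} {x₇} 1ℚ 1ℚ (- 1ℚ) (- 1ℚ)))
      (solve 8 (λ a b c d x₁ x₃ x₅ x₇ → ((a :+ b) :- (c :+ d)) :+ (con 1ℚ :* x₁ :+ con 1ℚ :* x₃ :+ con (- 1ℚ) :* x₅ :+ con (- 1ℚ) :* x₇)
        := (a :+ x₁ :+ (b :+ x₃)) :- (c :+ x₅ :+ (d :+ x₇))) refl a b c d x₁ x₃ x₅ x₇)
    block χ₃ a b c d x₀ x₁ x₂ x₃ x₄ x₅ x₆ x₇ = trans (cong (combination χ₃ a b c d +_) (drop {x₀} {x₁} {x₂} {x₃} {x₄} {x₅} {x₆} {x₇} 1ℚ (- 1ℚ) (- 1ℚ) 1ℚ))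
      (solve 8 (λ a b c d x₁ x₃ x₅ x₇ → ((a :+ d) :- (b :+ c)) :+ (con 1ℚ :* x₁ :+ con (- 1ℚ) :* x₃ :+ con (- 1ℚ) :* x₅ :+ con 1ℚ :* x₇)
        := (a :+ x₁ :+ (d :+ x₇)) :- (b :+ x₃ :+ (c :+ x₅))) refl a b c d x₁ x₃ x₅ x₇)

  -- In a pair (d , e), d is the weight of χ₀ and e that of each of the other characters.
  weighted : (Char → ℕ → ℚ) → List (ℕ × ℕ) → ℕ → ℚ
  weighted q []             s = 1ℚ
  weighted q ((d , e) ∷ es) s = q χ₀ s ^ d * (q χ₁ s ^ e * (q χ₂ s ^ e * (q χ₃ s ^ e * weighted q es (suc s))))

  weighted-cong : ∀ {q r} es s → (∀ i s → q i s ≡ r i s) → weighted q es s ≡ weighted r es s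
  weighted-cong []             s h = refl
  weighted-cong ((d , e) ∷ es) s h rewrite h χ₀ s | h χ₁ s | h χ₂ s | h χ₃ s | weighted-cong es (suc s) h = refl

  weighted-1 : ∀ es s → weighted (λ _ _ → 1ℚ) es s ≡ 1ℚ
  weighted-1 []             s = refl
  weighted-1 ((d , e) ∷ es) s rewrite 1^n≡1 d | 1^n≡1 e | weighted-1 es (suc s) = refl

  weighted-Π : ∀ (f : Char → ℕ → ℕ → ℚ) n es s → weighted (λ i s → Π (f i s) n) es s ≡ Π (λ j → weighted (λ i s → f i s j) es s) n
  weighted-Π f n []             s = sym (Π-1 n)
  weighted-Π f n ((d , e) ∷ es) s = begin
    Π (f χ₀ s) n ^ d * (Π (f χ₁ s) n ^ e * (Π (f χ₂ s) n ^ e * (Π (f χ₃ s) n ^ e * weighted (λ i s → Π (f i s) n) es (suc s))))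
      ≡⟨ cong₂ _*_ (pow χ₀ d) (cong₂ _*_ (pow χ₁ e) (cong₂ _*_ (pow χ₂ e) (cong₂ _*_ (pow χ₃ e) (weighted-Π f n es (suc s))))) ⟩
    Π (g χ₀ d) n * (Π (g χ₁ e) n * (Π (g χ₂ e) n * (Π (g χ₃ e) n * Π w n)))
      ≡⟨ cong (λ z → Π (g χ₀ d) n * (Π (g χ₁ e) n * (Π (g χ₂ e) n * z))) (Π-* (g χ₃ e) w n) ⟨
    Π (g χ₀ d) n * (Π (g χ₁ e) n * (Π (g χ₂ e) n * Π (λ j → g χ₃ e j * w j) n))
      ≡⟨ cong (λ z → Π (g χ₀ d) n * (Π (g χ₁ e) n * z)) (Π-* (g χ₂ e) (λ j → g χ₃ e j * w j) n) ⟨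
    Π (g χ₀ d) n * (Π (g χ₁ e) n * Π (λ j → g χ₂ e j * (g χ₃ e j * w j)) n)
      ≡⟨ cong (Π (g χ₀ d) n *_) (Π-* (g χ₁ e) (λ j → g χ₂ e j * (g χ₃ e j * w j)) n) ⟨
    Π (g χ₀ d) n * Π (λ j → g χ₁ e j * (g χ₂ e j * (g χ₃ e j * w j))) n
      ≡⟨ Π-* (g χ₀ d) (λ j → g χ₁ e j * (g χ₂ e j * (g χ₃ e j * w j))) n ⟨
    Π (λ j → g χ₀ d j * (g χ₁ e j * (g χ₂ e j * (g χ₃ e j * w j)))) n ∎
    where
    open ≡-Reasoning
    g : Char → ℕ → ℕ → ℚ
    g i m j = f i s j ^ m
    w : ℕ → ℚ
    w j = weighted (λ i s → f i s j) es (suc s)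
    pow : ∀ i m → Π (f i s) n ^ m ≡ Π (g i m) n
    pow i m = sym (Π-^ (f i s) m n)

-- Enclosing weighted products of reciprocal L-values without their small Euler factors.

module LValues where
  open ℚ
  open Rationals
  open Intervals
  open FactorialSeriesTails
  open Sieves
  open Characters

  consIf : ∀ {ℓ} {A : Set ℓ} → Dec A → ℕ → List ℕ → List ℕ
  consIf (yes _) n ns = n ∷ ns
  consIf (no _)  n ns = ns

  primesBelow : ℕ → List ℕ
  primesBelow zero    = []
  primesBelow (suc n) = consIf (prime? n) n (primesBelow n)

  points : ℕ → ℕ → List ℕ
  points y zero    = []
  points y (suc k) = pt y k ∷ points y k

  -- The powers mˢ are carried along with m and updated when s increases.
  withPowers : ℕ → List ℕ → List (ℕ × ℕ)
  withPowers s = map (λ m → m , m ℕ.^ s)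

  raise : List (ℕ × ℕ) → List (ℕ × ℕ)
  raise = map (λ (m , q) → m , m ℕ.* q)

  raise-withPowers : ∀ s ms → raise (withPowers s ms) ≡ withPowers (suc s) ms
  raise-withPowers s ms = sym (map-∘ ms)

  applyFactor : Sign → ℕ → Interval → Interval
  applyFactor ⊕ q I = scale (q ∸ 1) q I
  applyFactor ⊖ q I = scale (suc q) q I
  applyFactor ⊙ q I = I

  applyFactors : Char → List (ℕ × ℕ) → Interval → Interval
  applyFactors i []             I = I
  applyFactors i ((p , q) ∷ ps) I = applyFactor (sgn i (p ℕ.% 8)) q (applyFactors i ps I)

  State : Set
  State = List (ℕ × ℕ) × Row

  module LKernel (D : ℕ) .{{D≢0 : ℕ.NonZero D}} (k₀ J B : ℕ) where
    open FixedPoint D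

    combine : Char → Interval → Interval → Interval → Interval → Interval
    combine χ₀ a b c d = (a +ᴵ b +ᴵ c +ᴵ d) -ᴵ (0 ‥ 0)
    combine χ₁ a b c d = (a +ᴵ c) -ᴵ (b +ᴵ d)
    combine χ₂ a b c d = (a +ᴵ b) -ᴵ (c +ᴵ d)
    combine χ₃ a b c d = (a +ᴵ d) -ᴵ (b +ᴵ c)

    directSum : List (ℕ × ℕ) → Interval
    directSum []             = 0 ‥ 0
    directSum ((m , q) ∷ ms) = directSum ms +ᴵ scale 1 q one

    assemble : List (ℕ × ℕ) → Interval × Row → Interval × State
    assemble ms (h , row) = directSum ms +ᴵ h , raise ms , row

    advance : ℕ → State → Interval × State
    advance y (ms , I , Is) = assemble ms (step (pt y k₀) 0 I Is)

    lValues : List (ℕ × ℕ) → List (ℕ × ℕ) → State → State → State → State → List (ℕ × Interval)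
    -- Takes the four advanced states as arguments, so that each is evaluated once and shared by the
    -- four characters.
    emit : ℕ → ℕ → List (ℕ × ℕ) → List (ℕ × ℕ) → (a b c d : Interval × State) → List (ℕ × Interval)
    lValues []             ps S₀ S₂ S₄ S₆ = []
    lValues ((d , e) ∷ es) ps S₀ S₂ S₄ S₆ = emit d e es ps (advance 0 S₀) (advance 2 S₂) (advance 4 S₄) (advance 6 S₆)
    emit d e es ps (z₀ , S₀) (z₂ , S₂) (z₄ , S₄) (z₆ , S₆) =
      (d , l χ₀) ∷ (e , l χ₁) ∷ (e , l χ₂) ∷ (e , l χ₃) ∷ lValues es (raise ps) S₀ S₂ S₄ S₆
      where
      l : Char → Interval
      l i = applyFactors i ps (combine i z₀ z₂ z₄ z₆)

    initial : ℕ → State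
    initial y = withPowers 2 (points y k₀) , firstRow y k₀ 0 (scale 1 (pt y k₀) one) J

    consPower : ℕ → Maybe Interval → Maybe Interval → Maybe Interval
    -- 128 exceeds the number of binary digits of every weight, which lie below 10³⁴.
    consPower n (just I) (just W) = just (fastPow 128 I n *ᴵ W)
    consPower n _        _        = nothing

    powerProduct : List (ℕ × Interval) → Maybe Interval
    powerProduct []             = just one
    powerProduct ((n , I) ∷ Is) = consPower n (inv I) (powerProduct Is)

    kernel : List (ℕ × ℕ) → Maybe Interval
    kernel es = powerProduct (lValues es (withPowers 2 (primesBelow B)) (initial 0) (initial 2) (initial 4) (initial 6))

    -- q i s approximates the reciprocal of the L-value with the Euler factors below B removed.
    module Soundness (k : ℕ) (D≤k : D ℕ.≤ k) (q : Char → ℕ → ℚ) (0≤q : ∀ i s → 0ℚ ≤ q i s)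
      (near : ∀ i s → ∣ q i s * (Π (L.factor i s) B * Σ (term i (2 ℕ.+ s)) (8 ℕ.* (k₀ ℕ.+ k))) - 1ℚ ∣ * (ι D * ι D) ≤ 1ℚ) where

      directSum-sound : ∀ s y K → Z s y K ∈ directSum (withPowers s (points y K))
      directSum-sound s y zero    = ≤-reflexive (trans ι0 (sym (*-zeroˡ (ι D)))) , ≤-reflexive (trans (*-zeroˡ (ι D)) (sym ι0))
      directSum-sound s y (suc K) = ∈-+ (directSum (withPowers s (points y K))) (scale 1 q′ one) (directSum-sound s y K)
        (∈-subst (trans (*-identityˡ _) (trans (cong₂ _*_ ι1 (recip-^ (pt y K) s)) (*-identityˡ _)))
          (∈-scale one 1 q′ {{ℕₚ.m^n≢0 (pt y K) s}} ∈-one))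
        where q′ = pt y K ℕ.^ s

      combine-sound : ∀ i {a b c d} A B C E → a ∈ A → b ∈ B → c ∈ C → d ∈ E → combination i a b c d ∈± combine i A B C E
      combine-sound χ₀ A B C E a b c d = ∈-‑ {r = 0ℚ} (A +ᴵ B +ᴵ C +ᴵ E) (0 ‥ 0)
        (∈-+ (A +ᴵ B +ᴵ C) E (∈-+ (A +ᴵ B) C (∈-+ A B a b) c) d)
        (≤-reflexive (trans ι0 (sym (*-zeroˡ (ι D)))) , ≤-reflexive (trans (*-zeroˡ (ι D)) (sym ι0)))
      combine-sound χ₁ A B C E a b c d = ∈-‑ (A +ᴵ C) (B +ᴵ E) (∈-+ A C a c) (∈-+ B E b d)
      combine-sound χ₂ A B C E a b c d = ∈-‑ (A +ᴵ B) (C +ᴵ E) (∈-+ A B a b) (∈-+ C E c d)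
      combine-sound χ₃ A B C E a b c d = ∈-‑ (A +ᴵ E) (B +ᴵ C) (∈-+ A E a d) (∈-+ B C b c)

      applyFactor-sound : ∀ σ {r} I p .{{_ : ℕ.NonZero p}} s → r ∈± I → (1ℚ - ⟦ σ ⟧ * recip p ^ s) * r ∈± applyFactor σ (p ℕ.^ s) I
      applyFactor-sound ⊕ {r} I p s r∈I = subst (_∈± scale (p ℕ.^ s ∸ 1) (p ℕ.^ s) I) eq
        (∈±-scale I (p ℕ.^ s ∸ 1) (p ℕ.^ s) {{ℕₚ.m^n≢0 p s}} r∈I)
        where
        open ≡-Reasoning
        instance p^s≢0 = ℕₚ.m^n≢0 p s
        eq : r * (ι (p ℕ.^ s ∸ 1) * recip (p ℕ.^ s)) ≡ (1ℚ - 1ℚ * recip p ^ s) * r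
        eq = begin
          r * (ι (p ℕ.^ s ∸ 1) * recip (p ℕ.^ s))
            ≡⟨ solve 3 (λ r n R → r :* (n :* R) := ((con 1ℚ :+ n) :* R :- R) :* r) refl r (ι (p ℕ.^ s ∸ 1)) (recip (p ℕ.^ s)) ⟩
          ((1ℚ + ι (p ℕ.^ s ∸ 1)) * recip (p ℕ.^ s) - recip (p ℕ.^ s)) * r
            ≡⟨ cong (λ z → (z * recip (p ℕ.^ s) - recip (p ℕ.^ s)) * r) (trans (sym (ι-suc (p ℕ.^ s ∸ 1))) (cong ι (ℕₚ.m+[n∸m]≡n (ℕ.>-nonZero⁻¹ (p ℕ.^ s))))) ⟩
          (ι (p ℕ.^ s) * recip (p ℕ.^ s) - recip (p ℕ.^ s)) * r
            ≡⟨ cong₂ (λ u v → (u - v) * r) (ι*recip (p ℕ.^ s)) (trans (recip-^ p s) (sym (*-identityˡ (recip p ^ s)))) ⟩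
          (1ℚ - 1ℚ * recip p ^ s) * r ∎
      applyFactor-sound ⊖ {r} I p s r∈I = subst (_∈± scale (suc (p ℕ.^ s)) (p ℕ.^ s) I) eq
        (∈±-scale I (suc (p ℕ.^ s)) (p ℕ.^ s) {{ℕₚ.m^n≢0 p s}} r∈I)
        where
        open ≡-Reasoning
        instance p^s≢0 = ℕₚ.m^n≢0 p s
        eq : r * (ι (suc (p ℕ.^ s)) * recip (p ℕ.^ s)) ≡ (1ℚ - - 1ℚ * recip p ^ s) * r
        eq = begin
          r * (ι (suc (p ℕ.^ s)) * recip (p ℕ.^ s))
            ≡⟨ cong (λ z → r * (z * recip (p ℕ.^ s))) (ι-suc (p ℕ.^ s)) ⟩
          r * ((1ℚ + ι (p ℕ.^ s)) * recip (p ℕ.^ s))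
            ≡⟨ solve 3 (λ r n R → r :* ((con 1ℚ :+ n) :* R) := (n :* R :- con (- 1ℚ) :* R) :* r) refl r (ι (p ℕ.^ s)) (recip (p ℕ.^ s)) ⟩
          (ι (p ℕ.^ s) * recip (p ℕ.^ s) - - 1ℚ * recip (p ℕ.^ s)) * r
            ≡⟨ cong₂ (λ u v → (u - - 1ℚ * v) * r) (ι*recip (p ℕ.^ s)) (recip-^ p s) ⟩
          (1ℚ - - 1ℚ * recip p ^ s) * r ∎
      applyFactor-sound ⊙ {r} I p s r∈I = subst (_∈± I)
        (solve 2 (λ r x → r := (con 1ℚ :- con 0ℚ :* x) :* r) refl r (recip p ^ s)) r∈I

      applyFactors-sound : ∀ i s n {r} I → r ∈± I → Π (L.factor i s) n * r ∈± applyFactors i (withPowers (2 ℕ.+ s) (primesBelow n)) I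
      applyFactors-sound i s zero    {r} I r∈I = subst (_∈± I) (sym (*-identityˡ r)) r∈I
      applyFactors-sound i s (suc n) {r} I r∈I = go (prime? n)
        where
        P : ℚ
        P = Π (L.factor i s) n
        Is : Interval
        Is = applyFactors i (withPowers (2 ℕ.+ s) (primesBelow n)) I
        go : (n? : Dec (Prime n)) → P * onlyIf n? (1ℚ - term i (2 ℕ.+ s) n) * r ∈±
               applyFactors i (withPowers (2 ℕ.+ s) (consIf n? n (primesBelow n))) I
        go (no _)        = subst (λ z → z * r ∈± Is) (sym (*-identityʳ P)) (applyFactors-sound i s n I r∈I)
        go (yes prime-n) = subst (_∈± applyFactor (sgn i (n ℕ.% 8)) (n ℕ.^ (2 ℕ.+ s)) Is)
          (solve 3 (λ f P r → f :* (P :* r) := P :* f :* r) refl (1ℚ - term i (2 ℕ.+ s) n) P r)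
          (applyFactor-sound (sgn i (n ℕ.% 8)) Is n {{prime⇒nonZero prime-n}} (2 ℕ.+ s) (applyFactors-sound i s n I r∈I))

      module Tails (y : ℕ) where
        open TailEnclosure D y k₀ k D≤k public
        open FactorialSeries y public using (T)

      -- The direct terms are prepared for the exponent 2 + s to be emitted next, while the row
      -- still belongs to 1 + s because `step` raises it.
      Invariant : ℕ → ℕ → State → Set
      Invariant s y (ms , I , Is) = ms ≡ withPowers (2 ℕ.+ s) (points y k₀) ×
        Tails.T y k₀ k (suc s) 1 ∈ I × Tails.Encloses y (Tails.T y k₀ k (suc s)) 2 Is

      Z-split : ∀ s y → Z s y (k₀ ℕ.+ k) ≡ Z s y k₀ + Tails.T y k₀ k s 0
      Z-split s y = trans (Σ-split (λ j → recip (pt y j) ^ s) k₀ k)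
        (cong (Z s y k₀ +_) (Σ-cong k (λ j → sym (*-identityʳ (recip (pt y (k₀ ℕ.+ j)) ^ s)))))

      advance-sound : ∀ s y S → Invariant s y S →
        Z (2 ℕ.+ s) y (k₀ ℕ.+ k) ∈ proj₁ (advance y S) × Invariant (suc s) y (proj₂ (advance y S))
      advance-sound s y (ms , I , Is) (refl , t∈I , t∈Is) with step (pt y k₀) 0 I Is | Tails.step-sound y (suc s) 0 I Is t∈I t∈Is
      ... | h , row | t∈h , t∈row =
        ∈-subst (sym (Z-split (2 ℕ.+ s) y)) (∈-+ (directSum ms) h (directSum-sound (2 ℕ.+ s) y k₀) t∈h) ,
        raise-withPowers (2 ℕ.+ s) (points y k₀) , t∈row

      initial-sound : ∀ y → Invariant 0 y (initial y)
      initial-sound y = refl , Tails.firstRow-sound y 0 (scale 1 (pt y k₀) one) J (Tails.base-sound y)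

      -- Each listed interval encloses not the base x itself but a number r with x r = 1 up to D⁻²;
      -- this is the form in which `euler` supplies its information.
      Powers : ℚ → List (ℕ × Interval) → Set
      Powers w []             = w ≡ 1ℚ
      Powers w ((n , I) ∷ Is) = ∃[ x ] ∃[ w′ ] w ≡ x ^ n * w′ × Powers w′ Is ×
        0ℚ ≤ x × ∃[ r ] ∣ x * r - 1ℚ ∣ * (ι D * ι D) ≤ 1ℚ × r ∈± I

      consPower-sound : ∀ {x w} n I? W? {W} → (∀ {I} → I? ≡ just I → x ∈ I) → (∀ {W} → W? ≡ just W → w ∈ W) →
                        consPower n I? W? ≡ just W → x ^ n * w ∈ W
      consPower-sound n (just I) (just W) hI hW refl = ∈-* (fastPow 128 I n) W (∈-fastPow 128 I n (hI refl)) (hW refl)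
      consPower-sound n nothing  _        hI hW ()
      consPower-sound n (just I) nothing  hI hW ()

      powerProduct-sound : ∀ {w} Is {W} → Powers w Is → powerProduct Is ≡ just W → w ∈ W
      powerProduct-sound [] refl refl = ∈-one
      powerProduct-sound ((n , I) ∷ Is) (x , w′ , refl , powers , 0≤x , r , x*r≈1 , r∈I) =
        consPower-sound n (inv I) (powerProduct Is) (∈-inv 0≤x x*r≈1 r∈I) (powerProduct-sound Is powers)

      Advanced : ℕ → ℕ → Interval × State → Set
      Advanced s y (z , S) = Z (2 ℕ.+ s) y (k₀ ℕ.+ k) ∈ z × Invariant (suc s) y S

      lValues-sound : ∀ es s S₀ S₂ S₄ S₆ → Invariant s 0 S₀ → Invariant s 2 S₂ → Invariant s 4 S₄ → Invariant s 6 S₆ →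
        Powers (weighted q es s) (lValues es (withPowers (2 ℕ.+ s) (primesBelow B)) S₀ S₂ S₄ S₆)
      emit-sound : ∀ d e es s A₀ A₂ A₄ A₆ → Advanced s 0 A₀ → Advanced s 2 A₂ → Advanced s 4 A₄ → Advanced s 6 A₆ →
        Powers (weighted q ((d , e) ∷ es) s) (emit d e es (withPowers (2 ℕ.+ s) (primesBelow B)) A₀ A₂ A₄ A₆)
      lValues-sound []             s S₀ S₂ S₄ S₆ i₀ i₂ i₄ i₆ = refl
      lValues-sound ((d , e) ∷ es) s S₀ S₂ S₄ S₆ i₀ i₂ i₄ i₆ =
        emit-sound d e es s (advance 0 S₀) (advance 2 S₂) (advance 4 S₄) (advance 6 S₆)
          (advance-sound s 0 S₀ i₀) (advance-sound s 2 S₂ i₂) (advance-sound s 4 S₄ i₄) (advance-sound s 6 S₆ i₆)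
      emit-sound d e es s (z₀ , S₀) (z₂ , S₂) (z₄ , S₄) (z₆ , S₆) (z₀∈ , i₀) (z₂∈ , i₂) (z₄∈ , i₄) (z₆∈ , i₆) =
        q χ₀ s , w₁ , refl , (q χ₁ s , w₂ , refl , (q χ₂ s , w₃ , refl , (q χ₃ s , weighted q es (suc s) , refl ,
          subst (λ ps → Powers (weighted q es (suc s)) (lValues es ps S₀ S₂ S₄ S₆)) (sym (raise-withPowers (2 ℕ.+ s) (primesBelow B)))
            (lValues-sound es (suc s) S₀ S₂ S₄ S₆ i₀ i₂ i₄ i₆) ,
          value χ₃) , value χ₂) , value χ₁) , value χ₀
        where
        w₁ w₂ w₃ : ℚ
        w₃ = q χ₃ s ^ e * weighted q es (suc s)
        w₂ = q χ₂ s ^ e * w₃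
        w₁ = q χ₁ s ^ e * w₂
        value : ∀ i → 0ℚ ≤ q i s × ∃[ r ] ∣ q i s * r - 1ℚ ∣ * (ι D * ι D) ≤ 1ℚ ×
                      r ∈± applyFactors i (withPowers (2 ℕ.+ s) (primesBelow B)) (combine i z₀ z₂ z₄ z₆)
        value i = 0≤q i s , Π (L.factor i s) B * Σ (term i (2 ℕ.+ s)) (8 ℕ.* (k₀ ℕ.+ k)) , near i s ,
          applyFactors-sound i s B (combine i z₀ z₂ z₄ z₆)
            (subst (_∈± combine i z₀ z₂ z₄ z₆) (sym (Σ-term i (2 ℕ.+ s) (k₀ ℕ.+ k))) (combine-sound i z₀ z₂ z₄ z₆ z₀∈ z₂∈ z₄∈ z₆∈))

      kernel-sound : ∀ es {I} → kernel es ≡ just I → weighted q es 0 ∈ I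
      kernel-sound es = powerProduct-sound (lValues es (withPowers 2 (primesBelow B)) (initial 0) (initial 2) (initial 4) (initial 6))
        (lValues-sound es 0 (initial 0) (initial 2) (initial 4) (initial 6) (initial-sound 0) (initial-sound 2) (initial-sound 4) (initial-sound 6))

-- Taylor models with integer coefficients for products of powers of 1 ± xˢ.

module TaylorModels where
  open import Data.Integer as ℤ using (ℤ; +_; -[1+_])
  open ℚ
  open Rationals
  open Intervals
  open Characters

  infixr 5 _∷ᵀ_
  -- Horner form a₀ + x (a₁ + x (⋯)) with exact integer coefficients; `end` bounds the cofactor of
  -- the final power of x.
  data TaylorModel : Set where
    end  : ℕ → TaylorModel
    _∷ᵀ_ : ℤ → TaylorModel → TaylorModel

  ∣ιℤ∣ : ∀ a → ∣ ιℤ a ∣ ≡ ι ℤ.∣ a ∣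
  ∣ιℤ∣ (+ n)    = 0≤p⇒∣p∣≡p (0≤ι n)
  ∣ιℤ∣ -[1+ n ] = trans (cong ∣_∣ eq) (trans (∣-p∣≡∣p∣ (ι (suc n))) (0≤p⇒∣p∣≡p (0≤ι (suc n))))
    where
    eq : ιℤ -[1+ n ] ≡ - ι (suc n)
    eq = trans (solve 2 (λ x y → x := (x :+ y) :- y) refl (ιℤ -[1+ n ]) (ι (suc n)))
      (trans (cong (_- ι (suc n)) (trans (sym (ιℤ-+ -[1+ n ] (+ suc n))) (trans (cong ιℤ (ℤₚ.+-inverseˡ (+ suc n))) ι0)))
        (+-identityˡ (- ι (suc n))))

  ιℤ-1 : ιℤ -[1+ 0 ] ≡ - 1ℚ
  ιℤ-1 = trans (solve 2 (λ x y → x := (x :+ y) :- y) refl (ιℤ -[1+ 0 ]) (ι 1))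
    (trans (cong₂ _-_ (trans (sym (ιℤ-+ -[1+ 0 ] (+ 1))) ι0) ι1) (+-identityˡ (- 1ℚ)))

  -- The remainder C of a model stands for C/K, and the expansion variable x ranges over [0, 1/B].
  module Arithmetic (B K : ℕ) .{{B≢0 : ℕ.NonZero B}} .{{K≢0 : ℕ.NonZero K}} where

    bound : TaylorModel → ℕ
    bound (end C)  = C
    bound (a ∷ᵀ t) = ℤ.∣ a ∣ ℕ.* K ℕ.+ suc (bound t div B)

    infixl 6 _+ᵀ_
    _+ᵀ_ : TaylorModel → TaylorModel → TaylorModel
    end C    +ᵀ u        = end (C ℕ.+ bound u)
    (a ∷ᵀ t) +ᵀ end C    = end (C ℕ.+ bound (a ∷ᵀ t))
    (a ∷ᵀ t) +ᵀ (b ∷ᵀ u) = (a ℤ.+ b) ∷ᵀ (t +ᵀ u)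

    infixr 7 _·ᵀ_
    _·ᵀ_ : ℤ → TaylorModel → TaylorModel
    a ·ᵀ end C    = end (ℤ.∣ a ∣ ℕ.* C)
    a ·ᵀ (b ∷ᵀ t) = (a ℤ.* b) ∷ᵀ (a ·ᵀ t)

    infixl 7 _*ᵀ_
    _*ᵀ_ : TaylorModel → TaylorModel → TaylorModel
    end C    *ᵀ u = end (suc (C ℕ.* bound u div K))
    (a ∷ᵀ t) *ᵀ u = a ·ᵀ u +ᵀ (+ 0 ∷ᵀ t *ᵀ u)

    squareᵀ : TaylorModel → TaylorModel
    squareᵀ t = t *ᵀ t

    shift : ℕ → TaylorModel → TaylorModel
    shift zero    t = t
    shift (suc n) t = + 0 ∷ᵀ shift n t

    -- The explicit zeros fix the order: everything multiplied onto this model by `multiply` is cut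
    -- off at n + 1 coefficients.
    constᵀ : ℤ → ℕ → TaylorModel
    constᵀ a n = a ∷ᵀ shift n (end 0)

    multiply : Sign → ℕ → TaylorModel → TaylorModel
    multiply ⊕ s t = t +ᵀ -[1+ 0 ] ·ᵀ shift s t
    multiply ⊖ s t = t +ᵀ shift s t
    multiply ⊙ s t = t

    -- (σ , s , n) stands for the factor (1 - σ xˢ)ⁿ.
    Factors : Set
    Factors = List (Sign × ℕ × ℕ)

    halve : Factors → Factors
    halve []                = []
    halve ((σ , s , n) ∷ fs) = (σ , s , n ℕ./ 2) ∷ halve fs

    multiplyOdd : Factors → TaylorModel → TaylorModel
    multiplyOdd []                 t = t
    multiplyOdd ((σ , s , n) ∷ fs) t with n ℕ.% 2
    ... | zero  = multiplyOdd fs t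
    ... | suc _ = multiply σ s (multiplyOdd fs t)

    multiplyPower : Sign → ℕ → ℕ → TaylorModel → TaylorModel
    multiplyPower σ s zero    t = t
    multiplyPower σ s (suc n) t = multiply σ s (multiplyPower σ s n t)

    multiplyAll : Factors → TaylorModel → TaylorModel
    multiplyAll []                 t = t
    multiplyAll ((σ , s , n) ∷ fs) t = multiplyPower σ s n (multiplyAll fs t)

    -- Square-and-multiply for all exponents at once; f bounds their number of
    -- binary digits and m is the order of the expansion.
    expand : ℕ → ℕ → Factors → TaylorModel
    expand m zero    fs = multiplyAll fs (constᵀ (+ 1) m)
    expand m (suc f) fs = multiplyOdd fs (squareᵀ (expand m f (halve fs)))

    agreement : ℕ → TaylorModel → TaylorModel → Maybe ℕ
    agreement zero    (end C)  (end C′) = just (C ℕ.+ C′)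
    agreement (suc n) (a ∷ᵀ t) (b ∷ᵀ u) with a ℤ.≟ b
    ... | yes _ = agreement n t u
    ... | no  _ = nothing
    agreement _       _        _        = nothing

    module Semantics (x : ℚ) (0≤x : 0ℚ ≤ x) (x≤1/B : x ≤ recip B) where

      infix 4 _⊨_
      _⊨_ : ℚ → TaylorModel → Set
      y ⊨ end C    = ∣ y ∣ * ι K ≤ ι C
      y ⊨ (a ∷ᵀ t) = ∃[ z ] y ≡ ιℤ a + x * z × z ⊨ t

      bound-sound : ∀ {y} t → y ⊨ t → ∣ y ∣ * ι K ≤ ι (bound t)
      bound-sound (end C) h = h
      bound-sound (a ∷ᵀ t) (z , refl , h) = begin
        ∣ ιℤ a + x * z ∣ * ι K                       ≤⟨ *-monoʳ (ι K) (0≤ι K) (∣+∣≤ {ιℤ a} {x * z} (≤-reflexive (∣ιℤ∣ a)) (∣*∣≤ {x} {z} (0≤⇒∣∣≤ 0≤x x≤1/B) ≤-refl)) ⟩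
        (ι ℤ.∣ a ∣ + recip B * ∣ z ∣) * ι K          ≡⟨ solve 4 (λ a b z k → (a :+ b :* z) :* k := a :* k :+ z :* k :* b) refl (ι ℤ.∣ a ∣) (recip B) ∣ z ∣ (ι K) ⟩
        ι ℤ.∣ a ∣ * ι K + ∣ z ∣ * ι K * recip B      ≤⟨ +-mono-≤ (≤-reflexive (sym (ι-* ℤ.∣ a ∣ K))) (≤-trans (*-monoʳ (recip B) (0≤recip B) (bound-sound t h)) (≤ceil (bound t) B)) ⟩
        ι (ℤ.∣ a ∣ ℕ.* K) + ι (suc (bound t div B))  ≡⟨ ι-+ (ℤ.∣ a ∣ ℕ.* K) (suc (bound t div B)) ⟨
        ι (bound (a ∷ᵀ t))                           ∎
        where open ℚₚ.≤-Reasoning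

      private
        end-+ : ∀ {y w} C u → ∣ y ∣ * ι K ≤ ι C → w ⊨ u → ∣ y + w ∣ * ι K ≤ ι (C ℕ.+ bound u)
        end-+ {y} {w} C u hy hw = begin
          ∣ y + w ∣ * ι K              ≤⟨ *-monoʳ (ι K) (0≤ι K) (∣p+q∣≤∣p∣+∣q∣ y w) ⟩
          (∣ y ∣ + ∣ w ∣) * ι K        ≡⟨ *-distribʳ-+ (ι K) ∣ y ∣ ∣ w ∣ ⟩
          ∣ y ∣ * ι K + ∣ w ∣ * ι K    ≤⟨ +-mono-≤ hy (bound-sound u hw) ⟩
          ι C + ι (bound u)            ≡⟨ ι-+ C (bound u) ⟨
          ι (C ℕ.+ bound u)            ∎
          where open ℚₚ.≤-Reasoning

      +ᵀ-sound : ∀ {y w} t u → y ⊨ t → w ⊨ u → y + w ⊨ t +ᵀ u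
      +ᵀ-sound {y} {w} (end C) u hy hw = end-+ {y} {w} C u hy hw
      +ᵀ-sound {y} {w} (a ∷ᵀ t) (end C) hy hw = subst (λ v → ∣ v ∣ * ι K ≤ ι (C ℕ.+ bound (a ∷ᵀ t))) (+-comm w y)
        (end-+ {w} {y} C (a ∷ᵀ t) hw hy)
      +ᵀ-sound (a ∷ᵀ t) (b ∷ᵀ u) (z , refl , hz) (v , refl , hv) = z + v ,
        trans (solve 5 (λ a b x z v → a :+ x :* z :+ (b :+ x :* v) := (a :+ b) :+ x :* (z :+ v)) refl (ιℤ a) (ιℤ b) x z v)
          (cong (_+ x * (z + v)) (sym (ιℤ-+ a b))) ,
        +ᵀ-sound t u hz hv

      ·ᵀ-sound : ∀ {y} a t → y ⊨ t → ιℤ a * y ⊨ a ·ᵀ t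
      ·ᵀ-sound {y} a (end C) h = begin
        ∣ ιℤ a * y ∣ * ι K         ≡⟨ cong (_* ι K) (trans (∣p*q∣≡∣p∣*∣q∣ (ιℤ a) y) (cong (_* ∣ y ∣) (∣ιℤ∣ a))) ⟩
        ι ℤ.∣ a ∣ * ∣ y ∣ * ι K    ≡⟨ *-assoc (ι ℤ.∣ a ∣) ∣ y ∣ (ι K) ⟩
        ι ℤ.∣ a ∣ * (∣ y ∣ * ι K)  ≤⟨ *-monoˡ (ι ℤ.∣ a ∣) (0≤ι ℤ.∣ a ∣) h ⟩
        ι ℤ.∣ a ∣ * ι C            ≡⟨ ι-* ℤ.∣ a ∣ C ⟨
        ι (ℤ.∣ a ∣ ℕ.* C)          ∎
        where open ℚₚ.≤-Reasoning
      ·ᵀ-sound a (b ∷ᵀ t) (z , refl , h) = ιℤ a * z ,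
        trans (solve 4 (λ a b x z → a :* (b :+ x :* z) := a :* b :+ x :* (a :* z)) refl (ιℤ a) (ιℤ b) x z)
          (cong (_+ x * (ιℤ a * z)) (sym (ιℤ-* a b))) ,
        ·ᵀ-sound a t h

      x*-sound : ∀ {y} t → y ⊨ t → x * y ⊨ (+ 0 ∷ᵀ t)
      x*-sound {y} t h = y , trans (sym (+-identityˡ (x * y))) (cong (_+ x * y) (sym ι0)) , h

      *ᵀ-sound : ∀ {y w} t u → y ⊨ t → w ⊨ u → y * w ⊨ t *ᵀ u
      *ᵀ-sound {y} {w} (end C) u hy hw = begin
        ∣ y * w ∣ * ι K                                  ≡⟨ cong (_* ι K) (∣p*q∣≡∣p∣*∣q∣ y w) ⟩
        ∣ y ∣ * ∣ w ∣ * ι K                              ≡⟨ cong (∣ y ∣ * ∣ w ∣ *_) (trans (sym (*-identityʳ (ι K))) (cong (ι K *_) (sym (ι*recip K)))) ⟩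
        ∣ y ∣ * ∣ w ∣ * (ι K * (ι K * recip K))          ≡⟨ solve 4 (λ y w k r → y :* w :* (k :* (k :* r)) := y :* k :* (w :* k) :* r) refl ∣ y ∣ ∣ w ∣ (ι K) (recip K) ⟩
        ∣ y ∣ * ι K * (∣ w ∣ * ι K) * recip K            ≤⟨ *-monoʳ (recip K) (0≤recip K) (*-mono (*-nonNeg (0≤∣p∣ y) (0≤ι K)) (*-nonNeg (0≤∣p∣ w) (0≤ι K)) hy (bound-sound u hw)) ⟩
        ι C * ι (bound u) * recip K                      ≡⟨ cong (_* recip K) (ι-* C (bound u)) ⟨
        ι (C ℕ.* bound u) * recip K                      ≤⟨ ≤ceil (C ℕ.* bound u) K ⟩
        ι (suc (C ℕ.* bound u div K))                    ∎
        where open ℚₚ.≤-Reasoning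
      *ᵀ-sound {w = w} (a ∷ᵀ t) u (z , refl , h) hw = subst (_⊨ a ·ᵀ u +ᵀ (+ 0 ∷ᵀ t *ᵀ u))
        (solve 4 (λ a x z w → a :* w :+ x :* (z :* w) := (a :+ x :* z) :* w) refl (ιℤ a) x z w)
        (+ᵀ-sound (a ·ᵀ u) (+ 0 ∷ᵀ t *ᵀ u) (·ᵀ-sound a u hw) (x*-sound (t *ᵀ u) (*ᵀ-sound t u h hw)))

      shift-sound : ∀ {y} s t → y ⊨ t → x ^ s * y ⊨ shift s t
      shift-sound {y} zero    t h = subst (_⊨ t) (sym (*-identityˡ y)) h
      shift-sound {y} (suc s) t h = subst (_⊨ (+ 0 ∷ᵀ shift s t)) (sym (*-assoc x (x ^ s) y))
        (x*-sound (shift s t) (shift-sound s t h))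

      const-sound : ∀ a n → ιℤ a ⊨ constᵀ a n
      const-sound a n = 0ℚ , sym (trans (cong (λ z → ιℤ a + z) (*-zeroʳ x)) (+-identityʳ (ιℤ a))) ,
        subst (_⊨ shift n (end 0)) (*-zeroʳ (x ^ n)) (shift-sound n (end 0) (≤-reflexive (trans (*-zeroˡ (ι K)) (sym ι0))))

      value : Sign → ℕ → ℚ
      value σ s = 1ℚ - ⟦ σ ⟧ * x ^ s

      multiply-sound : ∀ {y} σ s t → y ⊨ t → value σ s * y ⊨ multiply σ s t
      multiply-sound {y} ⊕ s t h = subst (_⊨ multiply ⊕ s t)
        (trans (cong (λ c → y + c * (x ^ s * y)) ιℤ-1)
          (solve 2 (λ y p → y :+ con (- 1ℚ) :* (p :* y) := (con 1ℚ :- con 1ℚ :* p) :* y) refl y (x ^ s)))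
        (+ᵀ-sound t (-[1+ 0 ] ·ᵀ shift s t) h (·ᵀ-sound -[1+ 0 ] (shift s t) (shift-sound s t h)))
      multiply-sound {y} ⊖ s t h = subst (_⊨ multiply ⊖ s t)
        (solve 2 (λ y p → y :+ p :* y := (con 1ℚ :- con (- 1ℚ) :* p) :* y) refl y (x ^ s))
        (+ᵀ-sound t (shift s t) h (shift-sound s t h))
      multiply-sound {y} ⊙ s t h = subst (_⊨ t)
        (solve 2 (λ y p → y := (con 1ℚ :- con 0ℚ :* p) :* y) refl y (x ^ s)) h

      values : Factors → ℚ
      values []                 = 1ℚ
      values ((σ , s , n) ∷ fs) = value σ s ^ n * values fs

      oddValues : Factors → ℚ
      oddValues []                 = 1ℚ
      oddValues ((σ , s , n) ∷ fs) = value σ s ^ (n ℕ.% 2) * oddValues fs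

      square-halve : ∀ fs → oddValues fs * (values (halve fs) * values (halve fs)) ≡ values fs
      square-halve [] = refl
      square-halve ((σ , s , n) ∷ fs) = begin
        v ^ (n ℕ.% 2) * o * (v ^ (n ℕ./ 2) * w * (v ^ (n ℕ./ 2) * w))
          ≡⟨ solve 4 (λ p o h w → p :* o :* (h :* w :* (h :* w)) := p :* (h :* h) :* (o :* (w :* w))) refl (v ^ (n ℕ.% 2)) o (v ^ (n ℕ./ 2)) w ⟩
        v ^ (n ℕ.% 2) * (v ^ (n ℕ./ 2) * v ^ (n ℕ./ 2)) * (o * (w * w))
          ≡⟨ cong₂ _*_ (trans (cong (v ^ (n ℕ.% 2) *_) (sym (^-distrib-* v v (n ℕ./ 2)))) (^-half v n)) (square-halve fs) ⟩
        v ^ n * values fs ∎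
        where
        open ≡-Reasoning
        v = value σ s
        o = oddValues fs
        w = values (halve fs)

      multiplyOdd-sound : ∀ {y} fs t → y ⊨ t → oddValues fs * y ⊨ multiplyOdd fs t
      multiplyOdd-sound {y} [] t h = subst (_⊨ t) (sym (*-identityˡ y)) h
      multiplyOdd-sound {y} ((σ , s , n) ∷ fs) t h with n ℕ.% 2 | ℕᵈ.m%n<n n 2
      ... | zero        | _ = subst (λ o → o * y ⊨ multiplyOdd fs t) (sym (*-identityˡ (oddValues fs))) (multiplyOdd-sound fs t h)
      ... | suc zero    | _ = subst (_⊨ multiply σ s (multiplyOdd fs t))
        (solve 3 (λ v o y → v :* (o :* y) := v :* con 1ℚ :* o :* y) refl (value σ s) (oddValues fs) y)
        (multiply-sound σ s (multiplyOdd fs t) (multiplyOdd-sound fs t h))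
      ... | suc (suc _) | ℕ.s≤s (ℕ.s≤s ())

      multiplyPower-sound : ∀ {y} σ s n t → y ⊨ t → value σ s ^ n * y ⊨ multiplyPower σ s n t
      multiplyPower-sound {y} σ s zero    t h = subst (_⊨ t) (sym (*-identityˡ y)) h
      multiplyPower-sound {y} σ s (suc n) t h = subst (_⊨ multiply σ s (multiplyPower σ s n t))
        (sym (*-assoc (value σ s) (value σ s ^ n) y))
        (multiply-sound σ s (multiplyPower σ s n t) (multiplyPower-sound σ s n t h))

      multiplyAll-sound : ∀ {y} fs t → y ⊨ t → values fs * y ⊨ multiplyAll fs t
      multiplyAll-sound {y} [] t h = subst (_⊨ t) (sym (*-identityˡ y)) h
      multiplyAll-sound {y} ((σ , s , n) ∷ fs) t h = subst (_⊨ multiplyPower σ s n (multiplyAll fs t))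
        (sym (*-assoc (value σ s ^ n) (values fs) y))
        (multiplyPower-sound σ s n (multiplyAll fs t) (multiplyAll-sound fs t h))

      expand-sound : ∀ m f fs → values fs ⊨ expand m f fs
      expand-sound m zero    fs = subst (_⊨ expand m zero fs) (trans (cong (values fs *_) ι1) (*-identityʳ (values fs)))
        (multiplyAll-sound fs (constᵀ (+ 1) m) (const-sound (+ 1) m))
      expand-sound m (suc f) fs = subst (_⊨ expand m (suc f) fs) (square-halve fs)
        (multiplyOdd-sound fs (squareᵀ t) (*ᵀ-sound t t (expand-sound m f (halve fs)) (expand-sound m f (halve fs))))
        where t = expand m f (halve fs)

      -- Each common coefficient cancels and leaves one factor x; after n of them only the two
      -- remainders are left.
      agreement-sound : ∀ {y w} n t u {C} → y ⊨ t → w ⊨ u → agreement n t u ≡ just C → ∣ y - w ∣ * ι K ≤ x ^ n * ι C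
      agreement-sound {y} {w} zero (end C) (end C′) hy hw refl = begin
        ∣ y - w ∣ * ι K                ≤⟨ *-monoʳ (ι K) (0≤ι K) (∣-∣≤ {y} {w} ≤-refl ≤-refl) ⟩
        (∣ y ∣ + ∣ w ∣) * ι K          ≡⟨ *-distribʳ-+ (ι K) ∣ y ∣ ∣ w ∣ ⟩
        ∣ y ∣ * ι K + ∣ w ∣ * ι K      ≤⟨ +-mono-≤ hy hw ⟩
        ι C + ι C′                     ≡⟨ ι-+ C C′ ⟨
        ι (C ℕ.+ C′)                   ≡⟨ *-identityˡ (ι (C ℕ.+ C′)) ⟨
        1ℚ * ι (C ℕ.+ C′)              ∎
        where open ℚₚ.≤-Reasoning
      agreement-sound (suc n) (a ∷ᵀ t) (b ∷ᵀ u) {C} (z , refl , hz) (v , refl , hv) eq with a ℤ.≟ b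
      ... | yes refl = begin
        ∣ ιℤ a + x * z - (ιℤ a + x * v) ∣ * ι K
          ≡⟨ cong (λ r → ∣ r ∣ * ι K) (solve 4 (λ a x z v → a :+ x :* z :- (a :+ x :* v) := x :* (z :- v)) refl (ιℤ a) x z v) ⟩
        ∣ x * (z - v) ∣ * ι K
          ≡⟨ cong (_* ι K) (trans (∣p*q∣≡∣p∣*∣q∣ x (z - v)) (cong (_* ∣ z - v ∣) (0≤p⇒∣p∣≡p 0≤x))) ⟩
        x * ∣ z - v ∣ * ι K
          ≡⟨ *-assoc x ∣ z - v ∣ (ι K) ⟩
        x * (∣ z - v ∣ * ι K)
          ≤⟨ *-monoˡ x 0≤x (agreement-sound n t u hz hv eq) ⟩
        x * (x ^ n * ι C)
          ≡⟨ *-assoc x (x ^ n) (ι C) ⟨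
        x ^ suc n * ι C ∎
        where open ℚₚ.≤-Reasoning

-- Comparing the Euler factors of the weighted product with those of the target.

module LocalComparison where
  open import Data.Bool using (Bool; true; false; T)
  open import Data.Integer as ℤ using (ℤ; +_; -[1+_])
  open import Data.Nat.Divisibility using (_∣_; divides)
  open ℚ
  open Rationals
  open Intervals
  open Sieves
  open Characters
  open TaylorModels
  open Real using (eulerFactor; Prime≡1[8]; prime≡1[8]?)

  infix 4 _≍[_]_
  -- Relative closeness, stated in both directions instead of by a quotient; the constants multiply
  -- along products.
  record _≍[_]_ (u c v : ℚ) : Set where
    constructor _,_
    field
      left  : u ≤ c * v
      right : v ≤ c * u
  open _≍[_]_ public

  ≍-refl : ∀ {u c} → 0ℚ ≤ u → 1ℚ ≤ c → u ≍[ c ] u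
  ≍-refl {u} {c} 0≤u 1≤c = h , h
    where
    h : u ≤ c * u
    h = subst (_≤ c * u) (*-identityˡ u) (*-monoʳ u 0≤u 1≤c)

  ≍-* : ∀ {u c v u′ c′ v′} → 0ℚ ≤ u → 0ℚ ≤ v → 0ℚ ≤ u′ → 0ℚ ≤ v′ →
        u ≍[ c ] v → u′ ≍[ c′ ] v′ → u * u′ ≍[ c * c′ ] v * v′
  ≍-* {u} {c} {v} {u′} {c′} {v′} 0≤u 0≤v 0≤u′ 0≤v′ (l , r) (l′ , r′) =
    subst (u * u′ ≤_) (swap v v′) (*-mono 0≤u 0≤u′ l l′) ,
    subst (v * v′ ≤_) (swap u u′) (*-mono 0≤v 0≤v′ r r′)
    where
    swap : ∀ a b → c * a * (c′ * b) ≡ c * c′ * (a * b)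
    swap a b = solve 4 (λ c a d b → c :* a :* (d :* b) := c :* d :* (a :* b)) refl c a c′ b

  ≍-cancelˡ : ∀ {u c v} w → 0ℚ < w → w * u ≍[ c ] w * v → u ≍[ c ] v
  ≍-cancelˡ {u} {c} {v} w 0<w (l , r) = cancel u v l , cancel v u r
    where
    cancel : ∀ a b → w * a ≤ c * (w * b) → a ≤ c * b
    cancel a b h = *-cancelʳ w 0<w (subst₂ _≤_ (*-comm w a) (solve 3 (λ c w b → c :* (w :* b) := c :* b :* w) refl c w b) h)

  4ℚ : ℚ
  4ℚ = 1ℚ + 1ℚ + 1ℚ + 1ℚ

  ι4 : ι 4 ≡ 4ℚ
  ι4 = ιℤ-/1 (+ 4)

  -- Both numbers are at least 1/4, so an absolute error ε/4 is a relative error of at most ε.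
  near⇒≍ : ∀ {u v ε} → 1ℚ ≤ 4ℚ * u → 1ℚ ≤ 4ℚ * v → 4ℚ * ∣ u - v ∣ ≤ ε → u ≍[ 1ℚ + ε ] v
  near⇒≍ {u} {v} {ε} hu hv h = side u v hv ≤-refl , side v u hu (≤-reflexive (trans (cong ∣_∣ (solve 2 (λ u v → v :- u := :- (u :- v)) refl u v)) (∣-p∣≡∣p∣ (u - v))))
    where
    open ℚₚ.≤-Reasoning
    0<4 : 0ℚ < 4ℚ
    0<4 = positive⁻¹ 4ℚ
    0≤ε : 0ℚ ≤ ε
    0≤ε = ≤-trans (*-nonNeg (<⇒≤ 0<4) (0≤∣p∣ (u - v))) h
    side : ∀ a b → 1ℚ ≤ 4ℚ * b → ∣ a - b ∣ ≤ ∣ u - v ∣ → a ≤ (1ℚ + ε) * b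
    side a b hb k = *-cancelʳ 4ℚ 0<4 (begin
      a * 4ℚ                        ≡⟨ solve 3 (λ a b f → a :* f := f :* (a :- b) :+ b :* f) refl a b 4ℚ ⟩
      4ℚ * (a - b) + b * 4ℚ         ≤⟨ +-monoˡ-≤ (b * 4ℚ) (≤-trans (*-monoˡ 4ℚ (<⇒≤ 0<4) (≤-trans (∣∣≤⇒≤ {a - b} ≤-refl) k)) h) ⟩
      ε + b * 4ℚ                    ≡⟨ cong (_+ b * 4ℚ) (*-identityʳ ε) ⟨
      ε * 1ℚ + b * 4ℚ               ≤⟨ +-monoˡ-≤ (b * 4ℚ) (*-monoˡ ε 0≤ε hb) ⟩
      ε * (4ℚ * b) + b * 4ℚ         ≡⟨ solve 3 (λ e f b → e :* (f :* b) :+ b :* f := (con 1ℚ :+ e) :* b :* f) refl ε 4ℚ b ⟩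
      (1ℚ + ε) * b * 4ℚ             ∎)

  recip-suc : ∀ n .{{_ : ℕ.NonZero n}} → recip n ≡ recip (suc n) + recip (suc n) * recip n
  recip-suc n = begin
    R                              ≡⟨ *-identityˡ R ⟨
    1ℚ * R                         ≡⟨ cong (_* R) (ι*recip (suc n)) ⟨
    ι (suc n) * r * R              ≡⟨ cong (λ z → z * r * R) (ι-suc n) ⟩
    (1ℚ + ι n) * r * R             ≡⟨ solve 3 (λ n r R → (con 1ℚ :+ n) :* r :* R := r :* (n :* R) :+ r :* R) refl (ι n) r R ⟩
    r * (ι n * R) + r * R          ≡⟨ cong (λ z → r * z + r * R) (ι*recip n) ⟩
    r * 1ℚ + r * R                 ≡⟨ cong (_+ r * R) (*-identityʳ r) ⟩
    r + r * R                      ∎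
    where
    open ≡-Reasoning
    r = recip (suc n)
    R = recip n

  module _ (κ : ℚ) (0≤κ : 0ℚ ≤ κ) (κ≤1 : κ ≤ 1ℚ) where

    0≤1+κ* : ∀ {x} → 0ℚ ≤ x → 0ℚ ≤ 1ℚ + κ * x
    0≤1+κ* 0≤x = +-nonNeg 0≤1 (*-nonNeg 0≤κ 0≤x)

    -- 1 + κ/(n+1)² is at most the quotient of 1 + κ/n by 1 + κ/(n+1), so that products of such
    -- factors telescope. After expansion it comes down to r + κ r² ≤ r + r R = R, where κ ≤ 1
    -- enters.
    telescope-step : ∀ n .{{_ : ℕ.NonZero n}} → (1ℚ + κ * recip (suc n) ^ 2) * (1ℚ + κ * recip (suc n)) ≤ 1ℚ + κ * recip n
    telescope-step n = begin
      (1ℚ + κ * (r * (r * 1ℚ))) * (1ℚ + κ * r)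
        ≡⟨ solve 2 (λ k r → (con 1ℚ :+ k :* (r :* (r :* con 1ℚ))) :* (con 1ℚ :+ k :* r) := con 1ℚ :+ k :* (r :+ r :* (r :+ k :* (r :* r)))) refl κ r ⟩
      1ℚ + κ * (r + r * (r + κ * (r * r)))
        ≤⟨ +-monoʳ-≤ 1ℚ (*-monoˡ κ 0≤κ (+-monoʳ-≤ r (*-monoˡ r (0≤recip (suc n)) inner))) ⟩
      1ℚ + κ * (r + r * R)
        ≡⟨ cong (λ z → 1ℚ + κ * z) (recip-suc n) ⟨
      1ℚ + κ * R ∎
      where
      open ℚₚ.≤-Reasoning
      r = recip (suc n)
      R = recip n
      inner : r + κ * (r * r) ≤ R
      inner = begin
        r + κ * (r * r)      ≤⟨ +-monoʳ-≤ r (*-monoʳ (r * r) (*-nonNeg (0≤recip (suc n)) (0≤recip (suc n))) κ≤1) ⟩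
        r + 1ℚ * (r * r)     ≤⟨ +-monoʳ-≤ r (subst (_≤ r * R) (sym (*-identityˡ (r * r))) (*-monoˡ r (0≤recip (suc n)) (recip-antimono (ℕₚ.n≤1+n n)))) ⟩
        r + r * R            ≡⟨ recip-suc n ⟨
        R                    ∎

    Π-telescope : ∀ b .{{_ : ℕ.NonZero b}} n →
                  Π (λ j → 1ℚ + κ * recip (suc b ℕ.+ j) ^ 2) n * (1ℚ + κ * recip (b ℕ.+ n)) ≤ 1ℚ + κ * recip b
    Π-telescope b zero = ≤-reflexive (trans (*-identityˡ (1ℚ + κ * recip (b ℕ.+ 0))) (cong (λ m → 1ℚ + κ * recip m) (ℕₚ.+-identityʳ b)))
    Π-telescope b@(suc _) (suc n) = begin
      P * t * (1ℚ + κ * recip (b ℕ.+ suc n))      ≡⟨ cong (λ m → P * t * (1ℚ + κ * recip m)) (ℕₚ.+-suc b n) ⟩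
      P * t * (1ℚ + κ * recip (suc b ℕ.+ n))      ≡⟨ *-assoc P t (1ℚ + κ * recip (suc b ℕ.+ n)) ⟩
      P * (t * (1ℚ + κ * recip (suc b ℕ.+ n)))    ≤⟨ *-monoˡ P 0≤P (telescope-step (b ℕ.+ n)) ⟩
      P * (1ℚ + κ * recip (b ℕ.+ n))              ≤⟨ Π-telescope b n ⟩
      1ℚ + κ * recip b                            ∎
      where
      open ℚₚ.≤-Reasoning
      P = Π (λ j → 1ℚ + κ * recip (suc b ℕ.+ j) ^ 2) n
      t = 1ℚ + κ * recip (suc b ℕ.+ n) ^ 2
      0≤P : 0ℚ ≤ P
      0≤P = Π-nonNeg n (λ j → 0≤1+κ* (^-nonNeg 2 (0≤recip (suc b ℕ.+ j))))

    Π-telescope-≤ : ∀ b .{{_ : ℕ.NonZero b}} n → Π (λ j → 1ℚ + κ * recip (suc b ℕ.+ j) ^ 2) n ≤ 1ℚ + κ * recip b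
    Π-telescope-≤ b n = ≤-trans
      (subst (_≤ P * (1ℚ + κ * recip (b ℕ.+ n))) (*-identityʳ P) (*-monoˡ P 0≤P
        (≤-diff (*-nonNeg 0≤κ (0≤recip (b ℕ.+ n))) refl)))
      (Π-telescope b n)
      where
      P = Π (λ j → 1ℚ + κ * recip (suc b ℕ.+ j) ^ 2) n
      0≤P : 0ℚ ≤ P
      0≤P = Π-nonNeg n (λ j → 0≤1+κ* (^-nonNeg 2 (0≤recip (suc b ℕ.+ j))))

    Π-≍ : ∀ b .{{_ : ℕ.NonZero b}} {f g} n → (∀ j → 0ℚ ≤ f j) → (∀ j → 0ℚ ≤ g j) →
          (∀ j → f j ≍[ 1ℚ + κ * recip (suc b ℕ.+ j) ^ 2 ] g j) → Π f n ≍[ 1ℚ + κ * recip b ] Π g n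
    Π-≍ b {f} {g} n 0≤f 0≤g h = widen (Π-nonNeg n 0≤f) (Π-nonNeg n 0≤g) (go n)
      where
      t : ℕ → ℚ
      t j = 1ℚ + κ * recip (suc b ℕ.+ j) ^ 2
      go : ∀ n → Π f n ≍[ Π t n ] Π g n
      go zero    = ≍-refl 0≤1 ≤-refl
      go (suc n) = ≍-* (Π-nonNeg n 0≤f) (Π-nonNeg n 0≤g) (0≤f n) (0≤g n) (go n) (h n)
      widen : ∀ {u v} → 0ℚ ≤ u → 0ℚ ≤ v → u ≍[ Π t n ] v → u ≍[ 1ℚ + κ * recip b ] v
      widen {u} {v} 0≤u 0≤v (l , r) = ≤-trans l (*-monoʳ v 0≤v (Π-telescope-≤ b n)) , ≤-trans r (*-monoʳ u 0≤u (Π-telescope-≤ b n))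

  -- v ≥ 1/2 and |u - v| ≤ 1/4 already give u ≥ 1/4, so only the explicitly known `v` has to be
  -- bounded from below.
  near⇒≍′ : ∀ {u v ε} → 1ℚ + 1ℚ ≤ 4ℚ * v → ε ≤ 1ℚ → 4ℚ * ∣ u - v ∣ ≤ ε → u ≍[ 1ℚ + ε ] v
  near⇒≍′ {u} {v} {ε} hv ε≤1 h = near⇒≍ hu (≤-trans (+-monoˡ-≤ 1ℚ 0≤1) hv) h
    where
    open ℚₚ.≤-Reasoning
    hu : 1ℚ ≤ 4ℚ * u
    hu = begin
      1ℚ                           ≡⟨⟩
      1ℚ + 1ℚ - 1ℚ                 ≤⟨ +-mono-≤ hv (neg-antimono-≤ (≤-trans h ε≤1)) ⟩
      4ℚ * v - 4ℚ * ∣ u - v ∣      ≡⟨ solve 3 (λ f v a → f :* v :- f :* a := f :* (v :+ :- a)) refl 4ℚ v ∣ u - v ∣ ⟩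
      4ℚ * (v + - ∣ u - v ∣)       ≤⟨ *-monoˡ 4ℚ (nonNegative⁻¹ 4ℚ) (+-monoʳ-≤ v (∣∣≤⇒-≤ {u - v} ≤-refl)) ⟩
      4ℚ * (v + (u - v))           ≡⟨ solve 3 (λ f u v → f :* (v :+ (u :- v)) := f :* u) refl 4ℚ u v ⟩
      4ℚ * u                       ∎

  eulerFactor-x : ∀ m → let x = recip (2 ℕ.+ m) in
    (1ℚ - x) ^ 2 * eulerFactor (2 ℕ.+ m) ≡ (1ℚ - ι 4 * x) * (1ℚ + x) ^ 2
  eulerFactor-x m = begin
    (1ℚ - x) ^ 2 * ((1ℚ - + 4 / p) * (r * r))
      ≡⟨ cong (λ z → (1ℚ - x) ^ 2 * ((1ℚ - z) * (r * r))) (z/n (+ 4) p) ⟩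
    (1ℚ - x) ^ 2 * ((1ℚ - ι 4 * x) * (r * r))
      ≡⟨ solve 3 (λ y f r → y :* (y :* con 1ℚ) :* (f :* (r :* r)) := f :* ((r :* y) :* ((r :* y) :* con 1ℚ))) refl (1ℚ - x) (1ℚ - ι 4 * x) r ⟩
    (1ℚ - ι 4 * x) * (r * (1ℚ - x)) ^ 2
      ≡⟨ cong (λ z → (1ℚ - ι 4 * x) * z ^ 2) r*[1-x] ⟩
    (1ℚ - ι 4 * x) * (1ℚ + x) ^ 2 ∎
    where
    open ≡-Reasoning
    p : ℕ
    p = 2 ℕ.+ m
    x r : ℚ
    x = recip p
    r = + suc p / suc m
    1-x : 1ℚ - x ≡ ι (suc m) * x
    1-x = trans (cong (_- x) (trans (sym (ι*recip p)) (cong (_* x) (ι-suc (suc m)))))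
      (solve 2 (λ n x → (con 1ℚ :+ n) :* x :- x := n :* x) refl (ι (suc m)) x)
    r*[1-x] : r * (1ℚ - x) ≡ 1ℚ + x
    r*[1-x] = begin
      r * (1ℚ - x)                                    ≡⟨ cong₂ _*_ (z/n (+ suc p) (suc m)) 1-x ⟩
      ι (suc p) * recip (suc m) * (ι (suc m) * x)     ≡⟨ solve 4 (λ a b c x → a :* b :* (c :* x) := a :* x :* (c :* b)) refl (ι (suc p)) (recip (suc m)) (ι (suc m)) x ⟩
      ι (suc p) * x * (ι (suc m) * recip (suc m))     ≡⟨ cong₂ (λ a b → a * x * b) (ι-suc p) (ι*recip (suc m)) ⟩
      (1ℚ + ι p) * x * 1ℚ                             ≡⟨ solve 2 (λ n x → (con 1ℚ :+ n) :* x :* con 1ℚ := n :* x :+ x) refl (ι p) x ⟩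
      ι p * x + x                                     ≡⟨ cong (_+ x) (ι*recip p) ⟩
      1ℚ + x                                          ∎

  module _ (B K M C k : ℕ) .{{_ : ℕ.NonZero B}} .{{_ : ℕ.NonZero K}} .{{_ : ℕ.NonZero M}}
           (C≤ : 4 ℕ.* C ℕ.* M ℕ.≤ K ℕ.* B ℕ.^ k) {x : ℚ} (0≤x : 0ℚ ≤ x) (x≤1/B : x ≤ recip B) where

    -- Of the 2 + k powers of x, k are spent as B⁻ᵏ against the constant C; the other two are kept
    -- so that the errors can be multiplied up over all p.
    remainder-≤ : ∀ a → a * ι K ≤ x ^ (2 ℕ.+ k) * ι C → 4ℚ * a ≤ recip M * x ^ 2
    remainder-≤ a h = *-cancelʳ (ι K) (0<ι K) (begin
      4ℚ * a * ι K                                     ≡⟨ cong (λ z → z * a * ι K) ι4 ⟨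
      ι 4 * a * ι K                                    ≡⟨ *-assoc (ι 4) a (ι K) ⟩
      ι 4 * (a * ι K)                                  ≤⟨ *-monoˡ (ι 4) (0≤ι 4) h ⟩
      ι 4 * (x ^ (2 ℕ.+ k) * ι C)                      ≡⟨ cong (λ z → ι 4 * (z * ι C)) (^-homo-* x 2 k) ⟩
      ι 4 * (x ^ 2 * x ^ k * ι C)                      ≤⟨ *-monoˡ (ι 4) (0≤ι 4) (*-monoʳ (ι C) (0≤ι C) (*-monoˡ (x ^ 2) (^-nonNeg 2 0≤x) (^-mono-≤ k 0≤x x≤1/B))) ⟩
      ι 4 * (x ^ 2 * recip B ^ k * ι C)                ≡⟨ solve 4 (λ f x b c → f :* (x :* b :* c) := x :* b :* (f :* c)) refl (ι 4) (x ^ 2) (recip B ^ k) (ι C) ⟩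
      x ^ 2 * recip B ^ k * (ι 4 * ι C)                ≡⟨ cong₂ (λ u v → x ^ 2 * u * v) (sym (recip-^ B k)) (sym (ι-* 4 C)) ⟩
      x ^ 2 * recip (B ℕ.^ k) * ι (4 ℕ.* C)            ≡⟨ cong (x ^ 2 * recip (B ℕ.^ k) *_) (trans (sym (*-identityʳ (ι (4 ℕ.* C)))) (cong (ι (4 ℕ.* C) *_) (sym (ι*recip M)))) ⟩
      x ^ 2 * recip (B ℕ.^ k) * (ι (4 ℕ.* C) * (ι M * recip M)) ≡⟨ solve 5 (λ x b c m r → x :* b :* (c :* (m :* r)) := x :* b :* r :* (c :* m)) refl (x ^ 2) (recip (B ℕ.^ k)) (ι (4 ℕ.* C)) (ι M) (recip M) ⟩
      x ^ 2 * recip (B ℕ.^ k) * recip M * (ι (4 ℕ.* C) * ι M)   ≡⟨ cong (x ^ 2 * recip (B ℕ.^ k) * recip M *_) (ι-* (4 ℕ.* C) M) ⟨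
      x ^ 2 * recip (B ℕ.^ k) * recip M * ι (4 ℕ.* C ℕ.* M)     ≤⟨ *-monoˡ (x ^ 2 * recip (B ℕ.^ k) * recip M) (*-nonNeg (*-nonNeg (^-nonNeg 2 0≤x) (0≤recip (B ℕ.^ k))) (0≤recip M)) (ι-mono-≤ C≤) ⟩
      x ^ 2 * recip (B ℕ.^ k) * recip M * ι (K ℕ.* B ℕ.^ k)     ≡⟨ cong (x ^ 2 * recip (B ℕ.^ k) * recip M *_) (ι-* K (B ℕ.^ k)) ⟩
      x ^ 2 * recip (B ℕ.^ k) * recip M * (ι K * ι (B ℕ.^ k))   ≡⟨ solve 5 (λ x b r k B → x :* b :* r :* (k :* B) := r :* x :* k :* (B :* b)) refl (x ^ 2) (recip (B ℕ.^ k)) (recip M) (ι K) (ι (B ℕ.^ k)) ⟩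
      recip M * x ^ 2 * ι K * (ι (B ℕ.^ k) * recip (B ℕ.^ k))   ≡⟨ cong (recip M * x ^ 2 * ι K *_) (ι*recip (B ℕ.^ k) {{ℕₚ.m^n≢0 B k}}) ⟩
      recip M * x ^ 2 * ι K * 1ℚ                       ≡⟨ *-identityʳ (recip M * x ^ 2 * ι K) ⟩
      recip M * x ^ 2 * ι K                            ∎)
      where open ℚₚ.≤-Reasoning

  oddResidue : ∀ {p} → Prime p → 3 ℕ.≤ p →
               p ℕ.% 8 ≡ 1 ⊎ p ℕ.% 8 ≡ 3 ⊎ p ℕ.% 8 ≡ 5 ⊎ p ℕ.% 8 ≡ 7
  oddResidue {p} prime-p 3≤p = go (p ℕ.% 8) refl (ℕᵈ.m%n<n p 8)
    where
    even : ∀ r → p ℕ.% 8 ≡ r ℕ.* 2 → ∀ {ℓ} {A : Set ℓ} → A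
    even r eq with prime⇒irreducible prime-p 2∣p
      where
      2∣p : 2 ∣ p
      2∣p = divides (r ℕ.+ p ℕ./ 8 ℕ.* 4) (trans (ℕᵈ.m≡m%n+[m/n]*n p 8) (trans (cong₂ ℕ._+_ eq (sym (ℕₚ.*-assoc (p ℕ./ 8) 4 2)))
        (sym (ℕₚ.*-distribʳ-+ 2 r (p ℕ./ 8 ℕ.* 4)))))
    ... | inj₂ refl = contradiction 3≤p λ { (ℕ.s≤s (ℕ.s≤s ())) }
    go : ∀ r → p ℕ.% 8 ≡ r → r ℕ.< 8 → p ℕ.% 8 ≡ 1 ⊎ p ℕ.% 8 ≡ 3 ⊎ p ℕ.% 8 ≡ 5 ⊎ p ℕ.% 8 ≡ 7
    go 0 eq _ = even 0 eq
    go 1 eq _ = inj₁ eq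
    go 2 eq _ = even 1 eq
    go 3 eq _ = inj₂ (inj₁ eq)
    go 4 eq _ = even 2 eq
    go 5 eq _ = inj₂ (inj₂ (inj₁ eq))
    go 6 eq _ = even 3 eq
    go 7 eq _ = inj₂ (inj₂ (inj₂ eq))
    go (suc (suc (suc (suc (suc (suc (suc (suc _)))))))) _ (ℕ.s≤s (ℕ.s≤s (ℕ.s≤s (ℕ.s≤s (ℕ.s≤s (ℕ.s≤s (ℕ.s≤s (ℕ.s≤s ()))))))))

  -- The Euler factors of the weighted product at a prime p ≡ 1 modulo 8 ...
  factorsOne : ℕ → List (ℕ × ℕ) → List (Sign × ℕ × ℕ)
  factorsOne s []             = []
  factorsOne s ((d , e) ∷ es) = (⊕ , 2 ℕ.+ s , d ℕ.+ (e ℕ.+ (e ℕ.+ e))) ∷ factorsOne (suc s) es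

  -- ... and at the other odd primes, where χ₀ and exactly one more character take the value 1.
  factorsOther : ℕ → List (ℕ × ℕ) → List (Sign × ℕ × ℕ)
  factorsOther s []             = []
  factorsOther s ((d , e) ∷ es) = (⊕ , 2 ℕ.+ s , d ℕ.+ e) ∷ (⊖ , 2 ℕ.+ s , e ℕ.+ e) ∷ factorsOther (suc s) es

  module LocalFactors (B K : ℕ) .{{B≢0 : ℕ.NonZero B}} .{{K≢0 : ℕ.NonZero K}} (x : ℚ) (0≤x : 0ℚ ≤ x) (x≤1/B : x ≤ recip B) where
    open Arithmetic B K
    open Semantics x 0≤x x≤1/B

    local : ℕ → Char → ℕ → ℚ
    local r i s = value (sgn i r) (2 ℕ.+ s)

    local-one : ∀ es s → weighted (local 1) es s ≡ values (factorsOne s es)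
    local-one []             s = refl
    local-one ((d , e) ∷ es) s = begin
      v ^ d * (v ^ e * (v ^ e * (v ^ e * weighted (local 1) es (suc s))))
        ≡⟨ cong (λ w → v ^ d * (v ^ e * (v ^ e * (v ^ e * w)))) (local-one es (suc s)) ⟩
      v ^ d * (v ^ e * (v ^ e * (v ^ e * w)))
        ≡⟨ solve 3 (λ d e w → d :* (e :* (e :* (e :* w))) := d :* (e :* (e :* e)) :* w) refl (v ^ d) (v ^ e) w ⟩
      v ^ d * (v ^ e * (v ^ e * v ^ e)) * w
        ≡⟨ cong (λ z → v ^ d * (v ^ e * z) * w) (^-homo-* v e e) ⟨
      v ^ d * (v ^ e * v ^ (e ℕ.+ e)) * w
        ≡⟨ cong (λ z → v ^ d * z * w) (^-homo-* v e (e ℕ.+ e)) ⟨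
      v ^ d * v ^ (e ℕ.+ (e ℕ.+ e)) * w
        ≡⟨ cong (_* w) (^-homo-* v d (e ℕ.+ (e ℕ.+ e))) ⟨
      v ^ (d ℕ.+ (e ℕ.+ (e ℕ.+ e))) * w ∎
      where
      open ≡-Reasoning
      v = value ⊕ (2 ℕ.+ s)
      w = values (factorsOne (suc s) es)

    private
      regroup : ∀ s d e w → let v = value ⊕ (2 ℕ.+ s); u = value ⊖ (2 ℕ.+ s) in
                v ^ d * (v ^ e * (u ^ e * (u ^ e * w))) ≡ v ^ (d ℕ.+ e) * (u ^ (e ℕ.+ e) * w)
      regroup s d e w = trans
        (solve 4 (λ d e u w → d :* (e :* (u :* (u :* w))) := d :* e :* (u :* u :* w)) refl (v ^ d) (v ^ e) (u ^ e) w)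
        (cong₂ (λ a b → a * (b * w)) (sym (^-homo-* v d e)) (sym (^-homo-* u e e)))
        where
        v = value ⊕ (2 ℕ.+ s)
        u = value ⊖ (2 ℕ.+ s)

      swap : ∀ a b c → a * (b * c) ≡ b * (a * c)
      swap = solve 3 (λ a b c → a :* (b :* c) := b :* (a :* c)) refl

    -- The nontrivial character with value 1 is `χ₂` at residue 3, `χ₁` at 5 and `χ₃` at 7; where
    -- necessary, `swap` moves its power next to that of `χ₀`.
    local-three : ∀ es s → weighted (local 3) es s ≡ values (factorsOther s es)
    local-three []             s = refl
    local-three ((d , e) ∷ es) s = trans
      (cong (v ^ d *_) (trans (swap (u ^ e) (v ^ e) (u ^ e * weighted (local 3) es (suc s)))
        (cong (λ w → v ^ e * (u ^ e * (u ^ e * w))) (local-three es (suc s)))))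
      (regroup s d e (values (factorsOther (suc s) es)))
      where
      v = value ⊕ (2 ℕ.+ s)
      u = value ⊖ (2 ℕ.+ s)

    local-five : ∀ es s → weighted (local 5) es s ≡ values (factorsOther s es)
    local-five []             s = refl
    local-five ((d , e) ∷ es) s = trans
      (cong (λ w → v ^ d * (v ^ e * (u ^ e * (u ^ e * w)))) (local-five es (suc s)))
      (regroup s d e (values (factorsOther (suc s) es)))
      where
      v = value ⊕ (2 ℕ.+ s)
      u = value ⊖ (2 ℕ.+ s)

    local-seven : ∀ es s → weighted (local 7) es s ≡ values (factorsOther s es)
    local-seven []             s = refl
    local-seven ((d , e) ∷ es) s = trans
      (cong (v ^ d *_) (trans (cong (u ^ e *_) (swap (u ^ e) (v ^ e) (weighted (local 7) es (suc s))))
        (trans (swap (u ^ e) (v ^ e) (u ^ e * weighted (local 7) es (suc s)))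
          (cong (λ w → v ^ e * (u ^ e * (u ^ e * w))) (local-seven es (suc s))))))
      (regroup s d e (values (factorsOther (suc s) es)))
      where
      v = value ⊕ (2 ℕ.+ s)
      u = value ⊖ (2 ℕ.+ s)

  weighted-nonNeg : ∀ {q} es s → (∀ i s → 0ℚ ≤ q i s) → 0ℚ ≤ weighted q es s
  weighted-nonNeg         []             s h = 0≤1
  weighted-nonNeg {q = q} ((d , e) ∷ es) s h = *-nonNeg (^-nonNeg d (h χ₀ s)) (*-nonNeg (^-nonNeg e (h χ₁ s))
    (*-nonNeg (^-nonNeg e (h χ₂ s)) (*-nonNeg (^-nonNeg e (h χ₃ s)) (weighted-nonNeg es (suc s) h))))

  0≤factor : ∀ i s n → 0ℚ ≤ L.factor i s n
  0≤factor i s n = go (prime? n)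
    where
    go : (n? : Dec (Prime n)) → 0ℚ ≤ onlyIf n? (1ℚ - term i (2 ℕ.+ s) n)
    go (no _)  = 0≤1
    go (yes _) = p≤q⇒0≤q-p (∣∣≤⇒≤ {term i (2 ℕ.+ s) n} (≤-trans (term-≤ i s n) (^-≤1 2 (0≤recip n) (recip≤1 n))))

  restrictedFactor : ℕ → ℚ
  restrictedFactor n = onlyIf (prime≡1[8]? n) (eulerFactor n)

  onlyIf-yes : ∀ {ℓ} {A : Set ℓ} (A? : Dec A) x → A → onlyIf A? x ≡ x
  onlyIf-yes (yes _) x a = refl
  onlyIf-yes (no ¬a) x a = contradiction a ¬a

  onlyIf-no : ∀ {ℓ} {A : Set ℓ} (A? : Dec A) x → ¬ A → onlyIf A? x ≡ 1ℚ
  onlyIf-no (yes a) x ¬a = contradiction a ¬a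
  onlyIf-no (no _)  x ¬a = refl

  module EulerFactorBounds (m : ℕ) (8≤p : 8 ℕ.≤ 2 ℕ.+ m) where
    private
      p : ℕ
      p = 2 ℕ.+ m
      x : ℚ
      x = recip p

    0≤x : 0ℚ ≤ x
    0≤x = 0≤recip p

    8x≤1 : ι 8 * x ≤ 1ℚ
    8x≤1 = subst (ι 8 * x ≤_) (ι*recip 8) (*-monoˡ (ι 8) (0≤ι 8) (recip-antimono 8≤p))

    2≤4[1-4x] : 1ℚ + 1ℚ ≤ 4ℚ * (1ℚ - ι 4 * x)
    2≤4[1-4x] = ≤-diff {r = (1ℚ + 1ℚ) * (1ℚ - ι 8 * x)} (*-nonNeg (nonNegative⁻¹ (1ℚ + 1ℚ)) (p≤q⇒0≤q-p 8x≤1))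
      (trans (cong (λ z → 1ℚ + 1ℚ + (1ℚ + 1ℚ) * (1ℚ - z * x)) (trans (ι-* 2 4) (cong (_* ι 4) ι2)))
        (solve 2 (λ f x → con (1ℚ + 1ℚ) :+ con (1ℚ + 1ℚ) :* (con 1ℚ :- con (1ℚ + 1ℚ) :* f :* x) := con 4ℚ :* (con 1ℚ :- f :* x)) refl (ι 4) x))

    1≤[1+x]² : 1ℚ ≤ (1ℚ + x) ^ 2
    1≤[1+x]² = 1≤^ 2 (≤-diff 0≤x refl)

    0<1-x : 0ℚ < 1ℚ - x
    0<1-x = <-diff {r = 1ℚ - x} (*-cancelʳ-< (ι 8) (0<ι 8) (subst₂ _<_ (sym (*-zeroˡ (ι 8)))
        (solve 2 (λ e x → (e :- con 1ℚ) :+ (con 1ℚ :- e :* x) := (con 1ℚ :- x) :* e) refl (ι 8) x)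
        (+-mono-<-≤ (subst (0ℚ <_) (sym (trans (cong (_- 1ℚ) (ι-suc 7)) (solve 1 (λ a → con 1ℚ :+ a :- con 1ℚ := a) refl (ι 7)))) (0<ι 7)) (p≤q⇒0≤q-p 8x≤1))))
      (+-identityˡ (1ℚ - x))

    0<[1-x]² : 0ℚ < (1ℚ - x) ^ 2
    0<[1-x]² = *-pos 0<1-x (*-pos 0<1-x (positive⁻¹ 1ℚ))

    0≤1-4x : 0ℚ ≤ 1ℚ - ι 4 * x
    0≤1-4x = *-cancelʳ 4ℚ (positive⁻¹ 4ℚ) (subst₂ _≤_ (sym (*-zeroˡ 4ℚ)) (*-comm 4ℚ (1ℚ - ι 4 * x))
      (≤-trans (nonNegative⁻¹ (1ℚ + 1ℚ)) 2≤4[1-4x]))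

    2≤4v : 1ℚ + 1ℚ ≤ 4ℚ * ((1ℚ - ι 4 * x) * (1ℚ + x) ^ 2)
    2≤4v = ≤-trans 2≤4[1-4x] (*-monoˡ 4ℚ (nonNegative⁻¹ 4ℚ)
      (subst (_≤ (1ℚ - ι 4 * x) * (1ℚ + x) ^ 2) (*-identityʳ (1ℚ - ι 4 * x)) (*-monoˡ (1ℚ - ι 4 * x) 0≤1-4x 1≤[1+x]²)))

    0≤eulerFactor : 0ℚ ≤ eulerFactor p
    0≤eulerFactor = *-cancelʳ ((1ℚ - x) ^ 2) 0<[1-x]² (subst₂ _≤_ (sym (*-zeroˡ ((1ℚ - x) ^ 2)))
      (trans (sym (eulerFactor-x m)) (*-comm ((1ℚ - x) ^ 2) (eulerFactor p)))
      (*-nonNeg 0≤1-4x (^-nonNeg 2 (+-nonNeg 0≤1 0≤x))))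

    private
      -- Both (1 - x)² and (1 - 4x)(1 + x)² begin with 1 - 2x, so the difference starts at x². This
      -- is why the product converges absolutely.
      [1-x]²[1-f] : (1ℚ - x) ^ 2 * (1ℚ - eulerFactor p) ≡ (ι 8 + ι 4 * x) * x ^ 2
      [1-x]²[1-f] = begin
        (1ℚ - x) ^ 2 * (1ℚ - eulerFactor p)
          ≡⟨ solve 2 (λ a f → a :* (con 1ℚ :- f) := a :- a :* f) refl ((1ℚ - x) ^ 2) (eulerFactor p) ⟩
        (1ℚ - x) ^ 2 - (1ℚ - x) ^ 2 * eulerFactor p
          ≡⟨ cong (λ z → (1ℚ - x) ^ 2 - z) (trans (eulerFactor-x m) (cong (λ f → (1ℚ - f * x) * (1ℚ + x) ^ 2) ι4)) ⟩
        (1ℚ - x) ^ 2 - (1ℚ - 4ℚ * x) * (1ℚ + x) ^ 2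
          ≡⟨ solve 1 (λ x → (con 1ℚ :- x) :* ((con 1ℚ :- x) :* con 1ℚ) :- (con 1ℚ :- con 4ℚ :* x) :* ((con 1ℚ :+ x) :* ((con 1ℚ :+ x) :* con 1ℚ))
               := (con 4ℚ :+ con 4ℚ :+ con 4ℚ :* x) :* (x :* (x :* con 1ℚ))) refl x ⟩
        (4ℚ + 4ℚ + 4ℚ * x) * x ^ 2
          ≡⟨ cong₂ (λ a b → (a + b * x) * x ^ 2) (trans (cong₂ _+_ (sym ι4) (sym ι4)) (sym (ι-+ 4 4))) (sym ι4) ⟩
        (ι 8 + ι 4 * x) * x ^ 2 ∎
        where open ≡-Reasoning

    eulerFactor≤1 : eulerFactor p ≤ 1ℚ
    eulerFactor≤1 = *-cancelʳ ((1ℚ - x) ^ 2) 0<[1-x]² (≤-diff {r = (ι 8 + ι 4 * x) * x ^ 2}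
      (*-nonNeg (+-nonNeg (0≤ι 8) (*-nonNeg (0≤ι 4) 0≤x)) (^-nonNeg 2 0≤x))
      (trans (cong (λ z → eulerFactor p * (1ℚ - x) ^ 2 + z) (sym [1-x]²[1-f]))
        (solve 2 (λ f a → f :* a :+ a :* (con 1ℚ :- f) := con 1ℚ :* a) refl (eulerFactor p) ((1ℚ - x) ^ 2))))

    1-eulerFactor≤ : 1ℚ - eulerFactor p ≤ ι 16 * x ^ 2
    1-eulerFactor≤ = *-cancelʳ ((1ℚ - x) ^ 2) 0<[1-x]² (begin
      (1ℚ - eulerFactor p) * (1ℚ - x) ^ 2         ≡⟨ trans (*-comm (1ℚ - eulerFactor p) ((1ℚ - x) ^ 2)) [1-x]²[1-f] ⟩
      (ι 8 + ι 4 * x) * x ^ 2                     ≤⟨ *-monoʳ (x ^ 2) (^-nonNeg 2 0≤x) coefficient ⟩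
      ι 16 * (1ℚ - x) ^ 2 * x ^ 2                 ≡⟨ solve 3 (λ s a b → s :* a :* b := s :* b :* a) refl (ι 16) ((1ℚ - x) ^ 2) (x ^ 2) ⟩
      ι 16 * x ^ 2 * (1ℚ - x) ^ 2                 ∎)
      where
      open ℚₚ.≤-Reasoning
      -- 16 (1 - x)² - (8 + 4x) = 3 + 5 (1 - 8x) + 4x + 16x²
      coefficient : ι 8 + ι 4 * x ≤ ι 16 * (1ℚ - x) ^ 2
      coefficient = ≤-diff {r = ι 3 + ι 5 * (1ℚ - ι 8 * x) + ι 4 * x + ι 16 * (x * x)}
        (+-nonNeg (+-nonNeg (+-nonNeg (0≤ι 3) (*-nonNeg (0≤ι 5) (p≤q⇒0≤q-p 8x≤1))) (*-nonNeg (0≤ι 4) 0≤x)) (*-nonNeg (0≤ι 16) (*-nonNeg 0≤x 0≤x)))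
        (trans (cong₂ _+_ (cong₂ (λ a b → a + b * x) (ιℤ-/1 (+ 8)) (ιℤ-/1 (+ 4)))
          (cong₂ _+_ (cong₂ _+_ (cong₂ _+_ (ιℤ-/1 (+ 3)) (cong₂ (λ a b → a * (1ℚ - b * x)) (ιℤ-/1 (+ 5)) (ιℤ-/1 (+ 8)))) (cong (_* x) (ιℤ-/1 (+ 4)))) (cong (_* (x * x)) (ιℤ-/1 (+ 16)))))
        (trans (solve 1 (λ x → (con (+ 8 / 1) :+ con (+ 4 / 1) :* x) :+ (con (+ 3 / 1) :+ con (+ 5 / 1) :* (con 1ℚ :- con (+ 8 / 1) :* x) :+ con (+ 4 / 1) :* x :+ con (+ 16 / 1) :* (x :* x))
          := con (+ 16 / 1) :* ((con 1ℚ :- x) :* ((con 1ℚ :- x) :* con 1ℚ))) refl x)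
        (cong (_* (1ℚ - x) ^ 2) (sym (ιℤ-/1 (+ 16))))))

  module Comparison (b K M : ℕ) .{{K≢0 : ℕ.NonZero K}} .{{M≢0 : ℕ.NonZero M}} (7≤b : 7 ℕ.≤ b)
    (es : List (ℕ × ℕ)) (f k : ℕ) where
    private
      B : ℕ
      B = suc b
      instance
        b≢0 : ℕ.NonZero b
        b≢0 = ℕ.>-nonZero (ℕₚ.≤-trans (ℕ.s≤s ℕ.z≤n) 7≤b)
    open Arithmetic B K

    -- The expansion of (1 - 4x)(1 + x)².
    eulerModel : TaylorModel
    eulerModel = + 1 ∷ᵀ -[1+ 1 ] ∷ᵀ -[1+ 6 ] ∷ᵀ -[1+ 3 ] ∷ᵀ shift k (end 0)

    -- The factor (1 - x)² clears the denominator of the Euler factor.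
    agreementOne agreementOther : Maybe ℕ
    agreementOne   = agreement (4 ℕ.+ k) (expand (3 ℕ.+ k) f ((⊕ , 1 , 2) ∷ factorsOne 0 es)) eulerModel
    agreementOther = agreement (4 ℕ.+ k) (expand (3 ℕ.+ k) f (factorsOther 0 es)) (constᵀ (+ 1) (3 ℕ.+ k))

    small : Maybe ℕ → Bool
    small (just C) = 4 ℕ.* C ℕ.* M ℕ.≤ᵇ K ℕ.* B ℕ.^ (2 ℕ.+ k)
    small nothing  = false

    small-sound : ∀ m → small m ≡ true → ∃[ C ] m ≡ just C × 4 ℕ.* C ℕ.* M ℕ.≤ K ℕ.* B ℕ.^ (2 ℕ.+ k)
    small-sound (just C) h = C , refl , ℕₚ.≤ᵇ⇒≤ (4 ℕ.* C ℕ.* M) (K ℕ.* B ℕ.^ (2 ℕ.+ k)) (subst T (sym h) tt)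

    module _ {C₁ C₂ : ℕ} (eq₁ : agreementOne ≡ just C₁) (eq₂ : agreementOther ≡ just C₂)
      (C₁≤ : 4 ℕ.* C₁ ℕ.* M ℕ.≤ K ℕ.* B ℕ.^ (2 ℕ.+ k)) (C₂≤ : 4 ℕ.* C₂ ℕ.* M ℕ.≤ K ℕ.* B ℕ.^ (2 ℕ.+ k)) where

      κ : ℚ
      κ = recip M

      module At (m : ℕ) (B≤p : B ℕ.≤ 2 ℕ.+ m) where
        p : ℕ
        p = 2 ℕ.+ m
        x : ℚ
        x = recip p
        open EulerFactorBounds m (ℕₚ.≤-trans (ℕ.s≤s 7≤b) B≤p)
        x≤1/B : x ≤ recip B
        x≤1/B = recip-antimono B≤p
        open Semantics x 0≤x x≤1/B
        open LocalFactors B K x 0≤x x≤1/B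

        c : ℚ
        c = 1ℚ + κ * x ^ 2

        κx²≤1 : κ * x ^ 2 ≤ 1ℚ
        κx²≤1 = *-mono {s = 1ℚ} (0≤recip M) (^-nonNeg 2 0≤x) (recip≤1 M) (^-≤1 2 0≤x (recip≤1 p))

        1≤c : 1ℚ ≤ c
        1≤c = ≤-diff (*-nonNeg (0≤recip M) (^-nonNeg 2 0≤x)) refl

        zero-sound : ∀ n → 0ℚ ⊨ shift n (end 0)
        zero-sound n = subst (_⊨ shift n (end 0)) (*-zeroʳ (x ^ n))
          (shift-sound n (end 0) (≤-reflexive (trans (*-zeroˡ (ι K)) (sym ι0))))

        eulerModel-sound : (1ℚ - ι 4 * x) * (1ℚ + x) ^ 2 ⊨ eulerModel
        eulerModel-sound = _ , expansion , _ , refl , _ , refl , 0ℚ , refl , zero-sound k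
          where
          y : ℚ
          y = ιℤ -[1+ 1 ] + x * (ιℤ -[1+ 6 ] + x * (ιℤ -[1+ 3 ] + x * 0ℚ))
          expansion : (1ℚ - ι 4 * x) * (1ℚ + x) ^ 2 ≡ ι 1 + x * y
          expansion = trans (cong (λ f → (1ℚ - f * x) * (1ℚ + x) ^ 2) (ιℤ-/1 (+ 4))) (trans
            (solve 1 (λ x → (con 1ℚ :- con (+ 4 / 1) :* x) :* ((con 1ℚ :+ x) :* ((con 1ℚ :+ x) :* con 1ℚ))
               := con 1ℚ :+ x :* (con (-[1+ 1 ] / 1) :+ x :* (con (-[1+ 6 ] / 1) :+ x :* (con (-[1+ 3 ] / 1) :+ x :* con 0ℚ)))) refl x)
            (sym (cong₂ (λ a z → a + x * z) ι1 (cong₂ (λ a z → a + x * z) (ιℤ-/1 -[1+ 1 ])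
              (cong₂ (λ a z → a + x * z) (ιℤ-/1 -[1+ 6 ]) (cong (λ a → a + x * 0ℚ) (ιℤ-/1 -[1+ 3 ])))))))

        compareOne : values (factorsOne 0 es) ≍[ c ] eulerFactor p
        compareOne = ≍-cancelˡ ((1ℚ - x) ^ 2) 0<[1-x]² (subst₂ (λ u v → u ≍[ c ] v) [1-x]² (sym (eulerFactor-x m))
          (near⇒≍′ 2≤4v κx²≤1 (remainder-≤ B K M C₁ (2 ℕ.+ k) C₁≤ 0≤x x≤1/B ∣ values fs - (1ℚ - ι 4 * x) * (1ℚ + x) ^ 2 ∣
            (agreement-sound (4 ℕ.+ k) (expand (3 ℕ.+ k) f fs) eulerModel (expand-sound (3 ℕ.+ k) f fs) eulerModel-sound eq₁))))
          where
          fs : Factors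
          fs = (⊕ , 1 , 2) ∷ factorsOne 0 es
          [1-x]² : values fs ≡ (1ℚ - x) ^ 2 * values (factorsOne 0 es)
          [1-x]² = cong (λ z → (1ℚ - z) ^ 2 * values (factorsOne 0 es)) (trans (*-identityˡ (x * 1ℚ)) (*-identityʳ x))

        compareOther : values (factorsOther 0 es) ≍[ c ] 1ℚ
        compareOther = near⇒≍′ (nonNegative⁻¹ (1ℚ + 1ℚ) ⟨≤⟩) κx²≤1 (remainder-≤ B K M C₂ (2 ℕ.+ k) C₂≤ 0≤x x≤1/B ∣ values (factorsOther 0 es) - 1ℚ ∣
          (agreement-sound (4 ℕ.+ k) (expand (3 ℕ.+ k) f (factorsOther 0 es)) (constᵀ (+ 1) (3 ℕ.+ k))
            (expand-sound (3 ℕ.+ k) f (factorsOther 0 es)) (subst (_⊨ constᵀ (+ 1) (3 ℕ.+ k)) ι1 (const-sound (+ 1) (3 ℕ.+ k))) eq₂))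
          where
          _⟨≤⟩ : 0ℚ ≤ 1ℚ + 1ℚ → 1ℚ + 1ℚ ≤ 4ℚ * 1ℚ
          h ⟨≤⟩ = ≤-diff h refl

        comparePrime : Prime p → weighted (λ i s → 1ℚ - term i (2 ℕ.+ s) p) es 0 ≍[ c ] restrictedFactor p
        comparePrime prime-p with oddResidue prime-p (ℕₚ.≤-trans (ℕ.s≤s (ℕ.s≤s (ℕ.s≤s ℕ.z≤n))) (ℕₚ.≤-trans (ℕ.s≤s 7≤b) B≤p))
        ... | inj₁ r≡1 = subst₂ (λ u v → u ≍[ c ] v)
          (trans (sym (local-one es 0)) (weighted-cong es 0 (λ i s → cong (λ r → value (sgn i r) (2 ℕ.+ s)) (sym r≡1))))
          (sym (onlyIf-yes (prime≡1[8]? p) (eulerFactor p) (prime-p , r≡1))) compareOne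
        ... | inj₂ (inj₁ r≡3) = subst₂ (λ u v → u ≍[ c ] v)
          (trans (sym (local-three es 0)) (weighted-cong es 0 (λ i s → cong (λ r → value (sgn i r) (2 ℕ.+ s)) (sym r≡3))))
          (sym (onlyIf-no (prime≡1[8]? p) (eulerFactor p) λ (_ , r≡1) → contradiction (trans (sym r≡3) r≡1) λ ())) compareOther
        ... | inj₂ (inj₂ (inj₁ r≡5)) = subst₂ (λ u v → u ≍[ c ] v)
          (trans (sym (local-five es 0)) (weighted-cong es 0 (λ i s → cong (λ r → value (sgn i r) (2 ℕ.+ s)) (sym r≡5))))
          (sym (onlyIf-no (prime≡1[8]? p) (eulerFactor p) λ (_ , r≡1) → contradiction (trans (sym r≡5) r≡1) λ ())) compareOther
        ... | inj₂ (inj₂ (inj₂ r≡7)) = subst₂ (λ u v → u ≍[ c ] v)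
          (trans (sym (local-seven es 0)) (weighted-cong es 0 (λ i s → cong (λ r → value (sgn i r) (2 ℕ.+ s)) (sym r≡7))))
          (sym (onlyIf-no (prime≡1[8]? p) (eulerFactor p) λ (_ , r≡1) → contradiction (trans (sym r≡7) r≡1) λ ())) compareOther

        compare : weighted (λ i s → L.factor i s p) es 0 ≍[ c ] restrictedFactor p
        compare = go (prime? p)
          where
          go : Dec (Prime p) → weighted (λ i s → L.factor i s p) es 0 ≍[ c ] restrictedFactor p
          go (yes prime-p) = subst (λ u → u ≍[ c ] restrictedFactor p)
            (weighted-cong es 0 (λ i s → sym (L.factor-prime i s prime-p))) (comparePrime prime-p)
          go (no ¬prime-p) = subst₂ (λ u v → u ≍[ c ] v)
            (sym (trans (weighted-cong es 0 (λ i s → L.factor-composite i s ¬prime-p)) (weighted-1 es 0)))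
            (sym (onlyIf-no (prime≡1[8]? p) (eulerFactor p) λ (prime-p , _) → ¬prime-p prime-p)) (≍-refl 0≤1 1≤c)

        0≤restrictedFactor : 0ℚ ≤ restrictedFactor p
        0≤restrictedFactor = go (prime≡1[8]? p)
          where
          go : (p? : Dec (Prime≡1[8] p)) → 0ℚ ≤ onlyIf p? (eulerFactor p)
          go (yes _) = 0≤eulerFactor
          go (no _)  = 0≤1

      comparison : ∀ N → weighted (λ i s → Π (λ j → L.factor i s (B ℕ.+ j)) N) es 0
                         ≍[ 1ℚ + κ * recip b ] Π (λ j → restrictedFactor (B ℕ.+ j)) N
      comparison N = subst (λ u → u ≍[ 1ℚ + κ * recip b ] Π (λ j → restrictedFactor (B ℕ.+ j)) N)
        (sym (weighted-Π (λ i s j → L.factor i s (B ℕ.+ j)) N es 0))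
        (Π-≍ κ (0≤recip M) (recip≤1 M) b N
          (λ j → weighted-nonNeg es 0 (λ i s → 0≤factor i s (B ℕ.+ j)))
          (λ j → at {λ p → 0ℚ ≤ restrictedFactor p} j 0≤restrictedFactor-at)
          (λ j → at {λ p → weighted (λ i s → L.factor i s p) es 0 ≍[ 1ℚ + κ * recip p ^ 2 ] restrictedFactor p} j compare-at))
        where
        -- Brings B + j into the form 2 + m, on which `eulerFactor` computes.
        at : ∀ {Q : ℕ → Set} j → (∀ m → B ℕ.≤ 2 ℕ.+ m → Q (2 ℕ.+ m)) → Q (B ℕ.+ j)
        at {Q} j h = subst Q (ℕₚ.m+[n∸m]≡n 2≤B+j) (h (B ℕ.+ j ℕ.∸ 2) (subst (B ℕ.≤_) (sym (ℕₚ.m+[n∸m]≡n 2≤B+j)) (ℕₚ.m≤m+n B j)))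
          where
          2≤B+j : 2 ℕ.≤ B ℕ.+ j
          2≤B+j = ℕₚ.≤-trans (ℕ.s≤s (ℕₚ.≤-trans (ℕ.s≤s ℕ.z≤n) 7≤b)) (ℕₚ.m≤m+n B j)
        0≤restrictedFactor-at : ∀ m → B ℕ.≤ 2 ℕ.+ m → 0ℚ ≤ restrictedFactor (2 ℕ.+ m)
        0≤restrictedFactor-at m B≤p = At.0≤restrictedFactor m B≤p
        compare-at : ∀ m → B ℕ.≤ 2 ℕ.+ m → weighted (λ i s → L.factor i s (2 ℕ.+ m)) es 0 ≍[ 1ℚ + κ * recip (2 ℕ.+ m) ^ 2 ] restrictedFactor (2 ℕ.+ m)
        compare-at m B≤p = At.compare m B≤p

-- One enclosure for all late partial products.

module PartialProductEnclosure where
  open import Data.Bool using (Bool; true; false; T; _∧_)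
  open import Data.Integer as ℤ using (+_)
  open ℚ
  open Rationals
  open Intervals
  open Sieves
  open Characters
  open LValues
  open TaylorModels
  open LocalComparison
  open Real using (eulerFactor; Prime≡1[8]; prime≡1[8]?; partialProduct)

  foldr-++ : ∀ xs ys → foldr _*_ 1ℚ (xs ++ ys) ≡ foldr _*_ 1ℚ xs * foldr _*_ 1ℚ ys
  foldr-++ []       ys = sym (*-identityˡ (foldr _*_ 1ℚ ys))
  foldr-++ (x ∷ xs) ys = trans (cong (x *_) (foldr-++ xs ys)) (sym (*-assoc x (foldr _*_ 1ℚ xs) (foldr _*_ 1ℚ ys)))

  partialProduct-Π : ∀ n → partialProduct n ≡ Π restrictedFactor n
  partialProduct-Π zero    = refl
  partialProduct-Π (suc n) = begin
    prod (filter prime≡1[8]? (upTo (suc n)))                          ≡⟨ cong (λ ns → prod (filter prime≡1[8]? ns)) (Listₚ.upTo-∷ʳ n) ⟨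
    prod (filter prime≡1[8]? (upTo n ++ (n ∷ [])))                       ≡⟨ cong prod (Listₚ.filter-++ prime≡1[8]? (upTo n) (n ∷ [])) ⟩
    prod (filter prime≡1[8]? (upTo n) ++ filter prime≡1[8]? (n ∷ []))    ≡⟨ cong (foldr _*_ 1ℚ) (Listₚ.map-++ eulerFactor (filter prime≡1[8]? (upTo n)) (filter prime≡1[8]? (n ∷ []))) ⟩
    foldr _*_ 1ℚ (map eulerFactor (filter prime≡1[8]? (upTo n)) ++ map eulerFactor (filter prime≡1[8]? (n ∷ []))) ≡⟨ foldr-++ (map eulerFactor (filter prime≡1[8]? (upTo n))) _ ⟩
    partialProduct n * prod (filter prime≡1[8]? (n ∷ []))                ≡⟨ cong₂ _*_ (partialProduct-Π n) singleton ⟩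
    Π restrictedFactor n * restrictedFactor n                         ∎
    where
    open ≡-Reasoning
    prod : List ℕ → ℚ
    prod ns = foldr _*_ 1ℚ (map eulerFactor ns)
    singleton : prod (filter prime≡1[8]? (n ∷ [])) ≡ restrictedFactor n
    singleton = go (prime≡1[8]? n)
      where
      go : (n? : Dec (Prime≡1[8] n)) → prod (filter prime≡1[8]? (n ∷ [])) ≡ onlyIf n? (eulerFactor n)
      go (yes h) = trans (cong prod (Listₚ.filter-accept prime≡1[8]? h)) (*-identityʳ (eulerFactor n))
      go (no ¬h) = cong prod (Listₚ.filter-reject prime≡1[8]? ¬h)

  -- With p = 4 + t, numerator and denominator are natural numbers, as `scale` requires.
  eulerFactor-fraction : ∀ t → eulerFactor (4 ℕ.+ t) ≡ ι (t ℕ.* (5 ℕ.+ t) ℕ.^ 2) * recip ((4 ℕ.+ t) ℕ.* (3 ℕ.+ t) ℕ.^ 2)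
  eulerFactor-fraction t = begin
    (1ℚ - + 4 / p) * (r * r)                               ≡⟨ cong₂ (λ a b → a * (b * b)) 1-4/p (z/n (+ suc p) (3 ℕ.+ t)) ⟩
    ι t * recip p * (ι (suc p) * s * (ι (suc p) * s))      ≡⟨ solve 4 (λ t x a s → t :* x :* (a :* s :* (a :* s)) := t :* (a :* (a :* con 1ℚ)) :* (x :* (s :* (s :* con 1ℚ)))) refl (ι t) (recip p) (ι (suc p)) s ⟩
    ι t * ι (suc p) ^ 2 * (recip p * s ^ 2)                ≡⟨ cong₂ _*_ (trans (ι-* t (suc p ℕ.^ 2)) (cong (ι t *_) (ι-^ (suc p) 2))) (trans (recip-* p ((3 ℕ.+ t) ℕ.^ 2)) (cong (recip p *_) (recip-^ (3 ℕ.+ t) 2))) ⟨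
    ι (t ℕ.* suc p ℕ.^ 2) * recip (p ℕ.* (3 ℕ.+ t) ℕ.^ 2)  ∎
    where
    open ≡-Reasoning
    p : ℕ
    p = 4 ℕ.+ t
    r s : ℚ
    r = + suc p / (3 ℕ.+ t)
    s = recip (3 ℕ.+ t)
    1-4/p : 1ℚ - + 4 / p ≡ ι t * recip p
    1-4/p = trans (cong₂ _-_ (sym (ι*recip p)) (z/n (+ 4) p)) (trans (cong (λ z → z * recip p - ι 4 * recip p) (ι-+ 4 t))
      (solve 3 (λ f t x → (f :+ t) :* x :- f :* x := t :* x) refl (ι 4) (ι t) (recip p)))

  scaleIf : ∀ {ℓ} {A : Set ℓ} → Dec A → ℕ → Interval → Interval
  scaleIf (yes _) p I = scale ((p ∸ 4) ℕ.* suc p ℕ.^ 2) (p ℕ.* (p ∸ 1) ℕ.^ 2) I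
  scaleIf (no _)  p I = I

  module InitialProduct (D : ℕ) .{{D≢0 : ℕ.NonZero D}} where
    open FixedPoint D

    initialProduct : ℕ → Interval
    initialProduct zero    = one
    initialProduct (suc n) = scaleIf (prime≡1[8]? n) n (initialProduct n)

    scaleIf-sound : ∀ {q} p (p? : Dec (Prime≡1[8] p)) I → q ∈ I → q * onlyIf p? (eulerFactor p) ∈ scaleIf p? p I
    scaleIf-sound {q} p (no _) I q∈I = ∈-subst (sym (*-identityʳ q)) q∈I
    scaleIf-sound 0 (yes (prime-0 , _)) I q∈I = contradiction prime-0 ¬prime[0]
    scaleIf-sound 1 (yes (prime-1 , _)) I q∈I = contradiction prime-1 ¬prime[1]
    scaleIf-sound 2 (yes (_ , ())) I q∈I
    scaleIf-sound 3 (yes (_ , ())) I q∈I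
    scaleIf-sound {q} p@(suc (suc (suc (suc t)))) (yes _) I q∈I = ∈-subst (cong (q *_) (sym (eulerFactor-fraction t)))
      (∈-scale I (t ℕ.* suc p ℕ.^ 2) (p ℕ.* (3 ℕ.+ t) ℕ.^ 2) {{ℕₚ.m*n≢0 p ((3 ℕ.+ t) ℕ.^ 2) {{_}} {{ℕₚ.m^n≢0 (3 ℕ.+ t) 2}}}} q∈I)

    initialProduct-sound : ∀ n → Π restrictedFactor n ∈ initialProduct n
    initialProduct-sound zero    = ∈-one
    initialProduct-sound (suc n) = scaleIf-sound n (prime≡1[8]? n) (initialProduct n) (initialProduct-sound n)

  near-1 : ∀ D .{{_ : ℕ.NonZero D}} n M e {y} → 2 ℕ.* (D ℕ.* D) ℕ.≤ n → 2 ℕ.^ e ℕ.* (2 ℕ.* (D ℕ.* D)) ℕ.≤ M →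
           y ≤ recip n + ι 2 ^ e * recip M → y * (ι D * ι D) ≤ 1ℚ
  near-1 D@(suc _) n M e {y} hn hM h = begin
    y * (ι D * ι D)                                   ≡⟨ cong (y *_) (ι-* D D) ⟨
    y * ι X                                           ≤⟨ *-monoʳ (ι X) (0≤ι X) (≤-trans h (+-mono-≤ (recip-antimono hn) second)) ⟩
    (recip (2 ℕ.* X) + recip (2 ℕ.* X)) * ι X         ≡⟨ solve 2 (λ r x → (r :+ r) :* x := r :* ((con 1ℚ :+ con 1ℚ) :* x)) refl (recip (2 ℕ.* X)) (ι X) ⟩
    recip (2 ℕ.* X) * ((1ℚ + 1ℚ) * ι X)               ≡⟨ cong (λ z → recip (2 ℕ.* X) * (z * ι X)) ι2 ⟨
    recip (2 ℕ.* X) * (ι 2 * ι X)                     ≡⟨ cong (recip (2 ℕ.* X) *_) (ι-* 2 X) ⟨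
    recip (2 ℕ.* X) * ι (2 ℕ.* X)                     ≡⟨ recip*ι (2 ℕ.* X) ⟩
    1ℚ                                                ∎
    where
    open ℚₚ.≤-Reasoning
    X : ℕ
    X = D ℕ.* D
    instance
      2^e≢0 : ℕ.NonZero (2 ℕ.^ e)
      2^e≢0 = ℕₚ.m^n≢0 2 e
    second : ι 2 ^ e * recip M ≤ recip (2 ℕ.* X)
    second = begin
      ι 2 ^ e * recip M                                 ≡⟨ cong (_* recip M) (ι-^ 2 e) ⟨
      ι (2 ℕ.^ e) * recip M                             ≤⟨ *-monoˡ (ι (2 ℕ.^ e)) (0≤ι (2 ℕ.^ e)) (recip-antimono {{ℕₚ.m*n≢0 (2 ℕ.^ e) (2 ℕ.* X)}} hM) ⟩
      ι (2 ℕ.^ e) * recip (2 ℕ.^ e ℕ.* (2 ℕ.* X))       ≡⟨ cong (ι (2 ℕ.^ e) *_) (recip-* (2 ℕ.^ e) (2 ℕ.* X)) ⟩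
      ι (2 ℕ.^ e) * (recip (2 ℕ.^ e) * recip (2 ℕ.* X)) ≡⟨ *-assoc (ι (2 ℕ.^ e)) (recip (2 ℕ.^ e)) (recip (2 ℕ.* X)) ⟨
      ι (2 ℕ.^ e) * recip (2 ℕ.^ e) * recip (2 ℕ.* X)   ≡⟨ cong (_* recip (2 ℕ.* X)) (ι*recip (2 ℕ.^ e)) ⟩
      1ℚ * recip (2 ℕ.* X)                              ≡⟨ *-identityˡ (recip (2 ℕ.* X)) ⟩
      recip (2 ℕ.* X)                                   ∎

  module PartialProducts (D b k₀ J K M f k : ℕ) .{{D≢0 : ℕ.NonZero D}} .{{K≢0 : ℕ.NonZero K}} .{{M≢0 : ℕ.NonZero M}}
    (7≤b : 7 ℕ.≤ b) (es : List (ℕ × ℕ)) where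
    private
      B : ℕ
      B = suc b
    open FixedPoint D
    open InitialProduct D
    open LKernel D k₀ J B
    open Comparison b K M 7≤b es f k

    -- Allows for a relative error 1/M in both directions, which exceeds the (1/M)(1/b) left by the
    -- local comparison.
    widen : Interval → Interval
    widen (l ‥ h) = (l ℕ.* M div suc M) ‥ suc (h ℕ.* suc M div M)

    widen-sound : ∀ {u v} I → 0ℚ ≤ u → 0ℚ ≤ v → u ≍[ 1ℚ + recip M * recip b ] v → u ∈ I → v ∈ widen I
    widen-sound {u} {v} (l ‥ h) 0≤u 0≤v (u≤cv , v≤cu) (lu , uh) = lower , upper
      where
      open ℚₚ.≤-Reasoning
      w : ℚ
      w = ι (suc M) * recip M
      c≤w : 1ℚ + recip M * recip b ≤ w
      c≤w = begin
        1ℚ + recip M * recip b             ≤⟨ +-monoʳ-≤ 1ℚ (subst (recip M * recip b ≤_) (*-identityʳ (recip M)) (*-monoˡ (recip M) (0≤recip M) (recip≤1 b))) ⟩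
        1ℚ + recip M                       ≡⟨ cong (_+ recip M) (ι*recip M) ⟨
        ι M * recip M + recip M            ≡⟨ solve 2 (λ m r → m :* r :+ r := (con 1ℚ :+ m) :* r) refl (ι M) (recip M) ⟩
        (1ℚ + ι M) * recip M               ≡⟨ cong (_* recip M) (ι-suc M) ⟨
        w                                  ∎
      upper : v * ι D ≤ ι (suc (h ℕ.* suc M div M))
      upper = begin
        v * ι D                            ≤⟨ *-monoʳ (ι D) (0≤ι D) (≤-trans v≤cu (*-monoʳ u 0≤u c≤w)) ⟩
        w * u * ι D                        ≡⟨ cong (_* ι D) (*-comm w u) ⟩
        u * w * ι D                        ≤⟨ ≤-scale {u} h (suc M) M uh ⟩
        ι (suc (h ℕ.* suc M div M))        ∎
      lower : ι (l ℕ.* M div suc M) ≤ v * ι D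
      lower = begin
        ι (l ℕ.* M div suc M)              ≤⟨ scale-≤ {u} l M (suc M) lu ⟩
        u * (ι M * recip (suc M)) * ι D    ≤⟨ *-monoʳ (ι D) (0≤ι D) (*-monoʳ (ι M * recip (suc M)) (*-nonNeg (0≤ι M) (0≤recip (suc M))) (≤-trans u≤cv (*-monoʳ v 0≤v c≤w))) ⟩
        w * v * (ι M * recip (suc M)) * ι D ≡⟨ solve 6 (λ a b v c d e → a :* b :* v :* (c :* d) :* e := v :* ((a :* d) :* (c :* b)) :* e) refl (ι (suc M)) (recip M) v (ι M) (recip (suc M)) (ι D) ⟩
        v * (ι (suc M) * recip (suc M) * (ι M * recip M)) * ι D ≡⟨ cong₂ (λ a b → v * (a * b) * ι D) (ι*recip (suc M)) (ι*recip M) ⟩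
        v * (1ℚ * 1ℚ) * ι D                ≡⟨ solve 2 (λ v d → v :* (con 1ℚ :* con 1ℚ) :* d := v :* d) refl v (ι D) ⟩
        v * ι D                            ∎

    enclosure : Maybe Interval → Maybe Interval
    enclosure (just W) = just (widen (W *ᴵ initialProduct B))
    enclosure nothing  = nothing

    module _ {C₁ C₂ : ℕ} (eq₁ : agreementOne ≡ just C₁) (eq₂ : agreementOther ≡ just C₂)
      (C₁≤ : 4 ℕ.* C₁ ℕ.* M ℕ.≤ K ℕ.* B ℕ.^ (2 ℕ.+ k)) (C₂≤ : 4 ℕ.* C₂ ℕ.* M ℕ.≤ K ℕ.* B ℕ.^ (2 ℕ.+ k)) where

      partialProduct-∈ : ∀ {I} → enclosure (kernel es) ≡ just I →
                         ∀ N → 2 ℕ.* (D ℕ.* D) ℕ.≤ N → partialProduct (B ℕ.+ N) ∈ I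
      partialProduct-∈ {I} eq N X≤N = go (kernel es) refl eq
        where
        q : Char → ℕ → ℚ
        q i s = Π (λ j → L.factor i s (B ℕ.+ j)) N
        e n k₁ : ℕ
        n = b ℕ.+ N
        e = suc (suc n)
        -- Long enough for the sieve error 2ᵉ/M to be at most 1/(2D²). As e > N ≥ 2D², this number
        -- can only be reasoned about, never evaluated.
        k₁ = 2 ℕ.^ e ℕ.* (2 ℕ.* (D ℕ.* D))
        k₁≤M : k₁ ℕ.≤ 7 ℕ.+ 8 ℕ.* (k₀ ℕ.+ k₁)
        k₁≤M = ℕₚ.≤-trans (ℕₚ.m≤n+m k₁ k₀) (ℕₚ.≤-trans (ℕₚ.m≤m+n (k₀ ℕ.+ k₁) _) (ℕₚ.m≤n+m (8 ℕ.* (k₀ ℕ.+ k₁)) 7))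
        D≤k₁ : D ℕ.≤ k₁
        D≤k₁ = ℕₚ.≤-trans (ℕₚ.m≤m*n D D) (ℕₚ.≤-trans (ℕₚ.m≤m+n (D ℕ.* D) _) (ℕₚ.m≤n*m (2 ℕ.* (D ℕ.* D)) (2 ℕ.^ e) {{ℕₚ.m^n≢0 2 e}}))
        n≤k₁ : n ℕ.≤ k₁
        n≤k₁ = ℕₚ.≤-trans (ℕₚ.≤-trans (ℕₚ.m≤n+m n 2) (n≤2^n e)) (ℕₚ.m≤m*n (2 ℕ.^ e) (2 ℕ.* (D ℕ.* D)) {{ℕₚ.m*n≢0 2 (D ℕ.* D) {{_}} {{ℕₚ.m*n≢0 D D}}}})
        near : ∀ i s → ∣ q i s * (Π (L.factor i s) B * Σ (term i (2 ℕ.+ s)) (8 ℕ.* (k₀ ℕ.+ suc k₁))) - 1ℚ ∣ * (ι D * ι D) ≤ 1ℚ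
        -- `euler` sums over m < M + 1, and M = 7 + 8 (k₀ + k₁) makes these k₀ + k₁ + 1 full
        -- periods.
        near i s = near-1 D n (7 ℕ.+ 8 ℕ.* (k₀ ℕ.+ k₁)) e (ℕₚ.≤-trans X≤N (ℕₚ.m≤n+m N b)) k₁≤M
          (subst (λ z → ∣ z - 1ℚ ∣ ≤ recip n + ι 2 ^ e * recip (7 ℕ.+ 8 ℕ.* (k₀ ℕ.+ k₁))) eq-product
            (L.euler i s n {{ℕ.>-nonZero (ℕₚ.≤-trans (ℕ.s≤s ℕ.z≤n) (ℕₚ.≤-trans 7≤b (ℕₚ.m≤m+n b N)))}} (7 ℕ.+ 8 ℕ.* (k₀ ℕ.+ k₁)) (ℕₚ.≤-trans n≤k₁ k₁≤M)))
          where
          open ≡-Reasoning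
          S : ℕ → ℚ
          S = Σ (term i (2 ℕ.+ s))
          eq-product : Π (L.factor i s) (suc n) * S (8 ℕ.+ 8 ℕ.* (k₀ ℕ.+ k₁)) ≡ q i s * (Π (L.factor i s) B * S (8 ℕ.* (k₀ ℕ.+ suc k₁)))
          eq-product = trans (cong₂ _*_ (Π-split (L.factor i s) B N)
              (cong S (sym (trans (cong (8 ℕ.*_) (ℕₚ.+-suc k₀ k₁)) (ℕₚ.*-suc 8 (k₀ ℕ.+ k₁))))))
            (solve 3 (λ p q s → p :* q :* s := q :* (p :* s)) refl (Π (L.factor i s) B) (q i s) (S (8 ℕ.* (k₀ ℕ.+ suc k₁))))
        0≤q : ∀ i s → 0ℚ ≤ q i s
        0≤q i s = Π-nonNeg N (λ j → 0≤factor i s (B ℕ.+ j))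
        w v u : ℚ
        w = weighted q es 0
        v = Π (λ j → restrictedFactor (B ℕ.+ j)) N
        u = Π restrictedFactor B
        0≤w : 0ℚ ≤ w
        0≤w = weighted-nonNeg es 0 0≤q
        0≤c : 0ℚ ≤ 1ℚ + recip M * recip b
        0≤c = 0≤1+κ* (recip M) (0≤recip M) (recip≤1 M) (0≤recip b)
        w≍v : w ≍[ 1ℚ + recip M * recip b ] v
        w≍v = comparison eq₁ eq₂ C₁≤ C₂≤ N
        0≤v : 0ℚ ≤ v
        0≤v = *-cancelʳ (1ℚ + recip M * recip b) 0<c (subst₂ _≤_ (sym (*-zeroˡ (1ℚ + recip M * recip b))) (*-comm (1ℚ + recip M * recip b) v) (≤-trans 0≤w (left w≍v)))
          where
          0<c : 0ℚ < 1ℚ + recip M * recip b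
          0<c = <-≤-trans (positive⁻¹ 1ℚ) (≤-diff (*-nonNeg (0≤recip M) (0≤recip b)) refl)
        0≤u : 0ℚ ≤ u
        0≤u = ∈⇒0≤ (initialProduct B) (initialProduct-sound B)
        wu≍vu : w * u ≍[ 1ℚ + recip M * recip b ] v * u
        wu≍vu = subst (λ c → w * u ≍[ c ] v * u) (*-identityʳ (1ℚ + recip M * recip b))
          (≍-* 0≤w 0≤v 0≤u 0≤u w≍v (≍-refl 0≤u ≤-refl))
        vu≡ : v * u ≡ partialProduct (B ℕ.+ N)
        vu≡ = sym (trans (partialProduct-Π (B ℕ.+ N)) (trans (Π-split restrictedFactor B N) (*-comm u v)))
        go : ∀ W → kernel es ≡ W → enclosure W ≡ just I → partialProduct (B ℕ.+ N) ∈ I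
        go (just W) eqW refl = ∈-subst vu≡ (widen-sound (W *ᴵ initialProduct B) (*-nonNeg 0≤w 0≤u) (*-nonNeg 0≤v 0≤u) wu≍vu
          (∈-* W (initialProduct B)
            (Soundness.kernel-sound (suc k₁) (ℕₚ.m≤n⇒m≤1+n D≤k₁) q 0≤q near es eqW) (initialProduct-sound B)))

    within : ℕ → ℕ → Maybe Interval → Bool
    within l h (just (a ‥ b)) = (l ℕ.≤ᵇ a) ∧ (b ℕ.≤ᵇ h)
    within l h nothing        = false

    within-sound : ∀ l h m → within l h m ≡ true → ∃[ I ] m ≡ just I × (∀ {q} → q ∈ I → q ∈ (l ‥ h))
    within-sound l h (just (a ‥ b)) eq with l ℕ.≤ᵇ a in l≤a | b ℕ.≤ᵇ h in b≤h
    ... | true | true = a ‥ b , refl , λ (lower , upper) →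
      ≤-trans (ι-mono-≤ (ℕₚ.≤ᵇ⇒≤ l a (subst T (sym l≤a) tt))) lower ,
      ≤-trans upper (ι-mono-≤ (ℕₚ.≤ᵇ⇒≤ b h (subst T (sym b≤h) tt)))

    -- All numerical input is gathered in three Boolean equations, which hold by evaluation for
    -- concrete parameters.
    partialProduct-within : ∀ l h → small agreementOne ≡ true → small agreementOther ≡ true →
      within l h (enclosure (kernel es)) ≡ true → ∀ N → 2 ℕ.* (D ℕ.* D) ℕ.≤ N → partialProduct (B ℕ.+ N) ∈ (l ‥ h)
    partialProduct-within l h small₁ small₂ w N X≤N =
      let C₁ , eq₁ , C₁≤ = small-sound agreementOne small₁
          C₂ , eq₂ , C₂≤ = small-sound agreementOther small₂
          I , eq , I⊆lh = within-sound l h (enclosure (kernel es)) w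
      in I⊆lh (partialProduct-∈ eq₁ eq₂ C₁≤ C₂≤ eq N X≤N)

-- Partial sums of the cosine and exponential series at rational points.

module CosExpSeries where
  open ℚ
  open Rationals
  open Intervals
  open Sieves using (Σ-head; Σ-cong-<)

  sign : ℕ → ℚ
  sign n = (- 1ℚ) ^ n

  alternating : (ℕ → ℚ) → ℕ → ℚ
  alternating d = Σ (λ j → sign j * d j)

  alternating-suc : ∀ d n → alternating d (suc n) ≡ d 0 - alternating (d ∘ suc) n
  alternating-suc d n = begin
    alternating d (suc n)                                ≡⟨ Σ-head (λ j → sign j * d j) n ⟩
    1ℚ * d 0 + Σ (λ j → - 1ℚ * sign j * d (suc j)) n     ≡⟨ cong (λ z → 1ℚ * d 0 + z) (trans (Σ-cong n (λ j → *-assoc (- 1ℚ) (sign j) (d (suc j)))) (Σ-*ˡ (- 1ℚ) (λ j → sign j * d (suc j)) n)) ⟩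
    1ℚ * d 0 + - 1ℚ * alternating (d ∘ suc) n            ≡⟨ solve 2 (λ x y → con 1ℚ :* x :+ con (- 1ℚ) :* y := x :- y) refl (d 0) (alternating (d ∘ suc) n) ⟩
    d 0 - alternating (d ∘ suc) n                        ∎
    where open ≡-Reasoning

  -- Leibniz: the sum is `d 0` minus an alternating sum that itself lies between 0 and `d 1`.
  alternating-bounds : ∀ d n → (∀ j → 0ℚ ≤ d j) → (∀ j → d (suc j) ≤ d j) → 0ℚ ≤ alternating d n × alternating d n ≤ d 0
  alternating-bounds d zero    0≤d anti = ≤-refl , 0≤d 0
  alternating-bounds d (suc n) 0≤d anti with alternating-bounds (d ∘ suc) n (0≤d ∘ suc) (anti ∘ suc)
  ... | 0≤a , a≤d₁ =
    subst (0ℚ ≤_) (sym (alternating-suc d n)) (p≤q⇒0≤q-p (≤-trans a≤d₁ (anti 0))) ,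
    subst (_≤ d 0) (sym (alternating-suc d n)) (≤-diff 0≤a (solve 2 (λ x a → x :- a :+ a := x) refl (d 0) (alternating (d ∘ suc) n)))

  sign-+ : ∀ m n → sign (m ℕ.+ n) ≡ sign m * sign n
  sign-+ = ^-homo-* (- 1ℚ)

  sign-2* : ∀ n → sign (2 ℕ.* n) ≡ 1ℚ
  sign-2* n = trans (cong sign (cong (n ℕ.+_) (ℕₚ.+-identityʳ n))) (trans (sign-+ n n) (go n))
    where
    go : ∀ n → sign n * sign n ≡ 1ℚ
    go zero    = refl
    go (suc n) = trans (solve 1 (λ s → con (- 1ℚ) :* s :* (con (- 1ℚ) :* s) := s :* s) refl (sign n)) (go n)

  alternating-split : ∀ d m n → alternating d (m ℕ.+ n) ≡ alternating d m + sign m * alternating (λ j → d (m ℕ.+ j)) n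
  alternating-split d m n = trans (Σ-split (λ j → sign j * d j) m n) (cong (λ z → alternating d m + z)
    (trans (Σ-cong n (λ j → trans (cong (_* d (m ℕ.+ j)) (sign-+ m j)) (*-assoc (sign m) (sign j) (d (m ℕ.+ j)))))
      (Σ-*ˡ (sign m) (λ j → sign j * d (m ℕ.+ j)) n)))

  -- cosSum u n is the n-th partial sum of the series of cos √u.
  cosCoefficient : ℕ → ℚ
  cosCoefficient j = recip ((2 ℕ.* j) !)

  cosTerm : ℚ → ℕ → ℚ
  cosTerm u j = u ^ j * cosCoefficient j

  cosSum : ℚ → ℕ → ℚ
  cosSum u = alternating (cosTerm u)

  cosDenominator : ℕ → ℕ
  cosDenominator j = suc (suc (2 ℕ.* j)) ℕ.* suc (2 ℕ.* j)

  cosCoefficient-suc : ∀ j → cosCoefficient (suc j) ≡ cosCoefficient j * recip (cosDenominator j)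
  cosCoefficient-suc j = begin
    recip ((2 ℕ.* suc j) !)                            ≡⟨ cong (λ n → recip (n !)) (ℕₚ.*-suc 2 j) ⟩
    recip (suc (suc n) ℕ.* (suc n ℕ.* n !))            ≡⟨ cong recip (ℕₚ.*-assoc (suc (suc n)) (suc n) (n !)) ⟨
    recip (cosDenominator j ℕ.* n !)                   ≡⟨ recip-* (cosDenominator j) (n !) ⟩
    recip (cosDenominator j) * recip (n !)             ≡⟨ *-comm (recip (cosDenominator j)) (recip (n !)) ⟩
    recip (n !) * recip (cosDenominator j)             ∎
    where
    open ≡-Reasoning
    n = 2 ℕ.* j

  0≤cosCoefficient : ∀ j → 0ℚ ≤ cosCoefficient j
  0≤cosCoefficient j = 0≤recip ((2 ℕ.* j) !)

  -- The quotient of the two coefficients is at least 12. The weaker 6 suffices near x = π/2, where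
  -- even 2x² is below 6.
  6*cosCoefficient≤ : ∀ j → ι 6 * cosCoefficient (2 ℕ.+ j) ≤ cosCoefficient (suc j)
  6*cosCoefficient≤ j = begin
    ι 6 * cosCoefficient (suc (suc j))                 ≡⟨ cong (ι 6 *_) (cosCoefficient-suc (suc j)) ⟩
    ι 6 * (c * recip d)                                ≡⟨ solve 3 (λ s c r → s :* (c :* r) := c :* (s :* r)) refl (ι 6) c (recip d) ⟩
    c * (ι 6 * recip d)                                ≤⟨ *-monoˡ c (0≤cosCoefficient (suc j)) (*-monoʳ (recip d) (0≤recip d) (ι-mono-≤ 6≤d)) ⟩
    c * (ι d * recip d)                                ≡⟨ cong (c *_) (ι*recip d) ⟩
    c * 1ℚ                                             ≡⟨ *-identityʳ c ⟩
    c                                                  ∎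
    where
    open ℚₚ.≤-Reasoning
    c = cosCoefficient (suc j)
    d = cosDenominator (suc j)
    6≤d : 6 ℕ.≤ d
    6≤d = ℕₚ.*-mono-≤ {3} {suc (suc (2 ℕ.* suc j))} {2} (ℕ.s≤s (ℕ.s≤s (ℕ.s≤s ℕ.z≤n))) (ℕ.s≤s (ℕ.s≤s ℕ.z≤n))

  module _ {u : ℚ} (0≤u : 0ℚ ≤ u) (u≤6 : u ≤ ι 6) where

    private
      term-antitone : ∀ j → cosTerm u (2 ℕ.+ j) ≤ cosTerm u (suc j)
      term-antitone j = begin
        u * u ^ suc j * c₂            ≡⟨ solve 3 (λ u p c → u :* p :* c := p :* (u :* c)) refl u (u ^ suc j) c₂ ⟩
        u ^ suc j * (u * c₂)          ≤⟨ *-monoˡ (u ^ suc j) (^-nonNeg (suc j) 0≤u) (≤-trans (*-monoʳ c₂ (0≤cosCoefficient (2 ℕ.+ j)) u≤6) (6*cosCoefficient≤ j)) ⟩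
        u ^ suc j * cosCoefficient (suc j) ∎
        where
        open ℚₚ.≤-Reasoning
        c₂ = cosCoefficient (2 ℕ.+ j)

      tail-bounds : ∀ m n → 0ℚ ≤ alternating (λ j → cosTerm u (suc m ℕ.+ j)) n
      tail-bounds m n = proj₁ (alternating-bounds (λ j → cosTerm u (suc m ℕ.+ j)) n
        (λ j → *-nonNeg (^-nonNeg (suc m ℕ.+ j) 0≤u) (0≤cosCoefficient (suc m ℕ.+ j)))
        (λ j → subst (λ i → cosTerm u i ≤ cosTerm u (suc (m ℕ.+ j))) (sym (ℕₚ.+-suc (suc m) j)) (term-antitone (m ℕ.+ j))))

    -- The terms decrease only from index 1 on, because u may exceed 2; hence the even partial sums
    -- are taken from length 2 on.
    cosSum-even : ∀ m n → cosSum u (2 ℕ.* suc m) ≤ cosSum u (2 ℕ.* suc m ℕ.+ n)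
    cosSum-even m n = ≤-diff (tail-bounds (m ℕ.+ 1 ℕ.* suc m) n) (sym (trans (alternating-split (cosTerm u) (2 ℕ.* suc m) n)
      (cong (λ z → cosSum u (2 ℕ.* suc m) + z) (trans (cong (_* alternating (λ j → cosTerm u (2 ℕ.* suc m ℕ.+ j)) n) (sign-2* (suc m)))
        (*-identityˡ (alternating (λ j → cosTerm u (2 ℕ.* suc m ℕ.+ j)) n))))))

    cosSum-odd : ∀ m n → cosSum u (suc (2 ℕ.* m) ℕ.+ n) ≤ cosSum u (suc (2 ℕ.* m))
    cosSum-odd m n = ≤-diff (tail-bounds (2 ℕ.* m) n) (trans (cong (_+ a) (alternating-split (cosTerm u) (suc (2 ℕ.* m)) n))
      (trans (cong (λ s → cosSum u (suc (2 ℕ.* m)) + - 1ℚ * s * a + a) (sign-2* m))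
        (solve 2 (λ c a → c :+ con (- 1ℚ) :* con 1ℚ :* a :+ a := c) refl (cosSum u (suc (2 ℕ.* m))) a)))
      where a = alternating (λ j → cosTerm u (suc (2 ℕ.* m) ℕ.+ j)) n

  -- The difference of the two sums is the alternating sum of the `d j`, and these decrease because
  -- u + v ≤ 6. Thus every partial sum is antitone, and no limit is involved.
  cosSum-antitone : ∀ {u v} → 0ℚ ≤ v → v ≤ u → u + v ≤ ι 6 → ∀ n → cosSum u n ≤ cosSum v n
  cosSum-antitone {u} {v} 0≤v v≤u u+v≤6 zero    = ≤-refl
  cosSum-antitone {u} {v} 0≤v v≤u u+v≤6 (suc n) = ≤-diff (proj₁ (alternating-bounds d n 0≤d antitone)) (begin
    cosSum u (suc n) + alternating d n
      ≡⟨ cong (_+ alternating d n) (alternating-suc (cosTerm u) n) ⟩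
    cosTerm u 0 - alternating (cosTerm u ∘ suc) n + alternating d n
      ≡⟨ cong (λ z → cosTerm u 0 - alternating (cosTerm u ∘ suc) n + z) difference ⟩
    cosTerm u 0 - alternating (cosTerm u ∘ suc) n + (alternating (cosTerm u ∘ suc) n + - 1ℚ * alternating (cosTerm v ∘ suc) n)
      ≡⟨ solve 3 (λ a b c → a :- b :+ (b :+ con (- 1ℚ) :* c) := a :- c) refl (cosTerm u 0) (alternating (cosTerm u ∘ suc) n) (alternating (cosTerm v ∘ suc) n) ⟩
    cosTerm v 0 - alternating (cosTerm v ∘ suc) n
      ≡⟨ alternating-suc (cosTerm v) n ⟨
    cosSum v (suc n) ∎)
    where
    open ≡-Reasoning
    d : ℕ → ℚ
    d j = (u ^ suc j - v ^ suc j) * cosCoefficient (suc j)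
    difference : alternating d n ≡ alternating (cosTerm u ∘ suc) n + - 1ℚ * alternating (cosTerm v ∘ suc) n
    difference = trans (Σ-cong n (λ j → solve 4 (λ s a b c → s :* ((a :- b) :* c) := s :* (a :* c) :+ con (- 1ℚ) :* (s :* (b :* c))) refl (sign j) (u ^ suc j) (v ^ suc j) (cosCoefficient (suc j))))
      (trans (Σ-+ (λ j → sign j * cosTerm u (suc j)) (λ j → - 1ℚ * (sign j * cosTerm v (suc j))) n)
        (cong (λ z → alternating (cosTerm u ∘ suc) n + z) (Σ-*ˡ (- 1ℚ) (λ j → sign j * cosTerm v (suc j)) n)))
    0≤u : 0ℚ ≤ u
    0≤u = ≤-trans 0≤v v≤u
    0≤Δ : ∀ j → 0ℚ ≤ u ^ j - v ^ j
    0≤Δ j = p≤q⇒0≤q-p (^-mono-≤ j 0≤v v≤u)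
    0≤d : ∀ j → 0ℚ ≤ d j
    0≤d j = *-nonNeg (0≤Δ (suc j)) (0≤cosCoefficient (suc j))
    -- (u + v) (uʲ⁺¹ - vʲ⁺¹) - (uʲ⁺² - vʲ⁺²) = uv (uʲ - vʲ)
    power-step : ∀ j → u ^ (2 ℕ.+ j) - v ^ (2 ℕ.+ j) ≤ (u + v) * (u ^ suc j - v ^ suc j)
    power-step j = ≤-diff (*-nonNeg (*-nonNeg 0≤u 0≤v) (0≤Δ j))
      (solve 4 (λ u v p q → u :* (u :* p) :- v :* (v :* q) :+ u :* v :* (p :- q) := (u :+ v) :* (u :* p :- v :* q)) refl u v (u ^ j) (v ^ j))
    antitone : ∀ j → d (suc j) ≤ d j
    antitone j = ≤-trans (*-monoʳ c₂ (0≤cosCoefficient (2 ℕ.+ j)) (≤-trans (power-step j) (*-monoʳ (u ^ suc j - v ^ suc j) (0≤Δ (suc j)) u+v≤6)))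
      (subst (_≤ d j) (solve 3 (λ D s c → D :* (s :* c) := s :* D :* c) refl (u ^ suc j - v ^ suc j) (ι 6) c₂)
        (*-monoˡ (u ^ suc j - v ^ suc j) (0≤Δ (suc j)) (6*cosCoefficient≤ j)))
      where c₂ = cosCoefficient (2 ℕ.+ j)

  expTerm : ℚ → ℕ → ℚ
  expTerm x j = x ^ j * recip (j !)

  expSum : ℚ → ℕ → ℚ
  expSum x = Σ (expTerm x)

  expTerm-suc : ∀ x j → expTerm x (suc j) ≡ expTerm x j * (x * recip (suc j))
  expTerm-suc x j = trans (cong (x * x ^ j *_) (recip-* (suc j) (j !)))
    (solve 4 (λ x p a b → x :* p :* (a :* b) := p :* b :* (x :* a)) refl x (x ^ j) (recip (suc j)) (recip (j !)))

  0≤expTerm : ∀ {x} j → 0ℚ ≤ x → 0ℚ ≤ expTerm x j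
  0≤expTerm j 0≤x = *-nonNeg (^-nonNeg j 0≤x) (0≤recip (j !))

  expTerm-mono : ∀ {x y} j → 0ℚ ≤ x → x ≤ y → expTerm x j ≤ expTerm y j
  expTerm-mono j 0≤x x≤y = *-monoʳ (recip (j !)) (0≤recip (j !)) (^-mono-≤ j 0≤x x≤y)

  expSum-mono : ∀ {x y} n → 0ℚ ≤ x → x ≤ y → expSum x n ≤ expSum y n
  expSum-mono n 0≤x x≤y = Σ-mono n (λ j → expTerm-mono j 0≤x x≤y)

  expSum-extend : ∀ {x} m n → 0ℚ ≤ x → expSum x m ≤ expSum x (m ℕ.+ n)
  expSum-extend {x} m n 0≤x = ≤-diff (Σ-nonNeg n (λ j → 0≤expTerm (m ℕ.+ j) 0≤x)) (sym (Σ-split (expTerm x) m n))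

  -- The extra 2 `f n` on the left is what the rest of a geometric series of ratio 1/2 could still
  -- contribute, and makes the induction close.
  Σ-halving : ∀ f n → (∀ j → f (suc j) + f (suc j) ≤ f j) → Σ f n + (f n + f n) ≤ f 0 + f 0
  Σ-halving f zero    h = ≤-reflexive (+-identityˡ (f 0 + f 0))
  Σ-halving f (suc n) h = begin
    Σ f n + f n + (f (suc n) + f (suc n))    ≤⟨ +-monoʳ-≤ (Σ f n + f n) (h n) ⟩
    Σ f n + f n + f n                        ≡⟨ +-assoc (Σ f n) (f n) (f n) ⟩
    Σ f n + (f n + f n)                      ≤⟨ Σ-halving f n h ⟩
    f 0 + f 0                                ∎
    where open ℚₚ.≤-Reasoning

  expTerm-halving : ∀ {x} j → 0ℚ ≤ x → x + x ≤ ι (suc j) → expTerm x (suc j) + expTerm x (suc j) ≤ expTerm x j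
  expTerm-halving {x} j 0≤x 2x≤j+1 = begin
    expTerm x (suc j) + expTerm x (suc j)            ≡⟨ cong₂ _+_ (expTerm-suc x j) (expTerm-suc x j) ⟩
    t * (x * r) + t * (x * r)                        ≡⟨ solve 3 (λ t x r → t :* (x :* r) :+ t :* (x :* r) := t :* ((x :+ x) :* r)) refl t x r ⟩
    t * ((x + x) * r)                                ≤⟨ *-monoˡ t (0≤expTerm j 0≤x) (*-monoʳ r (0≤recip (suc j)) 2x≤j+1) ⟩
    t * (ι (suc j) * r)                              ≡⟨ cong (t *_) (ι*recip (suc j)) ⟩
    t * 1ℚ                                           ≡⟨ *-identityʳ t ⟩
    t                                                ∎
    where
    open ℚₚ.≤-Reasoning
    t = expTerm x j
    r = recip (suc j)

  expSum-tail : ∀ {x} m n → 0ℚ ≤ x → x + x ≤ ι (suc m) →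
                Σ (λ j → expTerm x (m ℕ.+ j)) n ≤ expTerm x m + expTerm x m
  expSum-tail {x} m n 0≤x 2x≤m+1 = subst (λ i → Σ t n ≤ expTerm x i + expTerm x i) (ℕₚ.+-identityʳ m)
    (≤-trans (≤-diff (+-nonNeg (0≤t n) (0≤t n)) refl) (Σ-halving t n halving))
    where
    t : ℕ → ℚ
    t j = expTerm x (m ℕ.+ j)
    0≤t : ∀ j → 0ℚ ≤ t j
    0≤t j = 0≤expTerm (m ℕ.+ j) 0≤x
    halving : ∀ j → t (suc j) + t (suc j) ≤ t j
    halving j = subst (λ i → expTerm x i + expTerm x i ≤ t j) (sym (ℕₚ.+-suc m j))
      (expTerm-halving (m ℕ.+ j) 0≤x (≤-trans 2x≤m+1 (ι-mono-≤ (ℕ.s≤s (ℕₚ.m≤m+n m j)))))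

  -- The Cauchy product shows expSum x n * expSum (- x) n ≈ 1, which bounds exp at negative arguments.

  Σ-mono-< : ∀ {f g} n → (∀ i → i ℕ.< n → f i ≤ g i) → Σ f n ≤ Σ g n
  Σ-mono-< zero    h = ≤-refl
  Σ-mono-< (suc n) h = +-mono-≤ (Σ-mono-< n (λ i i<n → h i (ℕₚ.m<n⇒m<1+n i<n))) (h n ℕₚ.≤-refl)

  ∣Σ∣≤Σ∣∣ : ∀ f n → ∣ Σ f n ∣ ≤ Σ (λ i → ∣ f i ∣) n
  ∣Σ∣≤Σ∣∣ f n = ∣Σ∣≤ n (λ _ → ≤-refl)

  Σ-const : ∀ c n → Σ (λ _ → c) n ≡ ι n * c
  Σ-const c zero    = sym (trans (cong (_* c) ι0) (*-zeroˡ c))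
  Σ-const c (suc n) = trans (cong (_+ c) (Σ-const c n)) (trans (solve 2 (λ n c → n :* c :+ c := (con 1ℚ :+ n) :* c) refl (ι n) c)
    (cong (_* c) (sym (ι-suc n))))

  module CauchyProduct (x : ℚ) where
    private
      a b : ℕ → ℚ
      a = expTerm x
      b = expTerm (- x)

    ι*expTerm : ∀ x j → ι (suc j) * expTerm x (suc j) ≡ x * expTerm x j
    ι*expTerm x j = trans (cong (ι (suc j) *_) (expTerm-suc x j))
      (trans (solve 4 (λ n t x r → n :* (t :* (x :* r)) := x :* t :* (n :* r)) refl (ι (suc j)) (expTerm x j) x (recip (suc j)))
        (trans (cong (x * expTerm x j *_) (ι*recip (suc j))) (*-identityʳ (x * expTerm x j))))

    convolution : ℕ → ℚ
    convolution m = Σ (λ i → a i * b (m ℕ.∸ i)) (suc m)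

    -- The convolution is (x - x)ᵐ⁺¹/(m+1)!, but no binomial theorem is used: multiply by m + 1 = i
    -- + (m + 1 - i) and apply (j+1) xʲ⁺¹/(j+1)! = x xʲ/j! to either factor. The two resulting sums
    -- are x and -x times the previous convolution.
    convolution≡0 : ∀ m → convolution (suc m) ≡ 0ℚ
    convolution≡0 m = *-cancelʳ-≡ (ι (suc m)) (0<ι (suc m)) (trans (*-comm (convolution (suc m)) (ι (suc m))) (trans (begin
      ι (suc m) * convolution (suc m)
        ≡⟨ Σ-*ˡ (ι (suc m)) (λ i → a i * b (suc m ℕ.∸ i)) (suc (suc m)) ⟨
      Σ (λ i → ι (suc m) * (a i * b (suc m ℕ.∸ i))) (suc (suc m))
        ≡⟨ Σ-cong-< (suc (suc m)) (λ { i (ℕ.s≤s i≤m+1) → separate i i≤m+1 }) ⟩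
      Σ (λ i → f i + g i) (suc (suc m))
        ≡⟨ Σ-+ f g (suc (suc m)) ⟩
      Σ f (suc (suc m)) + Σ g (suc (suc m))
        ≡⟨ cong₂ _+_ Σf Σg ⟩
      x * convolution m + - x * convolution m
        ≡⟨ solve 2 (λ x c → x :* c :+ (:- x) :* c := con 0ℚ) refl x (convolution m) ⟩
      0ℚ ∎) (sym (*-zeroˡ (ι (suc m))))))
      where
      open ≡-Reasoning
      f g : ℕ → ℚ
      f i = ι i * a i * b (suc m ℕ.∸ i)
      g i = a i * (ι (suc m ℕ.∸ i) * b (suc m ℕ.∸ i))
      separate : ∀ i → i ℕ.≤ suc m → ι (suc m) * (a i * b (suc m ℕ.∸ i)) ≡ f i + g i
      separate i i≤m+1 = trans (cong (λ n → n * (a i * b (suc m ℕ.∸ i))) (trans (cong ι (sym (ℕₚ.m+[n∸m]≡n i≤m+1))) (ι-+ i (suc m ℕ.∸ i))))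
        (solve 4 (λ i k a b → (i :+ k) :* (a :* b) := i :* a :* b :+ a :* (k :* b)) refl (ι i) (ι (suc m ℕ.∸ i)) (a i) (b (suc m ℕ.∸ i)))
      Σf : Σ f (suc (suc m)) ≡ x * convolution m
      Σf = begin
        Σ f (suc (suc m))                                ≡⟨ Σ-head f (suc m) ⟩
        ι 0 * a 0 * b (suc m) + Σ (f ∘ suc) (suc m)      ≡⟨ cong₂ _+_ (trans (cong (λ z → z * a 0 * b (suc m)) ι0) (solve 2 (λ a b → con 0ℚ :* a :* b := con 0ℚ) refl (a 0) (b (suc m))))
                                                             (Σ-cong (suc m) (λ i → trans (cong (_* b (m ℕ.∸ i)) (ι*expTerm x i)) (*-assoc x (a i) (b (m ℕ.∸ i))))) ⟩
        0ℚ + Σ (λ i → x * (a i * b (m ℕ.∸ i))) (suc m)   ≡⟨ trans (+-identityˡ (Σ (λ i → x * (a i * b (m ℕ.∸ i))) (suc m))) (Σ-*ˡ x (λ i → a i * b (m ℕ.∸ i)) (suc m)) ⟩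
        x * convolution m                                ∎
      Σg : Σ g (suc (suc m)) ≡ - x * convolution m
      Σg = begin
        Σ g (suc m) + g (suc m)
          ≡⟨ cong₂ _+_ (Σ-cong-< (suc m) (λ { i (ℕ.s≤s i≤m) → shift i i≤m }))
               (trans (cong (λ k → a (suc m) * (ι k * b k)) (ℕₚ.n∸n≡0 m)) (trans (cong (λ z → a (suc m) * (z * b 0)) ι0)
                 (solve 2 (λ a b → a :* (con 0ℚ :* b) := con 0ℚ) refl (a (suc m)) (b 0)))) ⟩
        Σ (λ i → - x * (a i * b (m ℕ.∸ i))) (suc m) + 0ℚ
          ≡⟨ trans (+-identityʳ (Σ (λ i → - x * (a i * b (m ℕ.∸ i))) (suc m))) (Σ-*ˡ (- x) (λ i → a i * b (m ℕ.∸ i)) (suc m)) ⟩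
        - x * convolution m ∎
        where
        shift : ∀ i → i ℕ.≤ m → g i ≡ - x * (a i * b (m ℕ.∸ i))
        shift i i≤m = trans (cong (λ k → a i * (ι k * b k)) (ℕₚ.+-∸-assoc 1 i≤m))
          (trans (cong (a i *_) (ι*expTerm (- x) (m ℕ.∸ i)))
            (solve 3 (λ a x b → a :* ((:- x) :* b) := (:- x) :* (a :* b)) refl (a i) x (b (m ℕ.∸ i))))

    -- The part i + j < k of the product of the two partial sums. Its diagonals are the
    -- convolutions, of which only the zeroth is nonzero.
    triangle : ℕ → ℚ
    triangle k = Σ (λ i → a i * expSum (- x) (k ℕ.∸ i)) k

    triangle-suc : ∀ k → triangle (suc k) ≡ triangle k + convolution k
    triangle-suc k = begin
      Σ (λ i → a i * B (suc k ℕ.∸ i)) (suc k)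
        ≡⟨ Σ-cong-< (suc k) (λ { i (ℕ.s≤s i≤k) → trans (cong (λ n → a i * B n) (ℕₚ.+-∸-assoc 1 i≤k)) (*-distribˡ-+ (a i) (B (k ℕ.∸ i)) (b (k ℕ.∸ i))) }) ⟩
      Σ (λ i → a i * B (k ℕ.∸ i) + a i * b (k ℕ.∸ i)) (suc k)
        ≡⟨ Σ-+ (λ i → a i * B (k ℕ.∸ i)) (λ i → a i * b (k ℕ.∸ i)) (suc k) ⟩
      triangle k + a k * B (k ℕ.∸ k) + convolution k
        ≡⟨ cong (λ n → triangle k + a k * B n + convolution k) (ℕₚ.n∸n≡0 k) ⟩
      triangle k + a k * 0ℚ + convolution k
        ≡⟨ solve 3 (λ t a c → t :+ a :* con 0ℚ :+ c := t :+ c) refl (triangle k) (a k) (convolution k) ⟩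
      triangle k + convolution k ∎
      where
      open ≡-Reasoning
      B : ℕ → ℚ
      B = expSum (- x)

    triangle≡1 : ∀ k → triangle (suc k) ≡ 1ℚ
    triangle≡1 zero    = trans (cong (λ z → 0ℚ + 1ℚ * z * (0ℚ + 1ℚ * z)) recip1) refl
    triangle≡1 (suc k) = trans (triangle-suc (suc k)) (trans (cong₂ _+_ (triangle≡1 k) (convolution≡0 k)) (+-identityʳ 1ℚ))

    product-triangle : ∀ k → expSum x k * expSum (- x) k - triangle k ≡ Σ (λ i → a i * (expSum (- x) k - expSum (- x) (k ℕ.∸ i))) k
    product-triangle k = sym (begin
      Σ (λ i → a i * (B k - B (k ℕ.∸ i))) k
        ≡⟨ Σ-cong k (λ i → solve 3 (λ a b c → a :* (b :- c) := b :* a :+ con (- 1ℚ) :* (a :* c)) refl (a i) (B k) (B (k ℕ.∸ i))) ⟩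
      Σ (λ i → B k * a i + - 1ℚ * (a i * B (k ℕ.∸ i))) k
        ≡⟨ trans (Σ-+ (λ i → B k * a i) (λ i → - 1ℚ * (a i * B (k ℕ.∸ i))) k)
             (cong₂ _+_ (Σ-*ˡ (B k) a k) (Σ-*ˡ (- 1ℚ) (λ i → a i * B (k ℕ.∸ i)) k)) ⟩
      B k * expSum x k + - 1ℚ * triangle k
        ≡⟨ solve 3 (λ b a t → b :* a :+ con (- 1ℚ) :* t := a :* b :- t) refl (B k) (expSum x k) (triangle k) ⟩
      expSum x k * B k - triangle k ∎)
      where
      open ≡-Reasoning
      B : ℕ → ℚ
      B = expSum (- x)

  ∣expTerm∣ : ∀ {x} j → 0ℚ ≤ x → ∣ expTerm (- x) j ∣ ≡ expTerm x j
  ∣expTerm∣ {x} j 0≤x = trans (∣p*q∣≡∣p∣*∣q∣ ((- x) ^ j) (recip (j !))) (cong₂ _*_ (power j) (0≤p⇒∣p∣≡p (0≤recip (j !))))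
    where
    power : ∀ j → ∣ (- x) ^ j ∣ ≡ x ^ j
    power zero    = refl
    power (suc j) = trans (∣p*q∣≡∣p∣*∣q∣ (- x) ((- x) ^ j)) (cong₂ _*_ (trans (∣-p∣≡∣p∣ x) (0≤p⇒∣p∣≡p 0≤x)) (power j))

  module ExpNegative (Y : ℕ) where
    private
      X m : ℕ
      X = 8 ℕ.* Y
      m = X ℕ.+ X
      ρ : ℚ
      ρ = recip 8

    -- An upper bound for exp(8Y), so that the terms at y ≤ Y are at most A 8⁻ʲ. The ratio 8 = 2³ is
    -- chosen to absorb the three factors k, k and A² of `remainder`, each of which is eventually at
    -- most 2ᵏ.
    A : ℚ
    A = expSum (ι X) m + (expTerm (ι X) m + expTerm (ι X) m)

    private

      0≤A : 0ℚ ≤ A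
      0≤A = +-nonNeg (Σ-nonNeg m (λ j → 0≤expTerm j (0≤ι X))) (+-nonNeg (0≤expTerm m (0≤ι X)) (0≤expTerm m (0≤ι X)))

      expTerm≤A : ∀ j → expTerm (ι X) j ≤ A
      expTerm≤A j = begin
        expTerm (ι X) j                             ≤⟨ ≤-diff (Σ-nonNeg j (λ j → 0≤expTerm j (0≤ι X))) (+-comm (expTerm (ι X) j) (expSum (ι X) j)) ⟩
        expSum (ι X) (suc j)                        ≤⟨ expSum-extend (suc j) m (0≤ι X) ⟩
        expSum (ι X) (suc j ℕ.+ m)                  ≡⟨ cong (expSum (ι X)) (ℕₚ.+-comm (suc j) m) ⟩
        expSum (ι X) (m ℕ.+ suc j)                  ≡⟨ Σ-split (expTerm (ι X)) m (suc j) ⟩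
        expSum (ι X) m + Σ (λ i → expTerm (ι X) (m ℕ.+ i)) (suc j) ≤⟨ +-monoʳ-≤ (expSum (ι X) m) (expSum-tail m (suc j) (0≤ι X) 2X≤m+1) ⟩
        A                                           ∎
        where
        open ℚₚ.≤-Reasoning
        2X≤m+1 : ι X + ι X ≤ ι (suc m)
        2X≤m+1 = subst (_≤ ι (suc m)) (ι-+ X X) (ι-mono-≤ (ℕₚ.n≤1+n m))

    expTerm≤ : ∀ {y} j → 0ℚ ≤ y → y ≤ ι Y → expTerm y j ≤ A * ρ ^ j
    expTerm≤ {y} j 0≤y y≤Y = begin
      y ^ j * r                            ≤⟨ *-monoʳ r (0≤recip (j !)) (^-mono-≤ j 0≤y y≤Y) ⟩
      ι Y ^ j * r                          ≡⟨ cong (λ z → z ^ j * r) (trans (sym (*-identityʳ (ι Y))) (trans (cong (ι Y *_) (sym (ι*recip 8)))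
                                                (trans (solve 3 (λ y e r → y :* (e :* r) := e :* y :* r) refl (ι Y) (ι 8) ρ) (cong (_* ρ) (sym (ι-* 8 Y)))))) ⟩
      (ι X * ρ) ^ j * r                    ≡⟨ cong (_* r) (^-distrib-* (ι X) ρ j) ⟩
      ι X ^ j * ρ ^ j * r                  ≡⟨ solve 3 (λ a b c → a :* b :* c := a :* c :* b) refl (ι X ^ j) (ρ ^ j) r ⟩
      expTerm (ι X) j * ρ ^ j              ≤⟨ *-monoʳ (ρ ^ j) (^-nonNeg j (0≤recip 8)) (expTerm≤A j) ⟩
      A * ρ ^ j                            ∎
      where
      open ℚₚ.≤-Reasoning
      r = recip (j !)

    -- Entries outside the triangle have i + j ≥ k, so each is at most A² 8⁻ᵏ, and there are at most
    -- k² of them.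
    remainder : ∀ {y} k → 0ℚ ≤ y → y ≤ ι Y →
                ∣ expSum y k * expSum (- y) k - CauchyProduct.triangle y k ∣ ≤ ι k * (ι k * (A * A * ρ ^ k))
    remainder {y} k 0≤y y≤Y = begin
      ∣ expSum y k * B k - CauchyProduct.triangle y k ∣                ≡⟨ cong ∣_∣ (CauchyProduct.product-triangle y k) ⟩
      ∣ Σ (λ i → expTerm y i * (B k - B (k ℕ.∸ i))) k ∣                ≤⟨ ∣Σ∣≤Σ∣∣ (λ i → expTerm y i * (B k - B (k ℕ.∸ i))) k ⟩
      Σ (λ i → ∣ expTerm y i * (B k - B (k ℕ.∸ i)) ∣) k                ≤⟨ Σ-mono-< k (λ i i<k → row i (ℕₚ.<⇒≤ i<k)) ⟩
      Σ (λ _ → ι k * (A * A * ρ ^ k)) k                                ≡⟨ Σ-const (ι k * (A * A * ρ ^ k)) k ⟩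
      ι k * (ι k * (A * A * ρ ^ k))                                    ∎
      where
      open ℚₚ.≤-Reasoning
      B : ℕ → ℚ
      B = expSum (- y)
      0≤AAρ : 0ℚ ≤ A * A * ρ ^ k
      0≤AAρ = *-nonNeg (*-nonNeg 0≤A 0≤A) (^-nonNeg k (0≤recip 8))
      row : ∀ i → i ℕ.≤ k → ∣ expTerm y i * (B k - B (k ℕ.∸ i)) ∣ ≤ ι k * (A * A * ρ ^ k)
      row i i≤k = begin
        ∣ expTerm y i * (B k - B (k ℕ.∸ i)) ∣          ≡⟨ cong (λ z → ∣ expTerm y i * z ∣) tail ⟩
        ∣ expTerm y i * Σ t i ∣                        ≤⟨ ∣*∣≤ {expTerm y i} {Σ t i} (0≤⇒∣∣≤ (0≤expTerm i 0≤y) (expTerm≤ i 0≤y y≤Y))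
                                                          (∣Σ∣≤ i (λ j → subst (_≤ A * ρ ^ (k ℕ.∸ i)) (sym (∣expTerm∣ (k ℕ.∸ i ℕ.+ j) 0≤y)) (term j))) ⟩
        A * ρ ^ i * Σ (λ _ → A * ρ ^ (k ℕ.∸ i)) i      ≡⟨ cong (A * ρ ^ i *_) (Σ-const (A * ρ ^ (k ℕ.∸ i)) i) ⟩
        A * ρ ^ i * (ι i * (A * ρ ^ (k ℕ.∸ i)))        ≡⟨ solve 4 (λ a p n q → a :* p :* (n :* (a :* q)) := n :* (a :* a :* (p :* q))) refl A (ρ ^ i) (ι i) (ρ ^ (k ℕ.∸ i)) ⟩
        ι i * (A * A * (ρ ^ i * ρ ^ (k ℕ.∸ i)))        ≡⟨ cong (λ z → ι i * (A * A * z)) (trans (sym (^-homo-* ρ i (k ℕ.∸ i))) (cong (ρ ^_) (ℕₚ.m+[n∸m]≡n i≤k))) ⟩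
        ι i * (A * A * ρ ^ k)                          ≤⟨ *-monoʳ (A * A * ρ ^ k) 0≤AAρ (ι-mono-≤ i≤k) ⟩
        ι k * (A * A * ρ ^ k)                          ∎
        where
        t : ℕ → ℚ
        t j = expTerm (- y) (k ℕ.∸ i ℕ.+ j)
        tail : B k - B (k ℕ.∸ i) ≡ Σ t i
        tail = trans (cong (λ n → B n - B (k ℕ.∸ i)) (sym (ℕₚ.m∸n+n≡m i≤k)))
          (trans (cong (_- B (k ℕ.∸ i)) (Σ-split (expTerm (- y)) (k ℕ.∸ i) i))
            (solve 2 (λ b s → b :+ s :- b := s) refl (B (k ℕ.∸ i)) (Σ t i)))
        term : ∀ j → expTerm y (k ℕ.∸ i ℕ.+ j) ≤ A * ρ ^ (k ℕ.∸ i)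
        term j = ≤-trans (expTerm≤ (k ℕ.∸ i ℕ.+ j) 0≤y y≤Y) (*-monoˡ A 0≤A
          (subst₂ _≤_ (sym (^-homo-* ρ (k ℕ.∸ i) j)) (*-identityʳ (ρ ^ (k ℕ.∸ i)))
            (*-monoˡ (ρ ^ (k ℕ.∸ i)) (^-nonNeg (k ℕ.∸ i) (0≤recip 8)) (^-≤1 j (0≤recip 8) (recip≤1 8)))))

    -- The product of the sums at y and -y is 1 up to an error of at most 1, and the sum at y is at
    -- least 1. The crude bound 2 suffices to keep arguments ≤ 0 away from exp = 1 + √2.
    expSum-negative : ∀ N → A * A ≤ ι N → ∀ {y} k → N ℕ.≤ suc k → 0ℚ ≤ y → y ≤ ι Y → expSum (- y) (suc k) ≤ 1ℚ + 1ℚ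
    expSum-negative N AA≤N {y} k N≤k+1 0≤y y≤Y = conclude (≤-total (B n) 0ℚ)
      where
      open ℚₚ.≤-Reasoning
      n : ℕ
      n = suc k
      B : ℕ → ℚ
      B = expSum (- y)
      p : ℚ
      p = ι (2 ℕ.^ n)
      0≤p : 0ℚ ≤ p
      0≤p = 0≤ι (2 ℕ.^ n)
      small : ι n * (ι n * (A * A * ρ ^ n)) ≤ 1ℚ
      small = begin
        ι n * (ι n * (A * A * ρ ^ n))    ≤⟨ *-mono (0≤ι n) (*-nonNeg (0≤ι n) (*-nonNeg (*-nonNeg 0≤A 0≤A) (^-nonNeg n (0≤recip 8)))) n≤p
                                              (*-mono (0≤ι n) (*-nonNeg (*-nonNeg 0≤A 0≤A) (^-nonNeg n (0≤recip 8))) n≤p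
                                                (*-monoʳ (ρ ^ n) (^-nonNeg n (0≤recip 8)) (≤-trans AA≤N (≤-trans (ι-mono-≤ N≤k+1) n≤p)))) ⟩
        p * (p * (p * ρ ^ n))            ≡⟨ cong (λ z → z * (z * (z * ρ ^ n))) (ι-^ 2 n) ⟩
        ι 2 ^ n * (ι 2 ^ n * (ι 2 ^ n * ρ ^ n)) ≡⟨ trans (cong (λ z → ι 2 ^ n * (ι 2 ^ n * z)) (sym (^-distrib-* (ι 2) ρ n)))
                                                 (trans (cong (ι 2 ^ n *_) (sym (^-distrib-* (ι 2) (ι 2 * ρ) n))) (sym (^-distrib-* (ι 2) (ι 2 * (ι 2 * ρ)) n))) ⟩
        (ι 2 * (ι 2 * (ι 2 * ρ))) ^ n    ≡⟨ cong (_^ n) (trans (solve 2 (λ t r → t :* (t :* (t :* r)) := t :* (t :* t) :* r) refl (ι 2) ρ)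
                                              (trans (cong (_* ρ) (trans (cong (ι 2 *_) (sym (ι-* 2 2))) (sym (ι-* 2 4)))) (ι*recip 8))) ⟩
        1ℚ ^ n                           ≡⟨ 1^n≡1 n ⟩
        1ℚ                               ∎
        where
        n≤p : ι n ≤ p
        n≤p = ι-mono-≤ (n≤2^n n)
      product≤2 : expSum y n * B n ≤ 1ℚ + 1ℚ
      product≤2 = begin
        expSum y n * B n                                       ≡⟨ solve 2 (λ e t → e := t :+ (e :- t)) refl (expSum y n * B n) (CauchyProduct.triangle y n) ⟩
        CauchyProduct.triangle y n + (expSum y n * B n - CauchyProduct.triangle y n)
          ≤⟨ +-mono-≤ (≤-reflexive (CauchyProduct.triangle≡1 y k)) (≤-trans (∣∣≤⇒≤ (remainder n 0≤y y≤Y)) small) ⟩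
        1ℚ + 1ℚ                                                ∎
      1≤E : 1ℚ ≤ expSum y n
      1≤E = subst (_≤ expSum y n) (trans (cong (λ z → 0ℚ + 1ℚ * z) recip1) refl) (expSum-extend 1 k 0≤y)
      conclude : B n ≤ 0ℚ ⊎ 0ℚ ≤ B n → B n ≤ 1ℚ + 1ℚ
      conclude (inj₁ B≤0) = ≤-trans B≤0 (nonNegative⁻¹ (1ℚ + 1ℚ))
      conclude (inj₂ 0≤B) = ≤-trans (subst (_≤ expSum y n * B n) (*-identityˡ (B n)) (*-monoʳ (B n) 0≤B 1≤E)) product≤2

-- Late terms of Cauchy sequences; cosine and π in terms of them.

module RealSequences where
  open import Data.Integer as ℤ using (ℤ; +_; -[1+_])
  open ℚ
  open Rationals
  open Intervals
  open TaylorModels using (∣ιℤ∣; ιℤ-1)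
  open CosExpSeries
  open Real using (ℝ; mkℝ; seq; cauchy; IsCauchy; fromℚ; fromℕ; partialSum; IsCos; IsExp; IsPi; IsSqrt; IsLog; HasSum)

  ≤ι : ∀ q → ∃[ n ] q ≤ ι n
  ≤ι q = ℤ.∣ ↥ q ∣ , (begin
    q                            ≡⟨ trans (sym (ℚₚ.↥p/↧p≡p q)) (z/n (↥ q) (↧ₙ q)) ⟩
    ιℤ (↥ q) * recip (↧ₙ q)      ≤⟨ *-monoʳ (recip (↧ₙ q)) (0≤recip (↧ₙ q)) (∣∣≤⇒≤ {ιℤ (↥ q)} (≤-reflexive (∣ιℤ∣ (↥ q)))) ⟩
    ι ℤ.∣ ↥ q ∣ * recip (↧ₙ q)   ≤⟨ *-monoˡ (ι ℤ.∣ ↥ q ∣) (0≤ι ℤ.∣ ↥ q ∣) (recip≤1 (↧ₙ q)) ⟩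
    ι ℤ.∣ ↥ q ∣ * 1ℚ             ≡⟨ *-identityʳ (ι ℤ.∣ ↥ q ∣) ⟩
    ι ℤ.∣ ↥ q ∣                  ∎)
    where open ℚₚ.≤-Reasoning

  recip≤ : ∀ {ε} → 0ℚ < ε → ∃[ n ] recip (suc n) ≤ ε
  recip≤ {ε} 0<ε = go ε refl (positive 0<ε)
    where
    go : ∀ q → q ≡ ε → Positive q → ∃[ n ] recip (suc n) ≤ ε
    go q@(mkℚ (+ suc z) d _) q≡ε _ = d , subst (recip (suc d) ≤_)
      (trans (trans (sym (z/n (+ suc z) (suc d))) (ℚₚ.↥p/↧p≡p q)) q≡ε)
      (subst (_≤ ι (suc z) * recip (suc d)) (*-identityˡ (recip (suc d)))
        (*-monoʳ (recip (suc d)) (0≤recip (suc d)) (1≤ι (suc z))))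

  cauchy-tail : ∀ {x} C → (∀ N .{{_ : ℕ.NonZero N}} k → ∣ x (N ℕ.+ k) - x N ∣ ≤ ι C * recip N) → IsCauchy x
  cauchy-tail {x} C h {ε} 0<ε with recip≤ 0<ε
  ... | n , 1/n≤ε = N , close
    where
    C′ N : ℕ
    C′ = C ℕ.+ C
    -- C′ + 1 = 2C + 1 makes 2C/N strictly smaller than 1/(n+1).
    N = suc C′ ℕ.* suc n
    open ℚₚ.≤-Reasoning
    small : ι C * recip N + ι C * recip N < ε
    small = <-≤-trans (<-diff {r = recip N} (0<recip N) (begin-equality
      ι C * recip N + ι C * recip N + recip N              ≡⟨ solve 2 (λ c r → c :* r :+ c :* r :+ r := (con 1ℚ :+ (c :+ c)) :* r) refl (ι C) (recip N) ⟩
      (1ℚ + (ι C + ι C)) * recip N                         ≡⟨ cong₂ _*_ (trans (cong (λ z → 1ℚ + z) (sym (ι-+ C C))) (sym (ι-suc C′))) (recip-* (suc C′) (suc n)) ⟩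
      ι (suc C′) * (recip (suc C′) * recip (suc n))        ≡⟨ *-assoc (ι (suc C′)) (recip (suc C′)) (recip (suc n)) ⟨
      ι (suc C′) * recip (suc C′) * recip (suc n)          ≡⟨ cong (_* recip (suc n)) (ι*recip (suc C′)) ⟩
      1ℚ * recip (suc n)                                   ≡⟨ *-identityˡ (recip (suc n)) ⟩
      recip (suc n)                                        ∎)) 1/n≤ε
    near : ∀ m → N ℕ.≤ m → ∣ x m - x N ∣ ≤ ι C * recip N
    near m N≤m with ℕₚ.m≤n⇒∃[o]m+o≡n N≤m
    ... | k , refl = h N k
    close : ∀ m k → N ℕ.≤ m → N ℕ.≤ k → ∣ x m - x k ∣ < ε
    close m k N≤m N≤k = ≤-<-trans (subst (λ z → ∣ z ∣ ≤ ι C * recip N + ι C * recip N)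
      (solve 3 (λ a b c → (a :- c) :- (b :- c) := a :- b) refl (x m) (x k) (x N))
      (∣-∣≤ {x m - x N} {x k - x N} (near m N≤m) (near k N≤k))) small

  Eventually : (ℕ → Set) → Set
  Eventually P = ∃[ N ] ∀ n → N ℕ.≤ n → P n

  both : ∀ {P Q} → Eventually P → Eventually Q → Eventually (λ n → P n × Q n)
  both (M , p) (N , q) = M ℕ.⊔ N , λ n ≤n → p n (ℕₚ.m⊔n≤o⇒m≤o M N ≤n) , q n (ℕₚ.m⊔n≤o⇒n≤o M N ≤n)

  mapᴱ : ∀ {P Q : ℕ → Set} → (∀ n → P n → Q n) → Eventually P → Eventually Q
  mapᴱ f (N , p) = N , λ n ≤n → f n (p n ≤n)

  never : ∀ {P} → Eventually P → (∀ n → ¬ P n) → ∀ {A : Set} → A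
  never (N , p) f = contradiction (p N ℕₚ.≤-refl) (f N)

  -- A single late term of a Cauchy sequence decides on which side of a + δ it stays.
  eventually-≥ : ∀ {x a δ} → IsCauchy x → 0ℚ < δ → ¬ Eventually (λ n → x n ≤ a + δ + δ) → Eventually (λ n → a ≤ x n)
  eventually-≥ {x} {a} {δ} cx 0<δ ¬below with cx 0<δ
  ... | N , close = go (≤-total (x N) (a + δ))
    where
    go : x N ≤ a + δ ⊎ a + δ ≤ x N → Eventually (λ n → a ≤ x n)
    go (inj₁ x≤) = ⊥-elim (¬below (N , λ n N≤n → subst (_≤ a + δ + δ) (solve 2 (λ y z → z :+ (y :- z) := y) refl (x n) (x N))
      (+-mono-≤ x≤ (∣∣≤⇒≤ (<⇒≤ (close n N N≤n ℕₚ.≤-refl))))))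
    go (inj₂ ≤x) = N , λ n N≤n → subst₂ _≤_ (solve 2 (λ a d → a :+ d :- d := a) refl a δ) (solve 2 (λ y z → z :+ (y :- z) := y) refl (x n) (x N))
      (+-mono-≤ ≤x (∣∣≤⇒-≤ {x n - x N} (<⇒≤ (close n N N≤n ℕₚ.≤-refl))))

  eventually-≤ : ∀ {x a δ} → IsCauchy x → 0ℚ < δ → ¬ Eventually (λ n → a ≤ x n) → Eventually (λ n → x n ≤ a + δ + δ)
  eventually-≤ {x} {a} {δ} cx 0<δ ¬above with cx 0<δ
  ... | N , close = go (≤-total (x N) (a + δ))
    where
    go : x N ≤ a + δ ⊎ a + δ ≤ x N → Eventually (λ n → x n ≤ a + δ + δ)
    go (inj₁ x≤) = N , λ n N≤n → subst (_≤ a + δ + δ) (solve 2 (λ y z → z :+ (y :- z) := y) refl (x n) (x N))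
      (+-mono-≤ x≤ (∣∣≤⇒≤ (<⇒≤ (close n N N≤n ℕₚ.≤-refl))))
    go (inj₂ ≤x) = ⊥-elim (¬above (N , λ n N≤n → subst₂ _≤_ (solve 2 (λ a d → a :+ d :- d := a) refl a δ) (solve 2 (λ y z → z :+ (y :- z) := y) refl (x n) (x N))
      (+-mono-≤ ≤x (∣∣≤⇒-≤ {x n - x N} (<⇒≤ (close n N N≤n ℕₚ.≤-refl))))))

  seq-^ : ∀ x m n → seq (x Real.^ m) n ≡ seq x n ^ m
  seq-^ x zero    n = refl
  seq-^ x (suc m) n = cong (seq x n *_) (seq-^ x m n)

  seq-partialSum : ∀ a n i → seq (partialSum a n) i ≡ Σ (λ k → seq (a k) i) n
  seq-partialSum a zero    i = refl
  seq-partialSum a (suc n) i = cong (_+ seq (a n) i) (seq-partialSum a n i)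

  ^-double : ∀ q k → q ^ (2 ℕ.* k) ≡ (q * q) ^ k
  ^-double q k = trans (cong (q ^_) (cong (k ℕ.+_) (ℕₚ.+-identityʳ k))) (trans (^-homo-* q k k) (sym (^-distrib-* q q k)))

  ιℤ-sign : ∀ k → ιℤ (ℤ.-1ℤ ℤ.^ k) ≡ sign k
  ιℤ-sign zero    = ι1
  ιℤ-sign (suc k) = trans (ιℤ-* ℤ.-1ℤ (ℤ.-1ℤ ℤ.^ k)) (cong₂ _*_ ιℤ-1 (ιℤ-sign k))

  hasSum-close : ∀ {a s} (f : ℚ → ℕ → ℚ) x → (∀ n i → seq (partialSum a n) i ≡ f (seq x i) n) → HasSum a s →
                 ∀ {ε} → 0ℚ < ε → Eventually (λ n → Eventually (λ i → ∣ f (seq x i) n - seq s i ∣ < ε))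
  hasSum-close {a} {s} f x eq lim {ε} 0<ε = mapᴱ inner (lim 0<ε)
    where
    inner : ∀ n → Real.∣ partialSum a n Real.- s ∣ Real.< fromℚ ε → Eventually (λ i → ∣ f (seq x i) n - seq s i ∣ < ε)
    inner n (ε′ , 0<ε′ , N , h) = N , λ i N≤i →
      <-≤-trans (<-diff 0<ε′ refl) (subst (λ z → ∣ z - seq s i ∣ + ε′ ≤ ε) (eq n i) (h i N≤i))

  -- The partial sums are constant sequences, so the rational sequence formed by them is already a
  -- representative of the limit.
  hasSum-rational : ∀ {a} s → (∀ n i → seq (partialSum a n) i ≡ seq s n) → HasSum a s
  hasSum-rational {a} s eq {ε} 0<ε =
    let N , close = cauchy s (Real.half-pos 0<ε)
    in N , λ n N≤n → ε * ½ , Real.half-pos 0<ε , N , λ i N≤i →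
      subst₂ (λ y z → ∣ y - seq s i ∣ + ε * ½ ≤ z) (sym (eq n i)) (Real.half+half ε)
        (+-monoˡ-≤ (ε * ½) (<⇒≤ (close n i N≤n N≤i)))

  cosSeries expSeries : ℝ → ℕ → ℝ
  cosSeries x k = fromℚ ((ℤ.-1ℤ ℤ.^ k / ((2 ℕ.* k) !)) {{ℕₚ._!≢0 (2 ℕ.* k)}}) Real.* x Real.^ (2 ℕ.* k)
  expSeries x k = fromℚ ((+ 1 / (k !)) {{ℕₚ._!≢0 k}}) Real.* x Real.^ k

  seq-cosSeries : ∀ x n i → seq (partialSum (cosSeries x) n) i ≡ cosSum (seq x i * seq x i) n
  seq-cosSeries x n i = trans (seq-partialSum (cosSeries x) n i) (Σ-cong n term)
    where
    term : ∀ k → seq (cosSeries x k) i ≡ sign k * cosTerm (seq x i * seq x i) k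
    term k = trans (cong₂ _*_ (trans (z/n (ℤ.-1ℤ ℤ.^ k) ((2 ℕ.* k) !) {{ℕₚ._!≢0 (2 ℕ.* k)}}) (cong (_* recip ((2 ℕ.* k) !)) (ιℤ-sign k)))
        (trans (seq-^ x (2 ℕ.* k) i) (^-double (seq x i) k)))
      (solve 3 (λ s r u → s :* r :* u := s :* (u :* r)) refl (sign k) (recip ((2 ℕ.* k) !)) ((seq x i * seq x i) ^ k))

  seq-expSeries : ∀ x n i → seq (partialSum (expSeries x) n) i ≡ expSum (seq x i) n
  seq-expSeries x n i = trans (seq-partialSum (expSeries x) n i) (Σ-cong n term)
    where
    term : ∀ k → seq (expSeries x k) i ≡ expTerm (seq x i) k
    term k = trans (cong₂ _*_ (trans (z/n (+ 1) (k !) {{ℕₚ._!≢0 k}}) (trans (cong (_* recip (k !)) ι1) (*-identityˡ (recip (k !))))) (seq-^ x k i))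
      (*-comm (recip (k !)) (seq x i ^ k))

  cos-close : ∀ {x y} → IsCos x y → ∀ {ε} → 0ℚ < ε →
              Eventually (λ n → Eventually (λ i → ∣ cosSum (seq x i * seq x i) n - seq y i ∣ < ε))
  cos-close {x} {y} = hasSum-close {cosSeries x} {y} (λ q → cosSum (q * q)) x (seq-cosSeries x)

  exp-close : ∀ {x y} → IsExp x y → ∀ {ε} → 0ℚ < ε →
              Eventually (λ n → Eventually (λ i → ∣ expSum (seq x i) n - seq y i ∣ < ε))
  exp-close {x} {y} = hasSum-close {expSeries x} {y} expSum x (seq-expSeries x)

  -- cos x exists for rational x with x² ≤ 3, where its terms are halved from the second on.
  module _ {x : ℚ} (0≤x : 0ℚ ≤ x) (2x²≤6 : x * x + x * x ≤ ι 6) where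
    private
      u : ℚ
      u = x * x
      0≤u : 0ℚ ≤ u
      0≤u = *-nonNeg 0≤x 0≤x
      u≤6 : u ≤ ι 6
      u≤6 = ≤-trans (≤-diff 0≤u refl) 2x²≤6
      0≤t : ∀ j → 0ℚ ≤ cosTerm u j
      0≤t j = *-nonNeg (^-nonNeg j 0≤u) (0≤cosCoefficient j)

    cosTerm-halving : ∀ j → cosTerm u (2 ℕ.+ j) + cosTerm u (2 ℕ.+ j) ≤ cosTerm u (suc j)
    cosTerm-halving j = begin
      u * p * c₂ + u * p * c₂       ≡⟨ solve 3 (λ u p c → u :* p :* c :+ u :* p :* c := p :* ((u :+ u) :* c)) refl u p c₂ ⟩
      p * ((u + u) * c₂)            ≤⟨ *-monoˡ p (^-nonNeg (suc j) 0≤u) (≤-trans (*-monoʳ c₂ (0≤cosCoefficient (2 ℕ.+ j)) 2x²≤6) (6*cosCoefficient≤ j)) ⟩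
      p * cosCoefficient (suc j)    ∎
      where
      open ℚₚ.≤-Reasoning
      p = u ^ suc j
      c₂ = cosCoefficient (2 ℕ.+ j)

    -- Halving makes j + 1 times the term nonincreasing; decay like 1/j is the form that
    -- `cauchy-tail` asks for.
    cosTerm-bound : ∀ j → cosTerm u (suc j) ≤ ι 6 * recip (suc j)
    cosTerm-bound j = *-cancelʳ (ι (suc j)) (0<ι (suc j)) (begin
      cosTerm u (suc j) * ι (suc j)                ≤⟨ decay j ⟩
      cosTerm u 1                                  ≤⟨ cosTerm1 ⟩
      ι 6                                          ≡⟨ *-identityʳ (ι 6) ⟨
      ι 6 * 1ℚ                                     ≡⟨ cong (ι 6 *_) (recip*ι (suc j)) ⟨
      ι 6 * (recip (suc j) * ι (suc j))            ≡⟨ *-assoc (ι 6) (recip (suc j)) (ι (suc j)) ⟨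
      ι 6 * recip (suc j) * ι (suc j)              ∎)
      where
      open ℚₚ.≤-Reasoning
      cosTerm1 : cosTerm u 1 ≤ ι 6
      cosTerm1 = ≤-trans (*-monoˡ (u * 1ℚ) (*-nonNeg 0≤u 0≤1) (recip≤1 2))
        (≤-trans (≤-reflexive (solve 1 (λ u → u :* con 1ℚ :* con 1ℚ := u) refl u)) u≤6)
      decay : ∀ j → cosTerm u (suc j) * ι (suc j) ≤ cosTerm u 1
      decay zero    = ≤-reflexive (trans (cong (cosTerm u 1 *_) ι1) (*-identityʳ (cosTerm u 1)))
      decay (suc j) = begin
        t * ι (2 ℕ.+ j)                            ≤⟨ *-monoˡ t (0≤t (2 ℕ.+ j)) (ι-mono-≤ (ℕ.s≤s (ℕₚ.m≤n+m (suc j) j))) ⟩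
        t * ι (suc j ℕ.+ suc j)                    ≡⟨ cong (t *_) (ι-+ (suc j) (suc j)) ⟩
        t * (ι (suc j) + ι (suc j))                ≡⟨ solve 2 (λ t n → t :* (n :+ n) := (t :+ t) :* n) refl t (ι (suc j)) ⟩
        (t + t) * ι (suc j)                        ≤⟨ *-monoʳ (ι (suc j)) (0≤ι (suc j)) (cosTerm-halving j) ⟩
        cosTerm u (suc j) * ι (suc j)              ≤⟨ decay j ⟩
        cosTerm u 1                                ∎
        where t = cosTerm u (2 ℕ.+ j)

    cosSum-tail : ∀ N .{{_ : ℕ.NonZero N}} k → ∣ cosSum u (N ℕ.+ k) - cosSum u N ∣ ≤ ι 6 * recip N
    cosSum-tail N@(suc j) k = begin
      ∣ cosSum u (N ℕ.+ k) - cosSum u N ∣          ≡⟨ cong (λ z → ∣ z - cosSum u N ∣) (alternating-split (cosTerm u) N k) ⟩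
      ∣ cosSum u N + sign N * a - cosSum u N ∣     ≡⟨ cong ∣_∣ (solve 2 (λ c s → c :+ s :- c := s) refl (cosSum u N) (sign N * a)) ⟩
      ∣ sign N * a ∣                               ≤⟨ ∣*∣≤ {sign N} {a} (∣sign∣ N) (0≤⇒∣∣≤ (proj₁ bounds) (proj₂ bounds)) ⟩
      1ℚ * cosTerm u (N ℕ.+ 0)                     ≡⟨ trans (*-identityˡ (cosTerm u (N ℕ.+ 0))) (cong (cosTerm u) (ℕₚ.+-identityʳ N)) ⟩
      cosTerm u N                                  ≤⟨ cosTerm-bound j ⟩
      ι 6 * recip N                                ∎
      where
      open ℚₚ.≤-Reasoning
      a : ℚ
      a = alternating (λ i → cosTerm u (N ℕ.+ i)) k
      bounds : 0ℚ ≤ a × a ≤ cosTerm u (N ℕ.+ 0)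
      bounds = alternating-bounds (λ i → cosTerm u (N ℕ.+ i)) k (λ i → 0≤t (N ℕ.+ i))
        (λ i → subst (λ m → cosTerm u m ≤ cosTerm u (N ℕ.+ i)) (sym (ℕₚ.+-suc N i))
          (≤-trans (≤-diff (0≤t (2 ℕ.+ (j ℕ.+ i))) refl) (cosTerm-halving (j ℕ.+ i))))
      ∣sign∣ : ∀ n → ∣ sign n ∣ ≤ 1ℚ
      ∣sign∣ zero    = ≤-refl
      ∣sign∣ (suc n) = ∣*∣≤ { - 1ℚ} {sign n} (≤-refl {1ℚ}) (∣sign∣ n)

    cosReal : ℝ
    cosReal = mkℝ (cosSum u) (cauchy-tail {cosSum u} 6 cosSum-tail)

    isCos-cosReal : IsCos (fromℚ x) cosReal
    isCos-cosReal = hasSum-rational {cosSeries (fromℚ x)} cosReal (seq-cosSeries (fromℚ x))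

  -- If 0 ≤ x ≤ c, then the partial sums of cos at x are at least those at c, hence at least κ,
  -- whereas cos x = 0 makes them smaller than κ.
  ¬cosZero≤ : ∀ {x c κ n₀} → IsCos x Real.0ℝ → Eventually (λ i → 0ℚ ≤ seq x i) →
              0ℚ < κ → c * c + c * c ≤ ι 6 → (∀ n → κ ≤ cosSum (c * c) (n₀ ℕ.+ n)) → ¬ Eventually (λ i → seq x i ≤ c)
  ¬cosZero≤ {x} {c} {κ} {n₀} cos≡0 0≤x 0<κ 2c²≤6 κ≤cos below = finish (cos-close {x} {Real.0ℝ} cos≡0 0<κ)
    where
    absurd : ∀ n y → κ ≤ cosSum (c * c) n → ∣ cosSum (y * y) n - 0ℚ ∣ < κ × 0ℚ ≤ y × y ≤ c → ⊥
    absurd n y κ≤ (near , 0≤y , y≤c) = <-irrefl refl (begin-strict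
      κ                            ≤⟨ κ≤ ⟩
      cosSum (c * c) n             ≤⟨ cosSum-antitone {c * c} {y * y} (*-nonNeg 0≤y 0≤y) y²≤c² (≤-trans (+-monoʳ-≤ (c * c) y²≤c²) 2c²≤6) n ⟩
      cosSum (y * y) n             ≡⟨ +-identityʳ (cosSum (y * y) n) ⟨
      cosSum (y * y) n - 0ℚ        ≤⟨ ∣∣≤⇒≤ {cosSum (y * y) n - 0ℚ} ≤-refl ⟩
      ∣ cosSum (y * y) n - 0ℚ ∣    <⟨ near ⟩
      κ                            ∎)
      where
      open ℚₚ.≤-Reasoning
      y²≤c² : y * y ≤ c * c
      y²≤c² = *-mono 0≤y 0≤y y≤c y≤c
    finish : Eventually (λ n → Eventually (λ i → ∣ cosSum (seq x i * seq x i) n - 0ℚ ∣ < κ)) → ⊥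
    finish (N , close) = never (both (close (n₀ ℕ.+ N) (ℕₚ.m≤n+m N n₀)) (both 0≤x below)) (λ i → absurd (n₀ ℕ.+ N) (seq x i) (κ≤cos N))

  isPi-positive : ∀ {π y c δ} → IsPi π → 0ℚ ≤ c → 0ℚ < δ → Eventually (λ i → c + δ ≤ seq π i * ½) → IsCos (fromℚ c) y → Real.0ℝ Real.< y
  isPi-positive {π} {y} {c} {δ} (_ , _ , cos-positive) 0≤c 0<δ (M , above) isCos = cos-positive {fromℚ c} {y}
    (λ {ε} 0<ε → 0 , λ _ _ → ≤-trans 0≤c (≤-diff (<⇒≤ 0<ε) refl)) (δ , 0<δ , M , above) (λ {ε} → isCos {ε})

  -- If c were below π/2, then cos c would be positive by `IsPi`. Applying that clause takes cos c
  -- as a real number, which is `cosReal`; its late terms are at most -κ.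
  ¬≤halfPi : ∀ {π c δ κ n₀} → IsPi π → 0ℚ < κ → 0ℚ < δ → 0ℚ ≤ c → c * c + c * c ≤ ι 6 → (∀ n → cosSum (c * c) (n₀ ℕ.+ n) ≤ - κ) →
              ¬ Eventually (λ i → c + δ ≤ seq π i * ½)
  ¬≤halfPi {π} {c} {δ} {κ} {n₀} isPi 0<κ 0<δ 0≤c 2c²≤6 cos≤-κ above = finish
    (isPi-positive {π} {cosReal 0≤c 2c²≤6} {c} {δ} isPi 0≤c 0<δ above (λ {ε} → isCos-cosReal 0≤c 2c²≤6 {ε}))
    where
    open ℚₚ.≤-Reasoning
    finish : Real.0ℝ Real.< cosReal 0≤c 2c²≤6 → ⊥
    finish (ε , 0<ε , N , h) = <-irrefl refl (begin-strict
      0ℚ                            <⟨ 0<ε ⟩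
      ε                             ≡⟨ +-identityˡ ε ⟨
      0ℚ + ε                        ≤⟨ h (n₀ ℕ.+ N) (ℕₚ.m≤n+m N n₀) ⟩
      cosSum (c * c) (n₀ ℕ.+ N)     ≤⟨ cos≤-κ N ⟩
      - κ                           ≤⟨ neg-antimono-≤ (<⇒≤ 0<κ) ⟩
      0ℚ                            ∎)

-- Locating square roots and logarithms by rational comparison.

module SqrtAndLog where
  open ℚ
  open Rationals
  open CosExpSeries
  open RealSequences
  open Real using (ℝ; seq; cauchy; fromℚ; fromℕ; IsExp; IsSqrt)

  module _ {s : ℝ} {q : ℕ} (isSqrt : IsSqrt (fromℕ q) s) where

    -- 0 ≤ s yields only -1 ≤ s n for late n; together with 1 ≤ l this makes l + s n nonnegative, so
    -- l² - s² = (l - s)(l + s) has the sign of l - s.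
    sqrt-≥ : ∀ {l ε} → 1ℚ ≤ l → 0ℚ < ε → l * l + ε < ι q → Eventually (λ n → l ≤ seq s n)
    sqrt-≥ {l} {ε} 1≤l 0<ε l²+ε<q = mapᴱ bound (both (proj₁ isSqrt (positive⁻¹ 1ℚ)) (proj₂ (proj₂ isSqrt) 0<ε))
      where
      open ℚₚ.≤-Reasoning
      bound : ∀ n → 0ℚ ≤ seq s n + 1ℚ × seq (fromℕ q) n ≤ seq s n * seq s n + ε → l ≤ seq s n
      bound n (-1≤s , q≤s²+ε) with ≤-total l (seq s n)
      ... | inj₁ l≤s = l≤s
      ... | inj₂ s≤l = ⊥-elim (<-irrefl refl (begin-strict
        ι q                    ≡⟨ ιℤ-/1 _ ⟩
        seq (fromℕ q) n        ≤⟨ q≤s²+ε ⟩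
        seq s n * seq s n + ε  ≤⟨ +-monoˡ-≤ ε (≤-diff {p = seq s n * seq s n} {r = (l - seq s n) * (l + seq s n)} (*-nonNeg (p≤q⇒0≤q-p s≤l) (≤-trans -1≤s (subst (_≤ l + seq s n) (+-comm 1ℚ (seq s n)) (+-monoˡ-≤ (seq s n) 1≤l))))
                                    (solve 2 (λ s l → s :* s :+ (l :- s) :* (l :+ s) := l :* l) refl (seq s n) l)) ⟩
        l * l + ε              <⟨ l²+ε<q ⟩
        ι q                    ∎))

    sqrt-≤ : ∀ {h ε} → 0ℚ ≤ h → 0ℚ < ε → ι q + ε < h * h → Eventually (λ n → seq s n ≤ h)
    sqrt-≤ {h} {ε} 0≤h 0<ε q+ε<h² = mapᴱ bound (proj₁ (proj₂ isSqrt) 0<ε)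
      where
      open ℚₚ.≤-Reasoning
      bound : ∀ n → seq s n * seq s n ≤ seq (fromℕ q) n + ε → seq s n ≤ h
      bound n s²≤q+ε with ≤-total (seq s n) h
      ... | inj₁ s≤h = s≤h
      ... | inj₂ h≤s = ⊥-elim (<-irrefl refl (begin-strict
        h * h                  ≤⟨ *-mono 0≤h 0≤h h≤s h≤s ⟩
        seq s n * seq s n      ≤⟨ s²≤q+ε ⟩
        seq (fromℕ q) n + ε    ≡⟨ cong (_+ ε) (ιℤ-/1 _) ⟨
        ι q + ε                <⟨ q+ε<h² ⟩
        h * h                  ∎))

  module _ {ℓ w : ℝ} (isExp : IsExp ℓ w) where

    private
      bounded : ∃[ Y ] Eventually (λ i → - ι Y ≤ seq ℓ i)
      bounded = let B , _ , N , h = Real.eventually-bounded (cauchy ℓ)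
                    Y , B≤Y = ≤ι B
                in Y , N , λ i N≤i → ∣∣≤⇒-≤ (≤-trans (h i N≤i) B≤Y)

    -- An upper bound c for ℓ does not exclude negative arguments, where partial sums of exp are not
    -- monotone. Arguments ≥ 0 are compared with c, and arguments ≤ 0 are covered by
    -- `expSum-negative` and 2 ≤ u.
    ¬log≤ : ∀ {c u w₁ κ n₀} → (∀ n → expSum c (n₀ ℕ.+ n) ≤ u) → 1ℚ + 1ℚ ≤ u → 0ℚ < κ → u + κ ≤ w₁ →
            Eventually (λ i → w₁ ≤ seq w i) → ¬ Eventually (λ i → seq ℓ i ≤ c)
    ¬log≤ {c} {u} {w₁} {κ} {n₀} exp≤u 2≤u 0<κ u+κ≤w₁ w₁≤w below = finish bounded (exp-close {ℓ} {w} isExp 0<κ)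
      where
      open ℚₚ.≤-Reasoning
      module _ (Y N : ℕ) where
        open ExpNegative Y
        N₂ k : ℕ
        N₂ = proj₁ (≤ι (A * A))
        k = n₀ ℕ.+ (N ℕ.+ N₂)
        N≤ : N ℕ.≤ suc k
        N≤ = ℕₚ.≤-trans (ℕₚ.m≤m+n N N₂) (ℕₚ.≤-trans (ℕₚ.m≤n+m (N ℕ.+ N₂) n₀) (ℕₚ.n≤1+n k))
        N₂≤ : N₂ ℕ.≤ suc k
        N₂≤ = ℕₚ.≤-trans (ℕₚ.m≤n+m N₂ N) (ℕₚ.≤-trans (ℕₚ.m≤n+m (N ℕ.+ N₂) n₀) (ℕₚ.n≤1+n k))
        exp≤ : ∀ y → - ι Y ≤ y → y ≤ c → y ≤ 0ℚ ⊎ 0ℚ ≤ y → expSum y (suc k) ≤ u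
        exp≤ y -Y≤y y≤c (inj₁ y≤0) = ≤-trans (subst (λ z → expSum z (suc k) ≤ 1ℚ + 1ℚ) (solve 1 (λ y → :- :- y := y) refl y)
          (expSum-negative N₂ (proj₂ (≤ι (A * A))) { - y} k N₂≤ (neg-antimono-≤ y≤0)
            (subst (- y ≤_) (solve 1 (λ y → :- :- y := y) refl (ι Y)) (neg-antimono-≤ -Y≤y)))) 2≤u
        exp≤ y -Y≤y y≤c (inj₂ 0≤y) = ≤-trans (expSum-mono (suc k) 0≤y y≤c) (subst (λ m → expSum c m ≤ u) (ℕₚ.+-suc n₀ (N ℕ.+ N₂)) (exp≤u (suc (N ℕ.+ N₂))))
      absurd : ∀ n y z → expSum y n ≤ u → ∣ expSum y n - z ∣ < κ → w₁ ≤ z → ⊥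
      absurd n y z exp≤u near w₁≤z = <-irrefl refl (begin-strict
        z                                ≡⟨ solve 2 (λ e z → z := e :- (e :- z)) refl (expSum y n) z ⟩
        expSum y n - (expSum y n - z)    ≤⟨ +-monoʳ-≤ (expSum y n) (neg-antimono-≤ (∣∣≤⇒-≤ {expSum y n - z} ≤-refl)) ⟩
        expSum y n - - ∣ expSum y n - z ∣ ≡⟨ solve 2 (λ e a → e :- (:- a) := e :+ a) refl (expSum y n) ∣ expSum y n - z ∣ ⟩
        expSum y n + ∣ expSum y n - z ∣  <⟨ +-mono-≤-< exp≤u near ⟩
        u + κ                            ≤⟨ u+κ≤w₁ ⟩
        w₁                               ≤⟨ w₁≤z ⟩
        z                                ∎)
      finish : (∃[ Y ] Eventually (λ i → - ι Y ≤ seq ℓ i)) → Eventually (λ n → Eventually (λ i → ∣ expSum (seq ℓ i) n - seq w i ∣ < κ)) → ⊥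
      finish (Y , -Y≤ℓ) (N , close) = never (both (close (suc (k Y N)) (N≤ Y N)) (both w₁≤w (both -Y≤ℓ below)))
        λ i (near , w₁≤ , -Y≤ , ≤c) → absurd (suc (k Y N)) (seq ℓ i) (seq w i)
          (exp≤ Y N (seq ℓ i) -Y≤ ≤c (≤-total (seq ℓ i) 0ℚ)) near w₁≤

    ¬≤log : ∀ {c v w₂ κ n₀} → 0ℚ ≤ c → (∀ n → v ≤ expSum c (n₀ ℕ.+ n)) → 0ℚ < κ → w₂ + κ ≤ v →
            Eventually (λ i → seq w i ≤ w₂) → ¬ Eventually (λ i → c ≤ seq ℓ i)
    ¬≤log {c} {v} {w₂} {κ} {n₀} 0≤c v≤exp 0<κ w₂+κ≤v w≤w₂ above = finish (exp-close {ℓ} {w} isExp 0<κ)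
      where
      open ℚₚ.≤-Reasoning
      absurd : ∀ n y z → v ≤ expSum c n → ∣ expSum y n - z ∣ < κ × z ≤ w₂ × c ≤ y → ⊥
      absurd n y z v≤ (near , z≤w₂ , c≤y) = <-irrefl refl (begin-strict
        w₂ + κ                           ≤⟨ w₂+κ≤v ⟩
        v                                ≤⟨ v≤ ⟩
        expSum c n                       ≤⟨ expSum-mono n 0≤c c≤y ⟩
        expSum y n                       ≡⟨ solve 2 (λ e z → e := z :+ (e :- z)) refl (expSum y n) z ⟩
        z + (expSum y n - z)             ≤⟨ +-monoʳ-≤ z (∣∣≤⇒≤ {expSum y n - z} ≤-refl) ⟩
        z + ∣ expSum y n - z ∣           <⟨ +-mono-≤-< z≤w₂ near ⟩
        w₂ + κ                           ∎)
      finish : Eventually (λ n → Eventually (λ i → ∣ expSum (seq ℓ i) n - seq w i ∣ < κ)) → ⊥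
      finish (N , close) = never (both (close (n₀ ℕ.+ N) (ℕₚ.m≤n+m N n₀)) (both w≤w₂ above)) (λ i → absurd (n₀ ℕ.+ N) (seq ℓ i) (seq w i) (v≤exp N))

-- Computing enclosures of cosine and exponential sums at fractions.

module CosExpEvaluation where
  open ℚ
  open Rationals
  open Intervals
  open Sieves using (Σ-head)
  open CosExpSeries

  fraction : ℕ → ℕ → ℚ
  fraction m n = ι m * recip n

  fraction-≤ : ∀ a m b n .{{_ : ℕ.NonZero m}} .{{_ : ℕ.NonZero n}} → a ℕ.* n ℕ.≤ b ℕ.* m → fraction a m ≤ fraction b n
  fraction-≤ a m b n h = *-cancelʳ (ι m * ι n) (*-pos (0<ι m) (0<ι n)) (begin
    ι a * recip m * (ι m * ι n)      ≡⟨ solve 4 (λ a r m n → a :* r :* (m :* n) := a :* n :* (m :* r)) refl (ι a) (recip m) (ι m) (ι n) ⟩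
    ι a * ι n * (ι m * recip m)      ≡⟨ cong₂ _*_ (sym (ι-* a n)) (ι*recip m) ⟩
    ι (a ℕ.* n) * 1ℚ                 ≤⟨ *-monoʳ 1ℚ 0≤1 (ι-mono-≤ h) ⟩
    ι (b ℕ.* m) * 1ℚ                 ≡⟨ cong₂ _*_ (ι-* b m) (sym (ι*recip n)) ⟩
    ι b * ι m * (ι n * recip n)      ≡⟨ solve 4 (λ b r m n → b :* m :* (n :* r) := b :* r :* (m :* n)) refl (ι b) (recip n) (ι m) (ι n) ⟩
    ι b * recip n * (ι m * ι n)      ∎)
    where open ℚₚ.≤-Reasoning

  0≤fraction : ∀ m n → 0ℚ ≤ fraction m n
  0≤fraction m n = *-nonNeg (0≤ι m) (0≤recip n)

  0<fraction : ∀ m n .{{_ : ℕ.NonZero m}} .{{_ : ℕ.NonZero n}} → 0ℚ < fraction m n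
  0<fraction m n = *-pos (0<ι m) (0<recip n)

  fraction-+ : ∀ a b n → fraction (a ℕ.+ b) n ≡ fraction a n + fraction b n
  fraction-+ a b n = trans (cong (_* recip n) (ι-+ a b)) (*-distribʳ-+ (recip n) (ι a) (ι b))

  fraction-* : ∀ a m b n → fraction a m * fraction b n ≡ fraction (a ℕ.* b) (m ℕ.* n)
  fraction-* a m b n = trans (solve 4 (λ a m b n → a :* m :* (b :* n) := a :* b :* (m :* n)) refl (ι a) (recip m) (ι b) (recip n))
    (sym (cong₂ _*_ (ι-* a b) (recip-* m n)))

  cosTerm-fraction : ∀ l S j → let u = fraction l S * fraction l S in
    cosTerm u (suc j) ≡ cosTerm u j * fraction (l ℕ.* l) (S ℕ.* S ℕ.* cosDenominator j)
  cosTerm-fraction l S j = begin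
    u * u ^ j * cosCoefficient (suc j)                              ≡⟨ cong (u * u ^ j *_) (cosCoefficient-suc j) ⟩
    u * u ^ j * (cosCoefficient j * recip (cosDenominator j))       ≡⟨ solve 4 (λ u p c r → u :* p :* (c :* r) := p :* c :* (u :* r)) refl u (u ^ j) (cosCoefficient j) (recip (cosDenominator j)) ⟩
    cosTerm u j * (u * recip (cosDenominator j))                    ≡⟨ cong (cosTerm u j *_) (trans (cong (_* recip (cosDenominator j)) (fraction-* l S l S))
                                                                         (trans (*-assoc (ι (l ℕ.* l)) (recip (S ℕ.* S)) (recip (cosDenominator j))) (cong (ι (l ℕ.* l) *_) (sym (recip-* (S ℕ.* S) (cosDenominator j)))))) ⟩
    cosTerm u j * fraction (l ℕ.* l) (S ℕ.* S ℕ.* cosDenominator j) ∎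
    where
    open ≡-Reasoning
    u = fraction l S * fraction l S

  expTerm-fraction : ∀ l S j → expTerm (fraction l S) (suc j) ≡ expTerm (fraction l S) j * fraction l (S ℕ.* suc j)
  expTerm-fraction l S j = trans (expTerm-suc (fraction l S) j) (cong (expTerm (fraction l S) j *_)
    (trans (*-assoc (ι l) (recip S) (recip (suc j))) (cong (ι l *_) (sym (recip-* S (suc j))))))

  module SeriesEvaluation (D : ℕ) .{{D≢0 : ℕ.NonZero D}} where
    open FixedPoint D

    -- Swapping the pair at every term collects positive and negative terms apart, so that no signed
    -- intervals arise.
    prepend : Interval → Interval × Interval → Interval × Interval
    prepend T (P , N) = T +ᴵ N , P

    -- p / q j is the ratio of the terms with index j + 1 and j.
    evenOdd : ℕ → (ℕ → ℕ) → ℕ → ℕ → Interval → Interval × Interval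
    evenOdd p q zero    j T = 0 ‥ 0 , 0 ‥ 0
    evenOdd p q (suc n) j T = prepend T (evenOdd p q n (suc j) (scale p (q j) T))

    total : ℕ → (ℕ → ℕ) → (Interval → Interval) → ℕ → ℕ → Interval → Interval
    total p q e zero    j T = e T
    total p q e (suc n) j T = T +ᴵ total p q e n (suc j) (scale p (q j) T)

    ∈-0 : 0ℚ ∈ (0 ‥ 0)
    ∈-0 = ≤-reflexive (trans ι0 (sym (*-zeroˡ (ι D)))) , ≤-reflexive (trans (*-zeroˡ (ι D)) (sym ι0))

    module _ (p : ℕ) (q : ℕ → ℕ) (q≢0 : ∀ j → ℕ.NonZero (q j)) where

      Ratio : (ℕ → ℚ) → ℕ → Set
      Ratio g j = ∀ i → g (suc i) ≡ g i * fraction p (q (j ℕ.+ i))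

      ratio-suc : ∀ {g} j → Ratio g j → Ratio (g ∘ suc) (suc j)
      ratio-suc {g} j h i = trans (h (suc i)) (cong (λ m → g (suc i) * fraction p (q m)) (ℕₚ.+-suc j i))

      next : ∀ {g} j T → Ratio g j → g 0 ∈ T → g 1 ∈ scale p (q j) T
      next {g} j T h g∈T = ∈-subst (sym (trans (h 0) (cong (λ m → g 0 * fraction p (q m)) (ℕₚ.+-identityʳ j))))
        (∈-scale T p (q j) {{q≢0 j}} g∈T)

      evenOdd-sound : ∀ g n j T → Ratio g j → g 0 ∈ T → let P , N = evenOdd p q n j T in
                      ∃[ a ] ∃[ b ] a ∈ P × b ∈ N × alternating g n ≡ a - b
      evenOdd-sound g zero    j T h g∈T = 0ℚ , 0ℚ , ∈-0 , ∈-0 , refl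
      evenOdd-sound g (suc n) j T h g∈T =
        let T′ = scale p (q j) T
            a , b , a∈P , b∈N , eq = evenOdd-sound (g ∘ suc) n (suc j) T′ (ratio-suc {g} j h) (next {g} j T h g∈T)
        in g 0 + b , a , ∈-+ T (proj₂ (evenOdd p q n (suc j) T′)) g∈T b∈N , a∈P ,
           trans (alternating-suc g n) (trans (cong (λ z → g 0 - z) eq) (solve 3 (λ g a b → g :- (a :- b) := g :+ b :- a) refl (g 0) a b))

      total-sound : ∀ g e (f : ℚ → ℚ) n j T → (∀ {y : ℚ} I → y ∈ I → f y ∈ e I) → Ratio g j → g 0 ∈ T → Σ g n + f (g n) ∈ total p q e n j T
      total-sound g e f zero    j T he h g∈T = ∈-subst (sym (+-identityˡ (f (g 0)))) (he T g∈T)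
      total-sound g e f (suc n) j T he h g∈T = ∈-subst
        (trans (sym (+-assoc (g 0) (Σ (g ∘ suc) n) (f (g (suc n))))) (cong (_+ f (g (suc n))) (sym (Σ-head g n))))
        (∈-+ T (total p q e n (suc j) (scale p (q j) T)) g∈T
          (total-sound (g ∘ suc) e f n (suc j) (scale p (q j) T) he (ratio-suc {g} j h) (next {g} j T h g∈T)))

    -- Ends are integers, so a strict inequality is a gap of a full unit 1/D. This supplies the
    -- positive κ of the cosine bounds.
    separated : ∀ {a b P N} → a ∈ P → b ∈ N → hi N ℕ.< lo P → recip D ≤ a - b
    separated {a} {b} {P} {N} (lower , _) (_ , upper) N<P = *-cancelʳ (ι D) 0<D (begin
      recip D * ι D                  ≡⟨ recip*ι D ⟩
      1ℚ                             ≡⟨ solve 1 (λ n → con 1ℚ := con 1ℚ :+ n :- n) refl (ι (hi N)) ⟩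
      1ℚ + ι (hi N) - ι (hi N)       ≡⟨ cong (_- ι (hi N)) (ι-suc (hi N)) ⟨
      ι (suc (hi N)) - ι (hi N)      ≤⟨ +-mono-≤ (≤-trans (ι-mono-≤ N<P) lower) (neg-antimono-≤ upper) ⟩
      a * ι D - b * ι D              ≡⟨ solve 3 (λ a b d → a :* d :- b :* d := (a :- b) :* d) refl a b (ι D) ⟩
      (a - b) * ι D                  ∎)
      where open ℚₚ.≤-Reasoning

    module _ (S l : ℕ) .{{S≢0 : ℕ.NonZero S}} where
      private
        c : ℚ
        c = fraction l S

      cosInterval : ℕ → Interval × Interval
      cosInterval n = evenOdd (l ℕ.* l) (λ j → S ℕ.* S ℕ.* cosDenominator j) n 0 one

      private
        cos-sound : ∀ n → ∃[ a ] ∃[ b ] a ∈ proj₁ (cosInterval n) × b ∈ proj₂ (cosInterval n) × cosSum (c * c) n ≡ a - b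
        cos-sound n = evenOdd-sound (l ℕ.* l) (λ j → S ℕ.* S ℕ.* cosDenominator j)
          (λ j → ℕₚ.m*n≢0 (S ℕ.* S) (cosDenominator j) {{ℕₚ.m*n≢0 S S}})
          (cosTerm (c * c)) n 0 one (cosTerm-fraction l S) (∈-subst (sym (trans (*-identityˡ (recip 1)) recip1)) ∈-one)

      cosSum-positive : ∀ n → hi (proj₂ (cosInterval n)) ℕ.< lo (proj₁ (cosInterval n)) → recip D ≤ cosSum (c * c) n
      cosSum-positive n N<P = let a , b , a∈ , b∈ , eq = cos-sound n in subst (recip D ≤_) (sym eq) (separated a∈ b∈ N<P)

      cosSum-negative : ∀ n → hi (proj₁ (cosInterval n)) ℕ.< lo (proj₂ (cosInterval n)) → cosSum (c * c) n ≤ - recip D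
      cosSum-negative n P<N = let a , b , a∈ , b∈ , eq = cos-sound n in
        subst (_≤ - recip D) (trans (solve 2 (λ a b → :- (b :- a) := a :- b) refl a b) (sym eq)) (neg-antimono-≤ (separated b∈ a∈ P<N))

      -- With tail = 0 for lower bounds; twice the last term bounds the remaining sum from above.
      expLower expUpper : ℕ → Interval
      expLower n = total l (λ j → S ℕ.* suc j) (λ _ → 0 ‥ 0) n 0 one
      expUpper n = total l (λ j → S ℕ.* suc j) (λ I → I +ᴵ I) n 0 one

      private
        expTerm-0 : expTerm c 0 ∈ one
        expTerm-0 = ∈-subst (sym (trans (*-identityˡ (recip 1)) recip1)) ∈-one

      expLower-sound : ∀ n → expSum c n ∈ expLower n
      expLower-sound n = ∈-subst (+-identityʳ (expSum c n)) (total-sound l (λ j → S ℕ.* suc j) (λ j → ℕₚ.m*n≢0 S (suc j))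
        (expTerm c) (λ _ → 0 ‥ 0) (λ _ → 0ℚ) n 0 one (λ _ _ → ∈-0) (expTerm-fraction l S) expTerm-0)

      expUpper-sound : ∀ n → expSum c n + (expTerm c n + expTerm c n) ∈ expUpper n
      expUpper-sound n = total-sound l (λ j → S ℕ.* suc j) (λ j → ℕₚ.m*n≢0 S (suc j))
        (expTerm c) (λ I → I +ᴵ I) (λ y → y + y) n 0 one (λ I y∈I → ∈-+ I I y∈I y∈I) (expTerm-fraction l S) expTerm-0

-- Convergence of the Euler product, bounds on π/2, √2 and the logarithm, and the final quotient.

module ShanksConstant where
  open import Data.Integer as ℤ using (+_)
  open ℚ
  open Rationals
  open Intervals
  open Sieves using (onlyIf; Σ-recip²≤recip)
  open LocalComparison using (restrictedFactor; module EulerFactorBounds)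
  open PartialProductEnclosure using (partialProduct-Π)
  open CosExpSeries
  open CosExpEvaluation
  open RealSequences
  open SqrtAndLog
  open Real using (ℝ; mkℝ; seq; cauchy; IsCauchy; fromℚ; fromℕ; IsPi; IsSqrt; IsLog; IsEulerProduct; HasDecimals;
    eulerFactor; Prime≡1[8]; prime≡1[8]?; partialProduct)

  record NearOne (p : ℕ) (x : ℚ) : Set where
    constructor nearOne
    field
      lower : 0ℚ ≤ x
      upper : x ≤ 1ℚ
      gap   : 1ℚ - x ≤ ι 16 * recip p ^ 2
  open NearOne

  eulerFactor-nearOne : ∀ p → Prime≡1[8] p → NearOne p (eulerFactor p)
  eulerFactor-nearOne p (prime-p , p≡1) = go p 8≤p
    where
    8≤p : 8 ℕ.≤ p
    8≤p with ℕₚ.≤-<-connex 8 p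
    ... | inj₁ h = h
    ... | inj₂ p<8 = contradiction (subst Prime (trans (sym (ℕᵈ.m<n⇒m%n≡m p<8)) p≡1) prime-p) ¬prime[1]
    go : ∀ p → 8 ℕ.≤ p → NearOne p (eulerFactor p)
    go (suc (suc m)) 8≤p = nearOne (E.0≤eulerFactor) (E.eulerFactor≤1) (E.1-eulerFactor≤)
      where module E = EulerFactorBounds m 8≤p
    go (suc zero) (ℕ.s≤s ())

  restrictedFactor-nearOne : ∀ n → NearOne n (restrictedFactor n)
  restrictedFactor-nearOne n = go (prime≡1[8]? n)
    where
    go : (n? : Dec (Prime≡1[8] n)) → NearOne n (onlyIf n? (eulerFactor n))
    go (yes h) = eulerFactor-nearOne n h
    go (no _)  = nearOne 0≤1 ≤-refl (*-nonNeg (0≤ι 16) (^-nonNeg 2 (0≤recip n)))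

  Π-nearOne : ∀ n → 0ℚ ≤ Π restrictedFactor n × Π restrictedFactor n ≤ 1ℚ
  Π-nearOne zero    = 0≤1 , ≤-refl
  Π-nearOne (suc n) = let l , u = Π-nearOne n; h = restrictedFactor-nearOne n in
    *-nonNeg l (lower h) , *-mono {s = 1ℚ} l (lower h) u (upper h)

  Π-decrease : ∀ n k → Π restrictedFactor (n ℕ.+ k) ≤ Π restrictedFactor n ×
               Π restrictedFactor n - Π restrictedFactor (n ℕ.+ k) ≤ ι 16 * Σ (λ i → recip (n ℕ.+ i) ^ 2) k
  Π-decrease n zero rewrite ℕₚ.+-identityʳ n = ≤-refl ,
    ≤-reflexive (trans (+-inverseʳ (Π restrictedFactor n)) (sym (*-zeroʳ (ι 16))))
  Π-decrease n (suc k) rewrite ℕₚ.+-suc n k =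
    ≤-trans (subst (P * r ≤_) (*-identityʳ P) (*-monoˡ P (proj₁ bounds) (upper near))) (proj₁ (Π-decrease n k)) ,
    (begin
      P₀ - P * r                        ≡⟨ solve 3 (λ a p r → a :- p :* r := (a :- p) :+ p :* (con 1ℚ :- r)) refl P₀ P r ⟩
      P₀ - P + P * (1ℚ - r)             ≤⟨ +-mono-≤ (proj₂ (Π-decrease n k)) (*-mono {s = ι 16 * recip (n ℕ.+ k) ^ 2} (proj₁ bounds) (p≤q⇒0≤q-p (upper near)) (proj₂ bounds) (gap near)) ⟩
      ι 16 * Σ s k + 1ℚ * (ι 16 * s k)  ≡⟨ solve 3 (λ c a b → c :* a :+ con 1ℚ :* (c :* b) := c :* (a :+ b)) refl (ι 16) (Σ s k) (s k) ⟩
      ι 16 * (Σ s k + s k)              ∎)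
    where
    open ℚₚ.≤-Reasoning
    s : ℕ → ℚ
    s i = recip (n ℕ.+ i) ^ 2
    P₀ P r : ℚ
    P₀ = Π restrictedFactor n
    P = Π restrictedFactor (n ℕ.+ k)
    r = restrictedFactor (n ℕ.+ k)
    bounds : 0ℚ ≤ P × P ≤ 1ℚ
    bounds = Π-nearOne (n ℕ.+ k)
    near : NearOne (n ℕ.+ k) r
    near = restrictedFactor-nearOne (n ℕ.+ k)

  -- Shifted by one because the sum of 1/m² from N + 1 on is bounded by 1/N, the shape required by
  -- `cauchy-tail`.
  shifted-cauchy : IsCauchy (λ n → partialProduct (suc n))
  shifted-cauchy = cauchy-tail {λ n → partialProduct (suc n)} 16 tail
    where
    open ℚₚ.≤-Reasoning
    tail : ∀ N .{{_ : ℕ.NonZero N}} k → ∣ partialProduct (suc (N ℕ.+ k)) - partialProduct (suc N) ∣ ≤ ι 16 * recip N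
    tail N k = begin
      ∣ partialProduct (suc (N ℕ.+ k)) - partialProduct (suc N) ∣   ≡⟨ Real.∣p-q∣≡∣q-p∣ (partialProduct (suc (N ℕ.+ k))) (partialProduct (suc N)) ⟩
      ∣ partialProduct (suc N) - partialProduct (suc (N ℕ.+ k)) ∣   ≡⟨ cong₂ (λ a b → ∣ a - b ∣) (partialProduct-Π (suc N)) (partialProduct-Π (suc N ℕ.+ k)) ⟩
      ∣ Π restrictedFactor (suc N) - Π restrictedFactor (suc N ℕ.+ k) ∣ ≤⟨ 0≤⇒∣∣≤ (p≤q⇒0≤q-p (proj₁ (Π-decrease (suc N) k))) (proj₂ (Π-decrease (suc N) k)) ⟩
      ι 16 * Σ (λ i → recip (suc N ℕ.+ i) ^ 2) k                    ≤⟨ *-monoˡ (ι 16) (0≤ι 16) (Σ-recip²≤recip N k) ⟩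
      ι 16 * recip N                                                ∎

  partialProduct-cauchy : IsCauchy partialProduct
  partialProduct-cauchy {ε} 0<ε = let N , h = shifted-cauchy 0<ε in suc N , close N h
    where
    close : ∀ N → (∀ m n → N ℕ.≤ m → N ℕ.≤ n → ∣ partialProduct (suc m) - partialProduct (suc n) ∣ < ε) →
            ∀ m n → suc N ℕ.≤ m → suc N ℕ.≤ n → ∣ partialProduct m - partialProduct n ∣ < ε
    close N h (suc m) (suc n) (ℕ.s≤s N≤m) (ℕ.s≤s N≤n) = h m n N≤m N≤n

  eulerProduct : ℝ
  eulerProduct = mkℝ partialProduct partialProduct-cauchy

  isEulerProduct : IsEulerProduct eulerProduct
  isEulerProduct {ε} 0<ε =
    let N , close = partialProduct-cauchy (Real.half-pos 0<ε)
    in N , λ n N≤n → ε * ½ , Real.half-pos 0<ε , N , λ i N≤i →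
      subst (∣ partialProduct n - partialProduct i ∣ + ε * ½ ≤_) (Real.half+half ε)
        (+-monoˡ-≤ (ε * ½) (<⇒≤ (close n i N≤n N≤i)))

  -- Asking for the upper bound 0.d₁...dₖ9 leaves a gap 10⁻ᵏ⁻¹, the witness that the strict order on
  -- reals needs.
  hasDecimals : ∀ k x d → Eventually (λ n → fraction d (10 ℕ.^ k) ≤ seq x n × seq x n ≤ fraction (9 ℕ.+ 10 ℕ.* d) (10 ℕ.^ suc k)) →
                HasDecimals k x d
  hasDecimals k x d (N , h) =
    (λ {ε} 0<ε → N , λ n N≤n → subst (_≤ seq x n + ε) (sym d/10^k) (≤-trans (proj₁ (h n N≤n)) (≤-diff (<⇒≤ 0<ε) refl))) ,
    (fraction 1 (10 ℕ.^ suc k) , 0<fraction 1 (10 ℕ.^ suc k) {{_}} {{10^1+k≢0}} , N , λ n N≤n → begin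
      seq x n + fraction 1 (10 ℕ.^ suc k)                                  ≤⟨ +-monoˡ-≤ (fraction 1 (10 ℕ.^ suc k)) (proj₂ (h n N≤n)) ⟩
      fraction (9 ℕ.+ 10 ℕ.* d) (10 ℕ.^ suc k) + fraction 1 (10 ℕ.^ suc k) ≡⟨ fraction-+ (9 ℕ.+ 10 ℕ.* d) 1 (10 ℕ.^ suc k) ⟨
      fraction (9 ℕ.+ 10 ℕ.* d ℕ.+ 1) (10 ℕ.^ suc k)                       ≤⟨ fraction-≤ (9 ℕ.+ 10 ℕ.* d ℕ.+ 1) (10 ℕ.^ suc k) (d ℕ.+ 1) (10 ℕ.^ k) {{10^1+k≢0}} (ℕₚ.≤-reflexive carry) ⟩
      fraction (d ℕ.+ 1) (10 ℕ.^ k)                                        ≡⟨ fraction-+ d 1 (10 ℕ.^ k) ⟩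
      fraction d (10 ℕ.^ k) + fraction 1 (10 ℕ.^ k)                        ≡⟨ cong₂ _+_ (sym d/10^k) (sym (z/n (+ 1) (10 ℕ.^ k))) ⟩
      + d / 10 ℕ.^ k + + 1 / 10 ℕ.^ k                                      ∎)
    where
    open ℚₚ.≤-Reasoning
    instance
      10^k≢0 : ℕ.NonZero (10 ℕ.^ k)
      10^k≢0 = ℕₚ.m^n≢0 10 k
    10^1+k≢0 : ℕ.NonZero (10 ℕ.^ suc k)
    10^1+k≢0 = ℕₚ.m^n≢0 10 (suc k)
    d/10^k : + d / 10 ℕ.^ k ≡ fraction d (10 ℕ.^ k)
    d/10^k = z/n (+ d) (10 ℕ.^ k)
    carry : (9 ℕ.+ 10 ℕ.* d ℕ.+ 1) ℕ.* 10 ℕ.^ k ≡ (d ℕ.+ 1) ℕ.* 10 ℕ.^ suc k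
    carry = trans (cong (ℕ._* 10 ℕ.^ k) (trans (ℕₚ.+-comm (9 ℕ.+ 10 ℕ.* d) 1) (trans (sym (ℕₚ.*-suc 10 d)) (trans (ℕₚ.*-comm 10 (suc d)) (cong (ℕ._* 10) (ℕₚ.+-comm 1 d))))))
      (ℕₚ.*-assoc (d ℕ.+ 1) 10 (10 ℕ.^ k))

  Between : (S l h : ℕ) → (ℕ → ℚ) → Set
  Between S l h x = Eventually (λ n → fraction l S ≤ x n × x n ≤ fraction h S)

  fraction-double : ∀ S l .{{_ : ℕ.NonZero S}} → l ℕ.* l ℕ.+ l ℕ.* l ℕ.≤ 6 ℕ.* (S ℕ.* S) →
                    fraction l S * fraction l S + fraction l S * fraction l S ≤ ι 6
  fraction-double S l h = subst₂ _≤_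
    (trans (fraction-+ (l ℕ.* l) (l ℕ.* l) (S ℕ.* S)) (sym (cong₂ _+_ (fraction-* l S l S) (fraction-* l S l S))))
    (trans (cong (ι 6 *_) recip1) (*-identityʳ (ι 6)))
    (fraction-≤ (l ℕ.* l ℕ.+ l ℕ.* l) (S ℕ.* S) 6 1 {{ℕₚ.m*n≢0 S S}} (subst (ℕ._≤ 6 ℕ.* (S ℕ.* S)) (sym (ℕₚ.*-identityʳ _)) h))

  isPi-cos : ∀ {π} → IsPi π → Real.IsCos (π Real.* fromℚ ½) Real.0ℝ
  isPi-cos h = proj₁ (proj₂ h)

  isPi-≥ : ∀ {π} → IsPi π → Eventually (λ i → 0ℚ ≤ seq (π Real.* fromℚ ½) i)
  isPi-≥ {π} isPi = let ε , 0<ε , N , above = proj₁ isPi in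
    N , λ i N≤i → *-nonNeg (≤-trans (<⇒≤ 0<ε) (subst (_≤ seq π i) (+-identityˡ ε) (above i N≤i))) (nonNegative⁻¹ ½)

  -- Deciding by a late term costs 2δ below and δ above its threshold. Above, the threshold is b + δ
  -- rather than b, because the strict order in `IsPi` takes one δ; this explains a + 2δ and b + 3δ.
  halfPi-bounds : ∀ {a b δ κ n₁ n₂} → 0ℚ < δ → 0ℚ < κ → 0ℚ ≤ b →
    (a + δ + δ) * (a + δ + δ) + (a + δ + δ) * (a + δ + δ) ≤ ι 6 → b * b + b * b ≤ ι 6 →
    (∀ n → κ ≤ cosSum ((a + δ + δ) * (a + δ + δ)) (n₁ ℕ.+ n)) → (∀ n → cosSum (b * b) (n₂ ℕ.+ n) ≤ - κ) →
    ∀ π → IsPi π → Eventually (λ i → a ≤ seq π i * ½ × seq π i * ½ ≤ b + δ + δ + δ)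
  halfPi-bounds {a} {b} {δ} {κ} {n₁} {n₂} 0<δ 0<κ 0≤b 2a²≤6 2b²≤6 cos-a cos-b π isPi =
    both (eventually-≥ {x = λ i → seq π i * ½} (cauchy (π Real.* fromℚ ½)) 0<δ
        (¬cosZero≤ {π Real.* fromℚ ½} {a + δ + δ} {κ} {n₁} (isPi-cos {π} isPi) (isPi-≥ {π} isPi) 0<κ 2a²≤6 cos-a))
      (eventually-≤ {x = λ i → seq π i * ½} (cauchy (π Real.* fromℚ ½)) 0<δ
        (¬≤halfPi {π} {b} {δ} {κ} {n₂} isPi 0<κ 0<δ 0≤b 2b²≤6 cos-b))

  fraction-+1 : ∀ m n → fraction m n + fraction 1 n ≡ fraction (suc m) n
  fraction-+1 m n = trans (sym (fraction-+ m 1 n)) (cong (λ k → fraction k n) (ℕₚ.+-comm m 1))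

  module _ (D S : ℕ) .{{D≢0 : ℕ.NonZero D}} .{{S≢0 : ℕ.NonZero S}} where
    open SeriesEvaluation D

    CosPositive CosNegative : ℕ → ℕ → Set
    CosPositive l n = hi (proj₂ (cosInterval S l n)) ℕ.< lo (proj₁ (cosInterval S l n))
    CosNegative l n = hi (proj₁ (cosInterval S l n)) ℕ.< lo (proj₂ (cosInterval S l n))

    private
      square≤6 : ∀ {q} → 0ℚ ≤ q → q * q + q * q ≤ ι 6 → q * q ≤ ι 6
      square≤6 {q} 0≤q 2q²≤6 = ≤-trans (≤-diff {q * q} (*-nonNeg 0≤q 0≤q) refl) 2q²≤6

    module _ (l : ℕ) (2l²≤ : l ℕ.* l ℕ.+ l ℕ.* l ℕ.≤ 6 ℕ.* (S ℕ.* S)) where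
      private
        c : ℚ
        c = fraction l S
        0≤c : 0ℚ ≤ c
        0≤c = 0≤fraction l S
        c²≤6 : c * c ≤ ι 6
        c²≤6 = square≤6 0≤c (fraction-double S l 2l²≤)

      cos-≥ : ∀ m → CosPositive l (2 ℕ.* suc m) → ∀ n → recip D ≤ cosSum (c * c) (2 ℕ.* suc m ℕ.+ n)
      cos-≥ m h n = ≤-trans (cosSum-positive S l (2 ℕ.* suc m) h) (cosSum-even (*-nonNeg 0≤c 0≤c) c²≤6 m n)

      cos-≤ : ∀ m → CosNegative l (suc (2 ℕ.* m)) → ∀ n → cosSum (c * c) (suc (2 ℕ.* m) ℕ.+ n) ≤ - recip D
      cos-≤ m h n = ≤-trans (cosSum-odd (*-nonNeg 0≤c 0≤c) c²≤6 m n) (cosSum-negative S l (suc (2 ℕ.* m)) h)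

    halfPi-between : ∀ l h m₁ m₂ →
      let L = suc (suc l) in L ℕ.* L ℕ.+ L ℕ.* L ℕ.≤ 6 ℕ.* (S ℕ.* S) → h ℕ.* h ℕ.+ h ℕ.* h ℕ.≤ 6 ℕ.* (S ℕ.* S) →
      CosPositive L (2 ℕ.* suc m₁) → CosNegative h (suc (2 ℕ.* m₂)) →
      ∀ π → IsPi π → Between S l (suc (suc (suc h))) (λ i → seq π i * ½)
    halfPi-between l h m₁ m₂ L²≤ h²≤ cosL cosh π isPi =
      subst (λ u → Eventually (λ i → fraction l S ≤ seq π i * ½ × seq π i * ½ ≤ u)) h+3
        (halfPi-bounds {fraction l S} {fraction h S} {fraction 1 S} {recip D} {2 ℕ.* suc m₁} {suc (2 ℕ.* m₂)}
          (0<fraction 1 S) (0<recip D) (0≤fraction h S)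
          (subst (λ c → c * c + c * c ≤ ι 6) (sym l+2) (fraction-double S (suc (suc l)) L²≤)) (fraction-double S h h²≤)
          (subst (λ c → ∀ n → recip D ≤ cosSum (c * c) (2 ℕ.* suc m₁ ℕ.+ n)) (sym l+2) (cos-≥ (suc (suc l)) L²≤ m₁ cosL))
          (cos-≤ h h²≤ m₂ cosh) π isPi)
      where
      δ : ℚ
      δ = fraction 1 S
      l+2 : fraction l S + δ + δ ≡ fraction (suc (suc l)) S
      l+2 = trans (cong (_+ δ) (fraction-+1 l S)) (fraction-+1 (suc l) S)
      h+3 : fraction h S + δ + δ + δ ≡ fraction (suc (suc (suc h))) S
      h+3 = trans (cong (_+ δ) (trans (cong (_+ δ) (fraction-+1 h S)) (fraction-+1 (suc h) S))) (fraction-+1 (suc (suc h)) S)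

    fraction-self : ∀ n .{{_ : ℕ.NonZero n}} → fraction n n ≡ 1ℚ
    fraction-self n = ι*recip n

    fraction-/1 : ∀ n → fraction n 1 ≡ ι n
    fraction-/1 n = trans (cong (ι n *_) recip1) (*-identityʳ (ι n))

    fraction-< : ∀ a b m n .{{_ : ℕ.NonZero m}} .{{_ : ℕ.NonZero n}} → suc a ℕ.* n ℕ.≤ b ℕ.* m → fraction a m < fraction b n
    fraction-< a b m n h = <-≤-trans (<-diff (0<fraction 1 m) (fraction-+1 a m)) (fraction-≤ (suc a) m b n h)

    sqrtTwo-between : ∀ l h → S ℕ.≤ l → 2 ℕ.+ l ℕ.* l ℕ.≤ 2 ℕ.* (S ℕ.* S) → 2 ℕ.+ 2 ℕ.* (S ℕ.* S) ℕ.≤ h ℕ.* h →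
      ∀ s → IsSqrt (fromℕ 2) s → Between S l h (seq s)
    sqrtTwo-between l h S≤l l²≤ ≤h² s isSqrt = both
      (sqrt-≥ {s} {2} isSqrt {fraction l S} {ε} (subst (_≤ fraction l S) (fraction-self S) (*-monoʳ (recip S) (0≤recip S) (ι-mono-≤ S≤l))) (0<fraction 1 SS)
        (subst₂ _<_ (trans (sym (fraction-+1 (l ℕ.* l) SS)) (cong (_+ ε) (sym (fraction-* l S l S)))) (fraction-/1 2)
          (fraction-< (suc (l ℕ.* l)) 2 SS 1 (subst (ℕ._≤ 2 ℕ.* SS) (sym (ℕₚ.*-identityʳ (2 ℕ.+ l ℕ.* l))) l²≤))))
      (sqrt-≤ {s} {2} isSqrt {fraction h S} {ε} (0≤fraction h S) (0<fraction 1 SS)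
        (subst₂ _<_ (trans (sym (fraction-+1 (2 ℕ.* SS) SS)) (cong (_+ ε) 2SS/SS)) (sym (fraction-* h S h S))
          (fraction-< (suc (2 ℕ.* SS)) (h ℕ.* h) SS SS (ℕₚ.*-monoˡ-≤ SS ≤h²))))
      where
      SS : ℕ
      SS = S ℕ.* S
      instance
        SS≢0 : ℕ.NonZero SS
        SS≢0 = ℕₚ.m*n≢0 S S
      ε : ℚ
      ε = fraction 1 SS
      2SS/SS : fraction (2 ℕ.* SS) SS ≡ ι 2
      2SS/SS = trans (cong (_* recip SS) (ι-* 2 SS)) (trans (*-assoc (ι 2) (ι SS) (recip SS)) (trans (cong (ι 2 *_) (ι*recip SS)) (*-identityʳ (ι 2))))

    module _ (l : ℕ) where
      private
        c : ℚ
        c = fraction l S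

      exp-≤ : l ℕ.≤ S → ∀ m n → expSum c (suc m ℕ.+ n) ≤ expSum c (suc m) + (expTerm c (suc m) + expTerm c (suc m))
      exp-≤ l≤S m n = subst (_≤ expSum c (suc m) + (expTerm c (suc m) + expTerm c (suc m))) (sym (Σ-split (expTerm c) (suc m) n))
        (+-monoʳ-≤ (expSum c (suc m)) (expSum-tail (suc m) n (0≤fraction l S) 2c≤))
        where
        c≤1 : c ≤ 1ℚ
        c≤1 = subst (c ≤_) (fraction-self S) (*-monoʳ (recip S) (0≤recip S) (ι-mono-≤ l≤S))
        2c≤ : c + c ≤ ι (suc (suc m))
        2c≤ = ≤-trans (+-mono-≤ c≤1 c≤1) (subst (_≤ ι (suc (suc m))) ι2 (ι-mono-≤ (ℕ.s≤s (ℕ.s≤s ℕ.z≤n))))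

      exp-≥ : ∀ m n → expSum c m ≤ expSum c (m ℕ.+ n)
      exp-≥ m n = expSum-extend m n (0≤fraction l S)

      ≤expUpper : ∀ m → expSum c m + (expTerm c m + expTerm c m) ≤ fraction (hi (expUpper S l m)) D
      ≤expUpper m = *-cancelʳ (ι D) (0<ι D) (subst ((expSum c m + (expTerm c m + expTerm c m)) * ι D ≤_) (sym (trans (*-assoc (ι u) (recip D) (ι D)) (trans (cong (ι u *_) (recip*ι D)) (*-identityʳ (ι u)))))
        (FixedPoint._∈_.upper (expUpper-sound S l m)))
        where u = hi (expUpper S l m)

      expLower≤ : ∀ m → fraction (lo (expLower S l m)) D ≤ expSum c m
      expLower≤ m = *-cancelʳ (ι D) (0<ι D) (subst (_≤ expSum c m * ι D) (sym (trans (*-assoc (ι u) (recip D) (ι D)) (trans (cong (ι u *_) (recip*ι D)) (*-identityʳ (ι u)))))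
        (FixedPoint._∈_.lower (expLower-sound S l m)))
        where u = lo (expLower S l m)

    -- a/S and b/S enclose exp ℓ. The numerators u and v over D separate a/S from an upper estimate
    -- of exp at (l+2)/S and b/S from a lower estimate at h/S, each with a gap of one unit 1/D.
    log-between : ∀ a b l h m u v → suc (suc l) ℕ.≤ S →
      hi (expUpper S (suc (suc l)) (suc m)) ℕ.≤ u → 2 ℕ.* D ℕ.≤ u → suc u ℕ.* S ℕ.≤ a ℕ.* D →
      suc v ℕ.≤ lo (expLower S h m) → b ℕ.* D ℕ.≤ v ℕ.* S →
      ∀ ℓ w → Real.IsExp ℓ w → Between S a b (seq w) → Between S l (suc (suc h)) (seq ℓ)
    log-between a b l h m u v l+2≤S U≤u 2D≤u u≤a v<V b≤v ℓ w isExp between =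
      both (eventually-≥ {x = seq ℓ} (cauchy ℓ) (0<fraction 1 S)
          (subst (λ z → ¬ Eventually (λ i → seq ℓ i ≤ z)) (sym l+2)
            (¬log≤ {ℓ} {w} isExp {fraction L S} {fraction u D} {fraction a S} {fraction 1 D} {suc m} exp≤u 2≤u (0<fraction 1 D)
              (subst (_≤ fraction a S) (sym (fraction-+1 u D)) (fraction-≤ (suc u) D a S u≤a))
              (mapᴱ (λ _ → proj₁) between))))
        (subst (λ z → Eventually (λ i → seq ℓ i ≤ z)) h+2 (eventually-≤ {x = seq ℓ} (cauchy ℓ) (0<fraction 1 S)
          (¬≤log {ℓ} {w} isExp {fraction h S} {fraction (suc v) D} {fraction b S} {fraction 1 D} {m} (0≤fraction h S) v≤exp (0<fraction 1 D)
            (subst (fraction b S + fraction 1 D ≤_) (fraction-+1 v D) (+-monoˡ-≤ (fraction 1 D) (fraction-≤ b S v D b≤v)))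
            (mapᴱ (λ _ → proj₂) between))))
      where
      L : ℕ
      L = suc (suc l)
      l+2 : fraction l S + fraction 1 S + fraction 1 S ≡ fraction L S
      l+2 = trans (cong (_+ fraction 1 S) (fraction-+1 l S)) (fraction-+1 (suc l) S)
      h+2 : fraction h S + fraction 1 S + fraction 1 S ≡ fraction (suc (suc h)) S
      h+2 = trans (cong (_+ fraction 1 S) (fraction-+1 h S)) (fraction-+1 (suc h) S)
      exp≤u : ∀ n → expSum (fraction L S) (suc m ℕ.+ n) ≤ fraction u D
      exp≤u n = ≤-trans (exp-≤ L l+2≤S m n) (≤-trans (≤expUpper L (suc m)) (*-monoʳ (recip D) (0≤recip D) (ι-mono-≤ U≤u)))
      2≤u : 1ℚ + 1ℚ ≤ fraction u D
      2≤u = subst (_≤ fraction u D) (trans (fraction-/1 2) ι2)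
        (fraction-≤ 2 1 u D (subst (2 ℕ.* D ℕ.≤_) (sym (ℕₚ.*-identityʳ u)) 2D≤u))
      v≤exp : ∀ n → fraction (suc v) D ≤ expSum (fraction h S) (m ℕ.+ n)
      v≤exp n = ≤-trans (*-monoʳ (recip D) (0≤recip D) (ι-mono-≤ v<V)) (≤-trans (expLower≤ h m) (exp-≥ h m n))

    onePlus-between : ∀ l h s → Between S l h (seq s) → Between S (S ℕ.+ l) (S ℕ.+ h) (seq (Real.1ℝ Real.+ s))
    onePlus-between l h s = mapᴱ λ n (l≤ , ≤h) →
      subst (_≤ 1ℚ + seq s n) (sym (shift l)) (+-monoʳ-≤ 1ℚ l≤) , subst (1ℚ + seq s n ≤_) (sym (shift h)) (+-monoʳ-≤ 1ℚ ≤h)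
      where
      shift : ∀ m → fraction (S ℕ.+ m) S ≡ 1ℚ + fraction m S
      shift m = trans (fraction-+ S m S) (cong (_+ fraction m S) (fraction-self S))

  module Quotient (S Q : ℕ) .{{S≢0 : ℕ.NonZero S}} .{{Q≢0 : ℕ.NonZero Q}} {π ℓ P : ℝ} (y₁ y₂ l₁ l₂ p₁ p₂ : ℕ) .{{l₁≢0 : ℕ.NonZero l₁}}
    (half : Between S y₁ y₂ (λ i → seq π i * ½)) (log : Between S l₁ l₂ (seq ℓ)) (product : Between Q p₁ p₂ (seq P)) where

    private
      16·_ : ℚ → ℚ
      16· x = (+ 16 / 1) * x

      positive-16ℓ : ∀ {x} → fraction l₁ S ≤ x → 0ℚ + fraction l₁ S ≤ 16· x
      positive-16ℓ {x} l₁≤x = begin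
        0ℚ + fraction l₁ S       ≡⟨ +-identityˡ (fraction l₁ S) ⟩
        fraction l₁ S            ≤⟨ l₁≤x ⟩
        x                        ≡⟨ *-identityˡ x ⟨
        1ℚ * x                   ≤⟨ *-monoʳ x (≤-trans (0≤fraction l₁ S) l₁≤x) (subst (1ℚ ≤_) (ιℤ-/1 (+ 16)) (1≤ι 16)) ⟩
        16· x                    ∎
        where open ℚₚ.≤-Reasoning

    apart : Real.0ℝ Real.< Real.∣ fromℕ 16 Real.* ℓ ∣
    apart = fraction l₁ S , 0<fraction l₁ S , proj₁ log , λ n N≤n → ≤-trans (positive-16ℓ (proj₁ (proj₂ log n N≤n)))
      (∣∣≤⇒≤ {16· seq ℓ n} ≤-refl)

    quotient : ℝ
    quotient = (π Real.^ 2) Real.÷ (fromℕ 16 Real.* ℓ) [ apart ] Real.* P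

    private
      ratio : ℚ → ℚ → ℚ → ℚ
      ratio x l p = x * (x * 1ℚ) * Real.1/₀ (16· l) * p

      -- Multiplying by 16 l removes the division, and x² = 4 (x/2)² brings in π/2, the quantity
      -- that is actually enclosed.
      ratio*16l : ∀ x l p → fraction l₁ S ≤ l → ratio x l p * (16· l) ≡ ι 4 * ((x * ½) * (x * ½) * p)
      ratio*16l x l p l₁≤l = begin
        x * (x * 1ℚ) * Real.1/₀ (16· l) * p * (16· l)        ≡⟨ solve 4 (λ x r p l → x :* (x :* con 1ℚ) :* r :* p :* l := x :* x :* p :* (l :* r)) refl x (Real.1/₀ (16· l)) p (16· l) ⟩
        x * x * p * (16· l * Real.1/₀ (16· l))               ≡⟨ cong (x * x * p *_) (Real.p*1/₀p (16· l) 16l≢0) ⟩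
        x * x * p * 1ℚ                                       ≡⟨ solve 2 (λ x p → x :* x :* p :* con 1ℚ := con (+ 4 / 1) :* ((x :* con ½) :* (x :* con ½) :* p)) refl x p ⟩
        (+ 4 / 1) * ((x * ½) * (x * ½) * p)                  ≡⟨ cong (_* ((x * ½) * (x * ½) * p)) (ιℤ-/1 (+ 4)) ⟨
        ι 4 * ((x * ½) * (x * ½) * p)                        ∎
        where
        open ≡-Reasoning
        16l≢0 : 16· l ≢ 0ℚ
        16l≢0 eq = <-irrefl refl (<-≤-trans (0<fraction l₁ S) (subst₂ _≤_ (+-identityˡ (fraction l₁ S)) eq (positive-16ℓ l₁≤l)))

      0<16l : ∀ {l} → fraction l₁ S ≤ l → 0ℚ < 16· l
      0<16l l₁≤l = <-≤-trans (0<fraction l₁ S) (subst (_≤ _) (+-identityˡ (fraction l₁ S)) (positive-16ℓ l₁≤l))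

      cube : ∀ y p → ι 4 * (fraction y S * fraction y S * fraction p Q) ≡ fraction (4 ℕ.* (y ℕ.* y ℕ.* p)) (S ℕ.* S ℕ.* Q)
      cube y p = trans (cong (ι 4 *_) (trans (cong (_* fraction p Q) (fraction-* y S y S)) (fraction-* (y ℕ.* y) (S ℕ.* S) p Q)))
        (trans (sym (*-assoc (ι 4) (ι (y ℕ.* y ℕ.* p)) (recip (S ℕ.* S ℕ.* Q)))) (cong (_* recip (S ℕ.* S ℕ.* Q)) (sym (ι-* 4 (y ℕ.* y ℕ.* p)))))

      16·fraction : ∀ a n l → fraction a n * (16· fraction l S) ≡ fraction (a ℕ.* (16 ℕ.* l)) (n ℕ.* S)
      16·fraction a n l = trans (cong (fraction a n *_) (trans (cong (_* fraction l S) (sym (ιℤ-/1 (+ 16))))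
          (trans (sym (*-assoc (ι 16) (ι l) (recip S))) (cong (_* recip S) (sym (ι-* 16 l))))))
        (fraction-* a n (16 ℕ.* l) S)

      16·-mono : ∀ {x y} → x ≤ y → 16· x ≤ 16· y
      16·-mono = *-monoˡ (+ 16 / 1) (subst (0ℚ ≤_) (ιℤ-/1 (+ 16)) (0≤ι 16))

      instance
        SSQ≢0 : ℕ.NonZero (S ℕ.* S ℕ.* Q)
        SSQ≢0 = ℕₚ.m*n≢0 (S ℕ.* S) Q {{ℕₚ.m*n≢0 S S}}

      cube-mono : ∀ {y y′ p p′} → 0ℚ ≤ y → 0ℚ ≤ p → y ≤ y′ → p ≤ p′ → ι 4 * (y * y * p) ≤ ι 4 * (y′ * y′ * p′)
      cube-mono 0≤y 0≤p y≤y′ p≤p′ = *-monoˡ (ι 4) (0≤ι 4) (*-mono (*-nonNeg 0≤y 0≤y) 0≤p (*-mono 0≤y 0≤y y≤y′ y≤y′) p≤p′)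

      ratio-≥ : ∀ a n .{{_ : ℕ.NonZero n}} → a ℕ.* (16 ℕ.* l₂) ℕ.* (S ℕ.* S ℕ.* Q) ℕ.≤ 4 ℕ.* (y₁ ℕ.* y₁ ℕ.* p₁) ℕ.* (n ℕ.* S) →
        ∀ x l p → fraction y₁ S ≤ x * ½ → fraction l₁ S ≤ l → l ≤ fraction l₂ S → fraction p₁ Q ≤ p → fraction a n ≤ ratio x l p
      ratio-≥ a n h x l p y₁≤ l₁≤l l≤l₂ p₁≤p = *-cancelʳ (16· l) (0<16l l₁≤l) (begin
        fraction a n * (16· l)                                       ≤⟨ *-monoˡ (fraction a n) (0≤fraction a n) (16·-mono l≤l₂) ⟩
        fraction a n * (16· fraction l₂ S)                           ≡⟨ 16·fraction a n l₂ ⟩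
        fraction (a ℕ.* (16 ℕ.* l₂)) (n ℕ.* S)                       ≤⟨ fraction-≤ (a ℕ.* (16 ℕ.* l₂)) (n ℕ.* S) (4 ℕ.* (y₁ ℕ.* y₁ ℕ.* p₁)) (S ℕ.* S ℕ.* Q) {{ℕₚ.m*n≢0 n S}} h ⟩
        fraction (4 ℕ.* (y₁ ℕ.* y₁ ℕ.* p₁)) (S ℕ.* S ℕ.* Q)          ≡⟨ cube y₁ p₁ ⟨
        ι 4 * (fraction y₁ S * fraction y₁ S * fraction p₁ Q)        ≤⟨ cube-mono (0≤fraction y₁ S) (0≤fraction p₁ Q) y₁≤ p₁≤p ⟩
        ι 4 * ((x * ½) * (x * ½) * p)                                ≡⟨ ratio*16l x l p l₁≤l ⟨
        ratio x l p * (16· l)                                        ∎)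
        where open ℚₚ.≤-Reasoning

      ratio-≤ : ∀ a n .{{_ : ℕ.NonZero n}} → 4 ℕ.* (y₂ ℕ.* y₂ ℕ.* p₂) ℕ.* (n ℕ.* S) ℕ.≤ a ℕ.* (16 ℕ.* l₁) ℕ.* (S ℕ.* S ℕ.* Q) →
        ∀ x l p → fraction y₁ S ≤ x * ½ → x * ½ ≤ fraction y₂ S → fraction l₁ S ≤ l → fraction p₁ Q ≤ p → p ≤ fraction p₂ Q → ratio x l p ≤ fraction a n
      ratio-≤ a n h x l p y₁≤ ≤y₂ l₁≤l p₁≤p p≤p₂ = *-cancelʳ (16· l) (0<16l l₁≤l) (begin
        ratio x l p * (16· l)                                        ≡⟨ ratio*16l x l p l₁≤l ⟩
        ι 4 * ((x * ½) * (x * ½) * p)                                ≤⟨ cube-mono (≤-trans (0≤fraction y₁ S) y₁≤) (≤-trans (0≤fraction p₁ Q) p₁≤p) ≤y₂ p≤p₂ ⟩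
        ι 4 * (fraction y₂ S * fraction y₂ S * fraction p₂ Q)        ≡⟨ cube y₂ p₂ ⟩
        fraction (4 ℕ.* (y₂ ℕ.* y₂ ℕ.* p₂)) (S ℕ.* S ℕ.* Q)          ≤⟨ fraction-≤ (4 ℕ.* (y₂ ℕ.* y₂ ℕ.* p₂)) (S ℕ.* S ℕ.* Q) (a ℕ.* (16 ℕ.* l₁)) (n ℕ.* S) {{SSQ≢0}} {{ℕₚ.m*n≢0 n S}} h ⟩
        fraction (a ℕ.* (16 ℕ.* l₁)) (n ℕ.* S)                       ≡⟨ 16·fraction a n l₁ ⟨
        fraction a n * (16· fraction l₁ S)                           ≤⟨ *-monoˡ (fraction a n) (0≤fraction a n) (16·-mono l₁≤l) ⟩
        fraction a n * (16· l)                                       ∎)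
        where open ℚₚ.≤-Reasoning

    quotient-hasDecimals : ∀ k d →
      d ℕ.* (16 ℕ.* l₂) ℕ.* (S ℕ.* S ℕ.* Q) ℕ.≤ 4 ℕ.* (y₁ ℕ.* y₁ ℕ.* p₁) ℕ.* (10 ℕ.^ k ℕ.* S) →
      4 ℕ.* (y₂ ℕ.* y₂ ℕ.* p₂) ℕ.* (10 ℕ.^ suc k ℕ.* S) ℕ.≤ (9 ℕ.+ 10 ℕ.* d) ℕ.* (16 ℕ.* l₁) ℕ.* (S ℕ.* S ℕ.* Q) →
      HasDecimals k quotient d
    quotient-hasDecimals k d h₁ h₂ = hasDecimals k quotient d (mapᴱ bounds (both half (both log product)))
      where
      bounds : ∀ n → (fraction y₁ S ≤ seq π n * ½ × seq π n * ½ ≤ fraction y₂ S) ×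
                 (fraction l₁ S ≤ seq ℓ n × seq ℓ n ≤ fraction l₂ S) × (fraction p₁ Q ≤ seq P n × seq P n ≤ fraction p₂ Q) →
               fraction d (10 ℕ.^ k) ≤ seq quotient n × seq quotient n ≤ fraction (9 ℕ.+ 10 ℕ.* d) (10 ℕ.^ suc k)
      bounds n ((y₁≤ , ≤y₂) , (l₁≤ , ≤l₂) , (p₁≤ , ≤p₂)) =
        ratio-≥ d (10 ℕ.^ k) {{ℕₚ.m^n≢0 10 k}} h₁ (seq π n) (seq ℓ n) (seq P n) y₁≤ l₁≤ ≤l₂ p₁≤ ,
        ratio-≤ (9 ℕ.+ 10 ℕ.* d) (10 ℕ.^ suc k) {{ℕₚ.m^n≢0 10 (suc k)}} h₂ (seq π n) (seq ℓ n) (seq P n) y₁≤ ≤y₂ l₁≤ p₁≤ ≤p₂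

-- Concrete parameters and the evaluations.

module Numerics where
  open import Data.Bool using (Bool; true; T)
  open import Data.Nat
  open ℕₚ using (m^n≢0; ≤ᵇ⇒≤; m≤n⇒∃[o]m+o≡n)
  open Rationals using (ι; 0<ι; recip; recip*ι; *-cancelʳ)
  open Intervals
  open LValues
  open LocalComparison
  open PartialProductEnclosure
  open CosExpEvaluation
  open RealSequences
  open ShanksConstant
  open Real using (partialProduct; IsPi; IsSqrt; IsLog; HasDecimals; seq; fromℕ; 1ℝ)

  ∈⇒fraction : ∀ D .{{_ : NonZero D}} {l h q} → FixedPoint._∈_ D q (l ‥ h) → fraction l D ℚ.≤ q × q ℚ.≤ fraction h D
  ∈⇒fraction D {l} {h} {q} q∈ =
    *-cancelʳ (ι D) (0<ι D) (subst (ℚ._≤ q ℚ.* ι D) (sym (clear l)) (FixedPoint._∈_.lower q∈)) ,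
    *-cancelʳ (ι D) (0<ι D) (subst (q ℚ.* ι D ℚ.≤_) (sym (clear h)) (FixedPoint._∈_.upper q∈))
    where
    clear : ∀ m → fraction m D ℚ.* ι D ≡ ι m
    clear m = trans (*-assoc (ι m) (recip D) (ι D))
      (trans (cong (ι m ℚ.*_) (recip*ι D)) (*-identityʳ (ι m)))

  eventually-between : ∀ D .{{_ : NonZero D}} {B X l h x} → (∀ N → X ≤ N → FixedPoint._∈_ D (x (B + N)) (l ‥ h)) → Between D l h x
  eventually-between D {B} {X} {l} {h} {x} bound = B + X , above
    where
    above : ∀ n → B + X ≤ n → fraction l D ℚ.≤ x n × x n ℚ.≤ fraction h D
    above n B+X≤n with m≤n⇒∃[o]m+o≡n (ℕₚ.≤-trans (ℕₚ.m≤m+n B X) B+X≤n)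
    ... | N , refl = ∈⇒fraction D (bound N (ℕₚ.+-cancelˡ-≤ B X N B+X≤n))

  ≤-by-computation : ∀ {m n} → (m ≤ᵇ n) ≡ true → m ≤ n
  ≤-by-computation {m} {n} eq = ≤ᵇ⇒≤ m n (subst T (sym eq) tt)

  -- The weights (d s , e s) of χ₀ and of the other characters, for s = 2, 3, …, 60.  With
  -- (1 - 4x)(1 - x²)²/(1 - x)⁴ = ∏ (1 - xˢ)^(b s), they are e s = (b s + 2 e (s/2))/4 and
  -- d s = e s - 2 e (s/2), where e (s/2) = 0 for odd s.
  weights : List (ℕ × ℕ)
  weights =
      (2 , 2) ∷ (5 , 5) ∷ (12 , 16) ∷ (51 , 51) ∷ (160 , 170) ∷ (585 , 585) ∷ (2016 , 2048) ∷ (7280 , 7280) ∷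
      (26112 , 26214) ∷ (95325 , 95325) ∷ (349180 , 349520) ∷ (1290555 , 1290555) ∷ (4792320 , 4793490) ∷
      (17895679 , 17895679) ∷ (67104768 , 67108864) ∷ (252645135 , 252645135) ∷ (954422560 , 954437120) ∷
      (3616814565 , 3616814565) ∷ (13743842916 , 13743895344) ∷ (52357696365 , 52357696365) ∷
      (199911014400 , 199911205050) ∷ (764877654105 , 764877654105) ∷ (2932030307680 , 2932031006720) ∷
      (11258999068416 , 11258999068416) ∷ (43303839989760 , 43303842570870) ∷ (166799986196480 , 166799986196480) ∷
      (643371365751660 , 643371375338640) ∷ (2484744621997515 , 2484744621997515) ∷
      (9607679169256928 , 9607679205048286) ∷ (37191016277640225 , 37191016277640225) ∷
      (144115187941638144 , 144115188075855872) ∷ (558992244657833425 , 558992244657833425) ∷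
      (2170205184637009920 , 2170205185142300190) ∷ (8432797290838652043 , 8432797290838652043) ∷
      (32794211684685767680 , 32794211686594641920) ∷ (127631526564044465235 , 127631526564044465235) ∷
      (497091208715886919680 , 497091208723120548810) ∷ (1937381121177289913895 , 1937381121177289913895) ∷
      (7555786372563944550816 , 7555786372591432341504) ∷ (29485995600356809139175 , 29485995600356809139175) ∷
      (115135792344145680600480 , 115135792344250395993210) ∷ (449832863112420158030205 , 449832863112420158030205) ∷
      (1758437555802697158980700 , 1758437555803096981390800) ∷
      (6877444662696557076806224 , 6877444662696557076806224) ∷
      (26911739984463258829455360 , 26911739984464788584763570) ∷
      (105356599088117470204180785 , 105356599088117470204180785) ∷
      (412646679761787560881991680 , 412646679761793424944005120) ∷
      (1616901275801313012113141760 , 1616901275801313012113141760) ∷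
      (6338253001141124489485373952 , 6338253001141147007483510784) ∷
      (24855894122122145127302122315 , 24855894122122145127302122315) ∷
      (97511584632940636584368950980 , 97511584632940723192054092720) ∷
      (382686973653805102338627382755 , 382686973653805102338627382755) ∷
      (1502400711381604882988394741760 , 1502400711381605216588367134720) ∷
      (5900337339244122305148291264135 , 5900337339244122305148291264135) ∷
      (23179896689887622054911250792160 , 23179896689887623341654001469440) ∷
      (91092927342716274184744344030585 , 91092927342716274184744344030585) ∷
      (358089438519643279756751882158080 , 358089438519643284726241126153110) ∷
      (1408080504009444780618439682500365 , 1408080504009444780618439682500365) ∷
      (5538449982437149451217166426369844 , 5538449982437149470432524836466416) ∷ []

  -- P₁₀₃ consists of the first 103 decimals of the product, and the last three numbers are ⌊10¹⁰⁸ x⌋ for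
  -- x = π/2, √2 and log (1 + √2).
  D S W M P₁₀₃ productDigits shanksDigits halfPi₁₀₈ sqrtTwo₁₀₈ log₁₀₈ : ℕ
  D = 10 ^ 145
  M = 10 ^ 105
  S = 10 ^ 108
  W = 10 ^ 116
  P₁₀₃ = 9569453478516011834369670572738918287531749772913914789054326042460170164448888594814405120390795084312
  productDigits = 95694_53478_51601_18343_69670_57273_89182_87531_74977_29139_14789_05432_60424_60170_16444_88885_94814_40512_03907_95084
  shanksDigits = 66974_09699_37071_22053_89224_31571_76440_66883_70157_43648_24185_73298_52284_52467_99956_45714_72731_50621_02143_59373
  halfPi₁₀₈ = 1570796326794896619231321691639751442098584699687552910487472296153908203143104499314017412671058533991074043
  sqrtTwo₁₀₈ = 1414213562373095048801688724209698078569671875376948073176679737990732478462107038850387534327641572735013846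
  log₁₀₈ = 881373587019543025232609324979792309028160328261635410753295608653377184222026087833706891910256042856739816

  instance
    D≢0 : NonZero D
    D≢0 = m^n≢0 10 145
    M≢0 : NonZero M
    M≢0 = m^n≢0 10 105
    S≢0 : NonZero S
    S≢0 = m^n≢0 10 108
    W≢0 : NonZero W
    W≢0 = m^n≢0 10 116

    log≢0 : NonZero (log₁₀₈ ∸ 5)
    log≢0 = _

  7≤255 : 7 ≤ 255
  7≤255 = ≤-by-computation refl

  abstract
    -- Primes below 256 are treated separately, the L-series are summed directly up to 8 · 132, their tails use 320
    -- terms of the factorial series, and the local expansions have order 4 + 57 with remainders in units of 10⁻⁶.
    partialProduct-between : Between D (P₁₀₃ * 10 ^ 42) (suc P₁₀₃ * 10 ^ 42) partialProduct
    partialProduct-between = eventually-between D {256} {2 * (D * D)} {P₁₀₃ * 10 ^ 42} {suc P₁₀₃ * 10 ^ 42} {partialProduct} (PartialProducts.partialProduct-within D 255 132 320 1000000 M 120 57 7≤255 weights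
      (P₁₀₃ * 10 ^ 42) (suc P₁₀₃ * 10 ^ 42) refl refl refl)

    π/2-between : ∀ π → IsPi π → Between S (halfPi₁₀₈ ∸ 3) (5 + halfPi₁₀₈) (λ i → seq π i ℚ.* ℚ.½)
    -- 22 and 23 stand for 46 and 47 terms of the cosine series, an even number for the lower and an
    -- odd one for the upper bound; the first term left out is below 10⁻¹²⁰.
    π/2-between = halfPi-between W S (halfPi₁₀₈ ∸ 3) (2 + halfPi₁₀₈) 22 23
      (≤-by-computation refl) (≤-by-computation refl) (≤-by-computation refl) (≤-by-computation refl)

    √2-between : ∀ s → IsSqrt (fromℕ 2) s → Between S (sqrtTwo₁₀₈ ∸ 1) (2 + sqrtTwo₁₀₈) (seq s)
    √2-between = sqrtTwo-between W S (sqrtTwo₁₀₈ ∸ 1) (2 + sqrtTwo₁₀₈)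
      (≤-by-computation refl) (≤-by-computation refl) (≤-by-computation refl)

    ℓ-between : ∀ s ℓ → IsSqrt (fromℕ 2) s → IsLog (1ℝ Real.+ s) ℓ → Between S (log₁₀₈ ∸ 5) (6 + log₁₀₈) (seq ℓ)
    ℓ-between s ℓ isSqrt isLog = log-between W S (S + (sqrtTwo₁₀₈ ∸ 1)) (S + (2 + sqrtTwo₁₀₈)) (log₁₀₈ ∸ 5) (4 + log₁₀₈) 79
      -- 10⁸ = W/S converts from units of 1/S to units of 1/W; the predecessor provides the gap of
      -- one unit below the lower bound of 1 + √2.
      (pred ((S + (sqrtTwo₁₀₈ ∸ 1)) * 10 ^ 8)) ((S + (2 + sqrtTwo₁₀₈)) * 10 ^ 8)
      (≤-by-computation refl) (≤-by-computation refl) (≤-by-computation refl) (≤-by-computation refl) (≤-by-computation refl) (≤-by-computation refl)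
      ℓ (1ℝ Real.+ s) isLog (onePlus-between W S (sqrtTwo₁₀₈ ∸ 1) (2 + sqrtTwo₁₀₈) s (√2-between s isSqrt))

    product-hasDecimals : HasDecimals 100 eulerProduct productDigits
    product-hasDecimals = hasDecimals 100 eulerProduct productDigits (mapᴱ bounds partialProduct-between)
      where
      bounds : ∀ n → fraction (P₁₀₃ * 10 ^ 42) D ℚ.≤ partialProduct n × partialProduct n ℚ.≤ fraction (suc P₁₀₃ * 10 ^ 42) D →
               fraction productDigits (10 ^ 100) ℚ.≤ partialProduct n × partialProduct n ℚ.≤ fraction (9 + 10 * productDigits) (10 ^ 101)
      bounds n (l≤ , ≤h) =
        ≤-trans (fraction-≤ productDigits (10 ^ 100) (P₁₀₃ * 10 ^ 42) D {{m^n≢0 10 100}} (≤-by-computation refl)) l≤ ,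
        ≤-trans ≤h (fraction-≤ (suc P₁₀₃ * 10 ^ 42) D (9 + 10 * productDigits) (10 ^ 101) {{_}} {{m^n≢0 10 101}} (≤-by-computation refl))

    shanks-hasDecimals : ∀ π √2 ℓ → IsPi π → IsSqrt (fromℕ 2) √2 → IsLog (1ℝ Real.+ √2) ℓ →
      ∃[ 16ℓ#0 ] HasDecimals 100 ((π Real.^ 2) Real.÷ (fromℕ 16 Real.* ℓ) [ 16ℓ#0 ] Real.* eulerProduct) shanksDigits
    shanks-hasDecimals π √2 ℓ isPi isSqrt isLog = C.apart ,
      C.quotient-hasDecimals 100 shanksDigits (≤-by-computation refl) (≤-by-computation refl)
      where
      module C = Quotient S D {π} {ℓ} {eulerProduct} (halfPi₁₀₈ ∸ 3) (5 + halfPi₁₀₈) (log₁₀₈ ∸ 5) (6 + log₁₀₈)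
        (P₁₀₃ * 10 ^ 42) (suc P₁₀₃ * 10 ^ 42) (π/2-between π isPi) (ℓ-between √2 ℓ isSqrt isLog) partialProduct-between

open import Data.Product using (∃-syntax; _×_; _,_)
open import Defs
open ShanksConstant using (eulerProduct; isEulerProduct)
open Numerics using (product-hasDecimals; shanks-hasDecimals)

corollary1p8 : ∃[ P ] IsEulerProduct P
    × HasDecimals 100 P 95694_53478_51601_18343_69670_57273_89182_87531_74977_29139_14789_05432_60424_60170_16444_88885_94814_40512_03907_95084
    × (∀ π √2 ℓ → IsPi π → IsSqrt (fromℕ 2) √2 → IsLog (1ℝ + √2) ℓ →
    ∃[ 16ℓ#0 ]
    HasDecimals 100 ((π ^ 2) ÷ (fromℕ 16 * ℓ) [ 16ℓ#0 ] * P)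
    66974_09699_37071_22053_89224_31571_76440_66883_70157_43648_24185_73298_52284_52467_99956_45714_72731_50621_02143_59373)
corollary1p8 = eulerProduct , (λ {ε} → isEulerProduct {ε}) , product-hasDecimals , shanks-hasDecimals
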